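{- The following statements are equivalent: (1) ${\rm UP}={\rm coUP}$. (2) ${\rm CLU\#P}$ is closed under increment (i.e., $f\in{\rm CLU\#P}$ implies $x\mapsto f(x)+1$ is in ${\rm CLU\#P}$). (3) ${\rm CLU\#P}$ is closed under addition of natural-number-valued ${\rm FP}_{\rm t}$ functions (i.e., $f\in{\rm CLU\#P}$ and $g\in{\rm FP}_{\rm t}$ with $g:\Sigma^*\to\mathbb{N}$ imply $f+g\in{\rm CLU\#P}$). (4) ${\rm CLU\#P}$ is closed under addition of natural-number-valued ${\rm UPSV_t}$ functions. (5) ${\rm CLU\#P}$ is closed under addition (i.e., $f,g\in{\rm CLU\#P}$ imply $f+g\in{\rm CLU\#P}$).
   Context: Alphabet $\Sigma=\{0,1\}$; NPTM = nondeterministic polynomial-time Turing machine. ${\rm UP}$ is the class of languages accepted by NPTMs having at most one accepting path on every input; ${\rm coUP}$ is the class of their complements. For a polynomial $p$, an NPTM $M$ is $p$-balanced if on every input $x$ its computation paths correspond exactly to the guess strings in $\{0,1\}^{p(|x|)}$; paths are identified with guess strings. $\mathrm{acc}_M(x)$ is the set of accepting paths, $\#\mathrm{acc}_M(x)$ its size. ${\rm FP}_{\rm t}$: total polynomial-time computable functions. For same-length strings, $a\prec_{\rm lex}b$ means $b$ is the immediate lexicographic successor of $a$; $\le_{\rm lex}$ is lexicographic order. ${\rm CLU\#P}$: total $f:\Sigma^*\to\mathbb{N}$ such that there exist a polynomial $p$, a $p$-balanced NPTM $M$, $b,t\in{\rm FP}_{\rm t}$ and a polynomial-time 3-argument predicate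 $\prec$ such that for every $x$ there is a bijection $h_x$ of $\Sigma^{p(|x|)}$ with: $|b(x)|=|t(x)|=p(|x|)$; $h_x(b(x))=0^{p(|x|)}$, $h_x(t(x))=1^{p(|x|)}$; for $y,z\in\{0,1\}^{p(|x|)}$, $\prec(x,y,z)$ iff $h_x(y)\prec_{\rm lex}h_x(z)$; if $f(x)\neq0$ there exist $\ell,u$ with $\mathrm{acc}_M(x)=\{w\in\{0,1\}^{p(|x|)}: h_x(\ell)\le_{\rm lex}h_x(w)\le_{\rm lex}h_x(u)\}$; $f(x)=\#\mathrm{acc}_M(x)$. ${\rm UPSV_p}$: partial functions $g$ for which there is an NPTM that on every input has at most one accepting path, has an accepting path exactly on the domain of $g$, and outputs $g(x)$ on that path. ${\rm UPSV_t}$: the total functions in ${\rm UPSV_p}$. A function is natural-number-valued if it maps $\Sigma^*$ to $\mathbb{N}$. -}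

module Defs where

open import Data.Bool using (Bool; true; false; if_then_else_)
open import Data.Nat using (ℕ; zero; suc; _+_; _*_)
open import Data.Fin using (Fin; zero; suc)
open import Data.List using (List; []; _∷_; _++_; length; map; filter; foldl; foldr)
open import Data.Vec using (Vec; []; _∷_; toList; replicate)
open import Data.Maybe using (Maybe; just; nothing)
open import Data.Product using (Σ; ∃; ∃-syntax; _×_; _,_)
open import Relation.Binary.PropositionalEquality using (_≡_; _≢_)
open import Relation.Nullary using (¬_)
open import Function.Bundles using (_⇔_; _⤖_; Bijection)

Str : Set
Str = List Bool

-- Binary encoding of natural numbers (most significant bit first;
-- the empty string and leading zeros are allowed).
decodeℕ : Str → ℕ
decodeℕ = foldl (λ acc b → (if b then 1 else 0) + 2 * acc) 0

double : Str → Str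
double [] = []
double (b ∷ bs) = b ∷ b ∷ double bs

⟨_,_,_⟩ : Str → Str → Str → Str
⟨ x , y , z ⟩ = double x ++ (false ∷ true ∷ []) ++ double y ++ (false ∷ true ∷ []) ++ double z

Lang : Set
Lang = Str → Bool

-- Polynomials with natural coefficients (coefficient list, constant first)

Poly : Set
Poly = List ℕ

⟦_⟧ : Poly → ℕ → ℕ
⟦ cs ⟧ n = foldr (λ c acc → c + n * acc) 0 cs

-- Nondeterministic single-tape Turing machines.
-- Tape alphabet Fin (3 + k): 0 = blank, 1 = bit 0, 2 = bit 1, rest extra.

Sym : ℕ → Set
Sym k = Fin (3 + k)

blank : ∀ {k} → Sym k
blank = zero

bitSym : ∀ {k} → Bool → Sym k
bitSym false = suc zero
bitSym true  = suc (suc zero)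

symBit : ∀ {k} → Sym k → Maybe Bool
symBit (suc zero) = just false
symBit (suc (suc zero)) = just true
symBit _ = nothing

record Tape (k : ℕ) : Set where
  constructor tape
  field
    lft  : List (Sym k)   -- cells left of the head, nearest first
    hd   : Sym k
    rgt  : List (Sym k)   -- cells right of the head, nearest first
open Tape public

data Move : Set where
  L R S : Move

write : ∀ {k} → Sym k → Tape k → Tape k
write s (tape l _ r) = tape l s r

move : ∀ {k} → Move → Tape k → Tape k
move L (tape [] h r) = tape [] blank (h ∷ r)
move L (tape (a ∷ l) h r) = tape l a (h ∷ r)
move R (tape l h []) = tape (h ∷ l) blank []
move R (tape l h (a ∷ r)) = tape (h ∷ l) a r
move S t = t

initTape : ∀ {k} → Str → Tape k
initTape [] = tape [] blank []
initTape (b ∷ bs) = tape [] (bitSym b) (map bitSym bs)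

readBits : ∀ {k} → List (Sym k) → Str
readBits [] = []
readBits (s ∷ ss) with symBit s
... | just b  = b ∷ readBits ss
... | nothing = []

output : ∀ {k} → Tape k → Str
output (tape _ h r) = readBits (h ∷ r)

-- A transition: halt (accepting if true), a deterministic step, or a
-- binary nondeterministic branch (choice 0 / choice 1).
data Action (Q A : Set) : Set where
  halt   : Bool → Action Q A
  step   : Q → A → Move → Action Q A
  branch : (Q × A × Move) → (Q × A × Move) → Action Q A

record NTM : Set where
  field
    nQ    : ℕ
    k     : ℕ
    start : Fin nQ
    δ     : Fin nQ → Sym k → Action (Fin nQ) (Sym k)

data Outcome (k : ℕ) : Set where
  halted  : Bool → Tape k → Outcome k   -- halted, guess string consumed exactly
  timeout : Outcome k
  badPath : Outcome k                   -- guess string does not describe a path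

module _ (M : NTM) where
  open NTM M
  runFrom : ℕ → Str → Fin nQ → Tape k → Outcome k
  runFrom fuel ys q τ = go (δ q (hd τ)) fuel ys
    where
    go : Action (Fin nQ) (Sym k) → ℕ → Str → Outcome k
    go (halt b) _ [] = halted b τ
    go (halt b) _ (_ ∷ _) = badPath
    go (step _ _ _) zero _ = timeout
    go (step q' s m) (suc n) ys' = runFrom n ys' q' (move m (write s τ))
    go (branch _ _) zero _ = timeout
    go (branch _ _) (suc n) [] = badPath
    go (branch (q' , s , m) _) (suc n) (false ∷ ys') = runFrom n ys' q' (move m (write s τ))
    go (branch _ (q' , s , m)) (suc n) (true ∷ ys') = runFrom n ys' q' (move m (write s τ))

run : (M : NTM) → ℕ → Str → Str → Outcome (NTM.k M)
run M fuel x ys = runFrom M fuel ys (NTM.start M) (initTape x)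

isAcc : ∀ {k} → Outcome k → Bool
isAcc (halted true _) = true
isAcc _ = false

NPoly : NTM → Poly → Set
NPoly M q = ∀ x ys → run M (⟦ q ⟧ (length x)) x ys ≢ timeout

AccPath : NTM → Poly → Str → Str → Set
AccPath M q x ys = ∃[ τ ] run M (⟦ q ⟧ (length x)) x ys ≡ halted true τ

-- deterministic polynomial-time machine: never branches, halts within q(|x|)
DetPoly : NTM → Poly → Set
DetPoly M q = ∀ x → ∃[ b ] ∃[ τ ] run M (⟦ q ⟧ (length x)) x [] ≡ halted b τ

InP : Lang → Set
InP A = ∃[ M ] ∃[ q ] DetPoly M q ×
  (∀ x → ∃[ τ ] run M (⟦ q ⟧ (length x)) x [] ≡ halted (A x) τ)

FPt : (Str → Str) → Set
FPt g = ∃[ M ] ∃[ q ] DetPoly M q ×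
  (∀ x → ∃[ b ] ∃[ τ ] (run M (⟦ q ⟧ (length x)) x [] ≡ halted b τ × output τ ≡ g x))

FPtℕ : (Str → ℕ) → Set
FPtℕ g = ∃[ g' ] FPt g' × (∀ x → g x ≡ decodeℕ (g' x))

UP : Lang → Set
UP A = ∃[ M ] ∃[ q ] NPoly M q ×
  (∀ x ys zs → AccPath M q x ys → AccPath M q x zs → ys ≡ zs) ×
  (∀ x → (A x ≡ true) ⇔ (∃[ ys ] AccPath M q x ys))

not : Bool → Bool
not true = false
not false = true

coUP : Lang → Set
coUP A = UP (λ x → not (A x))

UP≡coUP : Set
UP≡coUP = ∀ A → UP A ⇔ coUP A

UPSVp : (Str → Maybe Str) → Set
UPSVp g = ∃[ M ] ∃[ q ] NPoly M q ×
  (∀ x ys zs → AccPath M q x ys → AccPath M q x zs → ys ≡ zs) ×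
  (∀ x → (∃[ v ] g x ≡ just v) ⇔ (∃[ ys ] AccPath M q x ys)) ×
  (∀ x ys τ → run M (⟦ q ⟧ (length x)) x ys ≡ halted true τ → g x ≡ just (output τ))

UPSVt : (Str → Str) → Set
UPSVt g = UPSVp (λ x → just (g x))

UPSVtℕ : (Str → ℕ) → Set
UPSVtℕ g = ∃[ g' ] UPSVt g' × (∀ x → g x ≡ decodeℕ (g' x))

-- Balanced machines: on every input the computation paths are exactly the
-- guess strings in {0,1}^{p(|x|)}; all of them halt within q(|x|) steps.

Balanced : NTM → Poly → Poly → Set
Balanced M p q = ∀ x (w : Vec Bool (⟦ p ⟧ (length x))) →
  ∃[ b ] ∃[ τ ] run M (⟦ q ⟧ (length x)) x (toList w) ≡ halted b τ

accB : NTM → Poly → Str → Str → Bool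
accB M q x ys = isAcc (run M (⟦ q ⟧ (length x)) x ys)

allVecs : (m : ℕ) → List (Vec Bool m)
allVecs zero = [] ∷ []
allVecs (suc m) = map (false ∷_) (allVecs m) ++ map (true ∷_) (allVecs m)

count : ∀ {m} → (Vec Bool m → Bool) → ℕ
count {m} P = foldr (λ w n → (if P w then 1 else 0) + n) 0 (allVecs m)

data _<lex_ : ∀ {m} → Vec Bool m → Vec Bool m → Set where
  here : ∀ {m} {a b : Vec Bool m} → (false ∷ a) <lex (true ∷ b)
  there : ∀ {m c} {a b : Vec Bool m} → a <lex b → (c ∷ a) <lex (c ∷ b)

_≤lex_ : ∀ {m} → Vec Bool m → Vec Bool m → Set
a ≤lex b = a <lex b Data.Sum.⊎ a ≡ b
  where import Data.Sum

_≺lex_ : ∀ {m} → Vec Bool m → Vec Bool m → Set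
a ≺lex b = a <lex b × (∀ c → a <lex c → b ≤lex c)

CLUSharpP : (Str → ℕ) → Set
CLUSharpP f = ∃[ p ] ∃[ M ] ∃[ q ] Balanced M p q ×
  ∃[ bot ] ∃[ top ] FPt bot × FPt top ×
  ∃[ prec ] InP prec ×
  (∀ x → let m = ⟦ p ⟧ (length x) in
     length (bot x) ≡ m × length (top x) ≡ m ×
     Σ (Vec Bool m ⤖ Vec Bool m) λ hx → let h = Bijection.to hx in
       (∀ v → toList v ≡ bot x → h v ≡ replicate m false) ×
       (∀ v → toList v ≡ top x → h v ≡ replicate m true) ×
       (∀ y z → (prec ⟨ x , toList y , toList z ⟩ ≡ true) ⇔ (h y ≺lex h z)) ×
       (f x ≢ 0 → Σ (Vec Bool m) λ ℓ → Σ (Vec Bool m) λ u → ∀ w →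
          (accB M q x (toList w) ≡ true) ⇔ (h ℓ ≤lex h w × h w ≤lex h u)) ×
       f x ≡ count {m} (λ w → accB M q x (toList w)))

-- A function of CLU#P is determined, on each input, by an order on the strings of a fixed
-- length and a cluster [lo, lo + f x) of ranks in it. The top element of a nonempty cluster,
-- together with its cyclic successor (rejected, unless the top element is the last one of all),
-- is a unique and polynomial-time checkable witness of f x ≠ 0; similarly for the bottom.
--
-- If CLU#P is closed under increment and A ∈ UP, then one plus the characteristic function of A
-- has a nonempty cluster, which is a singleton iff x ∉ A; this is witnessed uniquely by its two
-- ends, so the complement of A is in UP. Conversely, under UP = coUP every x has a unique string
-- w telling whether f x and g x vanish and naming the top of f's cluster and the bottom of g's.
-- Order the strings w′ ++ v by w′ first, and inside the block of w put the f-order, rotated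
-- to end with its cluster, before the g-order, rotated to start with its cluster. Adjacency
-- remains decidable in polynomial time, since w can be read off any string of its block, and the
-- two clusters merge into one of size f x + g x. A function in UPSVt is in CLU#P by counting,
-- behind its unique path, the binary numbers below its value, so that addition covers the rest.
--
-- Polynomial-time computability is handled through a class of functions on tuples of strings that
-- is closed under composition, case distinction and loops whose state grows by a bounded amount
-- per iteration. Such functions run on a single-tape machine that keeps a pile of stacks on
-- parallel tracks, and every machine of the given model is in turn simulated by such a function.
module Submission where

open import Defs
open import Data.Bool using (Bool; true; false; if_then_else_; _∧_; _∨_)
open import Data.Nat hiding (NonZero)
open import Data.Nat.Properties
open import Data.Nat.Tactic.RingSolver using (solve-∀)
open import Data.Fin using (Fin; zero; suc; toℕ; splitAt; join; combine; remQuot)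
open import Data.Fin.Properties using (splitAt-join; remQuot-combine)
open import Data.List as List using (List; []; _∷_; _++_; length; foldr; foldl; reverse; _ʳ++_)
import Data.List.Properties as List
import Data.Fin.Properties
import Data.Bool
open import Data.Vec as Vec using (Vec; []; _∷_; lookup; _[_]≔_; toList)
import Data.Vec.Properties as Vec
open import Data.Maybe using (Maybe; just; nothing)
open import Data.Product using (Σ; ∃-syntax; _×_; _,_; proj₁; proj₂)
open import Data.Sum using (_⊎_; inj₁; inj₂; [_,_]′)
open import Data.Unit using (⊤; tt)
open import Data.Empty using (⊥; ⊥-elim)
open import Relation.Nullary using (¬_; yes; no; contradiction)
open import Relation.Binary.PropositionalEquality
open import Relation.Binary using (tri<; tri≈; tri>)
open import Function using (_∘_; id)
open import Function.Bundles using (_⇔_; _⤖_; Bijection; Equivalence; mk⇔; mk⤖)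

-- Polynomial bounds and finite types

-- A cluster cannot simply be moved inside its order, since its position is not known to be
-- computable; it is brought to an end of the order by cutting the cycle at a suitable place. The
-- strings themselves have to carry that place: every string names a candidate certificate, and the
-- blocks of wrong candidates are ordered lexicographically and rejected, so that all strings of one
-- length are still totally ordered. An empty cluster has no end to point at; without a certificate
-- for this case no block would be accepted and the other summand would be lost. This is where
-- `UP≡coUP` enters.
--
-- An end is certified together with a neighbour because the order lets adjacency be checked but
-- need not let a successor be computed. Neighbours are taken cyclically so that every element has
-- one on each side and all certificates have the same shape. The closure properties are linked
-- through increment, which each of the others implies.

data PolyExp : Set where
  con     : ℕ → PolyExp
  X       : PolyExp
  _:+_ _:*_ _:∘_ : PolyExp → PolyExp → PolyExp

infixl 6 _:+_
infixl 7 _:*_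
infixr 8 _:∘_

-- Running times are built by sums, products and composition. With expressions these operations
-- evaluate definitionally and monotonicity is structural; coefficient lists appear only at the
-- border to the given model.
⟪_⟫ : PolyExp → ℕ → ℕ
⟪ con c ⟫  n = c
⟪ X ⟫      n = n
⟪ p :+ q ⟫ n = ⟪ p ⟫ n + ⟪ q ⟫ n
⟪ p :* q ⟫ n = ⟪ p ⟫ n * ⟪ q ⟫ n
⟪ p :∘ q ⟫ n = ⟪ p ⟫ (⟪ q ⟫ n)

⟪⟫-mono : ∀ p {m n} → m ≤ n → ⟪ p ⟫ m ≤ ⟪ p ⟫ n
⟪⟫-mono (con c)  h = ≤-refl
⟪⟫-mono X        h = h
⟪⟫-mono (p :+ q) h = +-mono-≤ (⟪⟫-mono p h) (⟪⟫-mono q h)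
⟪⟫-mono (p :* q) h = *-mono-≤ (⟪⟫-mono p h) (⟪⟫-mono q h)
⟪⟫-mono (p :∘ q) h = ⟪⟫-mono p (⟪⟫-mono q h)

module _ where
  private
    _⊕_ : Poly → Poly → Poly
    []      ⊕ q       = q
    (a ∷ p) ⊕ []      = a ∷ p
    (a ∷ p) ⊕ (b ∷ q) = (a + b) ∷ (p ⊕ q)

    scale : ℕ → Poly → Poly
    scale c = List.map (c *_)

    _⊗_ : Poly → Poly → Poly
    []      ⊗ q = []
    (a ∷ p) ⊗ q = scale a q ⊕ (0 ∷ (p ⊗ q))

    _⊚_ : Poly → Poly → Poly
    []      ⊚ q = []
    (a ∷ p) ⊚ q = (a ∷ []) ⊕ (q ⊗ (p ⊚ q))

    ⊕-eval : ∀ p q n → ⟦ p ⊕ q ⟧ n ≡ ⟦ p ⟧ n + ⟦ q ⟧ n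
    ⊕-eval []      q       n = refl
    ⊕-eval (a ∷ p) []      n = sym (+-identityʳ _)
    ⊕-eval (a ∷ p) (b ∷ q) n rewrite ⊕-eval p q n = lemma a b n (⟦ p ⟧ n) (⟦ q ⟧ n)
      where
      lemma : ∀ a b n x y → (a + b) + n * (x + y) ≡ (a + n * x) + (b + n * y)
      lemma = solve-∀

    scale-eval : ∀ c q n → ⟦ scale c q ⟧ n ≡ c * ⟦ q ⟧ n
    scale-eval c []      n = sym (*-zeroʳ c)
    scale-eval c (b ∷ q) n rewrite scale-eval c q n = lemma c b n (⟦ q ⟧ n)
      where
      lemma : ∀ c b n x → c * b + n * (c * x) ≡ c * (b + n * x)
      lemma = solve-∀

    ⊗-eval : ∀ p q n → ⟦ p ⊗ q ⟧ n ≡ ⟦ p ⟧ n * ⟦ q ⟧ n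
    ⊗-eval []      q n = refl
    ⊗-eval (a ∷ p) q n
      rewrite ⊕-eval (scale a q) (0 ∷ (p ⊗ q)) n | scale-eval a q n | ⊗-eval p q n
      = lemma a n (⟦ p ⟧ n) (⟦ q ⟧ n)
      where
      lemma : ∀ a n x y → a * y + n * (x * y) ≡ (a + n * x) * y
      lemma = solve-∀

    ⊚-eval : ∀ p q n → ⟦ p ⊚ q ⟧ n ≡ ⟦ p ⟧ (⟦ q ⟧ n)
    ⊚-eval []      q n = refl
    ⊚-eval (a ∷ p) q n
      rewrite ⊕-eval (a ∷ []) (q ⊗ (p ⊚ q)) n | ⊗-eval q (p ⊚ q) n | ⊚-eval p q n
            | *-zeroʳ n | +-identityʳ a = refl

  toPoly : PolyExp → Poly
  toPoly (con c)  = c ∷ []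
  toPoly X        = 0 ∷ 1 ∷ []
  toPoly (p :+ q) = toPoly p ⊕ toPoly q
  toPoly (p :* q) = toPoly p ⊗ toPoly q
  toPoly (p :∘ q) = toPoly p ⊚ toPoly q

  toPoly-eval : ∀ p n → ⟦ toPoly p ⟧ n ≡ ⟪ p ⟫ n
  toPoly-eval (con c)  n = trans (cong (c +_) (*-zeroʳ n)) (+-identityʳ c)
  toPoly-eval X        n = lemma n
    where
    lemma : ∀ n → 0 + n * (1 + n * 0) ≡ n
    lemma = solve-∀
  toPoly-eval (p :+ q) n = trans (⊕-eval (toPoly p) _ n) (cong₂ _+_ (toPoly-eval p n) (toPoly-eval q n))
  toPoly-eval (p :* q) n = trans (⊗-eval (toPoly p) _ n) (cong₂ _*_ (toPoly-eval p n) (toPoly-eval q n))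
  toPoly-eval (p :∘ q) n = trans (⊚-eval (toPoly p) _ n)
    (trans (cong ⟦ toPoly p ⟧ (toPoly-eval q n)) (toPoly-eval p (⟪ q ⟫ n)))

fromPoly : Poly → PolyExp
fromPoly []      = con 0
fromPoly (c ∷ p) = con c :+ X :* fromPoly p

fromPoly-eval : ∀ p n → ⟪ fromPoly p ⟫ n ≡ ⟦ p ⟧ n
fromPoly-eval []      n = refl
fromPoly-eval (c ∷ p) n = cong (λ t → c + n * t) (fromPoly-eval p n)

-- A retraction suffices: the machine decodes its state and symbol before acting, so surplus codes
-- do no harm.
record Finite (A : Set) : Set where
  field
    card    : ℕ
    enc     : A → Fin card
    dec     : Fin card → A
    dec-enc : ∀ a → dec (enc a) ≡ a
open Finite

Finite-retract : ∀ {A B : Set} (to : A → B) (from : B → A) → (∀ a → from (to a) ≡ a) → Finite B → Finite A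
Finite-retract to from ft F = record
  { card = card F ; enc = enc F ∘ to ; dec = from ∘ dec F
  ; dec-enc = λ a → trans (cong from (dec-enc F (to a))) (ft a) }

Finite-Fin : ∀ n → Finite (Fin n)
Finite-Fin n = record { card = n ; enc = id ; dec = id ; dec-enc = λ _ → refl }

Finite-⊤ : Finite ⊤
Finite-⊤ = record { card = 1 ; enc = λ _ → zero ; dec = λ _ → tt ; dec-enc = λ _ → refl }

Finite-⊎ : ∀ {A B : Set} → Finite A → Finite B → Finite (A ⊎ B)
Finite-⊎ FA FB = record
  { card = card FA + card FB
  ; enc = λ { (inj₁ a) → join _ _ (inj₁ (enc FA a)) ; (inj₂ b) → join (card FA) _ (inj₂ (enc FB b)) }
  ; dec = λ i → [ inj₁ ∘ dec FA , inj₂ ∘ dec FB ]′ (splitAt (card FA) i)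
  ; dec-enc = λ
    { (inj₁ a) → trans (cong [ inj₁ ∘ dec FA , inj₂ ∘ dec FB ]′ (splitAt-join (card FA) (card FB) (inj₁ (enc FA a))))
                       (cong inj₁ (dec-enc FA a))
    ; (inj₂ b) → trans (cong [ inj₁ ∘ dec FA , inj₂ ∘ dec FB ]′ (splitAt-join (card FA) (card FB) (inj₂ (enc FB b))))
                       (cong inj₂ (dec-enc FB b)) } }

Finite-× : ∀ {A B : Set} → Finite A → Finite B → Finite (A × B)
Finite-× FA FB = record
  { card = card FA * card FB
  ; enc = λ { (a , b) → combine (enc FA a) (enc FB b) }
  ; dec = λ i → dec FA (proj₁ (remQuot (card FB) i)) , dec FB (proj₂ (remQuot {card FA} (card FB) i))
  ; dec-enc = λ { (a , b) →
      trans (cong (λ p → dec FA (proj₁ p) , dec FB (proj₂ p)) (remQuot-combine (enc FA a) (enc FB b)))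
            (cong₂ _,_ (dec-enc FA a) (dec-enc FB b)) } }

Finite-Maybe : ∀ {A : Set} → Finite A → Finite (Maybe A)
Finite-Maybe {A} FA = Finite-retract to from ft (Finite-⊎ Finite-⊤ FA)
  where
  to : Maybe A → ⊤ ⊎ A
  to nothing  = inj₁ tt
  to (just a) = inj₂ a
  from : ⊤ ⊎ A → Maybe A
  from (inj₁ _) = nothing
  from (inj₂ a) = just a
  ft : ∀ a → from (to a) ≡ a
  ft nothing  = refl
  ft (just _) = refl

Finite-Bool : Finite Bool
Finite-Bool = Finite-retract to from ft (Finite-Fin 2)
  where
  to : Bool → Fin 2
  to false = zero
  to true  = suc zero
  from : Fin 2 → Bool
  from zero    = false
  from (suc _) = true
  ft : ∀ a → from (to a) ≡ a
  ft false = refl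
  ft true  = refl

Finite-Vec : ∀ {A : Set} → Finite A → ∀ n → Finite (Vec A n)
Finite-Vec FA zero    = Finite-retract (λ _ → tt) (λ _ → []) (λ { [] → refl }) Finite-⊤
Finite-Vec FA (suc n) = Finite-retract (λ { (a ∷ v) → a , v }) (λ { (a , v) → a ∷ v }) (λ { (a ∷ v) → refl })
  (Finite-× FA (Finite-Vec FA n))

-- Stack machines on a single tape

run-step : ∀ (M : NTM) {q q' s m f ys} {τ : Tape (NTM.k M)} → NTM.δ M q (hd τ) ≡ step q' s m →
  runFrom M (suc f) ys q τ ≡ runFrom M f ys q' (move m (write s τ))
run-step M eq rewrite eq = refl

run-halt : ∀ (M : NTM) {q b f} {τ : Tape (NTM.k M)} → NTM.δ M q (hd τ) ≡ halt b →
  runFrom M f [] q τ ≡ halted b τ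
run-halt M eq rewrite eq = refl

run-halt-∷ : ∀ (M : NTM) {q b f y ys} {τ : Tape (NTM.k M)} → NTM.δ M q (hd τ) ≡ halt b →
  runFrom M f (y ∷ ys) q τ ≡ badPath
run-halt-∷ M eq rewrite eq = refl

module _ (M : NTM) {q q₀ q₁ s₀ s₁ m₀ m₁} {τ : Tape (NTM.k M)}
         (eq : NTM.δ M q (hd τ) ≡ branch (q₀ , s₀ , m₀) (q₁ , s₁ , m₁)) where
  run-branch₀ : ∀ {f ys} → runFrom M (suc f) (false ∷ ys) q τ ≡ runFrom M f ys q₀ (move m₀ (write s₀ τ))
  run-branch₀ rewrite eq = refl

  run-branch₁ : ∀ {f ys} → runFrom M (suc f) (true ∷ ys) q τ ≡ runFrom M f ys q₁ (move m₁ (write s₁ τ))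
  run-branch₁ rewrite eq = refl

  run-branch-[] : ∀ {f} → runFrom M (suc f) [] q τ ≡ badPath
  run-branch-[] rewrite eq = refl

-- The tape is unbounded on both sides. The end marker is put on the blank cell just left of the
-- input, so the input need not be shifted.
run-mark-left : ∀ (M : NTM) {q₁ q₂ g} → let open NTM M in
  (∀ x → δ start (hd (initTape x)) ≡ step q₁ (hd (initTape x)) L) → δ q₁ blank ≡ step q₂ g R →
  ∀ x f ys → runFrom M (2 + f) ys start (initTape x) ≡ runFrom M f ys q₂ (tape (g ∷ []) (hd (initTape x)) (rgt (initTape x)))
run-mark-left M {q₁} {q₂} {g} e₀ e₁ x f ys =
  trans (run-step M {f = suc f} {ys} {initTape x} (e₀ x)) (trans (cong (runFrom M (suc f) ys q₁) (moved x))
    (trans (run-step M {f = f} {ys} {tape [] blank (hd (initTape x) ∷ rgt (initTape x))} e₁) refl))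
  where
  moved : ∀ x → move L (write (hd (initTape x)) (initTape x)) ≡ tape [] blank (hd (initTape x) ∷ rgt (initTape x))
  moved []      = refl
  moved (_ ∷ _) = refl

-- The instructions of a machine with K stacks of bits. Track i of the tape
-- holds stack i, top at the left end, so pushing and popping shift a track.
data Instr (Q : Set) (K : ℕ) : Set where
  nop   : Q → Instr Q K
  push  : Fin K → Bool → Q → Instr Q K
  pop   : Fin K → Q → (Bool → Q) → Instr Q K
  guess : Fin K → Q → Instr Q K
  out   : Fin K → Q → Instr Q K
  stop  : Bool → Instr Q K

Cell : ℕ → Set
Cell K = Vec (Maybe Bool) K

-- `bl` and `bit` stand for the blank and the bits of the model, in which the input is found and the
-- output must be left; `cl` is a cell of the tracks.
data Symb (K : ℕ) : Set where
  bl  : Symb K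
  bit : Bool → Symb K
  cl  : Cell K → Symb K

-- `pushing` walks right, carrying the symbol displaced from the cell before. `seek` walks right to
-- the end of a stack, from where `popping` walks left to the marker, each cell receiving the symbol
-- of its right neighbour. `home` is the state at the left end in which the next instruction is
-- chosen.
data State (Q : Set) (K : ℕ) : Set where
  init₀ init₁ init₂ : State Q K
  home  : Q → State Q K
  ret   : Q → State Q K
  pushing : Fin K → Maybe Bool → Q → State Q K
  seek  : Fin K → Q → State Q K
  popping : Fin K → Maybe Bool → Q → State Q K
  outp  : Fin K → Q → State Q K

opaque
  Finite-State : ∀ {Q K} → Finite Q → Finite (State Q K)
  Finite-State {Q} {K} FQ = Finite-retract to from ft
    (Finite-⊎ (Finite-Fin 3) (Finite-⊎ (Finite-⊎ FQ FQ) (Finite-⊎ FIQ (Finite-⊎ FIQ (Finite-⊎ FICQ FICQ)))))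
    where
    FIQ : Finite (Fin K × Q)
    FIQ  = Finite-× (Finite-Fin K) FQ
    FICQ : Finite (Fin K × Maybe Bool × Q)
    FICQ = Finite-× (Finite-Fin K) (Finite-× (Finite-Maybe Finite-Bool) FQ)
    to : State Q K → Fin 3 ⊎ (Q ⊎ Q) ⊎ (Fin K × Q) ⊎ (Fin K × Q) ⊎ (Fin K × Maybe Bool × Q) ⊎ (Fin K × Maybe Bool × Q)
    to init₀ = inj₁ zero
    to init₁ = inj₁ (suc zero)
    to init₂ = inj₁ (suc (suc zero))
    to (home q) = inj₂ (inj₁ (inj₁ q))
    to (ret q)  = inj₂ (inj₁ (inj₂ q))
    to (seek i q) = inj₂ (inj₂ (inj₁ (i , q)))
    to (outp i q) = inj₂ (inj₂ (inj₂ (inj₁ (i , q))))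
    to (pushing i c q) = inj₂ (inj₂ (inj₂ (inj₂ (inj₁ (i , c , q)))))
    to (popping i c q) = inj₂ (inj₂ (inj₂ (inj₂ (inj₂ (i , c , q)))))
    from : Fin 3 ⊎ (Q ⊎ Q) ⊎ (Fin K × Q) ⊎ (Fin K × Q) ⊎ (Fin K × Maybe Bool × Q) ⊎ (Fin K × Maybe Bool × Q) → State Q K
    from (inj₁ zero) = init₀
    from (inj₁ (suc zero)) = init₁
    from (inj₁ (suc (suc _))) = init₂
    from (inj₂ (inj₁ (inj₁ q))) = home q
    from (inj₂ (inj₁ (inj₂ q))) = ret q
    from (inj₂ (inj₂ (inj₁ (i , q)))) = seek i q
    from (inj₂ (inj₂ (inj₂ (inj₁ (i , q))))) = outp i q
    from (inj₂ (inj₂ (inj₂ (inj₂ (inj₁ (i , c , q)))))) = pushing i c q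
    from (inj₂ (inj₂ (inj₂ (inj₂ (inj₂ (i , c , q)))))) = popping i c q
    ft : ∀ a → from (to a) ≡ a
    ft init₀ = refl
    ft init₁ = refl
    ft init₂ = refl
    ft (home _) = refl
    ft (ret _) = refl
    ft (pushing _ _ _) = refl
    ft (seek _ _) = refl
    ft (popping _ _ _) = refl
    ft (outp _ _) = refl

cellOf : ∀ {K} → Symb K → Cell K
cellOf (cl c) = c
cellOf _      = Vec.replicate _ nothing

get : ∀ {K} → Symb K → Fin K → Maybe Bool
get s i = lookup (cellOf s) i

set : ∀ {K} → Symb K → Fin K → Maybe Bool → Symb K
set s i c = cl (cellOf s [ i ]≔ c)

get-set : ∀ {K} (s : Symb K) i c → get (set s i c) i ≡ c
get-set s i c = Vec.lookup∘update i (cellOf s) c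

get-set-≢ : ∀ {K} (s : Symb K) {i j} c → j ≢ i → get (set s i c) j ≡ get s j
get-set-≢ s c ne = Vec.lookup∘update′ ne (cellOf s) c

track : ∀ {K} → Fin K → List (Symb K) → List (Maybe Bool)
track i = List.map (λ s → get s i)

-- Trailing gaps are allowed because stacks of different heights share the cells of one tape.
data Holds : List (Maybe Bool) → Str → Set where
  []ʰ  : Holds [] []
  gap  : ∀ {t} → Holds t [] → Holds (nothing ∷ t) []
  _∷ᵇ_ : ∀ {t s} b → Holds t s → Holds (just b ∷ t) (b ∷ s)

headM : Str → Maybe Bool
headM []      = nothing
headM (b ∷ _) = just b

tailS : Str → Str
tailS []      = []
tailS (_ ∷ s) = s

hdS : ∀ {K} → List (Symb K) → Symb K
hdS []      = bl
hdS (c ∷ _) = c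

tlS : ∀ {K} → List (Symb K) → List (Symb K)
tlS []       = []
tlS (_ ∷ cs) = cs

get-bl : ∀ {K} (i : Fin K) → get bl i ≡ nothing
get-bl i = Vec.lookup-replicate i nothing

Holds-pad : ∀ {K} (i : Fin K) cs {s} → Holds (track i cs) s → Holds (track i (hdS cs ∷ tlS cs)) s
Holds-pad i [] []ʰ rewrite get-bl i = gap []ʰ
Holds-pad i (c ∷ cs) h = h

Holds-head : ∀ {K} (i : Fin K) cs {s} → Holds (track i cs) s → get (hdS cs) i ≡ headM s
Holds-head i [] []ʰ = get-bl i
Holds-head i (c ∷ cs) h = lem h
  where
  lem : ∀ {t x s} → Holds (x ∷ t) s → x ≡ headM s
  lem (gap _) = refl
  lem (_ ∷ᵇ _) = refl

Holds-tail : ∀ {K} (i : Fin K) cs {s} → Holds (track i cs) s → Holds (track i (tlS cs)) (tailS s)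
Holds-tail i [] []ʰ = []ʰ
Holds-tail i (c ∷ cs) h = lem h
  where
  lem : ∀ {t x s} → Holds (x ∷ t) s → Holds t (tailS s)
  lem (gap h) = h
  lem (_ ∷ᵇ h) = h

Holds-∷ : ∀ {t x s} → x ≡ headM s → Holds t (tailS s) → Holds (x ∷ t) s
Holds-∷ {s = []}    refl h = gap h
Holds-∷ {s = b ∷ s} refl h = b ∷ᵇ h

module StackMachine {Q : Set} (FQ : Finite Q) (K : ℕ) (q₀ : Q) (i₀ : Fin K) (prog : Q → Instr Q K) where

  Tm : Set
  Tm = Action (State Q K) (Maybe (Symb K))

  -- nothing is the marker at the left end of the tape
  δt : State Q K → Maybe (Symb K) → Tm
  δhome : Instr Q K → Maybe (Symb K) → Tm
  δpop  : Fin K → Q → (Bool → Q) → Maybe (Symb K) → Maybe Bool → Tm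

  δpop i q f g nothing  = step (home q) g S
  δpop i q f g (just b) = step (seek i (f b)) g S

  δhome (nop q)      g = step (home q) g S
  δhome (push i b q) g = step (pushing i (just b) q) g S
  δhome (pop i q f)  nothing  = halt false
  δhome (pop i q f)  (just s) = δpop i q f (just s) (get s i)
  δhome (guess i q)  g = branch (pushing i (just false) q , g , S) (pushing i (just true) q , g , S)
  δhome (out i q)    g = step (outp i q) g S
  δhome (stop b)     g = halt b

  δseek : Fin K → Q → Symb K → Maybe Bool → Tm
  δseek i q s (just _) = step (seek i q) (just s) R
  δseek i q s nothing  = step (popping i nothing q) (just s) L

  δout : Fin K → Q → Maybe Bool → Tm
  δout i q (just b) = step (outp i q) (just (bit b)) R
  δout i q nothing  = step (ret q) (just bl) L

  δt init₀ g = step init₁ g L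
  δt init₁ g = step init₂ nothing R
  δt init₂ (just (bit b)) = step init₂ (just (set bl i₀ (just b))) R
  δt init₂ g              = step (ret q₀) g L
  δt (home q) g = δhome (prog q) g
  δt (ret q) nothing  = step (home q) nothing R
  δt (ret q) (just s) = step (ret q) (just s) L
  δt (pushing i (just b) q) (just s) = step (pushing i (get s i) q) (just (set s i (just b))) R
  δt (pushing i nothing q)  (just s) = step (ret q) (just s) L
  δt (pushing i c q)        nothing  = halt false
  δt (seek i q) (just s) = δseek i q s (get s i)
  δt (seek i q) nothing  = halt false
  δt (popping i c q) nothing  = step (home q) nothing R
  δt (popping i c q) (just s) = step (popping i (get s i) q) (just (set s i c)) L
  δt (outp i q) nothing  = halt false
  δt (outp i q) (just s) = δout i q (get s i)

  FS : Finite (State Q K)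
  FS = Finite-State FQ

  FC : Finite (Cell K)
  FC = Finite-Vec (Finite-Maybe Finite-Bool) K

  Sy : Set
  Sy = Sym (suc (card FC))

  encG : Maybe (Symb K) → Sy
  encG nothing         = suc (suc (suc zero))
  encG (just bl)       = blank
  encG (just (bit b))  = bitSym b
  encG (just (cl c))   = suc (suc (suc (suc (enc FC c))))

  decG : Sy → Maybe (Symb K)
  decG zero                        = just bl
  decG (suc zero)                  = just (bit false)
  decG (suc (suc zero))            = just (bit true)
  decG (suc (suc (suc zero)))      = nothing
  decG (suc (suc (suc (suc c))))   = just (cl (dec FC c))

  decG-encG : ∀ g → decG (encG g) ≡ g
  decG-encG nothing             = refl
  decG-encG (just bl)           = refl
  decG-encG (just (bit false))  = refl
  decG-encG (just (bit true))   = refl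
  decG-encG (just (cl c))       = cong (λ d → just (cl d)) (dec-enc FC c)

  encS : State Q K → Fin (card FS)
  encS = enc FS

  mapAct : Tm → Action (Fin (card FS)) Sy
  mapAct (halt b)     = halt b
  mapAct (step q g m) = step (encS q) (encG g) m
  mapAct (branch (q , g , m) (q' , g' , m')) = branch (encS q , encG g , m) (encS q' , encG g' , m')

  machine : NTM
  machine = record { nQ = card FS ; k = suc (card FC) ; start = encS init₀
                   ; δ = λ q s → mapAct (δt (dec FS q) (decG s)) }

  δ-enc : ∀ q g → NTM.δ machine (encS q) (encG g) ≡ mapAct (δt q g)
  δ-enc q g = cong₂ (λ a b → mapAct (δt a b)) (dec-enc FS q) (decG-encG g)

  enc* : List (Symb K) → List Sy
  enc* = List.map (λ s → encG (just s))

  mk : List Sy → List Sy → Tape (suc (card FC))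
  mk l []      = tape l blank []
  mk l (h ∷ r) = tape l h r

  data Conf : Set where
    conf : List (Symb K) → List (Symb K) → Conf
    atLM : List (Symb K) → Conf

  tp : Conf → Tape (suc (card FC))
  tp (conf l cs) = mk (enc* l ++ encG nothing ∷ []) (enc* cs)
  tp (atLM cs)   = tape [] (encG nothing) (enc* cs)

  opaque
    exec : ℕ → Str → State Q K → Conf → Outcome (suc (card FC))
    exec f ys q c = runFrom machine f ys (encS q) (tp c)

    start : ℕ → Str → Str → Outcome (suc (card FC))
    start f ys x = run machine f x ys

    start≡run : ∀ f ys x → start f ys x ≡ run machine f x ys
    start≡run f ys x = refl

  -- The count is exact and the fuel beyond it arbitrary, so that runs compose by adding counts. No
  -- guess is consumed on the way.
  record _⟶[_]_ (a : State Q K × Conf) (n : ℕ) (b : State Q K × Conf) : Set where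
    constructor steps
    field apply : ∀ f ys → exec (n + f) ys (proj₁ a) (proj₂ a) ≡ exec f ys (proj₁ b) (proj₂ b)
  open _⟶[_]_ public

  infixr 5 _▹_
  _▹_ : ∀ {a b c m n} → a ⟶[ m ] b → b ⟶[ n ] c → a ⟶[ m + n ] c
  _▹_ {a} {m = m} {n} (steps p) (steps q) = steps λ f ys →
    trans (cong (λ k → exec k ys (proj₁ a) (proj₂ a)) (+-assoc m n f)) (trans (p (n + f) ys) (q f ys))

  recount : ∀ {a b m n} → m ≡ n → a ⟶[ m ] b → a ⟶[ n ] b
  recount refl r = r

  left : List (Symb K) → List (Symb K) → Conf
  left []      cs = atLM cs
  left (a ∷ l) cs = conf l (a ∷ cs)

  private
    δ-at : ∀ q l cs {act} → δt q (just (hdS cs)) ≡ act → NTM.δ machine (encS q) (hd (tp (conf l cs))) ≡ mapAct act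
    δ-at q l []       eq = trans (δ-enc q (just bl)) (cong mapAct eq)
    δ-at q l (c ∷ cs) eq = trans (δ-enc q (just c)) (cong mapAct eq)

  opaque
    unfolding exec

    moveR : ∀ {q q' w} l cs → δt q (just (hdS cs)) ≡ step q' (just w) R →
            (q , conf l cs) ⟶[ 1 ] (q' , conf (w ∷ l) (tlS cs))
    moveR {q} {q'} {w} l cs eq = steps λ f ys → trans (run-step machine (δ-at q l cs eq)) (cong (runFrom machine f ys _) (lem cs))
      where
      lem : ∀ cs → move R (write (encG (just w)) (tp (conf l cs))) ≡ tp (conf (w ∷ l) (tlS cs))
      lem []           = refl
      lem (_ ∷ [])     = refl
      lem (_ ∷ _ ∷ _)  = refl

    moveL : ∀ {q q' w} l cs → δt q (just (hdS cs)) ≡ step q' (just w) L →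
            (q , conf l cs) ⟶[ 1 ] (q' , left l (w ∷ tlS cs))
    moveL {q} {q'} {w} l cs eq = steps λ f ys → trans (run-step machine (δ-at q l cs eq)) (cong (runFrom machine f ys _) (lem l cs))
      where
      lem : ∀ l cs → move L (write (encG (just w)) (tp (conf l cs))) ≡ tp (left l (w ∷ tlS cs))
      lem []      []      = refl
      lem []      (_ ∷ _) = refl
      lem (_ ∷ _) []      = refl
      lem (_ ∷ _) (_ ∷ _) = refl

  private
    stay-tape : ∀ l cs → move S (write (encG (just (hdS cs))) (tp (conf l cs))) ≡ tp (conf l cs)
    stay-tape l []      = refl
    stay-tape l (_ ∷ _) = refl

  opaque
    unfolding exec

    stay : ∀ {q q'} l cs → δt q (just (hdS cs)) ≡ step q' (just (hdS cs)) S →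
           (q , conf l cs) ⟶[ 1 ] (q' , conf l cs)
    stay {q} l cs eq = steps λ f ys →
      trans (run-step machine (δ-at q l cs eq)) (cong (runFrom machine f ys _) (stay-tape l cs))

    bounce : ∀ {q q'} cs → δt q nothing ≡ step q' nothing R → (q , atLM cs) ⟶[ 1 ] (q' , conf [] cs)
    bounce {q} cs eq = steps λ f ys →
      trans (run-step machine (trans (δ-enc q nothing) (cong mapAct eq))) (cong (runFrom machine f ys _) (lem cs))
      where
      lem : ∀ cs → move R (write (encG nothing) (tp (atLM cs))) ≡ tp (conf [] cs)
      lem []      = refl
      lem (_ ∷ _) = refl

  return-left : ∀ q l cs → (ret q , left l cs) ⟶[ suc (length l) ] (home q , conf [] (l ʳ++ cs))
  return-left q []      cs = bounce cs refl
  return-left q (a ∷ l) cs = moveL l (a ∷ cs) refl ▹ return-left q l (a ∷ cs)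

  Others : Fin K → List (Symb K) → List (Symb K) → Set
  Others i cs cs' = ∀ j → j ≢ i → ∀ s → Holds (track j cs) s → Holds (track j cs') s

  Others-set : ∀ {i cs c cs'} → Others i (tlS cs) cs' → Others i cs (set (hdS cs) i c ∷ cs')
  Others-set {i} {cs} {c} o j ne s h =
    Holds-∷ (trans (get-set-≢ (hdS cs) c ne) (Holds-head j cs h)) (o j ne (tailS s) (Holds-tail j cs h))

  -- Writing `b` displaces the old top, which is in turn pushed onto the rest of the stack. The
  -- length of `l` enters the bound through the walk home.
  pushing-run : ∀ i b q s l cs → Holds (track i cs) s →
    ∃[ cs' ] ∃[ n ] ((pushing i (just b) q , conf l cs) ⟶[ n ] (home q , conf [] (l ʳ++ cs')))
      × n ≤ 2 * length s + length l + 4 × Holds (track i cs') (b ∷ s) × Others i cs cs'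
  pushing-run i b q [] l cs h =
    set (hdS cs) i (just b) ∷ hdS (tlS cs) ∷ tlS (tlS cs) , _ ,
    (moveR l cs (cong (λ c → step (pushing i c q) (just (set (hdS cs) i (just b))) R) (Holds-head i cs h)) ▹
     moveL (set (hdS cs) i (just b) ∷ l) (tlS cs) refl ▹
     return-left q (set (hdS cs) i (just b) ∷ l) (hdS (tlS cs) ∷ tlS (tlS cs))) ,
    ≤-reflexive (+-comm 4 (length l)) ,
    Holds-∷ (get-set (hdS cs) i (just b)) (Holds-pad i (tlS cs) (Holds-tail i cs h)) ,
    Others-set {cs = cs} {just b} {hdS (tlS cs) ∷ tlS (tlS cs)} (λ j _ s h → Holds-pad j (tlS cs) h)
  pushing-run i b q (b' ∷ s) l cs h
    with pushing-run i b' q s (set (hdS cs) i (just b) ∷ l) (tlS cs) (Holds-tail i cs h)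
  ... | cs' , n , r , n≤ , h' , o =
    set (hdS cs) i (just b) ∷ cs' , suc n ,
    (moveR l cs (cong (λ c → step (pushing i c q) (just (set (hdS cs) i (just b))) R) (Holds-head i cs h)) ▹ r) ,
    ≤-trans (s≤s n≤) (≤-reflexive (lem (length s) (length l))) ,
    Holds-∷ (get-set (hdS cs) i (just b)) h' , Others-set {cs = cs} {just b} o
    where
    lem : ∀ a c → suc (2 * a + suc c + 4) ≡ 2 * suc a + c + 4
    lem = solve-∀

  -- The walk back is part of the induction: the run over the tail returns with the top of the tail
  -- in hand, and this symbol replaces the current one.
  seek-run : ∀ i q s l cs → Holds (track i cs) s →
    ∃[ cs' ] ((seek i q , conf l cs) ⟶[ suc (2 * length s) ] (popping i (headM s) q , left l cs'))
      × Holds (track i cs') (tailS s) × Others i cs cs'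
  seek-run i q [] l cs h = hdS cs ∷ tlS cs ,
    moveL l cs (cong (δseek i q (hdS cs)) (Holds-head i cs h)) ,
    Holds-pad i cs h , λ j _ s h → Holds-pad j cs h
  seek-run i q (b ∷ s) l (c ∷ cs) h with seek-run i q s (c ∷ l) cs (Holds-tail i (c ∷ cs) h)
  ... | cs' , r , h' , o = set c i (headM s) ∷ cs' ,
    recount (lem (length s))
     (moveR l (c ∷ cs) (cong (δseek i q c) (Holds-head i (c ∷ cs) h)) ▹ r ▹
      moveL l (c ∷ cs') (cong (λ x → step (popping i x q) (just (set c i (headM s))) L) (Holds-head i (c ∷ cs) h))) ,
    Holds-∷ (get-set c i (headM s)) h' , Others-set {cs = c ∷ cs} {headM s} o
    where
    lem : ∀ a → 1 + (suc (2 * a) + 1) ≡ suc (2 * suc a)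
    lem = solve-∀

  popping-run : ∀ i q f b s cs {q'} → Holds (track i cs) (b ∷ s) → prog q' ≡ pop i q f →
    ∃[ cs' ] ((home q' , conf [] cs) ⟶[ 2 * length (b ∷ s) + 3 ] (home (f b) , conf [] cs'))
      × Holds (track i cs') s × Others i cs cs'
  popping-run i q f b s cs h eq with seek-run i (f b) (b ∷ s) [] cs h
  ... | cs' , r , h' , o = cs' ,
    recount (lem (length s))
      (stay [] cs (trans (cong (λ p → δhome p _) eq) (cong (δpop i q f (just (hdS cs))) (Holds-head i cs h))) ▹ r ▹ bounce cs' refl) , h' , o
    where
    lem : ∀ a → 1 + (suc (2 * suc a) + 1) ≡ 2 * suc a + 3
    lem = solve-∀

  pop-empty-run : ∀ i q f cs {q'} → Holds (track i cs) [] → prog q' ≡ pop i q f →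
    (home q' , conf [] cs) ⟶[ 1 ] (home q , conf [] cs)
  pop-empty-run i q f cs h eq =
    stay [] cs (trans (cong (λ p → δhome p _) eq) (cong (δpop i q f (just (hdS cs))) (Holds-head i cs h)))

  push-run : ∀ i b q s cs {q'} → Holds (track i cs) s → prog q' ≡ push i b q →
    ∃[ cs' ] ∃[ n ] ((home q' , conf [] cs) ⟶[ n ] (home q , conf [] cs'))
      × n ≤ 2 * length s + 5 × Holds (track i cs') (b ∷ s) × Others i cs cs'
  push-run i b q s cs h eq with pushing-run i b q s [] cs h
  ... | cs' , n , r , n≤ , h' , o = cs' , suc n ,
    (stay [] cs (cong (λ p → δhome p _) eq) ▹ r) , ≤-trans (s≤s n≤) (≤-reflexive (lem (length s))) , h' , o
    where
    lem : ∀ a → suc (2 * a + 0 + 4) ≡ 2 * a + 5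
    lem = solve-∀

  nop-run : ∀ q cs {q'} → prog q' ≡ nop q → (home q' , conf [] cs) ⟶[ 1 ] (home q , conf [] cs)
  nop-run q cs eq = stay [] cs (cong (λ p → δhome p _) eq)

  opaque
    unfolding exec

    guess-step : ∀ i b q cs {q' f ys} → prog q' ≡ guess i q →
      exec (suc f) (b ∷ ys) (home q') (conf [] cs) ≡ exec f ys (pushing i (just b) q) (conf [] cs)
    guess-step i b q cs {q'} {f} {ys} eq = pick b (δ-at (home q') [] cs (cong (λ p → δhome p (just (hdS cs))) eq))
      where
      pick : ∀ b → NTM.δ machine (encS (home q')) (hd (tp (conf [] cs))) ≡ mapAct (δhome (guess i q) (just (hdS cs))) →
        exec (suc f) (b ∷ ys) (home q') (conf [] cs) ≡ exec f ys (pushing i (just b) q) (conf [] cs)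
      pick false δeq = trans (run-branch₀ machine δeq) (cong (runFrom machine f ys (encS (pushing i (just false) q))) (stay-tape [] cs))
      pick true  δeq = trans (run-branch₁ machine δeq) (cong (runFrom machine f ys (encS (pushing i (just true) q))) (stay-tape [] cs))

  guess-run : ∀ i b q s cs {q'} → Holds (track i cs) s → prog q' ≡ guess i q →
    ∃[ cs' ] ∃[ n ] (∀ f ys → exec (n + f) (b ∷ ys) (home q') (conf [] cs) ≡ exec f ys (home q) (conf [] cs'))
      × n ≤ 2 * length s + 5 × Holds (track i cs') (b ∷ s) × Others i cs cs'
  guess-run i b q s cs {q'} h eq with pushing-run i b q s [] cs h
  ... | cs' , n , r , n≤ , h' , o = cs' , suc n ,
    (λ f ys → trans (guess-step i b q cs eq) (apply r f ys)) , ≤-trans (s≤s n≤) (≤-reflexive (lem (length s))) , h' , o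
    where
    lem : ∀ a → suc (2 * a + 0 + 4) ≡ 2 * a + 5
    lem = solve-∀

  opaque
    unfolding exec

    guess-[] : ∀ i q cs {q' f} → prog q' ≡ guess i q → exec (suc f) [] (home q') (conf [] cs) ≡ badPath
    guess-[] i q cs {q'} eq =
      run-branch-[] machine (δ-at (home q') [] cs (cong (λ p → δhome p (just (hdS cs))) eq))

    stop-run : ∀ b cs {q f} → prog q ≡ stop b → exec f [] (home q) (conf [] cs) ≡ halted b (tp (conf [] cs))
    stop-run b cs {q} eq = run-halt machine (δ-at (home q) [] cs (cong (λ p → δhome p (just (hdS cs))) eq))

    stop-∷ : ∀ b cs {q f y ys} → prog q ≡ stop b → exec f (y ∷ ys) (home q) (conf [] cs) ≡ badPath
    stop-∷ b cs {q} eq = run-halt-∷ machine (δ-at (home q) [] cs (cong (λ p → δhome p (just (hdS cs))) eq))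

  -- The output is written over the tracks, so the stacks are not preserved and only halting may
  -- follow. The closing `bl` is what ends the reading of the output.
  outp-run : ∀ i q s l cs → Holds (track i cs) s →
    ∃[ cs' ] ((outp i q , conf l cs) ⟶[ 2 * length s + length l + 2 ]
              (home q , conf [] (l ʳ++ (List.map bit s ++ bl ∷ cs'))))
  outp-run i q [] l cs h = tlS cs , recount (+-comm 2 (length l))
    (moveL l cs (cong (δout i q) (Holds-head i cs h)) ▹ return-left q l (bl ∷ tlS cs))
  outp-run i q (b ∷ s) l cs h with outp-run i q s (bit b ∷ l) (tlS cs) (Holds-tail i cs h)
  ... | cs' , r = cs' , recount (lem (length s) (length l))
    (moveR l cs (cong (δout i q) (Holds-head i cs h)) ▹ r)
    where
    lem : ∀ a c → 1 + (2 * a + suc c + 2) ≡ 2 * suc a + c + 2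
    lem = solve-∀

  out-run : ∀ i q s cs {q'} → Holds (track i cs) s → prog q' ≡ out i q →
    ∃[ cs' ] ((home q' , conf [] cs) ⟶[ 2 * length s + 3 ] (home q , conf [] cs'))
      × output (tp (conf [] cs')) ≡ s
  out-run i q s cs h eq with outp-run i q s [] cs h
  ... | cs' , r = _ , recount (lem (length s)) (stay [] cs (cong (λ p → δhome p _) eq) ▹ r) ,
    read s
    where
    lem : ∀ a → 1 + (2 * a + 0 + 2) ≡ 2 * a + 3
    lem = solve-∀
    readBits-enc : ∀ s → readBits (enc* (List.map bit s ++ bl ∷ cs')) ≡ s
    readBits-enc []          = refl
    readBits-enc (false ∷ s) = cong (false ∷_) (readBits-enc s)
    readBits-enc (true ∷ s)  = cong (true ∷_) (readBits-enc s)
    read : ∀ s → output (tp (conf [] (List.map bit s ++ bl ∷ cs'))) ≡ s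
    read []      = refl
    read (b ∷ s) = readBits-enc (b ∷ s)

  init₂-run : ∀ x l → ∃[ cs ] ((init₂ , conf l (List.map bit x)) ⟶[ 2 * length x + length l + 2 ] (home q₀ , conf [] (l ʳ++ cs)))
    × Holds (track i₀ cs) x × (∀ j → j ≢ i₀ → Holds (track j cs) [])
  init₂-run [] l = bl ∷ [] , recount (+-comm 2 (length l))
    (moveL {q = init₂} {ret q₀} {bl} l [] refl ▹ return-left q₀ l (bl ∷ [])) , Holds-pad i₀ [] []ʰ , λ j _ → Holds-pad j [] []ʰ
  init₂-run (b ∷ x) l with init₂-run x (set bl i₀ (just b) ∷ l)
  ... | cs , r , h , o = set bl i₀ (just b) ∷ cs , recount (lem (length x) (length l)) (moveR {q = init₂} l (List.map bit (b ∷ x)) refl ▹ r) ,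
    Holds-∷ (get-set bl i₀ (just b)) h , λ j ne → Holds-∷ (trans (get-set-≢ bl (just b) ne) (get-bl j)) (o j ne)
    where
    lem : ∀ a c → 1 + (2 * a + suc c + 2) ≡ 2 * suc a + c + 2
    lem = solve-∀

  opaque
    unfolding exec start

    init-run : ∀ x → ∃[ cs ] (∀ f ys → start (2 * length x + 4 + f) ys x ≡ exec f ys (home q₀) (conf [] cs))
      × Holds (track i₀ cs) x × (∀ j → j ≢ i₀ → Holds (track j cs) [])
    init-run x with init₂-run x []
    ... | cs , r , h , o = cs , (λ f ys →
        trans (cong (λ n → runFrom machine n ys (NTM.start machine) (initTape x)) (lem (length x) f))
          (trans (run-mark-left machine e₀ e₁ x (2 * length x + 0 + 2 + f) ys)
            (trans (cong (runFrom machine (2 * length x + 0 + 2 + f) ys (encS init₂)) (start-tape x)) (apply r f ys)))) , h , o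
      where
      lem : ∀ a f → 2 * a + 4 + f ≡ 2 + (2 * a + 0 + 2 + f)
      lem = solve-∀
      enc-bits : ∀ x → List.map bitSym x ≡ enc* (List.map bit x)
      enc-bits []      = refl
      enc-bits (b ∷ x) = cong (bitSym b ∷_) (enc-bits x)
      start-tape : ∀ x → tape (encG nothing ∷ []) (hd (initTape x)) (rgt (initTape x)) ≡ tp (conf [] (List.map bit x))
      start-tape []      = refl
      start-tape (b ∷ x) = cong (tape _ (bitSym b)) (enc-bits x)
      e₀ : ∀ x → NTM.δ machine (NTM.start machine) (hd (initTape x)) ≡ step (encS init₁) (hd (initTape x)) L
      e₀ []      = δ-enc init₀ (just bl)
      e₀ (b ∷ x) = δ-enc init₀ (just (bit b))
      e₁ : NTM.δ machine (encS init₁) blank ≡ step (encS init₂) (encG nothing) R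
      e₁ = δ-enc init₁ (just bl)

-- Register programs

-- Programs on a pile of string registers, indexed by the number of registers
-- before and after; register zero is the most recently allocated one.
data Cmd : ℕ → ℕ → Set where
  _⨾_   : ∀ {d e f} → Cmd d e → Cmd e f → Cmd d f
  skip  : ∀ {d} → Cmd d d
  alloc : ∀ {d} → Cmd d (suc d)
  free  : ∀ {d} → Cmd (suc d) d
  pushC : ∀ {d} → Fin d → Bool → Cmd d d
  popC  : ∀ {d e} → Fin d → Cmd d e → (Bool → Cmd d e) → Cmd d e
  while : ∀ {d} → Fin d → (Bool → Cmd d d) → Cmd d d

infixr 5 _⨾_

-- The last index counts commands, not machine steps. `free` demands an empty register, so that the
-- stack is clean when it is allocated again.
data Exec : ∀ {d e} → Cmd d e → Vec Str d → Vec Str e → ℕ → Set where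
  seq      : ∀ {d e f} {c : Cmd d e} {c' : Cmd e f} {u v w m n} →
             Exec c u v m → Exec c' v w n → Exec (c ⨾ c') u w (m + n)
  skip     : ∀ {d} {v : Vec Str d} → Exec skip v v 1
  alloc    : ∀ {d} {v : Vec Str d} → Exec alloc v ([] ∷ v) 1
  free     : ∀ {d} {v : Vec Str d} → Exec free ([] ∷ v) v 1
  push     : ∀ {d} {v : Vec Str d} {j b} → Exec (pushC j b) v (v [ j ]≔ (b ∷ lookup v j)) 1
  pop-[]   : ∀ {d e} {v : Vec Str d} {w : Vec Str e} {j c f n} →
             lookup v j ≡ [] → Exec c v w n → Exec (popC j c f) v w (suc n)
  pop-∷    : ∀ {d e} {v : Vec Str d} {w : Vec Str e} {j c f n b s} →
             lookup v j ≡ b ∷ s → Exec (f b) (v [ j ]≔ s) w n → Exec (popC j c f) v w (suc n)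
  while-[] : ∀ {d} {v : Vec Str d} {j f} → lookup v j ≡ [] → Exec (while j f) v v 1
  while-∷  : ∀ {d} {u v w : Vec Str d} {j f m n b s} → lookup u j ≡ b ∷ s →
             Exec (f b) (u [ j ]≔ s) v m → Exec (while j f) v w n → Exec (while j f) u w (suc (m + n))

size : ∀ {d} → Vec Str d → ℕ
size []      = 0
size (s ∷ v) = length s + size v

size-set : ∀ {d} (v : Vec Str d) j s → size (v [ j ]≔ s) + length (lookup v j) ≡ size v + length s
size-set (t ∷ v) zero    s = lemma (length s) (size v) (length t)
  where
  lemma : ∀ a b c → a + b + c ≡ c + b + a
  lemma = solve-∀
size-set (t ∷ v) (suc j) s =
  trans (+-assoc (length t) _ _) (trans (cong (length t +_) (size-set v j s)) (sym (+-assoc (length t) _ _)))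

length-lookup : ∀ {d} (v : Vec Str d) j → length (lookup v j) ≤ size v
length-lookup (s ∷ v) zero    = m≤m+n (length s) _
length-lookup (s ∷ v) (suc j) = ≤-trans (length-lookup v j) (m≤n+m _ (length s))

size-push : ∀ {d} (v : Vec Str d) j b → size (v [ j ]≔ (b ∷ lookup v j)) ≡ suc (size v)
size-push v j b = +-cancelʳ-≡ (length (lookup v j)) _ _
  (trans (size-set v j (b ∷ lookup v j)) (+-suc (size v) _))

size-pop : ∀ {d} (v : Vec Str d) j {b s} → lookup v j ≡ b ∷ s → suc (size (v [ j ]≔ s)) ≡ size v
size-pop v j {b} {s} eq = +-cancelʳ-≡ (length s) _ _
  (trans (sym (+-suc _ (length s))) (trans (cong (λ t → size (v [ j ]≔ s) + length t) (sym eq)) (size-set v j s)))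

-- A command adds at most one bit. Hence a time bound is also a bound on all values, and thereby on
-- the cost of the stack operations that realise the commands.
Exec-size : ∀ {d e} {c : Cmd d e} {v w n} → Exec c v w n → size w ≤ size v + n
Exec-size {v = u} (seq {v = v} {w} {m} {n} p q) = begin
  size w             ≤⟨ Exec-size q ⟩
  size v + n         ≤⟨ +-monoˡ-≤ n (Exec-size p) ⟩
  size u + m + n     ≡⟨ +-assoc (size u) m n ⟩
  size u + (m + n)   ∎ where open ≤-Reasoning
Exec-size skip  = m≤m+n _ _
Exec-size alloc = m≤m+n _ _
Exec-size free  = m≤m+n _ _
Exec-size (push {v = v} {j} {b}) = ≤-reflexive (trans (size-push v j b) (+-comm 1 _))
Exec-size (pop-[] eq p) = ≤-trans (Exec-size p) (+-monoʳ-≤ _ (n≤1+n _))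
Exec-size (pop-∷ {v = v} {j = j} eq p) = ≤-trans (Exec-size p) (+-mono-≤ (≤-trans (n≤1+n _) (≤-reflexive (size-pop v j eq))) (n≤1+n _))
Exec-size (while-[] eq) = m≤m+n _ _
Exec-size (while-∷ {u = u} {v} {w} {j} {m = m} {n} eq p q) = begin
  size w                   ≤⟨ Exec-size q ⟩
  size v + n               ≤⟨ +-monoˡ-≤ n (Exec-size p) ⟩
  size (u [ j ]≔ _) + m + n ≤⟨ +-monoˡ-≤ n (+-monoˡ-≤ m (≤-trans (n≤1+n _) (≤-reflexive (size-pop u j eq)))) ⟩
  size u + m + n           ≡⟨ +-assoc (size u) m n ⟩
  size u + (m + n)         ≤⟨ +-monoʳ-≤ (size u) (n≤1+n _) ⟩
  size u + suc (m + n)     ∎ where open ≤-Reasoning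

-- The program points, which become states of the machine; `nothing` is the test of a conditional or
-- of a loop.
Pos : ∀ {d e} → Cmd d e → Set
Pos (c ⨾ c')      = Pos c ⊎ Pos c'
Pos skip          = ⊤
Pos alloc         = ⊤
Pos free          = ⊤
Pos (pushC _ _)   = ⊤
Pos (popC _ c f)  = Maybe (Pos c ⊎ Σ Bool λ b → Pos (f b))
Pos (while _ f)   = Maybe (Σ Bool λ b → Pos (f b))

Finite-ΣBool : ∀ {F : Bool → Set} → (∀ b → Finite (F b)) → Finite (Σ Bool F)
Finite-ΣBool {F} h = Finite-retract to from ft (Finite-⊎ (h false) (h true))
  where
  to : Σ Bool F → F false ⊎ F true
  to (false , p) = inj₁ p
  to (true  , p) = inj₂ p
  from : F false ⊎ F true → Σ Bool F
  from (inj₁ p) = false , p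
  from (inj₂ p) = true , p
  ft : ∀ a → from (to a) ≡ a
  ft (false , p) = refl
  ft (true  , p) = refl

Finite-Pos : ∀ {d e} (c : Cmd d e) → Finite (Pos c)
Finite-Pos (c ⨾ c')     = Finite-⊎ (Finite-Pos c) (Finite-Pos c')
Finite-Pos skip         = Finite-⊤
Finite-Pos alloc        = Finite-⊤
Finite-Pos free         = Finite-⊤
Finite-Pos (pushC _ _)  = Finite-⊤
Finite-Pos (popC _ c f) = Finite-Maybe (Finite-⊎ (Finite-Pos c) (Finite-ΣBool λ b → Finite-Pos (f b)))
Finite-Pos (while _ f)  = Finite-Maybe (Finite-ΣBool λ b → Finite-Pos (f b))

entry : ∀ {d e} (c : Cmd d e) → Pos c
entry (c ⨾ c')     = inj₁ (entry c)
entry skip         = tt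
entry alloc        = tt
entry free         = tt
entry (pushC _ _)  = tt
entry (popC _ _ _) = nothing
entry (while _ _)  = nothing

-- The stack holding a register, counted from the oldest one, so that it does
-- not change when registers are allocated.
phys : ∀ {d} → Fin d → ℕ
phys {suc d} zero    = d
phys {suc d} (suc j) = phys j

clamp : ∀ {K} → ℕ → Fin (suc K)
clamp         zero    = zero
clamp {zero}  (suc i) = zero
clamp {suc K} (suc i) = suc (clamp i)

toℕ-clamp : ∀ {K i} → i < suc K → toℕ (clamp {K} i) ≡ i
toℕ-clamp {K}     {zero}  h       = refl
toℕ-clamp {zero}  {suc i} (s≤s ())
toℕ-clamp {suc K} {suc i} (s≤s h) = cong suc (toℕ-clamp h)

module _ {K : ℕ} where
  -- The first function embeds the program points into the states of the whole machine, and the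
  -- state after it is the exit. The exit of a loop body is the test of its own loop.
  code : ∀ {d e} (c : Cmd d e) {Q : Set} → (Pos c → Q) → Q → Pos c → Instr Q (suc K)
  code (c ⨾ c')     e x (inj₁ p) = code c (λ p → e (inj₁ p)) (e (inj₂ (entry c'))) p
  code (c ⨾ c')     e x (inj₂ p) = code c' (λ p → e (inj₂ p)) x p
  code skip         e x _ = nop x
  code alloc        e x _ = nop x
  code free         e x _ = nop x
  code (pushC j b)  e x _ = push (clamp (phys j)) b x
  code (popC j c f) e x nothing = pop (clamp (phys j)) (e (just (inj₁ (entry c)))) (λ b → e (just (inj₂ (b , entry (f b)))))
  code (popC j c f) e x (just (inj₁ p))       = code c (λ p → e (just (inj₁ p))) x p
  code (popC j c f) e x (just (inj₂ (b , p))) = code (f b) (λ p → e (just (inj₂ (b , p)))) x p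
  code (while j f)  e x nothing = pop (clamp (phys j)) x (λ b → e (just (b , entry (f b))))
  code (while j f)  e x (just (b , p)) = code (f b) (λ p → e (just (b , p))) (e nothing) p

depth : ∀ {d e} → Cmd d e → ℕ
depth (c ⨾ c')          = depth c ⊔ depth c'
depth {d} (popC _ c f)  = d ⊔ (depth c ⊔ (depth (f false) ⊔ depth (f true)))
depth {d} (while _ f)   = d ⊔ (depth (f false) ⊔ depth (f true))
depth {d} {e} _         = d ⊔ e

depth-branch : ∀ {d e} (f : Bool → Cmd d e) b → depth (f b) ≤ depth (f false) ⊔ depth (f true)
depth-branch f false = m≤m⊔n _ _
depth-branch f true  = m≤n⊔m _ _

reg : ∀ {d} → Vec Str d → ℕ → Str
reg []                i = []
reg (_∷_ {n = d} s v) i with i ≟ d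
... | yes _ = s
... | no  _ = reg v i

phys< : ∀ {d} (j : Fin d) → phys j < d
phys< {suc d} zero    = ≤-refl
phys< {suc d} (suc j) = m<n⇒m<1+n (phys< j)

reg-phys : ∀ {d} (v : Vec Str d) j → reg v (phys j) ≡ lookup v j
reg-phys {suc d} (s ∷ v) zero with d ≟ d
... | yes _ = refl
... | no ne = ⊥-elim (ne refl)
reg-phys {suc d} (s ∷ v) (suc j) with phys j ≟ d
... | yes eq = ⊥-elim (<⇒≢ (phys< j) eq)
... | no _   = reg-phys v j

reg-set-other : ∀ {d} (v : Vec Str d) j {s i} → i ≢ phys j → reg (v [ j ]≔ s) i ≡ reg v i
reg-set-other {suc d} (t ∷ v) zero {i = i} ne with i ≟ d
... | yes eq = ⊥-elim (ne eq)
... | no _   = refl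
reg-set-other {suc d} (t ∷ v) (suc j) {i = i} ne with i ≟ d
... | yes _ = refl
... | no _  = reg-set-other v j ne

reg-out : ∀ {d} (v : Vec Str d) {i} → d ≤ i → reg v i ≡ []
reg-out []      h = refl
reg-out {suc d} (s ∷ v) {i} h with i ≟ d
... | yes refl = ⊥-elim (<-irrefl refl h)
... | no _     = reg-out v (<⇒≤ h)

-- A stack beyond the pile counts as holding the empty string; this is why allocation and freeing
-- leave the tape alone.
reg-alloc : ∀ {d} (v : Vec Str d) i → reg ([] ∷ v) i ≡ reg v i
reg-alloc {d} v i with i ≟ d
... | yes refl = sym (reg-out v ≤-refl)
... | no _     = refl

module Compile {Q : Set} (FQ : Finite Q) (K : ℕ) (q₀ : Q) (prog : Q → Instr Q (suc K)) where
  open StackMachine FQ (suc K) q₀ zero prog public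

  Rep : ∀ {d} → List (Symb (suc K)) → Vec Str d → Set
  Rep cs v = ∀ i → Holds (track i cs) (reg v (toℕ i))

  Rep-set : ∀ {d cs cs'} (v : Vec Str d) (j : Fin d) {s} → d ≤ suc K → Rep cs v →
    Holds (track (clamp (phys j)) cs') s → Others (clamp (phys j)) cs cs' → Rep cs' (v [ j ]≔ s)
  Rep-set {cs' = cs'} v j {s} d≤ r h o i with i Data.Fin.≟ clamp (phys j)
  ... | yes refl = subst (Holds _)
          (sym (trans (cong (reg (v [ j ]≔ s)) (toℕ-clamp (≤-trans (phys< j) d≤)))
                      (trans (reg-phys (v [ j ]≔ s) j) (Vec.lookup∘update j v s)))) h
  ... | no ne    = subst (Holds _) (sym (reg-set-other v j ne')) (o i ne _ (r i))
    where
    ne' : toℕ i ≢ phys j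
    ne' eq = ne (Data.Fin.Properties.toℕ-injective (trans eq (sym (toℕ-clamp (≤-trans (phys< j) d≤)))))

  Rep-at : ∀ {d cs} (v : Vec Str d) (j : Fin d) → d ≤ suc K → Rep cs v → ∀ {s} → lookup v j ≡ s →
    Holds (track (clamp (phys j)) cs) s
  Rep-at v j d≤ r eq = subst (Holds _)
    (trans (cong (reg v) (toℕ-clamp (≤-trans (phys< j) d≤))) (trans (reg-phys v j) eq)) (r (clamp (phys j)))

  Rep-alloc : ∀ {d cs} {v : Vec Str d} → Rep cs v → Rep cs ([] ∷ v)
  Rep-alloc {v = v} r i = subst (Holds _) (sym (reg-alloc v (toℕ i))) (r i)

  Rep-free : ∀ {d cs} {v : Vec Str d} → Rep cs ([] ∷ v) → Rep cs v
  Rep-free {v = v} r i = subst (Holds _) (reg-alloc v (toℕ i)) (r i)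

  private
    one≤ : ∀ B → 1 ≤ 1 * (2 * B + 5)
    one≤ B = ≤-trans (s≤s z≤n) (≤-reflexive (lemma B))
      where
      lemma : ∀ B → 5 + 2 * B ≡ 1 * (2 * B + 5)
      lemma = solve-∀

    unit≤ : ∀ {a B n} → n ≤ 2 * a + 5 → a ≤ B → n ≤ 1 * (2 * B + 5)
    unit≤ h a≤ = ≤-trans h (≤-trans (+-monoˡ-≤ 5 (*-monoʳ-≤ 2 a≤)) (≤-reflexive (sym (*-identityˡ _))))

    add≤ : ∀ m n {C a b} → a ≤ m * C → b ≤ n * C → a + b ≤ (m + n) * C
    add≤ m n {C} h k = ≤-trans (+-mono-≤ h k) (≤-reflexive (sym (*-distribʳ-+ C m n)))

    len≤ : ∀ {d} (v : Vec Str d) j {b s n B} → lookup v j ≡ b ∷ s → size v + n ≤ B → length (b ∷ s) ≤ B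
    len≤ v j eq h = ≤-trans (subst (λ t → length t ≤ size v) eq (length-lookup v j)) (m+n≤o⇒m≤o _ h)

    pop≤ : ∀ {a B} → a ≤ B → 2 * a + 3 ≤ 1 * (2 * B + 5)
    pop≤ {a} = unit≤ {a} (+-monoʳ-≤ (2 * a) (s≤s (s≤s (s≤s z≤n))))

    body≤ : ∀ {d} (u : Vec Str d) j m n {b s B} → lookup u j ≡ b ∷ s → size u + suc (m + n) ≤ B → size (u [ j ]≔ s) + m ≤ B
    body≤ u j m n eqj h = ≤-trans
      (+-mono-≤ (≤-trans (n≤1+n _) (≤-reflexive (size-pop u j eqj))) (≤-trans (m≤m+n m n) (n≤1+n (m + n)))) h

    rest≤ : ∀ {d} (u : Vec Str d) j m n {b s v B} {c : Cmd d d} → lookup u j ≡ b ∷ s → Exec c (u [ j ]≔ s) v m →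
      size u + suc (m + n) ≤ B → size v + n ≤ B
    rest≤ u j m n {b} {s} {v} {B} eqj p h = begin
      size v + n                    ≤⟨ +-monoˡ-≤ n (Exec-size p) ⟩
      size (u [ j ]≔ s) + m + n     ≡⟨ +-assoc (size (u [ j ]≔ s)) m n ⟩
      size (u [ j ]≔ s) + (m + n)   ≤⟨ +-mono-≤ (≤-trans (n≤1+n _) (≤-reflexive (size-pop u j eqj))) (n≤1+n (m + n)) ⟩
      size u + suc (m + n)          ≤⟨ h ⟩
      B                             ∎ where open ≤-Reasoning

  -- By `Exec-size`, `B` bounds every value occurring on the way. A stack operation walks to the end
  -- of its stack and back, which gives `2 * B + 5` machine steps per command. Leaving `B` free lets
  -- all parts of a command share one bound.
  compile : ∀ {d e} {c : Cmd d e} {v w t} → Exec c v w t → (em : Pos c → Q) (x : Q) →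
    (∀ p → prog (em p) ≡ code c em x p) → depth c ≤ suc K → ∀ {cs} → Rep cs v → ∀ {B} → size v + t ≤ B →
    ∃[ cs' ] ∃[ n ] ((home (em (entry c)) , conf [] cs) ⟶[ n ] (home x , conf [] cs')) × n ≤ t * (2 * B + 5) × Rep cs' w
  compile {v = u} (seq {c = c} {c'} {v = v} {w} {m} {n} p q) em x eq dep r {B} h
    with compile p (λ p → em (inj₁ p)) _ (λ p → eq (inj₁ p)) (m⊔n≤o⇒m≤o (depth c) _ dep) r
           (≤-trans (+-monoʳ-≤ (size u) (m≤m+n m n)) h)
  ... | cs₁ , n₁ , s₁ , l₁ , r₁
    with compile q (λ p → em (inj₂ p)) x (λ p → eq (inj₂ p)) (m⊔n≤o⇒n≤o (depth c) _ dep) r₁ {B}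
           (≤-trans (+-monoˡ-≤ n (Exec-size p)) (≤-trans (≤-reflexive (+-assoc (size u) m n)) h))
  ... | cs₂ , n₂ , s₂ , l₂ , r₂ = cs₂ , n₁ + n₂ , (s₁ ▹ s₂) , add≤ m n l₁ l₂ , r₂
  compile skip em x eq dep {cs} r {B} h = cs , 1 , nop-run x cs (eq tt) , one≤ B , r
  compile alloc em x eq dep {cs} r {B} h = cs , 1 , nop-run x cs (eq tt) , one≤ B , Rep-alloc r
  compile free em x eq dep {cs} r {B} h = cs , 1 , nop-run x cs (eq tt) , one≤ B , Rep-free r
  compile (push {v = v} {j} {b}) em x eq dep {cs} r h
    with push-run (clamp (phys j)) b x (lookup v j) cs (Rep-at v j (m⊔n≤o⇒m≤o _ _ dep) r refl) (eq tt)
  ... | cs' , n , s , l , hd' , o = cs' , n , s , unit≤ {length (lookup v j)} l (≤-trans (length-lookup v j) (m+n≤o⇒m≤o _ h)) ,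
        Rep-set v j (m⊔n≤o⇒m≤o _ _ dep) r hd' o
  compile {d} (pop-[] {v = v} {j = j} {c} {f} {n} eqj p) em x eq dep {cs} r {B} h
    with compile p (λ p → em (just (inj₁ p))) x (λ p → eq (just (inj₁ p)))
           (m⊔n≤o⇒m≤o (depth c) _ (m⊔n≤o⇒n≤o d _ dep)) r {B} (≤-trans (+-monoʳ-≤ (size v) (n≤1+n n)) h)
  ... | cs' , n' , s , l , r' = cs' , suc n' , (pop-empty-run (clamp (phys j)) _ _ cs (Rep-at v j (m⊔n≤o⇒m≤o d _ dep) r eqj) (eq nothing) ▹ s) ,
        add≤ 1 n (one≤ B) l , r'
  compile {d} (pop-∷ {v = v} {j = j} {c} {f} {n} {b} {s} eqj p) em x eq dep {cs} r {B} h
    with popping-run (clamp (phys j)) _ _ b s cs (Rep-at v j (m⊔n≤o⇒m≤o d _ dep) r eqj) (eq nothing)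
  ... | cs₁ , s₁ , h₁ , o
    with compile p (λ p → em (just (inj₂ (b , p)))) x (λ p → eq (just (inj₂ (b , p))))
           (≤-trans (depth-branch f b) (m⊔n≤o⇒n≤o (depth c) _ (m⊔n≤o⇒n≤o d _ dep)))
           (Rep-set v j (m⊔n≤o⇒m≤o d _ dep) r h₁ o) {B}
           (≤-trans (+-mono-≤ (≤-trans (n≤1+n _) (≤-reflexive (size-pop v j eqj))) (n≤1+n n)) h)
  ... | cs' , n' , s' , l , r' = cs' , _ , (s₁ ▹ s') , add≤ 1 n (pop≤ {length (b ∷ s)} (len≤ v j {b} {s} eqj h)) l , r'
  compile {d} (while-[] {v = v} {j} {f} eqj) em x eq dep {cs} r {B} h =
    cs , 1 , pop-empty-run (clamp (phys j)) _ _ cs (Rep-at v j (m⊔n≤o⇒m≤o d _ dep) r eqj) (eq nothing) , one≤ B , r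
  compile {d} (while-∷ {u = u} {v} {w} {j} {f} {m} {n} {b} {s} eqj p q) em x eq dep {cs} r {B} h
    with popping-run (clamp (phys j)) _ _ b s cs (Rep-at u j (m⊔n≤o⇒m≤o d _ dep) r eqj) (eq nothing)
  ... | cs₁ , s₁ , h₁ , o
    with compile p (λ p → em (just (b , p))) (em nothing) (λ p → eq (just (b , p)))
           (≤-trans (depth-branch f b) (m⊔n≤o⇒n≤o d _ dep))
           (Rep-set u j (m⊔n≤o⇒m≤o d _ dep) r h₁ o) {B} (body≤ u j m n eqj h)
  ... | cs₂ , n₂ , s₂ , l₂ , r₂
    with compile q em x eq dep r₂ {B} (rest≤ u j m n eqj p h)
  ... | cs₃ , n₃ , s₃ , l₃ , r₃ = cs₃ , _ , (s₁ ▹ s₂ ▹ s₃) ,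
        add≤ 1 (m + n) (pop≤ {length (b ∷ s)} (len≤ u j {b} {s} eqj h)) (add≤ m n l₂ l₃) , r₃

-- Polynomial-time functions

Exec-≡ : ∀ {d e} {c : Cmd d e} {v v' w w' n} → v ≡ v' → w ≡ w' → Exec c v w n → Exec c v' w' n
Exec-≡ refl refl x = x

private
  ≔≔ : ∀ {d} (v : Vec Str d) j {s t} → (v [ j ]≔ s) [ j ]≔ t ≡ v [ j ]≔ t
  ≔≔ v j = Vec.[]≔-idempotent v j

  2*suc : ∀ a → suc (suc (2 * a)) ≡ 2 * suc a
  2*suc a = sym (cong suc (+-suc a (a + 0)))

unload : ∀ {d} → Fin d → Cmd (suc d) (suc d)
unload j = while (suc j) (λ b → pushC zero b)

Exec-unload : ∀ {d} (v : Vec Str d) j s t →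
  Exec (unload j) (t ∷ v [ j ]≔ s) ((s ʳ++ t) ∷ v [ j ]≔ []) (2 * length s + 1)
Exec-unload v j []      t = while-[] (Vec.lookup∘update j v [])
Exec-unload v j (b ∷ s) t = subst (Exec _ _ _) (cong (_+ 1) (2*suc (length s)))
  (while-∷ {s = s} (Vec.lookup∘update j v (b ∷ s)) push (Exec-≡ (cong ((b ∷ t) ∷_) (sym (≔≔ v j))) refl (Exec-unload v j s (b ∷ t))))

load : ∀ {d} → Fin d → Cmd (suc d) (suc d)
load j = while zero (λ b → pushC (suc j) b)

Exec-load : ∀ {d} (v : Vec Str d) j s t →
  Exec (load j) (t ∷ v [ j ]≔ s) ([] ∷ v [ j ]≔ (t ʳ++ s)) (2 * length t + 1)
Exec-load v j s []      = while-[] refl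
Exec-load v j s (b ∷ t) = subst (Exec _ _ _) (cong (_+ 1) (2*suc (length t)))
  (while-∷ {s = t} refl push (Exec-≡ (cong (t ∷_) (sym pushed)) refl (Exec-load v j (b ∷ s) t)))
  where
  pushed : (v [ j ]≔ s) [ j ]≔ (b ∷ lookup (v [ j ]≔ s) j) ≡ v [ j ]≔ (b ∷ s)
  pushed = trans (≔≔ v j) (cong (λ x → v [ j ]≔ (b ∷ x)) (Vec.lookup∘update j v s))

reload : ∀ {d} → Fin d → Cmd (suc (suc d)) (suc (suc d))
reload j = while zero (λ b → pushC (suc zero) b ⨾ pushC (suc (suc j)) b)

Exec-reload : ∀ {d} (v : Vec Str d) j s r t →
  Exec (reload j) (t ∷ r ∷ v [ j ]≔ s) ([] ∷ (t ʳ++ r) ∷ v [ j ]≔ (t ʳ++ s)) (3 * length t + 1)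
Exec-reload v j s r []      = while-[] refl
Exec-reload v j s r (b ∷ t) = subst (Exec _ _ _) (lemma (length t))
  (while-∷ {s = t} refl (seq push push) (Exec-≡ (cong (λ x → t ∷ (b ∷ r) ∷ x) (sym pushed)) refl (Exec-reload v j (b ∷ s) (b ∷ r) t)))
  where
  pushed : (v [ j ]≔ s) [ j ]≔ (b ∷ lookup (v [ j ]≔ s) j) ≡ v [ j ]≔ (b ∷ s)
  pushed = trans (≔≔ v j) (cong (λ x → v [ j ]≔ (b ∷ x)) (Vec.lookup∘update j v s))
  lemma : ∀ a → suc (2 + (3 * a + 1)) ≡ 3 * suc a + 1
  lemma = solve-∀

ʳ++-twice : ∀ (s : Str) → (s ʳ++ []) ʳ++ [] ≡ s
ʳ++-twice s = trans (List.ʳ++-ʳ++ s) (List.++-identityʳ s)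

length-ʳ++ : ∀ (s : Str) → length (s ʳ++ []) ≡ length s
length-ʳ++ s = trans (List.length-ʳ++ s) (+-identityʳ _)

-- A register is read by emptying it: `unload` pours it in reverse into a scratch register, and
-- `reload` pours that back into the original and the copy at once.
copy : ∀ {d} → Fin d → Cmd d (suc d)
copy j = alloc ⨾ alloc ⨾ unload (suc j) ⨾ reload j ⨾ free

Exec-copy : ∀ {d} (v : Vec Str d) j → Exec (copy j) v (lookup v j ∷ v) (5 * length (lookup v j) + 5)
Exec-copy v j = subst (Exec _ _ _) (trans (cong (λ k → 2 + ((2 * length s + 1) + ((3 * k + 1) + 1))) (length-ʳ++ s)) (lemma (length s)))
  (seq alloc (seq alloc (seq (Exec-≡ (cong (λ x → [] ∷ [] ∷ x) (Vec.[]≔-lookup v j)) refl (Exec-unload ([] ∷ v) (suc j) s []))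
    (seq (Exec-reload v j [] [] (s ʳ++ [])) (Exec-≡ (cong ([] ∷_) (sym copied)) refl free)))))
  where
  s = lookup v j
  copied : ((s ʳ++ []) ʳ++ []) ∷ v [ j ]≔ ((s ʳ++ []) ʳ++ []) ≡ s ∷ v
  copied = trans (cong (λ x → x ∷ v [ j ]≔ x) (ʳ++-twice s)) (cong (s ∷_) (Vec.[]≔-lookup v j))
  lemma : ∀ a → 2 + ((2 * a + 1) + ((3 * a + 1) + 1)) ≡ 5 * a + 5
  lemma = solve-∀

clear : ∀ {d} → Fin d → Cmd d d
clear j = while j (λ _ → skip)

Exec-clear : ∀ {d} (v : Vec Str d) j s → Exec (clear j) (v [ j ]≔ s) (v [ j ]≔ []) (2 * length s + 1)
Exec-clear v j []      = while-[] (Vec.lookup∘update j v [])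
Exec-clear v j (b ∷ s) = subst (Exec _ _ _) (cong (_+ 1) (2*suc (length s)))
  (while-∷ {s = s} (Vec.lookup∘update j v (b ∷ s)) skip (Exec-≡ (sym (≔≔ v j)) refl (Exec-clear v j s)))

assign : ∀ {d} → Fin d → Cmd (suc d) d
assign j = clear (suc j) ⨾ alloc ⨾ unload zero ⨾ load (suc j) ⨾ free ⨾ free

Exec-assign : ∀ {d} s (v : Vec Str d) j →
  Exec (assign j) (s ∷ v) (v [ j ]≔ s) (2 * length (lookup v j) + 4 * length s + 6)
Exec-assign s v j = subst (Exec _ _ _) (trans (cong (λ k → (2 * length o + 1) + (1 + ((2 * length s + 1) + ((2 * k + 1) + 2)))) (length-ʳ++ s)) (lemma (length o) (length s)))
  (seq (Exec-≡ (cong (s ∷_) (Vec.[]≔-lookup v j)) refl (Exec-clear (s ∷ v) (suc j) o))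
  (seq alloc (seq (Exec-unload (s ∷ v [ j ]≔ []) zero s []) (seq (Exec-load ([] ∷ v) (suc j) [] (s ʳ++ []))
    (seq free (Exec-≡ refl (cong (v [ j ]≔_) (ʳ++-twice s)) free))))))
  where
  o = lookup v j
  lemma : ∀ o a → (2 * o + 1) + (1 + ((2 * a + 1) + ((2 * a + 1) + 2))) ≡ 2 * o + 4 * a + 6
  lemma = solve-∀

look : ∀ {d n} → Vec Str d → Vec (Fin d) n → Vec Str n
look v ρ = Vec.map (lookup v) ρ

look-suc : ∀ {d n} s (v : Vec Str d) (ρ : Vec (Fin d) n) → look (s ∷ v) (Vec.map suc ρ) ≡ look v ρ
look-suc s v ρ = sym (Vec.map-∘ (lookup (s ∷ v)) suc ρ)

-- Polynomial-time computable functions of n strings, as programs that push the value on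
-- top of any pile of registers containing the arguments.
record PF {n} (F : Vec Str n → Str) : Set where
  field
    body  : ∀ {d} → Vec (Fin d) n → Cmd d (suc d)
    bound : PolyExp
    runs  : ∀ {d} (ρ : Vec (Fin d) n) (v : Vec Str d) {a} → look v ρ ≡ a →
            ∃[ t ] Exec (body ρ) v (F a ∷ v) t × t ≤ ⟪ bound ⟫ (size a)
open PF

-- The program is run on a pile consisting of the arguments alone. They are still there at the end,
-- so everything that the pile has gained is the value.
PF-out : ∀ {n} {F : Vec Str n → Str} (f : PF F) a → length (F a) ≤ ⟪ bound f ⟫ (size a)
PF-out {F = F} f a with runs f (Vec.allFin _) a (Vec.map-lookup-allFin a)
... | t , ex , t≤ = ≤-trans (+-cancelʳ-≤ (size a) _ _
        (≤-trans (Exec-size ex) (≤-reflexive (+-comm (size a) t)))) t≤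

PF-ext : ∀ {n} {F G : Vec Str n → Str} → (∀ v → F v ≡ G v) → PF F → PF G
PF-ext eq f = record { body = body f ; bound = bound f ; runs = λ ρ v {a} la →
  let t , ex , t≤ = runs f ρ v la in t , Exec-≡ refl (cong (_∷ v) (eq a)) ex , t≤ }

PF-var : ∀ {n} (i : Fin n) → PF (λ v → lookup v i)
PF-var i = record
  { body = λ ρ → copy (lookup ρ i) ; bound = con 5 :* X :+ con 5
  ; runs = λ { ρ v refl → _ , Exec-≡ refl (cong (_∷ v) (sym (Vec.lookup-map i (lookup v) ρ))) (Exec-copy v (lookup ρ i)) ,
      +-monoˡ-≤ 5 (*-monoʳ-≤ 5 (subst (λ s → length s ≤ size (look v ρ)) (Vec.lookup-map i (lookup v) ρ) (length-lookup (look v ρ) i))) } }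

PF-[] : ∀ {n} → PF {n} (λ _ → [])
PF-[] = record { body = λ _ → alloc ; bound = con 1 ; runs = λ _ _ _ → _ , alloc , ≤-refl }

PF-∷ : ∀ {n} {F : Vec Str n → Str} b → PF F → PF (λ v → b ∷ F v)
PF-∷ b f = record { body = λ ρ → body f ρ ⨾ pushC zero b ; bound = bound f :+ con 1
  ; runs = λ ρ v la → let t , ex , t≤ = runs f ρ v la in _ , seq ex push , +-monoˡ-≤ 1 t≤ }

PF-rename : ∀ {m n} {F : Vec Str m → Str} (σ : Vec (Fin n) m) → PF F → PF (λ v → F (look v σ))
PF-rename {n = n} {F} σ f = record
  { body = λ ρ → body f (Vec.map (lookup ρ) σ) ; bound = bound f :∘ (con (size-bound σ) :* X)
  ; runs = λ { ρ v refl → let t , ex , t≤ = runs f (Vec.map (lookup ρ) σ) v (comp ρ v) in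
      t , ex , ≤-trans t≤ (⟪⟫-mono (bound f) (size-look σ (look v ρ))) } }
  where
  size-bound : ∀ {m} → Vec (Fin n) m → ℕ
  size-bound {m} _ = m
  size-look : ∀ {m} (σ : Vec (Fin n) m) v → size (look v σ) ≤ size-bound σ * size v
  size-look []      v = z≤n
  size-look (i ∷ σ) v = +-mono-≤ (length-lookup v i) (size-look σ v)
  comp : ∀ {d} ρ (v : Vec Str d) → look v (Vec.map (lookup ρ) σ) ≡ look (look v ρ) σ
  comp ρ v = trans (sym (Vec.map-∘ (lookup v) (lookup ρ) σ)) (Vec.map-cong (λ i → sym (Vec.lookup-map i (lookup v) ρ)) σ)

nip-cost : ∀ {o s A B} → o ≤ A → s ≤ B → 2 * o + 4 * s + 6 ≤ 2 * A + 4 * B + 6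
nip-cost h k = +-monoˡ-≤ 6 (+-mono-≤ (*-monoʳ-≤ 2 h) (*-monoʳ-≤ 4 k))

-- Composition in the form of a let. The final `assign zero` overwrites the intermediate value by
-- the result and thus removes it from the pile.
PF-let : ∀ {n} {F : Vec Str n → Str} {G : Vec Str (suc n) → Str} → PF F → PF G → PF (λ v → G (F v ∷ v))
PF-let {F = F} {G} f g = record
  { body = λ ρ → body f ρ ⨾ body g (zero ∷ Vec.map suc ρ) ⨾ assign zero
  ; bound = bound f :+ (bg :+ (con 2 :* bound f :+ con 4 :* bg :+ con 6))
  ; runs = λ ρ v {a} la →
      let t , ex , t≤ = runs f ρ v la
          u , ex' , u≤ = runs g (zero ∷ Vec.map suc ρ) (F a ∷ v) (cong (F a ∷_) (trans (look-suc (F a) v ρ) la))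
          arg≤ = ⟪⟫-mono (bound g) (+-monoˡ-≤ (size a) (PF-out f a))
      in _ , seq ex (seq ex' (Exec-assign (G (F a ∷ a)) (F a ∷ v) zero)) ,
         +-mono-≤ t≤ (+-mono-≤ (≤-trans u≤ arg≤)
           (nip-cost {length (F a)} (PF-out f a) (≤-trans (PF-out g (F a ∷ a)) arg≤))) }
  where
  bg = bound g :∘ (bound f :+ X)

caseS : ∀ {A : Set} → Str → A → (Bool → Str → A) → A
caseS []      x f = x
caseS (b ∷ s) x f = f b s

PF-case : ∀ {n} {F : Vec Str n → Str} {G : Vec Str n → Str} {H : Bool → Vec Str (suc n) → Str} →
  PF F → PF G → (∀ b → PF (H b)) → PF (λ v → caseS (F v) (G v) (λ b s → H b (s ∷ v)))
PF-case {n} {F = F} {G} {H} f g h = record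
  { body = λ ρ → body f ρ ⨾ popC zero (free ⨾ body g ρ) (λ b → body (h b) (zero ∷ Vec.map suc ρ) ⨾ assign zero)
  ; bound = bound f :+ ((con 2 :+ bound g) :+ (bh false :+ bh true))
  ; runs = λ ρ v {a} la → let t , ex , t≤ = runs f ρ v la ; u , ex' , u≤ = branches ρ v la (F a) (PF-out f a) in
      _ , seq ex ex' , +-mono-≤ t≤ u≤ }
  where
  bh : Bool → PolyExp
  bh b = con 1 :+ ((bound (h b) :∘ (bound f :+ X)) :+ (con 2 :* bound f :+ con 4 :* (bound (h b) :∘ (bound f :+ X)) :+ con 6))
  pick : ∀ b N → ⟪ bh b ⟫ N ≤ (⟪ con 2 :+ bound g ⟫ N) + (⟪ bh false ⟫ N + ⟪ bh true ⟫ N)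
  pick false N = ≤-trans (m≤m+n _ _) (m≤n+m _ (⟪ con 2 :+ bound g ⟫ N))
  pick true  N = ≤-trans (m≤n+m _ (⟪ bh false ⟫ N)) (m≤n+m _ (⟪ con 2 :+ bound g ⟫ N))
  branches : ∀ {d} (ρ : Vec (Fin d) n) v {a} → look v ρ ≡ a → ∀ x → length x ≤ ⟪ bound f ⟫ (size a) →
    ∃[ t ] Exec (popC zero (free ⨾ body g ρ) (λ b → body (h b) (zero ∷ Vec.map suc ρ) ⨾ assign zero)) (x ∷ v)
      (caseS x (G a) (λ b s → H b (s ∷ a)) ∷ v) t × t ≤ ⟪ (con 2 :+ bound g) :+ (bh false :+ bh true) ⟫ (size a)
  branches ρ v la [] _ = let t , ex , t≤ = runs g ρ v la in
    _ , pop-[] refl (seq free ex) , ≤-trans (s≤s (s≤s t≤)) (m≤m+n _ _)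
  branches ρ v {a} la (b ∷ s) x≤ =
    let s≤ = ≤-trans (n≤1+n (length s)) x≤
        u , ex , u≤ = runs (h b) (zero ∷ Vec.map suc ρ) (s ∷ v) (cong (s ∷_) (trans (look-suc s v ρ) la))
        arg≤ = ⟪⟫-mono (bound (h b)) (+-monoˡ-≤ (size a) s≤)
    in _ , pop-∷ refl (seq ex (Exec-assign (H b (s ∷ a)) (s ∷ v) zero)) ,
       ≤-trans (+-monoʳ-≤ 1 (+-mono-≤ (≤-trans u≤ arg≤) (nip-cost {length s} s≤ (≤-trans (PF-out (h b) (s ∷ a)) arg≤)))) (pick b (size a))

-- Three accumulators are what the simulation of a Turing machine takes: the state with the right
-- part of the tape, the left part, and the unread guesses.
loop : ∀ {n} (f₁ f₂ f₃ : Bool → Vec Str (3 + n) → Str) → Str → Vec Str (3 + n) → Vec Str (3 + n)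
loop f₁ f₂ f₃ []      w = w
loop f₁ f₂ f₃ (b ∷ s) w@(_ ∷ _ ∷ _ ∷ e) = loop f₁ f₂ f₃ s (f₁ b w ∷ f₂ b w ∷ f₃ b w ∷ e)

module _ {n} {f₁ f₂ f₃ : Bool → Vec Str (3 + n) → Str}
         (p₁ : ∀ b → PF (f₁ b)) (p₂ : ∀ b → PF (f₂ b)) (p₃ : ∀ b → PF (f₃ b)) (g : PolyExp)
         (growth : ∀ b x y z e → length (f₁ b (x ∷ y ∷ z ∷ e)) + (length (f₂ b (x ∷ y ∷ z ∷ e)) + length (f₃ b (x ∷ y ∷ z ∷ e)))
                     ≤ length x + (length y + length z) + ⟪ g ⟫ (size e)) where
  private
    accs : ∀ {d} → Vec (Fin d) n → Vec (Fin (4 + d)) (3 + n)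
    accs ρ = zero ∷ suc zero ∷ suc (suc zero) ∷ Vec.map suc (Vec.map suc (Vec.map suc (Vec.map suc ρ)))

    look-accs : ∀ {d} (ρ : Vec (Fin d) n) v {e} → look v ρ ≡ e → ∀ x y z s → look (x ∷ y ∷ z ∷ s ∷ v) (accs ρ) ≡ x ∷ y ∷ z ∷ e
    look-accs ρ v le x y z s = cong (λ t → x ∷ y ∷ z ∷ t)
      (trans (look-suc x _ _) (trans (look-suc y _ _) (trans (look-suc z _ _) (trans (look-suc s _ _) le))))

    step-body : ∀ {d} → Vec (Fin d) n → Bool → Cmd (4 + d) (4 + d)
    step-body ρ b = body (p₃ b) (accs ρ) ⨾ body (p₂ b) (Vec.map suc (accs ρ)) ⨾ body (p₁ b) (Vec.map suc (Vec.map suc (accs ρ))) ⨾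
      assign (suc (suc zero)) ⨾ assign (suc (suc zero)) ⨾ assign (suc (suc zero))

    bb : PolyExp
    bb = (bound (p₁ false) :+ bound (p₁ true)) :+ ((bound (p₂ false) :+ bound (p₂ true)) :+ (bound (p₃ false) :+ bound (p₃ true)))

    total≤ : ∀ {x y z} → x ≤ x + (y + z) × y ≤ x + (y + z) × z ≤ x + (y + z)
    total≤ {x} {y} {z} = m≤m+n x _ , ≤-trans (m≤m+n y z) (m≤n+m _ x) , ≤-trans (m≤n+m z y) (m≤n+m _ x)

    boundOf : ∀ {F : Bool → Vec Str (3 + n) → Str} (p : ∀ b → PF (F b)) b {N} →
      ⟪ bound (p b) ⟫ N ≤ ⟪ bound (p false) :+ bound (p true) ⟫ N
    boundOf p false = m≤m+n _ _
    boundOf p true  = m≤n+m _ _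

    iteration : PolyExp
    iteration = bb :+ con 18 :* X :+ con 18

    Exec-step : ∀ {d} (ρ : Vec (Fin d) n) v {e} → look v ρ ≡ e → ∀ b x y z s A →
      length x + (length y + length z) + ⟪ g ⟫ (size e) ≤ A →
      let w = x ∷ y ∷ z ∷ e in
      ∃[ t ] Exec (step-body ρ b) (x ∷ y ∷ z ∷ s ∷ v) (f₁ b w ∷ f₂ b w ∷ f₃ b w ∷ s ∷ v) t
        × t ≤ ⟪ iteration ⟫ (A + size e)
    Exec-step ρ v {e} le b x y z s A sz≤ =
      let w = x ∷ y ∷ z ∷ e
          x' = f₁ b w ; y' = f₂ b w ; z' = f₃ b w
          la = look-accs ρ v le x y z s
          t₃ , e₃ , l₃ = runs (p₃ b) (accs ρ) (x ∷ y ∷ z ∷ s ∷ v) la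
          t₂ , e₂ , l₂ = runs (p₂ b) (Vec.map suc (accs ρ)) (z' ∷ x ∷ y ∷ z ∷ s ∷ v) (trans (look-suc z' (x ∷ y ∷ z ∷ s ∷ v) (accs ρ)) la)
          t₁ , e₁ , l₁ = runs (p₁ b) (Vec.map suc (Vec.map suc (accs ρ))) (y' ∷ z' ∷ x ∷ y ∷ z ∷ s ∷ v)
                           (trans (look-suc y' (z' ∷ x ∷ y ∷ z ∷ s ∷ v) (Vec.map suc (accs ρ))) (trans (look-suc z' (x ∷ y ∷ z ∷ s ∷ v) (accs ρ)) la))
          old = ≤-trans (m≤m+n _ (⟪ g ⟫ (size e))) sz≤
          ox , oy , oz = total≤ {length x} {length y} {length z}
          nx , ny , nz = total≤ {length x'} {length y'} {length z'}
          new = ≤-trans (growth b x y z e) sz≤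
          w≤ : size w ≤ A + size e
          w≤ = ≤-trans (≤-reflexive (assoc (length x) (length y) (length z) (size e))) (+-monoˡ-≤ (size e) old)
          up : ∀ {F : Bool → Vec Str (3 + n) → Str} (p : ∀ b → PF (F b)) {t} → t ≤ ⟪ bound (p b) ⟫ (size w) →
                 t ≤ ⟪ bound (p false) :+ bound (p true) ⟫ (A + size e)
          up p h = ≤-trans h (≤-trans (⟪⟫-mono (bound (p b)) w≤) (boundOf p b))
          c = ⟪⟫-mono X (m≤m+n A (size e))
      in _ , seq e₃ (seq e₂ (seq e₁ (seq (Exec-assign x' (y' ∷ z' ∷ x ∷ y ∷ z ∷ s ∷ v) (suc (suc zero)))
               (seq (Exec-assign y' (z' ∷ x' ∷ y ∷ z ∷ s ∷ v) (suc (suc zero))) (Exec-assign z' (x' ∷ y' ∷ z ∷ s ∷ v) (suc (suc zero))))))) ,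
         (let open ≤-Reasoning in begin
           t₃ + (t₂ + (t₁ + _)) ≤⟨ +-mono-≤ (up p₃ l₃) (+-mono-≤ (up p₂ l₂) (+-mono-≤ (up p₁ l₁)
                (+-mono-≤ (nip-cost (≤-trans ox (≤-trans old c)) (≤-trans nx (≤-trans new c)))
                  (+-mono-≤ (nip-cost (≤-trans oy (≤-trans old c)) (≤-trans ny (≤-trans new c)))
                            (nip-cost (≤-trans oz (≤-trans old c)) (≤-trans nz (≤-trans new c))))))) ⟩
           _ ≡⟨ lemma (⟪ bound (p₁ false) :+ bound (p₁ true) ⟫ (A + size e)) (⟪ bound (p₂ false) :+ bound (p₂ true) ⟫ (A + size e)) (⟪ bound (p₃ false) :+ bound (p₃ true) ⟫ (A + size e)) (A + size e) ⟩
           ⟪ iteration ⟫ (A + size e) ∎)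
      where
      assoc : ∀ x y z e → x + (y + (z + e)) ≡ x + (y + z) + e
      assoc = solve-∀
      lemma : ∀ p q r N → r + (q + (p + ((2 * N + 4 * N + 6) + ((2 * N + 4 * N + 6) + (2 * N + 4 * N + 6))))) ≡ p + (q + r) + 18 * N + 18
      lemma = solve-∀

    -- `A` is a budget for the accumulators that includes the growth of all rounds still to come, so
    -- one and the same `A` serves in every round.
    Exec-iterate : ∀ {d} (ρ : Vec (Fin d) n) v {e} → look v ρ ≡ e → ∀ s x y z A →
      length x + (length y + length z) + length s * ⟪ g ⟫ (size e) ≤ A →
      ∃[ x' ] ∃[ y' ] ∃[ z' ] ∃[ t ] loop f₁ f₂ f₃ s (x ∷ y ∷ z ∷ e) ≡ x' ∷ y' ∷ z' ∷ e
        × length x' + (length y' + length z') ≤ A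
        × Exec (while (suc (suc (suc zero))) (step-body ρ)) (x ∷ y ∷ z ∷ s ∷ v) (x' ∷ y' ∷ z' ∷ [] ∷ v) t
        × t ≤ length s * suc (⟪ iteration ⟫ (A + size e)) + 1
    Exec-iterate ρ v le [] x y z A h = x , y , z , 1 , refl , ≤-trans (m≤m+n _ _) h , while-[] refl , ≤-refl
    Exec-iterate ρ v {e} le (b ∷ s) x y z A h =
      let w = x ∷ y ∷ z ∷ e
          G = ⟪ g ⟫ (size e)
          a = length x + (length y + length z)
          t , ex , t≤ = Exec-step ρ v le b x y z s A (≤-trans (+-monoʳ-≤ a (m≤m+n G _)) h)
          x' , y' , z' , u , eq , sz , ex' , u≤ = Exec-iterate ρ v le s (f₁ b w) (f₂ b w) (f₃ b w) A
            (≤-trans (+-monoˡ-≤ (length s * G) (growth b x y z e)) (≤-trans (≤-reflexive (+-assoc a G (length s * G))) h))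
      in x' , y' , z' , _ , eq , sz , while-∷ refl ex ex' ,
         ≤-trans (s≤s (+-mono-≤ t≤ u≤)) (≤-reflexive (sym (+-assoc (suc (⟪ iteration ⟫ (A + size e))) (length s * suc (⟪ iteration ⟫ (A + size e))) 1)))

  -- The condition `growth` plays the role of the bound in Cobham's recursion: the increment per
  -- round depends only on the parameters `e`, which the loop leaves fixed, so the accumulators
  -- cannot double repeatedly.
  PF-loop : ∀ {E₁ E₂ E₃ C : Vec Str n → Str} {H : Vec Str (3 + n) → Str} → PF C → PF E₁ → PF E₂ → PF E₃ → PF H →
    PF (λ v → H (loop f₁ f₂ f₃ (C v) (E₁ v ∷ E₂ v ∷ E₃ v ∷ v)))
  PF-loop {E₁} {E₂} {E₃} {C} {H} c i₁ i₂ i₃ h = record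
    { body = λ ρ → body c ρ ⨾ body i₃ (Vec.map suc ρ) ⨾ body i₂ (Vec.map suc (Vec.map suc ρ)) ⨾ body i₁ (Vec.map suc (Vec.map suc (Vec.map suc ρ))) ⨾
        while (suc (suc (suc zero))) (step-body ρ) ⨾ body h (accs ρ) ⨾ assign zero ⨾ assign zero ⨾ assign zero ⨾ assign zero
    ; bound = bound c :+ (bound i₃ :+ (bound i₂ :+ (bound i₁ :+ ((bound c :* (con 1 :+ (iteration :∘ (Ab :+ X))) :+ con 1) :+
        (bh :+ (nipb :+ (nipb :+ (nipb :+ nip0))))))))
    ; runs = λ ρ v {a} la →
      let t₀ , e₀ , l₀ = runs c ρ v la
          t₃ , e₃ , l₃ = runs i₃ (Vec.map suc ρ) (C a ∷ v) (trans (look-suc _ v ρ) la)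
          t₂ , e₂ , l₂ = runs i₂ (Vec.map suc (Vec.map suc ρ)) (E₃ a ∷ C a ∷ v) (trans (look-suc _ _ _) (trans (look-suc _ v ρ) la))
          t₁ , e₁ , l₁ = runs i₁ (Vec.map suc (Vec.map suc (Vec.map suc ρ))) (E₂ a ∷ E₃ a ∷ C a ∷ v)
                           (trans (look-suc _ _ _) (trans (look-suc _ _ _) (trans (look-suc _ v ρ) la)))
          C≤ = PF-out c a
          A = ⟪ Ab ⟫ (size a)
          x , y , z , u , eq , sz , ex , u≤ = Exec-iterate ρ v la (C a) (E₁ a) (E₂ a) (E₃ a) A
            (+-mono-≤ (+-mono-≤ (PF-out i₁ a) (+-mono-≤ (PF-out i₂ a) (PF-out i₃ a))) (*-monoˡ-≤ (⟪ g ⟫ (size a)) C≤))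
          w = x ∷ y ∷ z ∷ a
          tₕ , eₕ , lₕ = runs h (accs ρ) (x ∷ y ∷ z ∷ [] ∷ v) (look-accs ρ v la x y z [])
          ox , oy , oz = total≤ {length x} {length y} {length z}
          w≤ : size w ≤ A + size a
          w≤ = ≤-trans (≤-reflexive (assoc (length x) (length y) (length z) (size a))) (+-monoˡ-≤ (size a) sz)
          h≤ = ⟪⟫-mono (bound h) w≤
          H≤ = ≤-trans (PF-out h w) h≤
      in _ , seq e₀ (seq e₃ (seq e₂ (seq e₁ (seq ex (seq (Exec-≡ refl (cong (λ q → H q ∷ x ∷ y ∷ z ∷ [] ∷ v) (sym eq)) eₕ)
          (seq (Exec-assign _ (x ∷ y ∷ z ∷ [] ∷ v) zero) (seq (Exec-assign _ (y ∷ z ∷ [] ∷ v) zero)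
            (seq (Exec-assign _ (z ∷ [] ∷ v) zero) (Exec-assign _ ([] ∷ v) zero))))))))) ,
        +-mono-≤ l₀ (+-mono-≤ l₃ (+-mono-≤ l₂ (+-mono-≤ l₁ (+-mono-≤
          (≤-trans u≤ (+-monoˡ-≤ 1 (*-monoˡ-≤ (suc (⟪ iteration ⟫ (A + size a))) C≤)))
          (+-mono-≤ (≤-trans lₕ h≤)
            (subst (λ q → (2 * length x + 4 * length (H q) + 6) + ((2 * length y + 4 * length (H q) + 6) + ((2 * length z + 4 * length (H q) + 6) + (4 * length (H q) + 6))) ≤ ⟪ nipb :+ (nipb :+ (nipb :+ nip0)) ⟫ (size a)) (sym eq)
              (+-mono-≤ (nip-cost (≤-trans ox sz) H≤) (+-mono-≤ (nip-cost (≤-trans oy sz) H≤)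
                (+-mono-≤ (nip-cost (≤-trans oz sz) H≤) (+-monoˡ-≤ 6 (*-monoʳ-≤ 4 H≤)))))))))))
    }
    where
    Ab = (bound i₁ :+ (bound i₂ :+ bound i₃)) :+ bound c :* g
    bh = bound h :∘ (Ab :+ X)
    nipb = con 2 :* Ab :+ con 4 :* bh :+ con 6
    nip0 = con 4 :* bh :+ con 6
    assoc : ∀ x y z e → x + (y + (z + e)) ≡ x + (y + z) + e
    assoc = solve-∀

-- Guessing machines

headB : Str → Bool
headB []      = false
headB (b ∷ _) = b

-- A machine that guesses exactly len x bits ys and then computes F x ys, the
-- first bit of which is the verdict and the rest the output.
record GuessMachine (len : Str → ℕ) (F : Vec Str 2 → Str) : Set where
  field
    ntm  : NTM
    time : Poly
    full : ∀ x ys → length ys ≡ len x → ∃[ τ ] run ntm (⟦ time ⟧ (length x)) x ys ≡ halted (headB (F (x ∷ ys ∷ []))) τ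
             × output τ ≡ tailS (F (x ∷ ys ∷ []))
    part : ∀ x ys → length ys ≢ len x → run ntm (⟦ time ⟧ (length x)) x ys ≡ badPath

-- One bit of the ruler `U x` is consumed per guess, which makes the number of branchings exactly
-- its length. The guesses pile up on a stack and therefore reach `c₂` in reverse.
module GuessAndDecide
    (c₁ : Cmd 1 3) (c₂ : Cmd 3 5) (K : ℕ) (depth₁ : depth c₁ ≤ suc K) (depth₂ : depth c₂ ≤ suc K) (five≤ : 5 ≤ suc K)
    (U : Str → Str) (F : Str → Str → Str) (T₁ T₂ : PolyExp)
    (run₁ : ∀ x → ∃[ t ] Exec c₁ (x ∷ []) ([] ∷ U x ∷ x ∷ []) t × t ≤ ⟪ T₁ ⟫ (length x))
    (run₂ : ∀ x ys → ∃[ t ] Exec c₂ ((ys ʳ++ []) ∷ [] ∷ x ∷ []) (F x ys ∷ ys ∷ [] ∷ [] ∷ x ∷ []) t × t ≤ ⟪ T₂ ⟫ (length x + length ys)) where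

  private
    data Q : Set where
      prepare : Pos c₁ → Q
      test ask : Q
      decide  : Pos c₂ → Q
      finish  : Q
      write-out accept : Bool → Q

    opaque
      FQ : Finite Q
      FQ = Finite-retract to from ft (Finite-⊎ (Finite-Pos c₁) (Finite-⊎ (Finite-Pos c₂) (Finite-⊎ (Finite-Fin 3) (Finite-⊎ Finite-Bool Finite-Bool))))
        where
        to : Q → Pos c₁ ⊎ Pos c₂ ⊎ Fin 3 ⊎ Bool ⊎ Bool
        to (prepare p)   = inj₁ p
        to test          = inj₂ (inj₂ (inj₁ zero))
        to ask           = inj₂ (inj₂ (inj₁ (suc zero)))
        to (decide p)    = inj₂ (inj₁ p)
        to finish        = inj₂ (inj₂ (inj₁ (suc (suc zero))))
        to (write-out b) = inj₂ (inj₂ (inj₂ (inj₁ b)))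
        to (accept b)    = inj₂ (inj₂ (inj₂ (inj₂ b)))
        from : Pos c₁ ⊎ Pos c₂ ⊎ Fin 3 ⊎ Bool ⊎ Bool → Q
        from (inj₁ p) = prepare p
        from (inj₂ (inj₁ p)) = decide p
        from (inj₂ (inj₂ (inj₁ zero))) = test
        from (inj₂ (inj₂ (inj₁ (suc zero)))) = ask
        from (inj₂ (inj₂ (inj₁ (suc (suc _))))) = finish
        from (inj₂ (inj₂ (inj₂ (inj₁ b)))) = write-out b
        from (inj₂ (inj₂ (inj₂ (inj₂ b)))) = accept b
        ft : ∀ a → from (to a) ≡ a
        ft (prepare _)   = refl
        ft test          = refl
        ft ask           = refl
        ft (decide _)    = refl
        ft finish        = refl
        ft (write-out _) = refl
        ft (accept _)    = refl

    -- Stacks are numbered from the oldest register: 1 holds the ruler `U x`, 2 collects the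
    -- guesses, and 4 is where `c₂` leaves its result.
    prog : Q → Instr Q (suc K)
    prog (prepare p)   = code c₁ prepare test p
    prog test          = pop (clamp 1) (decide (entry c₂)) (λ _ → ask)
    prog ask           = guess (clamp 2) test
    prog (decide p)    = code c₂ decide finish p
    prog finish        = pop (clamp 4) (write-out false) write-out
    prog (write-out b) = out (clamp 4) (accept b)
    prog (accept b)    = stop b

    open Compile FQ K (prepare (entry c₁)) prog

    three≤ : 3 ≤ suc K
    three≤ = ≤-trans (s≤s (s≤s (s≤s z≤n))) five≤

    -- A round is one pop and one push, and `4 * B + 8` is the sum of their costs. `B` bounds ruler
    -- and guesses together, since one grows by a bit when the other shrinks by one.
    round≤ : ∀ m {a B n₁ n₂ n₃} → a ≤ B → n₁ ≤ 2 * B + 3 → n₂ ≤ 2 * a + 5 → n₃ ≤ m * (4 * B + 8) + 1 →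
      n₁ + (n₂ + n₃) ≤ suc m * (4 * B + 8) + 1
    round≤ m {a} {B} a≤ h₁ h₂ h₃ = ≤-trans (+-mono-≤ h₁ (+-mono-≤ (≤-trans h₂ (+-monoˡ-≤ 5 (*-monoʳ-≤ 2 a≤))) h₃)) (≤-reflexive (lemma B (m * (4 * B + 8))))
      where
      lemma : ∀ B r → 2 * B + 3 + (2 * B + 5 + (r + 1)) ≡ (4 * B + 8 + r) + 1
      lemma = solve-∀

    test-step : ∀ {cs w b u x} B → Rep cs (w ∷ (b ∷ u) ∷ x ∷ []) → length w + length (b ∷ u) ≤ B →
      ∃[ cs' ] ∃[ n ] ((home test , conf [] cs) ⟶[ n ] (home ask , conf [] cs')) × n ≤ 2 * B + 3 × Rep cs' (w ∷ u ∷ x ∷ [])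
    test-step {cs} {w} {b} {u} {x} B r h with popping-run (clamp 1) _ _ b u cs (Rep-at (w ∷ (b ∷ u) ∷ x ∷ []) (suc zero) three≤ r refl) refl
    ... | cs' , s , h' , o = cs' , _ , s , +-monoˡ-≤ 3 (*-monoʳ-≤ 2 (≤-trans (m≤n+m _ (length w)) h)) , Rep-set (w ∷ (b ∷ u) ∷ x ∷ []) (suc zero) three≤ r h' o

    guess-all : ∀ u w g rest x B {cs} → Rep cs (w ∷ u ∷ x ∷ []) → length g ≡ length u → length w + length u ≤ B →
      ∃[ cs' ] ∃[ n ] (∀ f → exec (n + f) (g ++ rest) (home test) (conf [] cs) ≡ exec f rest (home (decide (entry c₂))) (conf [] cs'))
        × n ≤ length u * (4 * B + 8) + 1 × Rep cs' ((g ʳ++ w) ∷ [] ∷ x ∷ [])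
    guess-all [] w [] rest x B {cs} r eq h = cs , 1 ,
      (λ f → apply (pop-empty-run (clamp 1) _ _ cs (Rep-at (w ∷ [] ∷ x ∷ []) (suc zero) three≤ r refl) refl) f rest) , ≤-refl , r
    guess-all (b ∷ u) w (y ∷ g) rest x B {cs} r eq h
      with test-step B r h
    ... | cs₁ , n₁ , s₁ , l₁ , r₁
      with guess-run (clamp 2) y test w cs₁ (Rep-at (w ∷ u ∷ x ∷ []) zero three≤ r₁ refl) refl
    ... | cs₂ , n₂ , s₂ , l₂ , h₂ , o₂
      with guess-all u (y ∷ w) g rest x B (Rep-set (w ∷ u ∷ x ∷ []) zero three≤ r₁ h₂ o₂) (suc-injective eq)
             (≤-trans (≤-reflexive (sym (+-suc (length w) (length u)))) h)
    ... | cs₃ , n₃ , s₃ , l₃ , r₃ = cs₃ , n₁ + (n₂ + n₃) ,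
      (λ f → trans (cong (λ k → exec k (y ∷ g ++ rest) (home test) (conf [] cs)) (assoc f))
        (trans (apply s₁ (n₂ + (n₃ + f)) (y ∷ g ++ rest)) (trans (s₂ (n₃ + f) (g ++ rest)) (s₃ f)))) ,
      round≤ (length u) (≤-trans (m≤m+n (length w) _) h) l₁ l₂ l₃ , r₃
      where
      assoc : ∀ f → n₁ + (n₂ + n₃) + f ≡ n₁ + (n₂ + (n₃ + f))
      assoc f = trans (+-assoc n₁ _ f) (cong (n₁ +_) (+-assoc n₂ n₃ f))

    guess-short : ∀ u w ys x B {cs} → Rep cs (w ∷ u ∷ x ∷ []) → length ys < length u → length w + length u ≤ B →
      ∃[ n ] (∀ f → exec (n + f) ys (home test) (conf [] cs) ≡ badPath) × n ≤ length u * (4 * B + 8) + 1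
    guess-short (b ∷ u) w [] x B {cs} r lt h with test-step B r h
    ... | cs₁ , n₁ , s₁ , l₁ , r₁ = n₁ + (1 + 0) , (λ f → trans (cong (λ k → exec k [] (home test) (conf [] cs)) (+-assoc n₁ 1 f))
            (trans (apply s₁ (1 + f) []) (guess-[] (clamp 2) test cs₁ refl))) ,
          ≤-trans (round≤ 0 {0} {B} z≤n l₁ (m≤n+m 1 4) (z≤n {1})) (+-monoˡ-≤ 1 (*-monoˡ-≤ (4 * B + 8) (s≤s (z≤n {length u}))))
    guess-short (b ∷ u) w (y ∷ ys) x B {cs} r (s≤s lt) h
      with test-step B r h
    ... | cs₁ , n₁ , s₁ , l₁ , r₁
      with guess-run (clamp 2) y test w cs₁ (Rep-at (w ∷ u ∷ x ∷ []) zero three≤ r₁ refl) refl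
    ... | cs₂ , n₂ , s₂ , l₂ , h₂ , o₂
      with guess-short u (y ∷ w) ys x B (Rep-set (w ∷ u ∷ x ∷ []) zero three≤ r₁ h₂ o₂) lt
             (≤-trans (≤-reflexive (sym (+-suc (length w) (length u)))) h)
    ... | n₃ , s₃ , l₃ = n₁ + (n₂ + n₃) ,
      (λ f → trans (cong (λ k → exec k (y ∷ ys) (home test) (conf [] cs)) (assoc f))
        (trans (apply s₁ (n₂ + (n₃ + f)) (y ∷ ys)) (trans (s₂ (n₃ + f) ys) (s₃ f)))) ,
      round≤ (length u) (≤-trans (m≤m+n (length w) _) h) l₁ l₂ l₃
      where
      assoc : ∀ f → n₁ + (n₂ + n₃) + f ≡ n₁ + (n₂ + (n₃ + f))
      assoc f = trans (+-assoc n₁ _ f) (cong (n₁ +_) (+-assoc n₂ n₃ f))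

    -- `D` bounds the contents of the registers when the decision starts, and `O` the length of its
    -- result.
    O D total : PolyExp
    O = X :+ T₁ :+ (T₂ :∘ (X :+ (X :+ T₁)))
    D = X :+ (X :+ T₁)
    total = (con 2 :* X :+ con 4) :+ (T₁ :* (con 2 :* (X :+ T₁) :+ con 5) :+
      ((D :* (con 4 :* D :+ con 8) :+ con 1) :+
      ((T₂ :∘ D) :* (con 2 :* (D :+ (T₂ :∘ D)) :+ con 5) :+ ((con 2 :* O :+ con 3) :+ (con 2 :* O :+ con 3)))))

    module _ (x : Str) where
      u : Str
      u = U x

      N : ℕ
      N = length x

      size≡ : size (x ∷ []) ≡ N
      size≡ = +-identityʳ N

      -- lengths of values are bounded by the initial size plus the running time
      xu≤ : N + length u ≤ ⟪ X :+ T₁ ⟫ N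
      xu≤ with run₁ x
      ... | t , ex , t≤ = begin
        N + length u              ≡⟨ +-comm N (length u) ⟩
        length u + N              ≡⟨ cong (length u +_) (sym size≡) ⟩
        size ([] ∷ u ∷ x ∷ [])    ≤⟨ Exec-size ex ⟩
        size (x ∷ []) + t         ≤⟨ +-mono-≤ (≤-reflexive size≡) t≤ ⟩
        N + ⟪ T₁ ⟫ N              ∎ where open ≤-Reasoning

      u≤ : length u ≤ ⟪ D ⟫ N
      u≤ = ≤-trans (m≤n+m (length u) N) (≤-trans xu≤ (m≤n+m _ N))

      startup : ∃[ cs ] ∃[ n ] (∀ f ys → start (n + f) ys x ≡ exec f ys (home test) (conf [] cs))
        × n ≤ ⟪ (con 2 :* X :+ con 4) :+ T₁ :* (con 2 :* (X :+ T₁) :+ con 5) ⟫ N × Rep cs ([] ∷ u ∷ x ∷ [])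
      startup with init-run x
      ... | cs₀ , r₀ , h₀ , o₀ with run₁ x
      ... | t , ex , t≤ with compile ex prepare test (λ _ → refl) depth₁ {cs₀} (λ { zero → h₀ ; (suc i) → o₀ (suc i) (λ ()) })
                               {⟪ X :+ T₁ ⟫ N} (+-mono-≤ (≤-reflexive size≡) t≤)
      ... | cs₁ , n₁ , s₁ , l₁ , r₁ = cs₁ , 2 * length x + 4 + n₁ ,
        (λ f ys → trans (cong (λ k → start k ys x) (+-assoc (2 * length x + 4) n₁ f))
                    (trans (r₀ (n₁ + f) ys) (apply s₁ f ys))) ,
        +-monoʳ-≤ (2 * N + 4) (≤-trans l₁ (*-monoˡ-≤ (2 * ⟪ X :+ T₁ ⟫ N + 5) t≤)) , r₁

      finishing : ∀ {r cs} {v : Vec Str 4} → Rep cs (r ∷ v) → length r ≤ ⟪ O ⟫ N →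
        ∃[ cs' ] ∃[ n ] ((home finish , conf [] cs) ⟶[ n ] (home (accept (headB r)) , conf [] cs'))
          × n ≤ (2 * ⟪ O ⟫ N + 3) + (2 * ⟪ O ⟫ N + 3) × output (tp (conf [] cs')) ≡ tailS r
      finishing {[]} {cs} {v} r h
        with out-run (clamp 4) (accept false) [] cs {write-out false} (Rep-at ([] ∷ v) zero five≤ r refl) refl
      ... | cs' , s , o = cs' , _ , (pop-empty-run (clamp 4) _ _ cs (Rep-at ([] ∷ v) zero five≤ r refl) refl ▹ s) ,
            +-mono-≤ (≤-trans (s≤s z≤n) (m≤n+m 3 (2 * ⟪ O ⟫ N))) (m≤n+m 3 (2 * ⟪ O ⟫ N)) , o
      finishing {b ∷ r} {cs} {v} rep h
        with popping-run (clamp 4) _ _ b r cs (Rep-at ((b ∷ r) ∷ v) zero five≤ rep refl) refl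
      ... | cs₁ , s₁ , h₁ , o₁
        with out-run (clamp 4) (accept b) r cs₁ {write-out b} h₁ refl
      ... | cs' , s , o = cs' , _ , (s₁ ▹ s) ,
            +-mono-≤ (+-monoˡ-≤ 3 (*-monoʳ-≤ 2 h)) (+-monoˡ-≤ 3 (*-monoʳ-≤ 2 (≤-trans (n≤1+n _) h))) , o

      deciding : ∀ ys {cs} → length ys ≡ length u → Rep cs ((ys ʳ++ []) ∷ [] ∷ x ∷ []) → let r = F x ys in
        ∃[ cs' ] ∃[ n ] ((home (decide (entry c₂)) , conf [] cs) ⟶[ n ] (home (accept (headB r)) , conf [] cs'))
          × n ≤ ⟪ (T₂ :∘ D) :* (con 2 :* (D :+ (T₂ :∘ D)) :+ con 5) :+ ((con 2 :* O :+ con 3) :+ (con 2 :* O :+ con 3)) ⟫ N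
          × output (tp (conf [] cs')) ≡ tailS r
      deciding ys {cs} len rep with run₂ x ys
      ... | t , ex , t≤ = let cs₁ , n₁ , s₁ , l₁ , r₁ = compile ex decide finish (λ _ → refl) depth₂ rep {⟪ D :+ (T₂ :∘ D) ⟫ N} (+-mono-≤ size≤D t≤D)
                              cs₂ , n₂ , s₂ , l₂ , o = finishing r₁ r≤
                          in cs₂ , _ , (s₁ ▹ s₂) , +-mono-≤ (≤-trans l₁ (*-monoˡ-≤ (2 * ⟪ D :+ (T₂ :∘ D) ⟫ N + 5) t≤D)) l₂ , o
        where
        xys≤ : N + length ys ≤ ⟪ X :+ T₁ ⟫ N
        xys≤ = ≤-trans (≤-reflexive (cong (N +_) len)) xu≤
        size≤ : size ((ys ʳ++ []) ∷ [] ∷ x ∷ []) ≤ ⟪ X :+ T₁ ⟫ N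
        size≤ = ≤-trans (≤-reflexive (trans (cong₂ _+_ (length-ʳ++ ys) size≡) (+-comm (length ys) N))) xys≤
        size≤D = ≤-trans size≤ (m≤n+m _ N)
        t≤D : t ≤ ⟪ T₂ :∘ D ⟫ N
        t≤D = ≤-trans t≤ (⟪⟫-mono T₂ (≤-trans xys≤ (m≤n+m _ N)))
        r≤ : length (F x ys) ≤ ⟪ O ⟫ N
        r≤ = ≤-trans (m≤m+n _ _) (≤-trans (Exec-size ex) (+-mono-≤ size≤ t≤D))

      total-run : ∀ {ys o} → (∃[ n ] (∀ f → start (n + f) ys x ≡ o) × n ≤ ⟪ total ⟫ N) →
        run machine (⟦ toPoly total ⟧ (length x)) x ys ≡ o
      total-run {ys} (n , eq , n≤) = trans (sym (start≡run _ ys x)) (trans (cong (λ k → start k ys x)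
        (trans (toPoly-eval total (length x)) (sym (m+[n∸m]≡n n≤)))) (eq (⟪ total ⟫ N ∸ n)))

      guess-bound : length u * (4 * length u + 8) + 1 ≤ ⟪ D :* (con 4 :* D :+ con 8) :+ con 1 ⟫ N
      guess-bound = +-monoˡ-≤ 1 (*-mono-≤ u≤ (+-monoˡ-≤ 8 (*-monoʳ-≤ 4 u≤)))

      regroup : ∀ {n₁ n₂ n₃ A B C D} → n₁ ≤ A + B → n₂ ≤ C → n₃ ≤ D → n₁ + (n₂ + n₃) ≤ A + (B + (C + D))
      regroup {A = A} {B} h₁ h₂ h₃ = ≤-trans (+-mono-≤ h₁ (+-mono-≤ h₂ h₃)) (≤-reflexive (+-assoc A B _))

      run-all : ∀ g rest → length g ≡ length u → ∃[ cs ] output (tp (conf [] cs)) ≡ tailS (F x g) ×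
        (∃[ n ] (∀ f → start (n + f) (g ++ rest) x
                         ≡ exec f rest (home (accept (headB (F x g)))) (conf [] cs)) × n ≤ ⟪ total ⟫ N)
      run-all g rest len with startup
      ... | cs₁ , n₁ , s₁ , l₁ , r₁ with guess-all u [] g rest x (length u) r₁ len ≤-refl
      ... | cs₂ , n₂ , s₂ , l₂ , r₂ with deciding g len r₂
      ... | cs₃ , n₃ , s₃ , l₃ , o = cs₃ , o , n₁ + (n₂ + n₃) ,
        (λ f → trans (cong (λ k → start k (g ++ rest) x) (trans (+-assoc n₁ _ f) (cong (n₁ +_) (+-assoc n₂ n₃ f))))
                 (trans (s₁ (n₂ + (n₃ + f)) (g ++ rest)) (trans (s₂ (n₃ + f)) (apply s₃ f rest)))) ,
        regroup {A = ⟪ con 2 :* X :+ con 4 ⟫ N} {⟪ T₁ :* (con 2 :* (X :+ T₁) :+ con 5) ⟫ N} l₁ (≤-trans l₂ guess-bound) l₃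

      run-short : ∀ ys → length ys < length u → run machine (⟦ toPoly total ⟧ (length x)) x ys ≡ badPath
      run-short ys lt with startup
      ... | cs₁ , n₁ , s₁ , l₁ , r₁ with guess-short u [] ys x (length u) r₁ lt ≤-refl
      ... | n₂ , s₂ , l₂ = total-run (n₁ + (n₂ + 0) ,
        (λ f → trans (cong (λ k → start k ys x) (trans (+-assoc n₁ _ f) (cong (λ k → n₁ + (k + f)) (+-identityʳ n₂))))
                 (trans (s₁ (n₂ + f) ys) (s₂ f))) ,
        regroup {A = ⟪ con 2 :* X :+ con 4 ⟫ N} {⟪ T₁ :* (con 2 :* (X :+ T₁) :+ con 5) ⟫ N} l₁ (≤-trans l₂ guess-bound) z≤n)

      run-full : ∀ ys → length ys ≡ length u → ∃[ τ ] run machine (⟦ toPoly total ⟧ (length x)) x ys ≡ halted (headB (F x ys)) τ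
             × output τ ≡ tailS (F x ys)
      run-full ys len with run-all ys [] len
      ... | cs , o , n , s , n≤ = tp (conf [] cs) , total-run (n , (λ f → trans (cong (λ z → start (n + f) z x) (sym (List.++-identityʳ ys)))
              (trans (s f) (stop-run (headB (F x ys)) cs refl))) , n≤) , o

      run-long : ∀ g y ys → length g ≡ length u → run machine (⟦ toPoly total ⟧ (length x)) x (g ++ y ∷ ys) ≡ badPath
      run-long g y ys len with run-all g (y ∷ ys) len
      ... | cs , o , n , s , n≤ = total-run (n , (λ f → trans (s f) (stop-∷ (headB (F x g)) cs refl)) , n≤)

      run-part : ∀ ys → length ys ≢ length u → run machine (⟦ toPoly total ⟧ (length x)) x ys ≡ badPath
      run-part ys ne with <-cmp (length ys) (length u)
      ... | tri< lt _ _ = run-short ys lt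
      ... | tri≈ _ eq _ = ⊥-elim (ne eq)
      ... | tri> _ _ gt with List.drop (length u) ys in eq
      ...   | [] = ⊥-elim (<⇒≱ gt (m∸n≡0⇒m≤n (trans (sym (List.length-drop (length u) ys)) (cong length eq))))
      ...   | y ∷ zs = subst (λ z → run machine _ x z ≡ badPath) (trans (cong (List.take (length u) ys ++_) (sym eq)) (List.take++drop≡id (length u) ys))
              (run-long (List.take (length u) ys) y zs (trans (List.length-take (length u) ys) (m≤n⇒m⊓n≡m (<⇒≤ gt))))

  guessMachine : GuessMachine (λ x → length (U x)) (λ v → F (lookup v zero) (lookup v (suc zero)))
  guessMachine = record { ntm = machine ; time = toPoly total ; full = run-full ; part = run-part }

module _ {U : Vec Str 1 → Str} {F : Vec Str 2 → Str} (pU : PF U) (pF : PF F) where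
  private
    c₁ : Cmd 1 3
    c₁ = body pU (zero ∷ []) ⨾ alloc

    c₂ : Cmd 3 5
    c₂ = alloc ⨾ unload zero ⨾ body pF (suc (suc (suc zero)) ∷ zero ∷ [])

    K : ℕ
    K = depth c₁ ⊔ (depth c₂ ⊔ 5)

    run₁ : ∀ x → ∃[ t ] Exec c₁ (x ∷ []) ([] ∷ U (x ∷ []) ∷ x ∷ []) t × t ≤ ⟪ bound pU :+ con 1 ⟫ (length x)
    run₁ x with runs pU (zero ∷ []) (x ∷ []) refl
    ... | t , ex , t≤ = t + 1 , seq ex alloc , +-monoˡ-≤ 1 (subst (λ n → t ≤ ⟪ bound pU ⟫ n) (+-identityʳ (length x)) t≤)

    T₂ : PolyExp
    T₂ = con 1 :+ ((con 2 :* X :+ con 1) :+ bound pF)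

    run₂ : ∀ x ys → ∃[ t ] Exec c₂ ((ys ʳ++ []) ∷ [] ∷ x ∷ []) (F (x ∷ ys ∷ []) ∷ ys ∷ [] ∷ [] ∷ x ∷ []) t × t ≤ ⟪ T₂ ⟫ (length x + length ys)
    run₂ x ys with runs pF (suc (suc (suc zero)) ∷ zero ∷ []) (ys ∷ [] ∷ [] ∷ x ∷ []) refl
    ... | t , ex , t≤ = 1 + ((2 * length (ys ʳ++ []) + 1) + t) ,
      seq alloc (seq (Exec-≡ refl (cong (λ s → s ∷ [] ∷ [] ∷ x ∷ []) (ʳ++-twice ys)) (Exec-unload ([] ∷ [] ∷ x ∷ []) zero (ys ʳ++ []) [])) ex) ,
      +-monoʳ-≤ 1 (+-mono-≤ (+-monoˡ-≤ 1 (*-monoʳ-≤ 2 (≤-trans (≤-reflexive (length-ʳ++ ys)) (m≤n+m _ (length x)))))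
        (subst (λ n → t ≤ ⟪ bound pF ⟫ (length x + n)) (+-identityʳ (length ys)) t≤))

    machine : GuessMachine (λ x → length (U (x ∷ []))) (λ v → F (lookup v zero ∷ lookup v (suc zero) ∷ []))
    machine = GuessAndDecide.guessMachine c₁ c₂ K
      (≤-trans (m≤m⊔n _ _) (n≤1+n K))
      (≤-trans (m≤m⊔n _ 5) (≤-trans (m≤n⊔m (depth c₁) _) (n≤1+n K)))
      (≤-trans (m≤n⊔m (depth c₂) 5) (≤-trans (m≤n⊔m (depth c₁) _) (n≤1+n K)))
      (λ x → U (x ∷ [])) (λ x ys → F (x ∷ ys ∷ [])) (bound pU :+ con 1) T₂ run₁ run₂

  opaque
    guessMachine : GuessMachine (λ x → length (U (x ∷ []))) F
    guessMachine = record { ntm = ntm machine ; time = time machine ; full = full machine ; part = part machine }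
      where open GuessMachine

-- Basic polynomial-time functions

PF-tail : ∀ {n} {F : Vec Str n → Str} → PF F → PF {suc n} (λ v → F (Vec.tail v))
PF-tail {n} {F} f = PF-ext (λ { (s ∷ v) → cong F (trans (look-suc s v (Vec.allFin n)) (Vec.map-lookup-allFin v)) })
  (PF-rename (Vec.map suc (Vec.allFin n)) f)

record PF₁ (f : Str → Str) : Set where
  constructor pf₁
  field un₁ : PF {1} (λ v → f (lookup v zero))

record PF₂ (f : Str → Str → Str) : Set where
  constructor pf₂
  field un₂ : PF {2} (λ v → f (lookup v zero) (lookup v (suc zero)))

record PF₃ (f : Str → Str → Str → Str) : Set where
  constructor pf₃
  field un₃ : PF {3} (λ v → f (lookup v zero) (lookup v (suc zero)) (lookup v (suc (suc zero))))

open PF₁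
open PF₂
open PF₃

module _ {n : ℕ} where
  ap₁ : ∀ {f} {A : Vec Str n → Str} → PF₁ f → PF A → PF (λ v → f (A v))
  ap₁ (pf₁ f) a = PF-let a (PF-rename (zero ∷ []) f)

  ap₂ : ∀ {f} {A B : Vec Str n → Str} → PF₂ f → PF A → PF B → PF (λ v → f (A v) (B v))
  ap₂ (pf₂ f) a b = PF-let a (PF-let (PF-tail b) (PF-rename (suc zero ∷ zero ∷ []) f))

  ap₃ : ∀ {f} {A B C : Vec Str n → Str} → PF₃ f → PF A → PF B → PF C → PF (λ v → f (A v) (B v) (C v))
  ap₃ (pf₃ f) a b c = PF-let a (PF-let (PF-tail b) (PF-let (PF-tail (PF-tail c))
    (PF-rename (suc (suc zero) ∷ suc zero ∷ zero ∷ []) f)))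

PF-const : ∀ {n} s → PF {n} (λ _ → s)
PF-const []      = PF-[]
PF-const (b ∷ s) = PF-∷ b (PF-const s)

flag : Bool → Str
flag b = b ∷ []

-- A Boolean is represented by a string of length one.
PB : ∀ {n} → (Vec Str n → Bool) → Set
PB F = PF (λ v → flag (F v))

PB₁ : (Str → Bool) → Set
PB₁ f = PF₁ (λ s → f s ∷ [])

PB₂ : (Str → Str → Bool) → Set
PB₂ f = PF₂ (λ s t → f s t ∷ [])

module _ {n : ℕ} {c : Vec Str n → Bool} where
  PF-if : ∀ {F G : Vec Str n → Str} → PB c → PF F → PF G → PF (λ v → if c v then F v else G v)
  PF-if {F} {G} pc f g = PF-case {H = λ b w → if b then F (Vec.tail w) else G (Vec.tail w)} pc PF-[]
    (λ { false → PF-tail g ; true → PF-tail f })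

  PB-∧ : ∀ {d : Vec Str n → Bool} → PB c → PB d → PB (λ v → c v ∧ d v)
  PB-∧ {d} pc pd = PF-ext lem (PF-if {F = λ v → flag (d v)} {λ _ → false ∷ []} pc pd (PF-const (false ∷ [])))
    where
    lem : ∀ v → (if c v then flag (d v) else flag false) ≡ flag (c v ∧ d v)
    lem v with c v
    ... | false = refl
    ... | true  = refl

  PB-∨ : ∀ {d : Vec Str n → Bool} → PB c → PB d → PB (λ v → c v ∨ d v)
  PB-∨ {d} pc pd = PF-ext lem (PF-if {F = λ _ → true ∷ []} {λ v → flag (d v)} pc (PF-const (true ∷ [])) pd)
    where
    lem : ∀ v → (if c v then flag true else flag (d v)) ≡ flag (c v ∨ d v)
    lem v with c v
    ... | false = refl
    ... | true  = refl

  PB-not : PB c → PB (λ v → not (c v))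
  PB-not pc = PF-ext lem (PF-if {F = λ _ → false ∷ []} {λ _ → true ∷ []} pc (PF-const (false ∷ [])) (PF-const (true ∷ [])))
    where
    lem : ∀ v → (if c v then flag false else flag true) ≡ flag (not (c v))
    lem v with c v
    ... | false = refl
    ... | true  = refl

  PB-if : ∀ {F G : Vec Str n → Bool} → PB c → PB F → PB G → PB (λ v → if c v then F v else G v)
  PB-if {F} {G} pc f g = PF-ext lem (PF-if {F = λ v → flag (F v)} {λ v → flag (G v)} pc f g)
    where
    lem : ∀ v → (if c v then flag (F v) else flag (G v)) ≡ flag (if c v then F v else G v)
    lem v with c v
    ... | false = refl
    ... | true  = refl

iter : ∀ {n} → (Bool → Vec Str (suc n) → Str) → Str → Str → Vec Str n → Str
iter f []      x e = x
iter f (b ∷ s) x e = iter f s (f b (x ∷ e)) e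

module _ {n} {f : Bool → Vec Str (suc n) → Str} (pf : ∀ b → PF (f b)) (g : PolyExp)
         (growth : ∀ b x e → length (f b (x ∷ e)) ≤ length x + ⟪ g ⟫ (size e)) where
  private
    rest : Vec Str (3 + n) → Vec Str n
    rest w = Vec.tail (Vec.tail (Vec.tail w))

    f₁ f₂ f₃ : Bool → Vec Str (3 + n) → Str
    f₁ b w = f b (lookup w zero ∷ rest w)
    f₂ b w = lookup w (suc zero)
    f₃ b w = lookup w (suc (suc zero))

    σ : Vec (Fin (3 + n)) (suc n)
    σ = zero ∷ Vec.map suc (Vec.map suc (Vec.map suc (Vec.allFin n)))

    p₁ : ∀ b → PF (f₁ b)
    p₁ b = PF-ext (λ { (x ∷ y ∷ z ∷ e) → cong (λ t → f b (x ∷ t))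
      (trans (look-suc x _ _) (trans (look-suc y _ _) (trans (look-suc z _ _) (Vec.map-lookup-allFin e)))) }) (PF-rename σ (pf b))

    collapse : ∀ s x e → lookup (loop f₁ f₂ f₃ s (x ∷ [] ∷ [] ∷ e)) zero ≡ iter f s x e
    collapse []      x e = refl
    collapse (b ∷ s) x e = collapse s (f b (x ∷ e)) e

  PF-iter : ∀ {C I : Vec Str n → Str} → PF C → PF I → PF (λ v → iter f (C v) (I v) v)
  PF-iter {C} {I} c i = PF-ext (λ v → collapse (C v) (I v) v)
    (PF-loop p₁ (λ b → PF-var (suc zero)) (λ b → PF-var (suc (suc zero))) g
      (λ b x y z e → ≤-trans (+-monoˡ-≤ _ (growth b x e)) (≤-reflexive (swap (length x) (⟪ g ⟫ (size e)) (length y + length z))))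
      c i PF-[] PF-[] (PF-var zero))
    where
    swap : ∀ a b c → a + b + c ≡ a + c + b
    swap = solve-∀

fold : (Bool → Str → Str) → Str → Str → Str
fold h []      x = x
fold h (b ∷ s) x = fold h s (h b x)

PF-fold : ∀ (h : Bool → Str → Str) c → (∀ b → PF₁ (h b)) → (∀ b x → length (h b x) ≤ length x + c) → PF₂ (fold h)
PF-fold h c ph growth = pf₂ (PF-ext (λ v → collapse (lookup v zero) (lookup v (suc zero)) v)
  (PF-iter {f = λ b w → h b (lookup w zero)} (λ b → ap₁ (ph b) (PF-var zero)) (con c) (λ b x e → growth b x) (PF-var zero) (PF-var (suc zero))))
  where
  collapse : ∀ s x (v : Vec Str 2) → iter (λ b w → h b (lookup w zero)) s x v ≡ fold h s x
  collapse []      x v = refl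
  collapse (b ∷ s) x v = collapse s (h b x) v

fold-reverse : ∀ h s x → fold h (reverse s) x ≡ foldr h x s
fold-reverse h s x = trans (as-foldl (reverse s) x) (List.reverse-foldl (λ a b → h b a) x s)
  where
  as-foldl : ∀ s x → fold h s x ≡ foldl (λ a b → h b a) x s
  as-foldl []      x = refl
  as-foldl (b ∷ s) x = as-foldl s (h b x)

PF-ʳ++ : PF₂ _ʳ++_
PF-ʳ++ = pf₂ (PF-ext (λ v → as-ʳ++ (lookup v zero) (lookup v (suc zero)))
  (un₂ (PF-fold _∷_ 1 (λ b → pf₁ (PF-∷ b (PF-var zero))) (λ b x → ≤-reflexive (+-comm 1 (length x))))))
  where
  as-ʳ++ : ∀ s x → fold _∷_ s x ≡ s ʳ++ x
  as-ʳ++ []      x = refl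
  as-ʳ++ (b ∷ s) x = as-ʳ++ s (b ∷ x)

PF-reverse : PF₁ reverse
PF-reverse = pf₁ (ap₂ PF-ʳ++ (PF-var zero) PF-[])

PF-++ : PF₂ _++_
PF-++ = pf₂ (PF-ext (λ v → List.ʳ++-ʳ++ (lookup v zero) {[]} {lookup v (suc zero)}) 
  (ap₂ PF-ʳ++ (ap₂ PF-ʳ++ (PF-var zero) PF-[]) (PF-var (suc zero))))

PF-foldr : ∀ (h : Bool → Str → Str) c → (∀ b → PF₁ (h b)) → (∀ b x → length (h b x) ≤ length x + c) →
  PF₂ (λ s x → foldr h x s)
PF-foldr h c ph growth = pf₂ (PF-ext (λ v → fold-reverse h (lookup v zero) (lookup v (suc zero)))
  (ap₂ (PF-fold h c ph growth) (ap₁ PF-reverse (PF-var zero)) (PF-var (suc zero))))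

PF-tailS : PF₁ tailS
PF-tailS = pf₁ (PF-ext (λ v → lem (lookup v zero)) (PF-case {H = λ b w → lookup w zero} (PF-var zero) PF-[] (λ b → PF-var zero)))
  where
  lem : ∀ s → caseS s [] (λ b t → t) ≡ tailS s
  lem []      = refl
  lem (_ ∷ _) = refl

PB-headB : PB₁ headB
PB-headB = pf₁ (PF-ext (λ v → lem (lookup v zero)) (PF-case {H = λ b w → b ∷ []} (PF-var zero) (PF-const (false ∷ [])) (λ b → PF-const (b ∷ []))))
  where
  lem : ∀ s → caseS s (false ∷ []) (λ b t → b ∷ []) ≡ headB s ∷ []
  lem []      = refl
  lem (_ ∷ _) = refl

isNil : Str → Bool
isNil []      = true
isNil (_ ∷ _) = false

PB-isNil : PB₁ isNil
PB-isNil = pf₁ (PF-ext (λ v → lem (lookup v zero)) (PF-case {H = λ b w → false ∷ []} (PF-var zero) (PF-const (true ∷ [])) (λ b → PF-const (false ∷ []))))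
  where
  lem : ∀ s → caseS s (true ∷ []) (λ b t → false ∷ []) ≡ isNil s ∷ []
  lem []      = refl
  lem (_ ∷ _) = refl

-- Lengths are passed as strings: the first argument only serves to measure.
dropL takeL : Str → Str → Str
dropL u w = fold (λ _ → tailS) u w
takeL u w = reverse (dropL (dropL u w) (reverse w))

dropL-++ : ∀ u a b → length a ≡ length u → dropL u (a ++ b) ≡ b
dropL-++ []      []      b eq = refl
dropL-++ (_ ∷ u) (_ ∷ a) b eq = dropL-++ u a b (suc-injective eq)

-- Dropping as many symbols as `u` has leaves `b`, and `b` in turn measures how much to drop from
-- the other end.
takeL-++ : ∀ u a b → length a ≡ length u → takeL u (a ++ b) ≡ a
takeL-++ u a b eq rewrite dropL-++ u a b eq = trans
  (cong reverse (trans (cong (dropL b) (List.reverse-++ a b)) (dropL-++ b (reverse b) (reverse a) (List.length-reverse b))))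
  (List.reverse-involutive a)

PF-dropL : PF₂ dropL
PF-dropL = PF-fold (λ _ → tailS) 0 (λ b → PF-tailS) (λ b x → ≤-trans (shorter x) (≤-reflexive (sym (+-identityʳ _))))
  where
  shorter : ∀ x → length (tailS x) ≤ length x
  shorter []      = ≤-refl
  shorter (_ ∷ x) = n≤1+n _

PF-takeL : PF₂ takeL
PF-takeL = pf₂ (ap₁ PF-reverse (ap₂ PF-dropL (un₂ PF-dropL) (ap₁ PF-reverse (PF-var (suc zero)))))

length-dropL : ∀ u w → length (dropL u w) ≡ length w ∸ length u
length-dropL []      w       = refl
length-dropL (_ ∷ u) []      = trans (length-dropL u []) (0∸n≡0 (length u))
length-dropL (_ ∷ u) (_ ∷ w) = length-dropL u w

takeL-dropL : ∀ u w → length u ≤ length w → takeL u w ++ dropL u w ≡ w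
takeL-dropL u w le with splits u w le
  where
  splits : ∀ (u w : Str) → length u ≤ length w → ∃[ a ] ∃[ b ] w ≡ a ++ b × length a ≡ length u
  splits []      w       h       = [] , w , refl , refl
  splits (_ ∷ u) (c ∷ w) (s≤s h) with splits u w h
  ... | a , b , refl , eq = c ∷ a , b , refl , cong suc eq
... | a , b , refl , eq = cong₂ _++_ (takeL-++ u a b eq) (dropL-++ u a b eq)

length-takeL : ∀ u w → length u ≤ length w → length (takeL u w) ≡ length u
length-takeL u w le = trans (List.length-reverse (dropL (dropL u w) (reverse w)))
  (trans (length-dropL (dropL u w) (reverse w)) (trans (cong₂ _∸_ (List.length-reverse w) (length-dropL u w)) (m∸[m∸n]≡n le)))

eqS : Str → Str → Bool
eqS []          []          = true
eqS []          (_ ∷ _)     = false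
eqS (_ ∷ _)     []          = false
eqS (false ∷ s) (false ∷ t) = eqS s t
eqS (true ∷ s)  (true ∷ t)  = eqS s t
eqS (false ∷ s) (true ∷ t)  = false
eqS (true ∷ s)  (false ∷ t) = false

eqS-sound : ∀ s t → eqS s t ≡ true → s ≡ t
eqS-sound []          []          h = refl
eqS-sound (false ∷ s) (false ∷ t) h = cong (false ∷_) (eqS-sound s t h)
eqS-sound (true ∷ s)  (true ∷ t)  h = cong (true ∷_) (eqS-sound s t h)

eqS-refl : ∀ s → eqS s s ≡ true
eqS-refl []          = refl
eqS-refl (false ∷ s) = eqS-refl s
eqS-refl (true ∷ s)  = eqS-refl s

-- Scanning s against the string that follows a leading true; the empty string means failure.
eqStep : Bool → Str → Str
eqStep false (true ∷ false ∷ t) = true ∷ t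
eqStep true  (true ∷ true ∷ t)  = true ∷ t
eqStep _     _                  = []

PF-eqStep : ∀ b → PF₁ (eqStep b)
PF-eqStep b = pf₁ (PF-ext (λ v → lem b (lookup v zero))
  (PF-case {H = λ c w → if c then caseS (lookup w zero) [] (λ d t → match b d t) else []} (PF-var zero) PF-[]
    (λ { false → PF-[] ; true → PF-case {H = λ d w → match b d (lookup w zero)} (PF-var zero) PF-[] (λ d → pm b d) })))
  where
  match : Bool → Bool → Str → Str
  match false false t = true ∷ t
  match true  true  t = true ∷ t
  match _     _     t = []
  pm : ∀ b d → PF {3} (λ w → match b d (lookup w zero))
  pm false false = PF-∷ true (PF-var zero)
  pm false true  = PF-[]
  pm true  false = PF-[]
  pm true  true  = PF-∷ true (PF-var zero)
  lem : ∀ b s → caseS s [] (λ c t → if c then caseS t [] (λ d t → match b d t) else []) ≡ eqStep b s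
  lem false []                    = refl
  lem true  []                    = refl
  lem false (false ∷ t)           = refl
  lem true  (false ∷ t)           = refl
  lem false (true ∷ [])           = refl
  lem true  (true ∷ [])           = refl
  lem false (true ∷ false ∷ t)    = refl
  lem false (true ∷ true ∷ t)     = refl
  lem true  (true ∷ false ∷ t)    = refl
  lem true  (true ∷ true ∷ t)     = refl

PB-eqS : PB₂ eqS
PB-eqS = pf₂ (PF-ext (λ v → cong (_∷ []) (lem (lookup v zero) (lookup v (suc zero))))
  (PB-∧ (ap₁ PB-headB scan) (ap₁ PB-isNil (ap₁ PF-tailS scan))))
  where
  scan = ap₂ (PF-fold eqStep 0 PF-eqStep (λ b x → ≤-trans (shorter b x) (≤-reflexive (sym (+-identityʳ _))))) (PF-var zero) (PF-∷ true (PF-var (suc zero)))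
    where
    shorter : ∀ b x → length (eqStep b x) ≤ length x
    shorter false []                    = z≤n
    shorter true  []                    = z≤n
    shorter false (false ∷ t)           = z≤n
    shorter true  (false ∷ t)           = z≤n
    shorter false (true ∷ [])           = z≤n
    shorter true  (true ∷ [])           = z≤n
    shorter false (true ∷ false ∷ t)    = n≤1+n _
    shorter false (true ∷ true ∷ t)     = z≤n
    shorter true  (true ∷ false ∷ t)    = z≤n
    shorter true  (true ∷ true ∷ t)     = n≤1+n _
  failed : ∀ s → fold eqStep s [] ≡ []
  failed []          = refl
  failed (false ∷ s) = failed s
  failed (true ∷ s)  = failed s
  lem : ∀ s t → headB (fold eqStep s (true ∷ t)) ∧ isNil (tailS (fold eqStep s (true ∷ t))) ≡ eqS s t
  lem []          []          = refl
  lem []          (_ ∷ _)     = refl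
  lem (false ∷ s) []          rewrite failed s = refl
  lem (true ∷ s)  []          rewrite failed s = refl
  lem (false ∷ s) (false ∷ t) = lem s t
  lem (true ∷ s)  (true ∷ t)  = lem s t
  lem (false ∷ s) (true ∷ t)  rewrite failed s = refl
  lem (true ∷ s)  (false ∷ t) rewrite failed s = refl

-- Numbers are available only as lengths of strings. These strings are the clocks of loops and the
-- rulers of witnesses; only their lengths matter.
unary : PolyExp → Str → Str
unary (con c)  s = List.replicate c true
unary X        s = s
unary (p :+ q) s = unary p s ++ unary q s
unary (p :* q) s = iter (λ b w → lookup w (suc zero) ++ lookup w zero) (unary p s) [] (unary q s ∷ [])
unary (p :∘ q) s = unary p (unary q s)

length-unary : ∀ p s → length (unary p s) ≡ ⟪ p ⟫ (length s)
length-unary (con c)  s = List.length-replicate c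
length-unary X        s = refl
length-unary (p :+ q) s = trans (List.length-++ (unary p s)) (cong₂ _+_ (length-unary p s) (length-unary q s))
length-unary (p :* q) s = trans (mult (unary p s) []) (trans (+-identityʳ _) (cong₂ _*_ (length-unary p s) (length-unary q s)))
  where
  mult : ∀ c x → length (iter (λ b w → lookup w (suc zero) ++ lookup w zero) c x (unary q s ∷ [])) ≡ length c * length (unary q s) + length x
  mult []      x = refl
  mult (_ ∷ c) x = trans (mult c (unary q s ++ x)) (trans (cong (length c * length (unary q s) +_) (List.length-++ (unary q s)))
    (swap (length c * length (unary q s)) (length (unary q s)) (length x)))
    where
    swap : ∀ a b c → a + (b + c) ≡ b + a + c
    swap = solve-∀
length-unary (p :∘ q) s = trans (length-unary p (unary q s)) (cong ⟪ p ⟫ (length-unary q s))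

PF-unary : ∀ p → PF₁ (unary p)
PF-unary (con c)  = pf₁ (PF-const (List.replicate c true))
PF-unary X        = pf₁ (PF-var zero)
PF-unary (p :+ q) = pf₁ (ap₂ PF-++ (un₁ (PF-unary p)) (un₁ (PF-unary q)))
PF-unary (p :* q) = pf₁ (PF-let {F = λ v → unary q (lookup v zero)} {λ w → mul (unary p (lookup w (suc zero))) [] (lookup w zero ∷ [])} (un₁ (PF-unary q))
  (PF-ext (λ w → lem w (unary p (lookup w (suc zero))) [])
  (PF-iter {f = λ b w → lookup w (suc zero) ++ lookup w zero} (λ b → ap₂ PF-++ (PF-var (suc zero)) (PF-var zero)) X
    (λ { b x e@(u ∷ _) → ≤-trans (≤-reflexive (trans (List.length-++ u) (+-comm (length u) (length x))))
                            (+-monoʳ-≤ (length x) (m≤m+n (length u) _)) })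
    (ap₁ (PF-unary p) (PF-var (suc zero))) PF-[])))
  where
  mul : ∀ {n} → Str → Str → Vec Str (suc n) → Str
  mul = iter (λ b w → lookup w (suc zero) ++ lookup w zero)
  lem : ∀ (w : Vec Str 2) c x → mul c x w ≡ mul c x (lookup w zero ∷ [])
  lem w []      x = refl
  lem w (_ ∷ c) x = lem w c (lookup w zero ++ x)
PF-unary (p :∘ q) = pf₁ (ap₁ (PF-unary p) (un₁ (PF-unary q)))

PF-double : PF₁ double
PF-double = pf₁ (PF-ext (λ v → lem (lookup v zero)) (ap₂ (PF-foldr (λ b x → b ∷ b ∷ x) 2 (λ b → pf₁ (PF-∷ b (PF-∷ b (PF-var zero)))) (λ b x → ≤-reflexive (+-comm 2 (length x)))) (PF-var zero) PF-[]))
  where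
  lem : ∀ s → foldr (λ b x → b ∷ b ∷ x) [] s ≡ double s
  lem []      = refl
  lem (b ∷ s) = cong (λ x → b ∷ b ∷ x) (lem s)

PF-triple : PF₃ ⟨_,_,_⟩
PF-triple = pf₃ (ap₂ PF-++ (ap₁ PF-double (PF-var zero)) (ap₂ PF-++ (PF-const (false ∷ true ∷ []))
  (ap₂ PF-++ (ap₁ PF-double (PF-var (suc zero))) (ap₂ PF-++ (PF-const (false ∷ true ∷ [])) (ap₁ PF-double (PF-var (suc (suc zero))))))))

-- One step of undoubling: the unread rest, and the part read so far in reverse order.
-- Both are left alone once the separator or the end is reached.
unreadStep readStep : Str → Str → Str
unreadStep (false ∷ false ∷ t) o = t
unreadStep (true ∷ true ∷ t)   o = t
unreadStep s                   o = s
readStep (false ∷ false ∷ t) o = false ∷ o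
readStep (true ∷ true ∷ t)   o = true ∷ o
readStep s                   o = o

module _ (ff tr : Str → Str → Str) (other : Str → Str → Str) (pff : PF₂ ff) (ptr : PF₂ tr) (pother : PF₂ other) where
  private
    byPairs : Str → Str → Str
    byPairs s o = caseS s (other s o) (λ a t → caseS t (other s o) (λ b r →
      if a then (if b then tr r o else other s o) else (if b then other s o else ff r o)))

    PF-byPairs : PF {2} (λ v → byPairs (lookup v zero) (lookup v (suc zero)))
    PF-byPairs = PF-case {H = λ a w → caseS (lookup w zero) (oth1 w) (λ b r → inner a b r w)} (PF-var zero) (un₂ pother)
      (λ a → PF-case {H = λ b w → inner a b (lookup w zero) (Vec.tail w)} (PF-var zero) (ap₂ pother (PF-var (suc zero)) (PF-var (suc (suc zero)))) (λ b → pin a b))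
      where
      oth1 : Vec Str 3 → Str
      oth1 w = other (lookup w (suc zero)) (lookup w (suc (suc zero)))
      inner : Bool → Bool → Str → Vec Str 3 → Str
      inner a b r w = if a then (if b then tr r (lookup w (suc (suc zero))) else oth1 w) else (if b then oth1 w else ff r (lookup w (suc (suc zero))))
      oth2 : PF {4} (λ w → oth1 (Vec.tail w))
      oth2 = PF-tail (ap₂ pother (PF-var (suc zero)) (PF-var (suc (suc zero))))
      pin : ∀ a b → PF {4} (λ w → inner a b (lookup w zero) (Vec.tail w))
      pin false false = ap₂ pff (PF-var zero) (PF-tail (PF-var (suc (suc zero))))
      pin false true  = oth2
      pin true  false = oth2
      pin true  true  = ap₂ ptr (PF-var zero) (PF-tail (PF-var (suc (suc zero))))

  PF-pairwise : ∀ {F : Str → Str → Str} → (∀ s o → byPairs s o ≡ F s o) → PF₂ F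
  PF-pairwise eq = pf₂ (PF-ext (λ v → eq (lookup v zero) (lookup v (suc zero))) PF-byPairs)

PF-unreadStep : PF₂ unreadStep
PF-unreadStep = PF-pairwise (λ t o → t) (λ t o → t) (λ s o → s) (pf₂ (PF-var zero)) (pf₂ (PF-var zero)) (pf₂ (PF-var zero)) lem
  where
  lem : ∀ s o → caseS s s (λ a t → caseS t s (λ b r → if a then (if b then r else s) else (if b then s else r))) ≡ unreadStep s o
  lem []                    o = refl
  lem (false ∷ [])          o = refl
  lem (true ∷ [])           o = refl
  lem (false ∷ false ∷ s)   o = refl
  lem (false ∷ true ∷ s)    o = refl
  lem (true ∷ false ∷ s)    o = refl
  lem (true ∷ true ∷ s)     o = refl

PF-readStep : PF₂ readStep
PF-readStep = PF-pairwise (λ t o → false ∷ o) (λ t o → true ∷ o) (λ s o → o) (pf₂ (PF-∷ false (PF-var (suc zero)))) (pf₂ (PF-∷ true (PF-var (suc zero)))) (pf₂ (PF-var (suc zero))) lem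
  where
  lem : ∀ s o → caseS s o (λ a t → caseS t o (λ b r → if a then (if b then true ∷ o else o) else (if b then o else false ∷ o))) ≡ readStep s o
  lem []                    o = refl
  lem (false ∷ [])          o = refl
  lem (true ∷ [])           o = refl
  lem (false ∷ false ∷ s)   o = refl
  lem (false ∷ true ∷ s)    o = refl
  lem (true ∷ false ∷ s)    o = refl
  lem (true ∷ true ∷ s)     o = refl

-- The loop always takes as many rounds as its input has symbols; a scan that has finished earlier
-- idles in a state that the step fixes. The growth condition says that the unread and the read part
-- together do not get longer.
module Scan (un rd : Str → Str → Str) (pun : PF₂ un) (prd : PF₂ rd)
            (growth : ∀ s o → length (un s o) + length (rd s o) ≤ length s + length o) where

  scan : Str → Str → Str → Str × Str
  scan []      s o = s , o
  scan (_ ∷ c) s o = scan c (un s o) (rd s o)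

  scan-stuck : ∀ {s} → (∀ o → un s o ≡ s × rd s o ≡ o) → ∀ c o → scan c s o ≡ (s , o)
  scan-stuck st []      o = refl
  scan-stuck st (_ ∷ c) o rewrite proj₁ (st o) | proj₂ (st o) = scan-stuck st c o

  module _ {H : Str → Str → Str} (pH : PF₂ H) where
    private
      f₁ f₂ f₃ : Bool → Vec Str 4 → Str
      f₁ b w = un (lookup w zero) (lookup w (suc zero))
      f₂ b w = rd (lookup w zero) (lookup w (suc zero))
      f₃ b w = lookup w (suc (suc zero))

      collapse : ∀ c s o e → let w = loop f₁ f₂ f₃ c (s ∷ o ∷ [] ∷ e) in
        H (lookup w zero) (lookup w (suc zero)) ≡ H (proj₁ (scan c s o)) (proj₂ (scan c s o))
      collapse []      s o e = refl
      collapse (_ ∷ c) s o e = collapse c (un s o) (rd s o) e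

    PF-scan : PF₁ (λ s → H (proj₁ (scan s s [])) (proj₂ (scan s s [])))
    PF-scan = pf₁ (PF-ext (λ v → collapse (lookup v zero) (lookup v zero) [] v)
      (PF-loop {f₁ = f₁} {f₂} {f₃} (λ b → ap₂ pun (PF-var zero) (PF-var (suc zero))) (λ b → ap₂ prd (PF-var zero) (PF-var (suc zero)))
        (λ b → PF-var (suc (suc zero))) (con 0)
        (λ b x y z e → grow₃ {length (un x y)} {length (rd x y)} {length x} {length y} (length z) (growth x y))
        (PF-var zero) (PF-var zero) PF-[] PF-[] (ap₂ pH (PF-var zero) (PF-var (suc zero)))))
      where
      grow₃ : ∀ {a b c d} z → a + b ≤ c + d → a + (b + z) ≤ c + (d + z) + 0
      grow₃ {a} {b} {c} {d} z h = ≤-trans (≤-reflexive (sym (+-assoc a b z))) (≤-trans (+-monoˡ-≤ z h) (≤-reflexive (lemma c d z)))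
        where
        lemma : ∀ c d z → c + d + z ≡ c + (d + z) + 0
        lemma = solve-∀

private
  undouble-growth : ∀ s o → length (unreadStep s o) + length (readStep s o) ≤ length s + length o
  undouble-growth []                  o = ≤-refl
  undouble-growth (false ∷ [])        o = ≤-refl
  undouble-growth (true ∷ [])         o = ≤-refl
  undouble-growth (false ∷ false ∷ s) o = ≤-trans (≤-reflexive (+-suc (length s) (length o))) (n≤1+n _)
  undouble-growth (false ∷ true ∷ s)  o = ≤-refl
  undouble-growth (true ∷ false ∷ s)  o = ≤-refl
  undouble-growth (true ∷ true ∷ s)   o = ≤-trans (≤-reflexive (+-suc (length s) (length o))) (n≤1+n _)

open Scan unreadStep readStep PF-unreadStep PF-readStep undouble-growth using ()
  renaming (scan to undouble; scan-stuck to undouble-stuck; PF-scan to PF-undouble)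

Stuck : Str → Set
Stuck s = ∀ o → unreadStep s o ≡ s × readStep s o ≡ o

undouble-spec : ∀ x c s o → length x ≤ length c → Stuck s → undouble c (double x ++ s) o ≡ (s , x ʳ++ o)
undouble-spec []          []      s o h st = refl
undouble-spec []          (_ ∷ c) s o h st rewrite proj₁ (st o) | proj₂ (st o) = undouble-spec [] c s o z≤n st
undouble-spec (false ∷ x) (_ ∷ c) s o (s≤s h) st = undouble-spec x c s (false ∷ o) h st
undouble-spec (true ∷ x)  (_ ∷ c) s o (s≤s h) st = undouble-spec x c s (true ∷ o) h st

opaque
  component remainder : Str → Str
  component s = reverse (proj₂ (undouble s s []))
  remainder s = tailS (tailS (proj₁ (undouble s s [])))

  PF-component : PF₁ component
  PF-component = PF-undouble {H = λ s o → reverse o} (pf₂ (ap₁ PF-reverse (PF-var (suc zero))))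

  PF-remainder : PF₁ remainder
  PF-remainder = PF-undouble {H = λ s o → tailS (tailS s)} (pf₂ (ap₁ PF-tailS (ap₁ PF-tailS (PF-var zero))))

  length-double : ∀ x → length x ≤ length (double x)
  length-double []      = z≤n
  length-double (_ ∷ x) = s≤s (≤-trans (length-double x) (n≤1+n _))

  component-spec : ∀ x s → Stuck s → component (double x ++ s) ≡ x
  component-spec x s st = trans (cong (λ p → reverse (proj₂ p)) (undouble-spec x (double x ++ s) s [] long st)) (ʳ++-twice x)
    where
    long : length x ≤ length (double x ++ s)
    long = ≤-trans (length-double x) (≤-trans (m≤m+n _ _) (≤-reflexive (sym (List.length-++ (double x)))))

  remainder-spec : ∀ x s → remainder (double x ++ false ∷ true ∷ s) ≡ s
  remainder-spec x s = cong (λ p → tailS (tailS (proj₁ p)))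
    (undouble-spec x (double x ++ false ∷ true ∷ s) (false ∷ true ∷ s) []
      (≤-trans (length-double x) (≤-trans (m≤m+n _ _) (≤-reflexive (sym (List.length-++ (double x)))))) (λ o → refl , refl))

fst³ snd³ thd³ : Str → Str
fst³ = component
snd³ s = component (remainder s)
thd³ s = component (remainder (remainder s))

fst³-triple : ∀ x y z → fst³ ⟨ x , y , z ⟩ ≡ x
fst³-triple x y z = component-spec x _ (λ o → refl , refl)

snd³-triple : ∀ x y z → snd³ ⟨ x , y , z ⟩ ≡ y
snd³-triple x y z = trans (cong component (remainder-spec x _)) (component-spec y _ (λ o → refl , refl))

thd³-triple : ∀ x y z → thd³ ⟨ x , y , z ⟩ ≡ z
thd³-triple x y z = trans (cong component (trans (cong remainder (remainder-spec x _)) (remainder-spec y _)))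
  (trans (cong component (sym (List.++-identityʳ (double z)))) (component-spec z [] (λ o → refl , refl)))

-- Simulation of Turing machines

-- A prefix code, so that codes can be concatenated without separators and split off again by
-- `caseFin`.
codeF : ∀ {n} → Fin n → Str
codeF zero    = false ∷ []
codeF (suc i) = true ∷ codeF i

length-codeF : ∀ {n} (i : Fin n) → length (codeF i) ≤ n
length-codeF {suc n} zero    = s≤s z≤n
length-codeF {suc n} (suc i) = s≤s (length-codeF i)

caseFin : ∀ {A : Set} → A → ∀ n → Str → (Fin n → Str → A) → A
caseFin d zero    s           K = d
caseFin d (suc n) []          K = d
caseFin d (suc n) (false ∷ s) K = K zero s
caseFin d (suc n) (true ∷ s)  K = caseFin d n s (λ i → K (suc i))

caseFin-code : ∀ {A : Set} {d : A} {n} (i : Fin n) s {K} → caseFin d n (codeF i ++ s) K ≡ K i s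
caseFin-code zero    s = refl
caseFin-code (suc i) s {K} = caseFin-code i s {λ j → K (suc j)}

caseFin-elim : ∀ {A : Set} (P : A → Set) {d} n s {K} → P d → (∀ i t → length t ≤ length s → P (K i t)) → P (caseFin d n s K)
caseFin-elim P zero    s           pd pk = pd
caseFin-elim P (suc n) []          pd pk = pd
caseFin-elim P (suc n) (false ∷ s) pd pk = pk zero s (n≤1+n _)
caseFin-elim P (suc n) (true ∷ s)  pd pk = caseFin-elim P n s pd (λ i t h → pk (suc i) t (≤-trans h (n≤1+n _)))

caseFin-map : ∀ {A B : Set} (g : A → B) {d} n s {K} → g (caseFin d n s K) ≡ caseFin (g d) n s (λ i t → g (K i t))
caseFin-map g zero    s           = refl
caseFin-map g (suc n) []          = refl
caseFin-map g (suc n) (false ∷ s) = refl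
caseFin-map g (suc n) (true ∷ s)  = caseFin-map g n s

PF-caseFin : ∀ {m} n {D F : Vec Str m → Str} {K : Fin n → Vec Str (suc m) → Str} → PF D → PF F → (∀ i → PF (K i)) →
  PF (λ v → caseFin (D v) n (F v) (λ i s → K i (s ∷ v)))
PF-caseFin zero pd pf pk = pd
PF-caseFin {m} (suc n) {D} {F} {K} pd pf pk = PF-ext (λ v → lem v (F v))
  (PF-case {H = λ b w → if b then caseFin (D (Vec.tail w)) n (lookup w zero) (λ i s → K (suc i) (s ∷ Vec.tail w)) else K zero w} pf pd
    (λ { false → pk zero
       ; true → PF-caseFin n {K = λ i w → K (suc i) (lookup w zero ∷ Vec.tail (Vec.tail w))} (PF-tail pd) (PF-var zero)
           (λ i → PF-ext (λ { (s ∷ t ∷ v) → cong (λ e → K (suc i) (s ∷ e)) (trans (look-suc s _ _) (trans (look-suc t _ _) (Vec.map-lookup-allFin v))) })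
             (PF-rename (zero ∷ Vec.map suc (Vec.map suc (Vec.allFin m))) (pk (suc i)))) }))
  where
  lem : ∀ v x → caseS x (D v) (λ b s → if b then caseFin (D v) n s (λ i t → K (suc i) (t ∷ v)) else K zero (s ∷ v))
          ≡ caseFin (D v) (suc n) x (λ i s → K i (s ∷ v))
  lem v []          = refl
  lem v (false ∷ x) = refl
  lem v (true ∷ x)  = refl

record PFV {n m} (F : Vec Str n → Vec Str m) : Set where
  constructor pfv
  field component-PF : ∀ i → PF (λ v → lookup (F v) i)
open PFV

PFV-cons : ∀ {n m} {F : Vec Str n → Str} {G : Vec Str n → Vec Str m} → PF F → PFV G → PFV (λ v → F v ∷ G v)
PFV-cons f (pfv g) = pfv λ { zero → f ; (suc i) → g i }

PFV-nil : ∀ {n} → PFV {n} (λ _ → [])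
PFV-nil = pfv λ ()

PFV-caseFin : ∀ {l m} n {D : Vec Str l → Vec Str m} {F : Vec Str l → Str} {K : Fin n → Vec Str (suc l) → Vec Str m} →
  PFV D → PF F → (∀ i → PFV (K i)) → PFV (λ v → caseFin (D v) n (F v) (λ i s → K i (s ∷ v)))
PFV-caseFin n {D} {F} {K} (pfv d) f k = pfv λ i → PF-ext (λ v → sym (caseFin-map (λ w → lookup w i) n (F v)))
  (PF-caseFin n (d i) f (λ j → component-PF (k j) i))

PFV-case : ∀ {l m} {D : Vec Str l → Vec Str m} {F : Vec Str l → Str} {K : Bool → Vec Str (suc l) → Vec Str m} →
  PFV D → PF F → (∀ b → PFV (K b)) → PFV (λ v → caseS (F v) (D v) (λ b s → K b (s ∷ v)))
PFV-case {D = D} {F} {K} (pfv d) f k = pfv λ i → PF-ext (λ v → lem i v (F v)) (PF-case f (d i) (λ b → component-PF (k b) i))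
  where
  lem : ∀ i v x → caseS x (lookup (D v) i) (λ b s → lookup (K b (s ∷ v)) i) ≡ lookup (caseS x (D v) (λ b s → K b (s ∷ v))) i
  lem i v []      = refl
  lem i v (_ ∷ _) = refl

module Simulation (M : NTM) (q : Poly) where
  open NTM M

  codeT : List (Sym k) → Str
  codeT []      = []
  codeT (a ∷ t) = codeF a ++ codeT t

  data Snapshot : Set where
    running : Fin nQ → Tape k → Str → Snapshot
    done    : Bool → Tape k → Snapshot
    fail    : Snapshot

  act : Action (Fin nQ) (Sym k) → Tape k → Str → Snapshot
  act (halt b) τ []      = done b τ
  act (halt b) τ (_ ∷ _) = fail
  act (step q' s m) τ ys = running q' (move m (write s τ)) ys
  act (branch _ _) τ []  = fail
  act (branch (q' , s , m) _) τ (false ∷ ys) = running q' (move m (write s τ)) ys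
  act (branch _ (q' , s , m)) τ (true ∷ ys)  = running q' (move m (write s τ)) ys

  next : Snapshot → Snapshot
  next (running q τ ys) = act (δ q (hd τ)) τ ys
  next c = c

  nexts : ℕ → Snapshot → Snapshot
  nexts zero    c = c
  nexts (suc n) c = nexts n (next c)

  result : Outcome k → Str
  result (halted b τ) = b ∷ output τ
  result _            = []

  verdict : Snapshot → Str
  verdict (done b τ) = b ∷ output τ
  verdict _          = []

  nexts-done : ∀ n {b τ} → nexts n (done b τ) ≡ done b τ
  nexts-done zero    = refl
  nexts-done (suc n) = nexts-done n

  nexts-fail : ∀ n → nexts n fail ≡ fail
  nexts-fail zero    = refl
  nexts-fail (suc n) = nexts-fail n

  -- Halting costs no fuel in `runFrom` but is a step of `next`, whence the additional step. A
  -- computation that has run out of fuel is still `running`, and its empty verdict agrees with the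
  -- empty result of `timeout`.
  nexts-run : ∀ n q τ ys → verdict (nexts (suc n) (running q τ ys)) ≡ result (runFrom M n ys q τ)
  nexts-run n q τ ys with δ q (hd τ)
  nexts-run n q τ []       | halt b = cong verdict (nexts-done n)
  nexts-run n q τ (_ ∷ _)  | halt b = cong verdict (nexts-fail n)
  nexts-run zero    q τ ys | step q' s m = refl
  nexts-run (suc n) q τ ys | step q' s m = nexts-run n q' _ ys
  nexts-run zero    q τ [] | branch _ _ = refl
  nexts-run (suc n) q τ [] | branch _ _ = cong verdict (nexts-fail n)
  nexts-run zero    q τ (false ∷ ys) | branch (q' , s , m) _ = refl
  nexts-run (suc n) q τ (false ∷ ys) | branch (q' , s , m) _ = nexts-run n q' _ ys
  nexts-run zero    q τ (true ∷ ys)  | branch _ (q' , s , m) = refl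
  nexts-run (suc n) q τ (true ∷ ys)  | branch _ (q' , s , m) = nexts-run n q' _ ys

  -- The three codes below are reserved for failure and the two verdicts.
  mode : Fin nQ → Fin (3 + nQ)
  mode q = suc (suc (suc q))

  verdictMode : Bool → Fin (3 + nQ)
  verdictMode false = suc zero
  verdictMode true  = suc (suc zero)

  failed : Vec Str 3
  failed = codeF {3 + nQ} zero ∷ [] ∷ [] ∷ []

  -- With mode, scanned symbol and right part in one string, and the left part nearest cell first in
  -- another, a step acts only on the fronts of strings.
  pack : Fin (3 + nQ) → Tape k → Str → Vec Str 3
  pack md (tape l h r) ys = (codeF md ++ (codeF h ++ codeT r)) ∷ codeT l ∷ ys ∷ []

  code-snapshot : Snapshot → Vec Str 3
  code-snapshot (running q τ ys) = pack (mode q) τ ys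
  code-snapshot (done b τ)       = pack (verdictMode b) τ []
  code-snapshot fail             = failed

  orBlank : Str → Str
  orBlank r = caseFin (codeF (blank {k})) (3 + k) r (λ a t → codeF a ++ t)

  moveT : Fin nQ → Sym k → Move → Str → Str → Str → Vec Str 3
  moveT q s S r l ys = (codeF (mode q) ++ (codeF s ++ r)) ∷ l ∷ ys ∷ []
  moveT q s R r l ys = (codeF (mode q) ++ orBlank r) ∷ (codeF s ++ l) ∷ ys ∷ []
  moveT q s L r l ys = caseFin ((codeF (mode q) ++ (codeF (blank {k}) ++ (codeF s ++ r))) ∷ [] ∷ ys ∷ []) (3 + k) l
                         (λ a t → (codeF (mode q) ++ (codeF a ++ (codeF s ++ r))) ∷ t ∷ ys ∷ [])

  moveT-spec : ∀ q s m l h r ys → moveT q s m (codeT r) (codeT l) ys ≡ pack (mode q) (move m (write s (tape l h r))) ys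
  moveT-spec q s L []      h r       ys = refl
  moveT-spec q s L (a ∷ l) h r       ys = caseFin-code a (codeT l)
  moveT-spec q s R l       h []      ys = refl
  moveT-spec q s R l       h (a ∷ r) ys = cong (λ t → (codeF (mode q) ++ t) ∷ (codeF s ++ codeT l) ∷ ys ∷ []) (caseFin-code a (codeT r))
  moveT-spec q s S l       h r       ys = refl

  actT : Action (Fin nQ) (Sym k) → Sym k → Str → Str → Str → Vec Str 3
  actT (halt b) h r l ys = caseS ys ((codeF (verdictMode b) ++ (codeF h ++ r)) ∷ l ∷ [] ∷ []) (λ _ _ → failed)
  actT (step q s m) h r l ys = moveT q s m r l ys
  actT (branch (q , s , m) (q' , s' , m')) h r l ys =
    caseS ys failed (λ b ys → if b then moveT q' s' m' r l ys else moveT q s m r l ys)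

  actT-spec : ∀ a l h r ys → actT a h (codeT r) (codeT l) ys ≡ code-snapshot (act a (tape l h r) ys)
  actT-spec (halt b) l h r []      = refl
  actT-spec (halt b) l h r (_ ∷ _) = refl
  actT-spec (step q s m) l h r ys  = moveT-spec q s m l h r ys
  actT-spec (branch _ _) l h r []  = refl
  actT-spec (branch (q , s , m) _) l h r (false ∷ ys) = moveT-spec q s m l h r ys
  actT-spec (branch _ (q , s , m)) l h r (true ∷ ys)  = moveT-spec q s m l h r ys

  modeT : Fin (3 + nQ) → Str → Str → Str → Str → Vec Str 3
  modeT (suc (suc (suc q))) t x l ys = caseFin failed (3 + k) t (λ h r → actT (δ q h) h r l ys)
  modeT _                   t x l ys = x ∷ l ∷ ys ∷ []

  nextT : Str → Str → Str → Vec Str 3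
  nextT x l ys = caseFin failed (3 + nQ) x (λ md t → modeT md t x l ys)

  nextT-spec : ∀ c → let v = code-snapshot c in nextT (lookup v zero) (lookup v (suc zero)) (lookup v (suc (suc zero))) ≡ code-snapshot (next c)
  nextT-spec (running q (tape l h r) ys) = trans
    (caseFin-code (mode q) (codeF h ++ codeT r) {λ md t → modeT md t (codeF (mode q) ++ (codeF h ++ codeT r)) (codeT l) ys})
    (trans (caseFin-code h (codeT r) {λ h r → actT (δ q h) h r (codeT l) ys}) (actT-spec (δ q h) l h r ys))
  nextT-spec (done false (tape l h r)) = refl
  nextT-spec (done true (tape l h r))  = refl
  nextT-spec fail = refl

  private
    -- One step writes at most one mode code and two symbol codes in front of what it keeps; code
    -- lengths are bounded by the numbers of modes and symbols.
    G : ℕ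
    G = (3 + nQ) + ((3 + k) + (3 + k))

    Bounded : Str → Str → Str → Vec Str 3 → Set
    Bounded x l ys v = size v ≤ length x + (length l + length ys) + G

    triple≤ : ∀ {a b c x l ys} (A B C : Str) → length A ≤ x + a → length B ≤ l + b → length C ≤ ys + c → a + (b + c) ≤ G →
      size (A ∷ B ∷ C ∷ []) ≤ x + (l + ys) + G
    triple≤ {a} {b} {c} {x} {l} {ys} A B C ha hb hc h = ≤-trans (+-mono-≤ ha (+-mono-≤ hb (≤-trans (≤-reflexive (+-identityʳ _)) hc)))
      (≤-trans (≤-reflexive (lemma x a l b ys c)) (+-monoʳ-≤ (x + (l + ys)) h))
      where
      lemma : ∀ x a l b y c → x + a + (l + b + (y + c)) ≡ x + (l + y) + (a + (b + c))
      lemma = solve-∀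

    prefix≤ : ∀ {n} (i : Fin n) s x {a} → length s ≤ x + a → length (codeF i ++ s) ≤ x + (n + a)
    prefix≤ {n} i s x {a} h = ≤-trans (≤-reflexive (List.length-++ (codeF i)))
      (≤-trans (+-mono-≤ (length-codeF i) h) (≤-reflexive (lemma n x a)))
      where
      lemma : ∀ n x a → n + (x + a) ≡ x + (n + a)
      lemma = solve-∀

    code≤ : ∀ {n} (i : Fin n) x → length (codeF i) ≤ x + n
    code≤ {n} i x = ≤-trans (length-codeF i) (m≤n+m n x)

    same : ∀ {s x : ℕ} → s ≤ x → s ≤ x + 0
    same {s} {x} h = ≤-trans h (≤-reflexive (sym (+-identityʳ x)))

    failed≤ : ∀ x l ys → Bounded x l ys failed
    failed≤ x l ys = ≤-trans (s≤s z≤n) (m≤n+m _ (length x + (length l + length ys)))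

    moveT≤ : ∀ q s m x r l ys ys' → length r ≤ length x → length ys' ≤ length ys → Bounded x l ys (moveT q s m r l ys')
    moveT≤ q s S x r l ys ys' hr hy = triple≤ {x = length x} {length l} {length ys} (codeF (mode q) ++ (codeF s ++ r)) l ys'
      (prefix≤ (mode q) (codeF s ++ r) (length x) (prefix≤ s r (length x) (same hr))) (same ≤-refl) (same hy)
      (≤-trans (≤-reflexive (+-identityʳ _)) (+-monoʳ-≤ (3 + nQ) (+-monoʳ-≤ (3 + k) z≤n)))
    moveT≤ q s R x r l ys ys' hr hy = triple≤ {x = length x} {length l} {length ys} (codeF (mode q) ++ orBlank r) (codeF s ++ l) ys'
      (prefix≤ (mode q) (orBlank r) (length x) (caseFin-elim (λ t → length t ≤ length x + ((3 + k) + 0)) (3 + k) r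
        (≤-trans (code≤ (blank {k}) (length x)) (+-monoʳ-≤ (length x) (≤-reflexive (sym (+-identityʳ (3 + k))))))
        (λ a t h → prefix≤ a t (length x) (same (≤-trans h hr))))) (prefix≤ s l (length l) (same ≤-refl)) (same hy)
      (≤-reflexive (lemma (3 + nQ) (3 + k)))
      where
      lemma : ∀ a b → (a + (b + 0)) + (b + 0 + 0) ≡ a + (b + b)
      lemma = solve-∀
    moveT≤ q s L x r l ys ys' hr hy = caseFin-elim (Bounded x l ys) (3 + k) l
        (shape (blank {k}) [] z≤n) (λ a t h → shape a t h)
      where
      fits : (3 + nQ) + ((3 + k) + ((3 + k) + 0)) + (0 + 0) ≤ G
      fits = ≤-reflexive (lemma (3 + nQ) (3 + k))
        where
        lemma : ∀ a b → a + (b + (b + 0)) + (0 + 0) ≡ a + (b + b)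
        lemma = solve-∀
      shape : ∀ a t → length t ≤ length l → Bounded x l ys ((codeF (mode q) ++ (codeF a ++ (codeF s ++ r))) ∷ t ∷ ys' ∷ [])
      shape a t h = triple≤ {x = length x} {length l} {length ys} (codeF (mode q) ++ (codeF a ++ (codeF s ++ r))) t ys'
        (prefix≤ (mode q) (codeF a ++ (codeF s ++ r)) (length x) (prefix≤ a (codeF s ++ r) (length x) (prefix≤ s r (length x) (same hr)))) (same h) (same hy) fits

    actT≤ : ∀ a h x r l ys → length r ≤ length x → Bounded x l ys (actT a h r l ys)
    actT≤ (halt b) h x r l [] hr = triple≤ {x = length x} {length l} {0} (codeF (verdictMode b) ++ (codeF h ++ r)) l []
      (prefix≤ (verdictMode b) (codeF h ++ r) (length x) (prefix≤ h r (length x) (same hr))) (same ≤-refl) z≤n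
      (≤-trans (≤-reflexive (+-identityʳ _)) (+-monoʳ-≤ (3 + nQ) (+-monoʳ-≤ (3 + k) z≤n)))
    actT≤ (halt b) h x r l (y ∷ ys) hr = failed≤ x l (y ∷ ys)
    actT≤ (step q s m) h x r l ys hr = moveT≤ q s m x r l ys ys hr ≤-refl
    actT≤ (branch _ _) h x r l [] hr = failed≤ x l []
    actT≤ (branch (q , s , m) _) h x r l (false ∷ ys) hr = moveT≤ q s m x r l (false ∷ ys) ys hr (n≤1+n _)
    actT≤ (branch _ (q , s , m)) h x r l (true ∷ ys) hr  = moveT≤ q s m x r l (true ∷ ys) ys hr (n≤1+n _)

    keep≤ : ∀ x l ys → Bounded x l ys (x ∷ l ∷ ys ∷ [])
    keep≤ x l ys = triple≤ {x = length x} {length l} {length ys} x l ys (same ≤-refl) (same ≤-refl) (same ≤-refl) z≤n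

    modeT≤ : ∀ md t x l ys → length t ≤ length x → Bounded x l ys (modeT md t x l ys)
    modeT≤ (suc (suc (suc q))) t x l ys h = caseFin-elim (Bounded x l ys) (3 + k) t (failed≤ x l ys)
      (λ s r h' → actT≤ (δ q s) s x r l ys (≤-trans h' h))
    modeT≤ zero             t x l ys h = keep≤ x l ys
    modeT≤ (suc zero)       t x l ys h = keep≤ x l ys
    modeT≤ (suc (suc zero)) t x l ys h = keep≤ x l ys

    nextT≤ : ∀ x l ys → Bounded x l ys (nextT x l ys)
    nextT≤ x l ys = caseFin-elim (Bounded x l ys) (3 + nQ) x (failed≤ x l ys) (λ md t h → modeT≤ md t x l ys h)

  PFV-const : ∀ {n m} (w : Vec Str m) → PFV {n} (λ _ → w)
  PFV-const w = pfv λ i → PF-const (lookup w i)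

  prefixed : ∀ {n} {F : Vec Str n → Str} s → PF F → PF (λ v → s ++ F v)
  prefixed s f = ap₂ PF-++ (PF-const s) f

  PF-moveT : ∀ {n} {F₁ F₂ F₃ : Vec Str n → Str} q s m → PF F₁ → PF F₂ → PF F₃ → PFV (λ v → moveT q s m (F₁ v) (F₂ v) (F₃ v))
  PF-moveT q s S f₁ f₂ f₃ = PFV-cons (prefixed (codeF (mode q)) (prefixed (codeF s) f₁)) (PFV-cons f₂ (PFV-cons f₃ PFV-nil))
  PF-moveT q s R f₁ f₂ f₃ = PFV-cons (prefixed (codeF (mode q)) (PF-caseFin (3 + k) {K = λ a w → codeF a ++ lookup w zero} (PF-const _) f₁ (λ a → prefixed (codeF a) (PF-var zero))))
    (PFV-cons (prefixed (codeF s) f₂) (PFV-cons f₃ PFV-nil))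
  PF-moveT {F₁ = F₁} {F₃ = F₃} q s L f₁ f₂ f₃ = PFV-caseFin (3 + k)
    {K = λ a w → (codeF (mode q) ++ (codeF a ++ (codeF s ++ F₁ (Vec.tail w)))) ∷ lookup w zero ∷ F₃ (Vec.tail w) ∷ []}
    (PFV-cons (prefixed (codeF (mode q)) (prefixed (codeF (blank {k})) (prefixed (codeF s) f₁))) (PFV-cons PF-[] (PFV-cons f₃ PFV-nil))) f₂
    (λ a → PFV-cons (prefixed (codeF (mode q)) (prefixed (codeF a) (prefixed (codeF s) (PF-tail f₁)))) (PFV-cons (PF-var zero) (PFV-cons (PF-tail f₃) PFV-nil)))

  PF-actT : ∀ {n} {F₁ F₂ F₃ : Vec Str n → Str} a h → PF F₁ → PF F₂ → PF F₃ → PFV (λ v → actT a h (F₁ v) (F₂ v) (F₃ v))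
  PF-actT (halt b) h f₁ f₂ f₃ = PFV-case {K = λ _ _ → failed}
    (PFV-cons (prefixed (codeF (verdictMode b)) (prefixed (codeF h) f₁)) (PFV-cons f₂ (PFV-cons PF-[] PFV-nil))) f₃ (λ _ → PFV-const failed)
  PF-actT (step q s m) h f₁ f₂ f₃ = PF-moveT q s m f₁ f₂ f₃
  PF-actT {F₁ = F₁} {F₂} (branch (q , s , m) (q' , s' , m')) h f₁ f₂ f₃ = PFV-case
    {K = λ b w → if b then moveT q' s' m' (F₁ (Vec.tail w)) (F₂ (Vec.tail w)) (lookup w zero) else moveT q s m (F₁ (Vec.tail w)) (F₂ (Vec.tail w)) (lookup w zero)}
    (PFV-const failed) f₃
    (λ { false → PF-moveT q s m (PF-tail f₁) (PF-tail f₂) (PF-var zero) ; true → PF-moveT q' s' m' (PF-tail f₁) (PF-tail f₂) (PF-var zero) })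

  PF-modeT : ∀ md → PFV {4} (λ w → modeT md (lookup w zero) (lookup w (suc zero)) (lookup w (suc (suc zero))) (lookup w (suc (suc (suc zero)))))
  PF-modeT (suc (suc (suc q))) = PFV-caseFin (3 + k) {K = λ h w → actT (δ q h) h (lookup w zero) (lookup w (suc (suc (suc zero)))) (lookup w (suc (suc (suc (suc zero)))))}
    (PFV-const failed) (PF-var zero) (λ h → PF-actT (δ q h) h (PF-var zero) (PF-var (suc (suc (suc zero)))) (PF-var (suc (suc (suc (suc zero))))))
  PF-modeT zero             = PFV-cons (PF-var (suc zero)) (PFV-cons (PF-var (suc (suc zero))) (PFV-cons (PF-var (suc (suc (suc zero)))) PFV-nil))
  PF-modeT (suc zero)       = PFV-cons (PF-var (suc zero)) (PFV-cons (PF-var (suc (suc zero))) (PFV-cons (PF-var (suc (suc (suc zero)))) PFV-nil))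
  PF-modeT (suc (suc zero)) = PFV-cons (PF-var (suc zero)) (PFV-cons (PF-var (suc (suc zero))) (PFV-cons (PF-var (suc (suc (suc zero)))) PFV-nil))

  PF-nextT : ∀ i → PF₃ (λ x l ys → lookup (nextT x l ys) i)
  PF-nextT i = pf₃ (component-PF (PFV-caseFin (3 + nQ)
    {K = λ md w → modeT md (lookup w zero) (lookup w (suc zero)) (lookup w (suc (suc zero))) (lookup w (suc (suc (suc zero))))}
    (PFV-const failed) (PF-var zero) PF-modeT) i)

  bitOf : Fin 3 → Str → Str
  bitOf zero             o = o
  bitOf (suc zero)       o = false ∷ o
  bitOf (suc (suc zero)) o = true ∷ o

  restOf : Fin 3 → Str → Str → Str
  restOf zero    s r = s
  restOf (suc _) s r = r

  skipBit takeBit : Str → Str → Str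
  skipBit s o = caseFin s 3 s (λ i r → restOf i s r)
  takeBit s o = caseFin o 3 s (λ i r → bitOf i o)

  PF-skipBit : PF₂ skipBit
  PF-skipBit = pf₂ (PF-caseFin 3 {K = λ i w → restOf i (lookup w (suc zero)) (lookup w zero)} (PF-var zero) (PF-var zero) (λ { zero → PF-var (suc zero) ; (suc _) → PF-var zero }))

  PF-takeBit : PF₂ takeBit
  PF-takeBit = pf₂ (PF-caseFin 3 {K = λ i w → bitOf i (lookup w (suc (suc zero)))} (PF-var (suc zero)) (PF-var zero)
    (λ { zero → PF-var (suc (suc zero)) ; (suc zero) → PF-∷ false (PF-var (suc (suc zero))) ; (suc (suc zero)) → PF-∷ true (PF-var (suc (suc zero))) }))

  private
    bits-growth : ∀ s o → length (skipBit s o) + length (takeBit s o) ≤ length s + length o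
    bits-growth []                         o = ≤-refl
    bits-growth (false ∷ s)                o = ≤-refl
    bits-growth (true ∷ [])                o = ≤-refl
    bits-growth (true ∷ false ∷ s)         o = ≤-trans (≤-reflexive (+-suc (length s) (length o))) (n≤1+n _)
    bits-growth (true ∷ true ∷ [])         o = ≤-refl
    bits-growth (true ∷ true ∷ false ∷ s)  o = ≤-trans (≤-reflexive (+-suc (length s) (length o))) (≤-trans (n≤1+n _) (n≤1+n _))
    bits-growth (true ∷ true ∷ true ∷ s)   o = ≤-refl

  open Scan skipBit takeBit PF-skipBit PF-takeBit bits-growth

  readCode : Str → Str
  readCode s = reverse (proj₂ (scan s s []))

  PF-readCode : PF₁ readCode
  PF-readCode = PF-scan {H = λ s o → reverse o} (pf₂ (ap₁ PF-reverse (PF-var (suc zero))))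

  scan-bits : ∀ cs c o → length cs ≤ length c → proj₂ (scan c (codeT cs) o) ≡ readBits cs ʳ++ o
  scan-bits []                          c       o h = cong proj₂ (scan-stuck (λ o → refl , refl) c o)
  scan-bits (zero ∷ cs)                 c       o h = cong proj₂ (scan-stuck (λ o → refl , refl) c o)
  scan-bits (suc (suc (suc a)) ∷ cs)    c       o h = cong proj₂ (scan-stuck (λ o → refl , refl) c o)
  scan-bits (suc zero ∷ cs)             (_ ∷ c) o (s≤s h) = scan-bits cs c (false ∷ o) h
  scan-bits (suc (suc zero) ∷ cs)       (_ ∷ c) o (s≤s h) = scan-bits cs c (true ∷ o) h

  readCode-spec : ∀ cs → readCode (codeT cs) ≡ readBits cs
  readCode-spec cs = trans (cong reverse (scan-bits cs (codeT cs) [] (longer cs))) (ʳ++-twice (readBits cs))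
    where
    longer : ∀ cs → length cs ≤ length (codeT cs)
    longer []       = z≤n
    longer (a ∷ cs) = ≤-trans (s≤s (longer cs)) (≤-trans (+-monoˡ-≤ (length (codeT cs)) (one a)) (≤-reflexive (sym (List.length-++ (codeF a)))))
      where
      one : ∀ {n} (a : Fin n) → 1 ≤ length (codeF a)
      one zero    = ≤-refl
      one (suc a) = s≤s z≤n

  verdictOf : Fin (3 + nQ) → Str → Str
  verdictOf (suc zero)       t = false ∷ readCode t
  verdictOf (suc (suc zero)) t = true ∷ readCode t
  verdictOf _                t = []

  verdictT : Str → Str
  verdictT x = caseFin [] (3 + nQ) x verdictOf

  verdictT-spec : ∀ c → verdictT (lookup (code-snapshot c) zero) ≡ verdict c
  verdictT-spec (running q (tape l h r) ys) = caseFin-code (mode q) (codeF h ++ codeT r) {verdictOf}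
  verdictT-spec (done false (tape l h r)) = cong (false ∷_) (readCode-spec (h ∷ r))
  verdictT-spec (done true (tape l h r))  = cong (true ∷_) (readCode-spec (h ∷ r))
  verdictT-spec fail = refl

  PF-verdictT : PF₁ verdictT
  PF-verdictT = pf₁ (PF-caseFin (3 + nQ) {K = λ md w → verdictOf md (lookup w zero)} PF-[] (PF-var zero)
    (λ { zero → PF-[] ; (suc zero) → PF-∷ false (ap₁ PF-readCode (PF-var zero)) ; (suc (suc zero)) → PF-∷ true (ap₁ PF-readCode (PF-var zero)) ; (suc (suc (suc _))) → PF-[] }))

  inputT : Str → Str
  inputT x = if isNil x then codeF (blank {k}) else foldr (λ b s → codeF (bitSym {k} b) ++ s) [] x

  PF-inputT : PF₁ inputT
  PF-inputT = pf₁ (PF-if (un₁ PB-isNil) (PF-const (codeF (blank {k})))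
    (ap₂ (PF-foldr (λ b s → codeF (bitSym {k} b) ++ s) (3 + k) (λ b → pf₁ (prefixed (codeF (bitSym {k} b)) (PF-var zero)))
      (λ b x → ≤-trans (≤-reflexive (List.length-++ (codeF (bitSym {k} b)))) (≤-trans (+-monoˡ-≤ (length x) (length-codeF (bitSym {k} b))) (≤-reflexive (+-comm (3 + k) (length x)))))) (PF-var zero) PF-[]))

  inputT-spec : ∀ x → code-snapshot (running start (initTape x) []) ≡ (codeF (mode start) ++ inputT x) ∷ [] ∷ [] ∷ []
  inputT-spec []      = refl
  inputT-spec (b ∷ x) = cong (λ t → (codeF (mode start) ++ (codeF (bitSym {k} b) ++ t)) ∷ [] ∷ [] ∷ []) (bits x)
    where
    bits : ∀ x → codeT (List.map bitSym x) ≡ foldr (λ b s → codeF (bitSym {k} b) ++ s) [] x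
    bits []      = refl
    bits (b ∷ x) = cong (codeF (bitSym {k} b) ++_) (bits x)

  f₁ f₂ f₃ : ∀ {n} → Bool → Vec Str (3 + n) → Str
  f₁ b w = lookup (nextT (lookup w zero) (lookup w (suc zero)) (lookup w (suc (suc zero)))) zero
  f₂ b w = lookup (nextT (lookup w zero) (lookup w (suc zero)) (lookup w (suc (suc zero)))) (suc zero)
  f₃ b w = lookup (nextT (lookup w zero) (lookup w (suc zero)) (lookup w (suc (suc zero)))) (suc (suc zero))

  clock : Str → Str
  clock x = unary (fromPoly q :+ con 1) x

  opaque
    simulate : Str → Str → Str
    simulate x ys = verdictT (lookup (loop f₁ f₂ f₃ (clock x) ((codeF (mode start) ++ inputT x) ∷ [] ∷ ys ∷ x ∷ ys ∷ [])) zero)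

    PF-simulate : PF₂ simulate
    PF-simulate = pf₂ (PF-ext (λ { (x ∷ ys ∷ []) → refl }) (PF-loop (λ b → ap₃ (PF-nextT zero) (PF-var zero) (PF-var (suc zero)) (PF-var (suc (suc zero))))
      (λ b → ap₃ (PF-nextT (suc zero)) (PF-var zero) (PF-var (suc zero)) (PF-var (suc (suc zero))))
      (λ b → ap₃ (PF-nextT (suc (suc zero))) (PF-var zero) (PF-var (suc zero)) (PF-var (suc (suc zero)))) (con G)
      (λ b x y z e → growth (nextT x y z) (nextT≤ x y z))
      (ap₁ (PF-unary (fromPoly q :+ con 1)) (PF-var zero)) (prefixed (codeF (mode start)) (ap₁ PF-inputT (PF-var zero))) PF-[] (PF-var (suc zero)) (ap₁ PF-verdictT (PF-var zero))))
      where
      growth : ∀ {N} (v : Vec Str 3) → size v ≤ N → length (lookup v zero) + (length (lookup v (suc zero)) + length (lookup v (suc (suc zero)))) ≤ N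
      growth (a ∷ b ∷ c ∷ []) h = ≤-trans (≤-reflexive (cong (λ n → length a + (length b + n)) (sym (+-identityʳ (length c))))) h

  loop-spec : ∀ {n} s c {a b d} {e : Vec Str n} → a ∷ b ∷ d ∷ [] ≡ code-snapshot c →
    lookup (loop f₁ f₂ f₃ s (a ∷ b ∷ d ∷ e)) zero ≡ lookup (code-snapshot (nexts (length s) c)) zero
  loop-spec []      c eq = cong (λ v → lookup v zero) eq
  loop-spec (_ ∷ s) c {a} {b} {d} eq = loop-spec s (next c) (trans (eta (nextT a b d)) (trans
    (cong (λ v → nextT (lookup v zero) (lookup v (suc zero)) (lookup v (suc (suc zero)))) eq) (nextT-spec c)))
    where
    eta : ∀ (v : Vec Str 3) → lookup v zero ∷ lookup v (suc zero) ∷ lookup v (suc (suc zero)) ∷ [] ≡ v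
    eta (_ ∷ _ ∷ _ ∷ []) = refl

  opaque
    unfolding simulate

    simulate-spec : ∀ x ys → simulate x ys ≡ result (run M (⟦ q ⟧ (length x)) x ys)
    simulate-spec x ys = begin
      simulate x ys
        ≡⟨ cong verdictT (loop-spec (clock x) (running start (initTape x) ys) (started x)) ⟩
      verdictT (lookup (code-snapshot (nexts (length (clock x)) (running start (initTape x) ys))) zero)
        ≡⟨ verdictT-spec (nexts (length (clock x)) (running start (initTape x) ys)) ⟩
      verdict (nexts (length (clock x)) (running start (initTape x) ys))
        ≡⟨ cong (λ n → verdict (nexts n (running start (initTape x) ys))) ticks ⟩
      verdict (nexts (suc (⟦ q ⟧ (length x))) (running start (initTape x) ys))
        ≡⟨ nexts-run (⟦ q ⟧ (length x)) start (initTape x) ys ⟩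
      result (run M (⟦ q ⟧ (length x)) x ys) ∎
      where
      open ≡-Reasoning
      ticks : length (clock x) ≡ suc (⟦ q ⟧ (length x))
      ticks = trans (length-unary (fromPoly q :+ con 1) x) (trans (+-comm _ 1) (cong suc (fromPoly-eval q (length x))))
      started : ∀ x → (codeF (mode start) ++ inputT x) ∷ [] ∷ ys ∷ [] ≡ code-snapshot (running start (initTape x) ys)
      started x with initTape {k} x | inputT-spec x
      ... | tape l h r | eq = cong₂ (λ a b → a ∷ b ∷ ys ∷ []) (sym (cong (λ v → lookup v zero) eq)) (sym (cong (λ v → lookup v (suc zero)) eq))

-- Complexity classes in terms of polynomial-time functions

module _ (M : NTM) (q : Poly) where
  open Simulation M q using (simulate; PF-simulate; simulate-spec; result)

  accepts : Str → Str → Bool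
  accepts x ys = headB (simulate x ys)

  outputOf : Str → Str → Str
  outputOf x ys = tailS (simulate x ys)

  PB-accepts : PB₂ accepts
  PB-accepts = pf₂ (ap₁ PB-headB (un₂ PF-simulate))

  PF-outputOf : PF₂ outputOf
  PF-outputOf = pf₂ (ap₁ PF-tailS (un₂ PF-simulate))

  simulate-halted : ∀ {x ys b τ} → run M (⟦ q ⟧ (length x)) x ys ≡ halted b τ → simulate x ys ≡ b ∷ output τ
  simulate-halted {x} {ys} eq = trans (simulate-spec x ys) (cong result eq)

  accepts-sound : ∀ x ys → accepts x ys ≡ true → AccPath M q x ys
  accepts-sound x ys h with run M (⟦ q ⟧ (length x)) x ys | simulate-spec x ys
  ... | halted true τ  | eq = τ , refl
  ... | halted false τ | eq = contradiction (trans (sym (cong headB eq)) h) λ ()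
  ... | timeout        | eq = contradiction (trans (sym (cong headB eq)) h) λ ()
  ... | badPath        | eq = contradiction (trans (sym (cong headB eq)) h) λ ()

  accepts-complete : ∀ x ys → AccPath M q x ys → accepts x ys ≡ true
  accepts-complete x ys (τ , eq) = cong headB (simulate-halted eq)

  accepts≡accB : ∀ x ys → accepts x ys ≡ accB M q x ys
  accepts≡accB x ys with run M (⟦ q ⟧ (length x)) x ys | simulate-spec x ys
  ... | halted true τ  | eq = cong headB eq
  ... | halted false τ | eq = cong headB eq
  ... | timeout        | eq = cong headB eq
  ... | badPath        | eq = cong headB eq

FPt⇒PF : ∀ {g} → FPt g → PF₁ g
FPt⇒PF (M , q , _ , h) = pf₁ (PF-ext (λ v → let x = lookup v zero ; b , τ , eq , out≡ = h x in trans (cong tailS (simulate-halted M q eq)) out≡)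
  (ap₂ (PF-outputOf M q) (PF-var zero) PF-[]))

InP⇒PB : ∀ {A} → InP A → PB₁ A
InP⇒PB (M , q , _ , h) = pf₁ (PF-ext (λ v → let x = lookup v zero ; τ , eq = h x in cong flag (cong headB (simulate-halted M q eq)))
  (ap₂ (PB-accepts M q) (PF-var zero) PF-[]))

module _ {F : Str → Str} (pf : PF₁ F) where
  private
    opaque
      machine : GuessMachine (λ _ → 0) (λ v → F (lookup v zero))
      machine = guessMachine PF-[] (ap₁ pf (PF-var zero))

    open GuessMachine machine

  deterministic : ∃[ M ] ∃[ q ] DetPoly M q ×
    (∀ x → ∃[ τ ] run M (⟦ q ⟧ (length x)) x [] ≡ halted (headB (F x)) τ × output τ ≡ tailS (F x)) ×
    (∀ x ys → length ys ≢ 0 → run M (⟦ q ⟧ (length x)) x ys ≡ badPath)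
  deterministic = ntm , time , (λ x → let τ , eq , _ = full x [] refl in _ , τ , eq) , (λ x → full x [] refl) , part

PF⇒FPt : ∀ {g} → PF₁ g → FPt g
PF⇒FPt {g} pg = let M , q , det , h , _ = deterministic {F = λ x → true ∷ g x} (pf₁ (PF-∷ true (un₁ pg))) in
  M , q , det , λ x → let τ , eq , out≡ = h x in _ , τ , eq , out≡

PB⇒InP : ∀ {A} → PB₁ A → InP A
PB⇒InP pA = let M , q , det , h , _ = deterministic pA in M , q , det , λ x → let τ , eq , _ = h x in τ , eq

FPt⇒UPSVt : ∀ {g} → FPt g → UPSVt g
FPt⇒UPSVt {g} fg with deterministic {F = λ x → true ∷ g x} (pf₁ (PF-∷ true (un₁ (FPt⇒PF fg))))
... | M , q , det , h , bad = M , q , total , (λ x ys zs a b → trans (empty x ys a) (sym (empty x zs b))) ,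
    (λ x → mk⇔ (λ _ → [] , proj₁ (h x) , proj₁ (proj₂ (h x))) (λ _ → g x , refl)) , correct
  where
  empty : ∀ x ys → AccPath M q x ys → ys ≡ []
  empty x []       _        = refl
  empty x (y ∷ ys) (τ , eq) = contradiction (trans (sym eq) (bad x (y ∷ ys) λ ())) λ ()
  total : NPoly M q
  total x []       eq = contradiction (trans (sym eq) (proj₁ (proj₂ (h x)))) λ ()
  total x (y ∷ ys) eq = contradiction (trans (sym eq) (bad x (y ∷ ys) λ ())) λ ()
  correct : ∀ x ys τ → run M (⟦ q ⟧ (length x)) x ys ≡ halted true τ → just (g x) ≡ just (output τ)
  correct x (y ∷ ys) τ eq = contradiction (trans (sym eq) (bad x (y ∷ ys) λ ())) λ ()
  correct x [] τ eq with h x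
  ... | τ' , eq' , out≡ with trans (sym eq) eq'
  ... | refl = cong just (sym out≡)

-- Every guess costs a unit of fuel. Hence all halting paths fit into a common length determined by
-- the running time, which makes the padding below possible.
runFrom-length : ∀ (M : NTM) n ys q τ {b τ'} → runFrom M n ys q τ ≡ halted b τ' → length ys ≤ n
runFrom-length M n ys q τ h with NTM.δ M q (hd τ)
runFrom-length M n       []       q τ h | _ = z≤n
runFrom-length M n       (_ ∷ ys) q τ () | halt b
runFrom-length M zero    (_ ∷ ys) q τ () | step q' s m
runFrom-length M (suc n) (y ∷ ys) q τ h | step q' s m = ≤-trans (runFrom-length M n (y ∷ ys) q' _ h) (n≤1+n n)
runFrom-length M zero    (_ ∷ ys) q τ () | branch _ _
runFrom-length M (suc n) (false ∷ ys) q τ h | branch (q' , s , m) _ = s≤s (runFrom-length M n ys q' _ h)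
runFrom-length M (suc n) (true ∷ ys)  q τ h | branch _ (q' , s , m) = s≤s (runFrom-length M n ys q' _ h)

-- Paths of varying length are coded as ys 1 0…0 of a fixed length.
dropFalse : Str → Str
dropFalse []          = []
dropFalse (false ∷ s) = dropFalse s
dropFalse (true ∷ s)  = true ∷ s

falses : ℕ → Str
falses n = List.replicate n false

dropFalse-falses : ∀ n s → dropFalse (falses n ++ true ∷ s) ≡ true ∷ s
dropFalse-falses zero    s = refl
dropFalse-falses (suc n) s = dropFalse-falses n s

dropFalse-split : ∀ s {t b} → dropFalse s ≡ b ∷ t → ∃[ n ] s ≡ falses n ++ true ∷ t
dropFalse-split (false ∷ s) eq with dropFalse-split s eq
... | n , refl = suc n , refl
dropFalse-split (true ∷ s)  refl = 0 , refl

reverse-falses : ∀ n → reverse (falses n) ≡ falses n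
reverse-falses n = trans (grow n []) (List.++-identityʳ _)
  where
  shift : ∀ n s → falses n ++ false ∷ s ≡ false ∷ falses n ++ s
  shift zero    s = refl
  shift (suc n) s = cong (false ∷_) (shift n s)
  grow : ∀ n s → falses n ʳ++ s ≡ falses n ++ s
  grow zero    s = refl
  grow (suc n) s = trans (grow n (false ∷ s)) (shift n s)

core : Str → Str
core w = dropFalse (reverse w)

unpad : Str → Str
unpad w = reverse (tailS (core w))

padded : ℕ → Str → Str
padded n ys = ys ++ true ∷ falses n

core-padded : ∀ n ys → core (padded n ys) ≡ true ∷ reverse ys
core-padded n ys = trans (cong dropFalse flipped) (dropFalse-falses n (reverse ys))
  where
  open ≡-Reasoning
  flipped : reverse (padded n ys) ≡ falses n ++ true ∷ reverse ys
  flipped = begin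
    reverse (ys ++ true ∷ falses n)                   ≡⟨ List.reverse-++ ys (true ∷ falses n) ⟩
    reverse (true ∷ falses n) ++ reverse ys           ≡⟨ cong (_++ reverse ys) (List.unfold-reverse true (falses n)) ⟩
    (reverse (falses n) ++ true ∷ []) ++ reverse ys   ≡⟨ List.++-assoc (reverse (falses n)) (true ∷ []) (reverse ys) ⟩
    reverse (falses n) ++ true ∷ reverse ys           ≡⟨ cong (_++ true ∷ reverse ys) (reverse-falses n) ⟩
    falses n ++ true ∷ reverse ys                     ∎

unpad-padded : ∀ n ys → unpad (padded n ys) ≡ ys
unpad-padded n ys = trans (cong (λ s → reverse (tailS s)) (core-padded n ys)) (List.reverse-involutive ys)

padded-unpad : ∀ w → isNil (core w) ≡ false → ∃[ n ] w ≡ padded n (unpad w)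
padded-unpad w h with core w in eq
... | b ∷ t with dropFalse-split (reverse w) eq
... | n , split = n , (begin
    w                                                ≡⟨ List.reverse-involutive w ⟨
    reverse (reverse w)                              ≡⟨ cong reverse split ⟩
    reverse (falses n ++ true ∷ t)                   ≡⟨ List.reverse-++ (falses n) (true ∷ t) ⟩
    reverse (true ∷ t) ++ reverse (falses n)         ≡⟨ cong₂ _++_ (List.unfold-reverse true t) (reverse-falses n) ⟩
    (reverse t ++ true ∷ []) ++ falses n             ≡⟨ List.++-assoc (reverse t) (true ∷ []) (falses n) ⟩
    padded n (reverse t)                             ∎)
  where open ≡-Reasoning

-- The total length fixes the amount of padding, so that a unique path has a unique code of the
-- prescribed length.
padded-injective : ∀ {m n} ys → length (padded m ys) ≡ length (padded n ys) → padded m ys ≡ padded n ys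
padded-injective {m} {n} ys eq = cong (λ k → padded k ys) (+-cancelˡ-≡ (length ys) m n (suc-injective (begin
  suc (length ys + m)    ≡⟨ len m ⟨
  length (padded m ys)   ≡⟨ eq ⟩
  length (padded n ys)   ≡⟨ len n ⟩
  suc (length ys + n)    ∎)))
  where
  open ≡-Reasoning
  len : ∀ n → length (padded n ys) ≡ suc (length ys + n)
  len n = trans (List.length-++ ys) (trans (+-suc (length ys) _) (cong (λ k → suc (length ys + k)) (List.length-replicate n)))

PF-core : PF₁ core
PF-core = pf₁ (PF-ext (λ v → lem (reverse (lookup v zero)) (reverse (lookup v zero)) ≤-refl)
  (ap₂ (PF-fold (λ _ → skip1) 0 (λ _ → pf₁ PF-skip1) (λ b x → ≤-trans (shorter x) (≤-reflexive (sym (+-identityʳ _)))))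
    (ap₁ PF-reverse (PF-var zero)) (ap₁ PF-reverse (PF-var zero))))
  where
  skip1 : Str → Str
  skip1 (false ∷ s) = s
  skip1 s           = s
  shorter : ∀ x → length (skip1 x) ≤ length x
  shorter []          = ≤-refl
  shorter (false ∷ x) = n≤1+n _
  shorter (true ∷ x)  = ≤-refl
  PF-skip1 : PF {1} (λ v → skip1 (lookup v zero))
  PF-skip1 = PF-ext (λ v → lem₁ (lookup v zero)) (PF-case {H = λ b w → if b then true ∷ lookup w zero else lookup w zero} (PF-var zero) PF-[]
    (λ { false → PF-var zero ; true → PF-∷ true (PF-var zero) }))
    where
    lem₁ : ∀ s → caseS s [] (λ b t → if b then true ∷ t else t) ≡ skip1 s
    lem₁ []          = refl
    lem₁ (false ∷ s) = refl
    lem₁ (true ∷ s)  = refl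
  stays : ∀ c s → fold (λ _ → skip1) c (true ∷ s) ≡ true ∷ s
  stays []      s = refl
  stays (_ ∷ c) s = stays c s
  ends : ∀ c → fold (λ _ → skip1) c [] ≡ []
  ends []      = refl
  ends (_ ∷ c) = ends c
  lem : ∀ c s → length s ≤ length c → fold (λ _ → skip1) c s ≡ dropFalse s
  lem c       []          h       = ends c
  lem (_ ∷ c) (false ∷ s) (s≤s h) = lem c s h
  lem c       (true ∷ s)  h       = stays c s

PF-unpad : PF₁ unpad
PF-unpad = pf₁ (ap₁ PF-reverse (ap₁ PF-tailS (un₁ PF-core)))

true≢false : true ≢ false
true≢false ()

∧-true : ∀ {a b} → a ∧ b ≡ true → a ≡ true × b ≡ true
∧-true {true} {true} _ = refl , refl

∧-intro : ∀ {a b} → a ≡ true → b ≡ true → a ∧ b ≡ true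
∧-intro refl refl = refl

not-true : ∀ {a} → not a ≡ true → a ≡ false
not-true {false} _ = refl

not-false : ∀ {a} → a ≡ false → not a ≡ true
not-false refl = refl

-- UP in the form of certificates: strings of one prescribed length, checked in polynomial time, at
-- most one for each input.
record Unambiguous : Set where
  field
    len    : PolyExp
    valid  : Str → Str → Bool
    PB-valid : PB₂ valid

  Witness : Str → Str → Set
  Witness x w = length w ≡ ⟪ len ⟫ (length x) × valid x w ≡ true

  field
    unique : ∀ x w w' → Witness x w → Witness x w' → w ≡ w'

open Unambiguous

module _ (M : NTM) (q : Poly) (uniq : ∀ x ys zs → AccPath M q x ys → AccPath M q x zs → ys ≡ zs) where

  paths : Unambiguous
  paths = record
    -- One more than the running time, for the bit `true` that separates the path from its padding.
    { len = fromPoly q :+ con 1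
    ; valid = λ x w → not (isNil (core w)) ∧ accepts M q x (unpad w)
    ; PB-valid = pf₂ (PB-∧ (PB-not (ap₁ PB-isNil (ap₁ PF-core (PF-var (suc zero))))) (ap₂ (PB-accepts M q) (PF-var zero) (ap₁ PF-unpad (PF-var (suc zero)))))
    ; unique = λ x w w' (l , v) (l' , v') →
        let c , a = ∧-true v ; c' , a' = ∧-true v'
            n , eq = padded-unpad w (not-true c) ; n' , eq' = padded-unpad w' (not-true c')
            same = uniq x (unpad w) (unpad w') (accepts-sound M q x _ a) (accepts-sound M q x _ a')
            eq'' = trans eq' (cong (padded n') (sym same))
        in trans eq (trans (padded-injective (unpad w) (trans (cong length (sym eq)) (trans l (trans (sym l') (cong length eq''))))) (sym eq''))
    }

  path⇒witness : ∀ x ys → AccPath M q x ys → ∃[ w ] Witness paths x w × unpad w ≡ ys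
  path⇒witness x ys acc@(τ , eq) = padded n ys , (length≡ , ∧-intro (not-false nonempty)
      (trans (cong (accepts M q x) (unpad-padded n ys)) (accepts-complete M q x ys acc))) , unpad-padded n ys
    where
    n = ⟦ q ⟧ (length x) ∸ length ys
    nonempty : isNil (core (padded n ys)) ≡ false
    nonempty = cong isNil (core-padded n ys)
    length≡ : length (padded n ys) ≡ ⟪ fromPoly q :+ con 1 ⟫ (length x)
    length≡ = begin
      length (padded n ys)                    ≡⟨ List.length-++ ys ⟩
      length ys + suc (length (falses n))     ≡⟨ +-suc (length ys) _ ⟩
      suc (length ys + length (falses n))     ≡⟨ cong (λ k → suc (length ys + k)) (List.length-replicate n) ⟩
      suc (length ys + n)                     ≡⟨ cong suc (m+[n∸m]≡n (runFrom-length M _ ys _ _ eq)) ⟩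
      suc (⟦ q ⟧ (length x))                  ≡⟨ cong suc (fromPoly-eval q (length x)) ⟨
      suc (⟪ fromPoly q ⟫ (length x))         ≡⟨ +-comm 1 _ ⟩
      ⟪ fromPoly q :+ con 1 ⟫ (length x)      ∎ where open ≡-Reasoning

  witness⇒path : ∀ x w → Witness paths x w → AccPath M q x (unpad w)
  witness⇒path x w (_ , v) = accepts-sound M q x (unpad w) (proj₂ (∧-true v))

UP⇒Unambiguous : ∀ {A} → UP A → Σ Unambiguous λ u → ∀ x → (A x ≡ true) ⇔ (∃[ w ] Witness u x w)
UP⇒Unambiguous (M , q , _ , uniq , iff) = paths M q uniq , λ x → mk⇔
  (λ a → let ys , acc = Equivalence.to (iff x) a ; w , wit , _ = path⇒witness M q uniq x ys acc in w , wit)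
  (λ (w , wit) → Equivalence.from (iff x) (unpad w , witness⇒path M q uniq x w wit))

module _ (p : PolyExp) (v : Str → Str → Bool) (pv : PB₂ v) where
  private
    opaque
      machine : GuessMachine (λ x → length (unary p x)) (λ v' → flag (v (lookup v' zero) (lookup v' (suc zero))))
      machine = guessMachine (ap₁ (PF-unary p) (PF-var zero)) (un₂ pv)

    open GuessMachine machine

    length≡ : ∀ x (ys : Str) → length ys ≡ ⟪ p ⟫ (length x) → length ys ≡ length (unary p x)
    length≡ x ys h = trans h (sym (length-unary p x))

  verifier : NTM
  verifier = ntm

  verifierTime : Poly
  verifierTime = time

  verifier-full : ∀ x ys → length ys ≡ ⟪ p ⟫ (length x) → ∃[ τ ] run verifier (⟦ verifierTime ⟧ (length x)) x ys ≡ halted (v x ys) τ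
  verifier-full x ys h = let τ , eq , _ = full x ys (length≡ x ys h) in τ , eq

  verifier-part : ∀ x ys → length ys ≢ ⟪ p ⟫ (length x) → run verifier (⟦ verifierTime ⟧ (length x)) x ys ≡ badPath
  verifier-part x ys ne = part x ys (λ h → ne (trans h (length-unary p x)))

  verifier-accB : ∀ x ys → length ys ≡ ⟪ p ⟫ (length x) → accB verifier verifierTime x ys ≡ v x ys
  verifier-accB x ys h with verifier-full x ys h
  ... | τ , eq rewrite eq with v x ys
  ... | false = refl
  ... | true  = refl

  verifier-path : ∀ x ys → AccPath verifier verifierTime x ys → length ys ≡ ⟪ p ⟫ (length x) × v x ys ≡ true
  verifier-path x ys (τ , acc) with length ys ≟ ⟪ p ⟫ (length x)
  ... | no ne = contradiction (trans (sym acc) (verifier-part x ys ne)) λ ()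
  ... | yes h with verifier-full x ys h
  ... | τ' , eq with v x ys
  ... | true  = h , refl
  ... | false = contradiction (trans (sym acc) eq) λ ()

  verifier-NPoly : NPoly verifier verifierTime
  verifier-NPoly x ys eq with length ys ≟ ⟪ p ⟫ (length x)
  ... | no ne = contradiction (trans (sym eq) (verifier-part x ys ne)) λ ()
  ... | yes h = contradiction (trans (sym eq) (proj₂ (verifier-full x ys h))) λ ()

Unambiguous⇒UP : ∀ {A} (u : Unambiguous) → (∀ x → (A x ≡ true) ⇔ (∃[ w ] Witness u x w)) → UP A
Unambiguous⇒UP u iff = M , q , verifier-NPoly (len u) (valid u) (PB-valid u) ,
  (λ x ys zs a b → unique u x ys zs (path x ys a) (path x zs b)) ,
  λ x → mk⇔ (λ a → let w , l , t = Equivalence.to (iff x) a ; τ , eq = verifier-full (len u) (valid u) (PB-valid u) x w l in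
                w , τ , trans eq (cong (λ b → halted b τ) t))
             (λ (ys , acc) → Equivalence.from (iff x) (ys , path x ys acc))
  where
  M = verifier (len u) (valid u) (PB-valid u)
  q = verifierTime (len u) (valid u) (PB-valid u)
  path : ∀ x ys → AccPath M q x ys → Witness u x ys
  path = verifier-path (len u) (valid u) (PB-valid u)

UPSVt⇒Unambiguous : ∀ {g} → UPSVt g → Σ Unambiguous λ u → Σ (Str → Str → Str) λ o → PF₂ o ×
  (∀ x → ∃[ w ] Witness u x w) × (∀ x w → Witness u x w → g x ≡ o x w)
UPSVt⇒Unambiguous {g} (M , q , _ , uniq , iff , correct) = paths M q uniq , (λ x w → outputOf M q x (unpad w)) ,
  pf₂ (ap₂ (PF-outputOf M q) (PF-var zero) (ap₁ PF-unpad (PF-var (suc zero)))) ,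
  (λ x → let ys , acc = Equivalence.to (iff x) (g x , refl) ; w , wit , _ = path⇒witness M q uniq x ys acc in w , wit) ,
  λ x w wit → let τ , eq = witness⇒path M q uniq x w wit in
    trans (just-injective (correct x (unpad w) τ eq)) (sym (cong tailS (simulate-halted M q eq)))
  where
  just-injective : ∀ {a b : Str} → just a ≡ just b → a ≡ b
  just-injective refl = refl

-- Binary numbers

bitVal : Bool → ℕ → ℕ
bitVal false n = 0
bitVal true  n = n

toNat : Str → ℕ
toNat []      = 0
toNat (b ∷ s) = bitVal b (2 ^ length s) + toNat s

private
  doubled : ∀ n → 2 ^ suc n ≡ 2 ^ n + 2 ^ n
  doubled n = cong (2 ^ n +_) (+-identityʳ _)

toNat< : ∀ s → toNat s < 2 ^ length s
toNat< []          = s≤s z≤n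
toNat< (false ∷ s) = ≤-trans (toNat< s) (m≤m+n _ _)
toNat< (true ∷ s)  = ≤-trans (≤-reflexive (sym (+-suc _ _))) (≤-trans (+-monoʳ-≤ (2 ^ length s) (toNat< s)) (≤-reflexive (sym (doubled (length s)))))

toNat-injective : ∀ s t → length s ≡ length t → toNat s ≡ toNat t → s ≡ t
toNat-injective []          []          l h = refl
toNat-injective (false ∷ s) (false ∷ t) l h = cong (false ∷_) (toNat-injective s t (suc-injective l) h)
toNat-injective (true ∷ s)  (true ∷ t)  l h = cong (true ∷_) (toNat-injective s t (suc-injective l)
  (+-cancelˡ-≡ (2 ^ length s) _ _ (trans h (cong (λ n → 2 ^ n + toNat t) (sym (suc-injective l))))))
toNat-injective (false ∷ s) (true ∷ t)  l h = ⊥-elim (<⇒≢ (≤-trans (toNat< s) (≤-trans (≤-reflexive (cong (2 ^_) (suc-injective l))) (m≤m+n _ _))) h)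
toNat-injective (true ∷ s)  (false ∷ t) l h = ⊥-elim (<⇒≢ (≤-trans (toNat< t) (≤-trans (≤-reflexive (cong (2 ^_) (sym (suc-injective l)))) (m≤m+n _ _))) (sym h))

toNat-++ : ∀ s t → toNat (s ++ t) ≡ toNat s * 2 ^ length t + toNat t
toNat-++ []      t = refl
toNat-++ (b ∷ s) t = begin
  bitVal b (2 ^ length (s ++ t)) + toNat (s ++ t)
    ≡⟨ cong₂ _+_ (scaled b) (toNat-++ s t) ⟩
  bitVal b (2 ^ length s) * 2 ^ length t + (toNat s * 2 ^ length t + toNat t)
    ≡⟨ lemma (bitVal b (2 ^ length s)) (toNat s) (2 ^ length t) (toNat t) ⟩
  (bitVal b (2 ^ length s) + toNat s) * 2 ^ length t + toNat t ∎
  where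
  open ≡-Reasoning
  lemma : ∀ a b c d → a * c + (b * c + d) ≡ (a + b) * c + d
  lemma = solve-∀
  scaled : ∀ b → bitVal b (2 ^ length (s ++ t)) ≡ bitVal b (2 ^ length s) * 2 ^ length t
  scaled false = refl
  scaled true  = trans (cong (2 ^_) (List.length-++ s)) (^-distribˡ-+-* 2 (length s) (length t))

toNat-falses : ∀ n → toNat (falses n) ≡ 0
toNat-falses zero    = refl
toNat-falses (suc n) = toNat-falses n

trues : ℕ → Str
trues n = List.replicate n true

toNat-trues : ∀ n → suc (toNat (trues n)) ≡ 2 ^ n
toNat-trues zero    = refl
toNat-trues (suc n) = begin
  suc (2 ^ length (trues n) + toNat (trues n))   ≡⟨ +-suc _ _ ⟨
  2 ^ length (trues n) + suc (toNat (trues n))   ≡⟨ cong₂ _+_ (cong (2 ^_) (List.length-replicate n)) (toNat-trues n) ⟩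
  2 ^ n + 2 ^ n                                  ≡⟨ doubled n ⟨
  2 ^ suc n                                      ∎
  where open ≡-Reasoning

decodeℕ≡toNat : ∀ s → decodeℕ s ≡ toNat s
decodeℕ≡toNat s = go s 0
  where
  go : ∀ s a → foldl (λ acc b → (if b then 1 else 0) + 2 * acc) a s ≡ a * 2 ^ length s + toNat s
  go []          a = lemma a
    where
    lemma : ∀ a → a ≡ a * 1 + 0
    lemma = solve-∀
  go (false ∷ s) a = trans (go s (2 * a)) (lemma a (2 ^ length s) (toNat s))
    where
    lemma : ∀ a p t → 2 * a * p + t ≡ a * (p + (p + 0)) + t
    lemma = solve-∀
  go (true ∷ s)  a = trans (go s (1 + 2 * a)) (lemma a (2 ^ length s) (toNat s))
    where
    lemma : ∀ a p t → (1 + 2 * a) * p + t ≡ a * (p + (p + 0)) + (p + t)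
    lemma = solve-∀

zerosLike onesLike : Str → Str
zerosLike s = fold (λ _ t → false ∷ t) s []
onesLike  s = fold (λ _ t → true ∷ t) s []

private
  fold-const : ∀ b s n → fold (λ _ t → b ∷ t) s (List.replicate n b) ≡ List.replicate (length s + n) b
  fold-const b []      n = refl
  fold-const b (_ ∷ s) n = trans (fold-const b s (suc n)) (cong (λ k → List.replicate k b) (+-suc (length s) n))

zerosLike≡ : ∀ s → zerosLike s ≡ falses (length s)
zerosLike≡ s = trans (fold-const false s 0) (cong falses (+-identityʳ _))

onesLike≡ : ∀ s → onesLike s ≡ trues (length s)
onesLike≡ s = trans (fold-const true s 0) (cong trues (+-identityʳ _))

length-zerosLike : ∀ s → length (zerosLike s) ≡ length s
length-zerosLike s = trans (cong length (zerosLike≡ s)) (List.length-replicate (length s))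

length-onesLike : ∀ s → length (onesLike s) ≡ length s
length-onesLike s = trans (cong length (onesLike≡ s)) (List.length-replicate (length s))

PF-zerosLike : PF₁ zerosLike
PF-zerosLike = pf₁ (ap₂ (PF-fold (λ _ t → false ∷ t) 1 (λ b → pf₁ (PF-∷ false (PF-var zero))) (λ b x → ≤-reflexive (+-comm 1 (length x)))) (PF-var zero) PF-[])

PF-onesLike : PF₁ onesLike
PF-onesLike = pf₁ (ap₂ (PF-fold (λ _ t → true ∷ t) 1 (λ b → pf₁ (PF-∷ true (PF-var zero))) (λ b x → ≤-reflexive (+-comm 1 (length x)))) (PF-var zero) PF-[])

isZeros isOnes : Str → Bool
isZeros s = eqS s (zerosLike s)
isOnes  s = eqS s (onesLike s)

PB-isZeros : PB₁ isZeros
PB-isZeros = pf₁ (ap₂ PB-eqS (PF-var zero) (un₁ PF-zerosLike))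

PB-isOnes : PB₁ isOnes
PB-isOnes = pf₁ (ap₂ PB-eqS (PF-var zero) (un₁ PF-onesLike))

eqS⇔ : ∀ {s t} → (eqS s t ≡ true) ⇔ (s ≡ t)
eqS⇔ {s} {t} = mk⇔ (eqS-sound s t) (λ { refl → eqS-refl s })

isZeros⇔ : ∀ s → (isZeros s ≡ true) ⇔ (toNat s ≡ 0)
isZeros⇔ s = mk⇔
  (λ h → trans (cong toNat (trans (eqS-sound s _ h) (zerosLike≡ s))) (toNat-falses (length s)))
  (λ h → Equivalence.from eqS⇔ (trans (toNat-injective s (falses (length s)) (sym (List.length-replicate (length s))) (trans h (sym (toNat-falses (length s))))) (sym (zerosLike≡ s))))

isOnes⇔ : ∀ s → (isOnes s ≡ true) ⇔ (suc (toNat s) ≡ 2 ^ length s)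
isOnes⇔ s = mk⇔
  (λ h → trans (cong (λ t → suc (toNat t)) (trans (eqS-sound s _ h) (onesLike≡ s))) (toNat-trues (length s)))
  (λ h → Equivalence.from eqS⇔ (trans (toNat-injective s (trues (length s)) (sym (List.length-replicate (length s)))
     (suc-injective (trans h (sym (toNat-trues (length s)))))) (sym (onesLike≡ s))))

xor : Bool → Bool → Bool
xor false c = c
xor true  c = not c

-- Binary increment; the leading bit of the result is the carry.
incStep : Bool → Str → Str
incStep b []      = []
incStep b (c ∷ s) = (b ∧ c) ∷ xor b c ∷ s

incr : Str → Str
incr = foldr incStep (true ∷ [])

PF-incStep : ∀ b → PF₁ (incStep b)
PF-incStep b = pf₁ (PF-ext (λ v → lem (lookup v zero)) (PF-case {H = λ c w → (b ∧ c) ∷ xor b c ∷ lookup w zero} (PF-var zero) PF-[] (λ c → PF-∷ _ (PF-∷ _ (PF-var zero)))))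
  where
  lem : ∀ s → caseS s [] (λ c t → (b ∧ c) ∷ xor b c ∷ t) ≡ incStep b s
  lem []      = refl
  lem (_ ∷ _) = refl

PF-incr : PF₁ incr
PF-incr = pf₁ (ap₂ (PF-foldr incStep 1 PF-incStep growth) (PF-var zero) (PF-const (true ∷ [])))
  where
  growth : ∀ b x → length (incStep b x) ≤ length x + 1
  growth b []      = z≤n
  growth b (_ ∷ x) = ≤-reflexive (+-comm 1 (suc (length x)))

incr-spec : ∀ s → ∃[ c ] ∃[ o ] incr s ≡ c ∷ o × length o ≡ length s × suc (toNat s) ≡ bitVal c (2 ^ length s) + toNat o
incr-spec []      = true , [] , refl , refl , refl
incr-spec (b ∷ s) with incr s | incr-spec s
... | _ | c , o , refl , l , h = b ∧ c , xor b c ∷ o , refl , cong suc l , carry b c h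
  where
  carry : ∀ b c → suc (toNat s) ≡ bitVal c (2 ^ length s) + toNat o →
    suc (bitVal b (2 ^ length s) + toNat s) ≡ bitVal (b ∧ c) (2 ^ suc (length s)) + (bitVal (xor b c) (2 ^ length o) + toNat o)
  carry false false h = h
  carry false true  h = trans h (cong (λ n → 2 ^ n + toNat o) (sym l))
  carry true  false h = trans (sym (+-suc (2 ^ length s) (toNat s))) (cong₂ _+_ (cong (2 ^_) (sym l)) h)
  carry true  true  h = trans (sym (+-suc (2 ^ length s) (toNat s))) (trans (cong (2 ^ length s +_) h)
    (trans (sym (+-assoc (2 ^ length s) _ _)) (cong (_+ toNat o) (sym (doubled (length s))))))

-- The leading `false` is the carry: it excludes the overflow from all ones to all zeros.
succS : Str → Str → Bool
succS s t = eqS (incr s) (false ∷ t)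

PB-succS : PB₂ succS
PB-succS = pf₂ (ap₂ PB-eqS (ap₁ PF-incr (PF-var zero)) (PF-∷ false (PF-var (suc zero))))

succS⇔ : ∀ s t → length s ≡ length t → (succS s t ≡ true) ⇔ (suc (toNat s) ≡ toNat t)
succS⇔ s t l with incr-spec s
... | c , o , eq , lo , h = mk⇔ to from
  where
  to : succS s t ≡ true → suc (toNat s) ≡ toNat t
  to e with trans (sym eq) (eqS-sound (incr s) (false ∷ t) e)
  ... | refl = h
  no-carry : ∀ c → suc (toNat s) ≡ toNat t → suc (toNat s) ≡ bitVal c (2 ^ length s) + toNat o → c ∷ o ≡ false ∷ t
  no-carry false e h = cong (false ∷_) (toNat-injective o t (trans lo l) (trans (sym h) e))
  no-carry true  e h = ⊥-elim (<⇒≱ (toNat< t) (≤-trans (≤-reflexive (cong (2 ^_) (sym l))) (≤-trans (m≤m+n _ (toNat o)) (≤-reflexive (trans (sym h) e)))))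
  from : suc (toNat s) ≡ toNat t → succS s t ≡ true
  from e = Equivalence.from eqS⇔ (trans eq (no-carry c e h))

ltS : Str → Str → Bool
ltS []          t           = false
ltS (_ ∷ _)     []          = false
ltS (false ∷ s) (false ∷ t) = ltS s t
ltS (true ∷ s)  (true ∷ t)  = ltS s t
ltS (false ∷ s) (true ∷ t)  = true
ltS (true ∷ s)  (false ∷ t) = false

ltS⇔ : ∀ s t → length s ≡ length t → (ltS s t ≡ true) ⇔ (toNat s < toNat t)
ltS⇔ s t l = mk⇔ (to s t l) (from s t l)
  where
  to : ∀ s t → length s ≡ length t → ltS s t ≡ true → toNat s < toNat t
  to (false ∷ s) (false ∷ t) l h = to s t (suc-injective l) h
  to (true ∷ s)  (true ∷ t)  l h rewrite suc-injective l =
    ≤-trans (≤-reflexive (sym (+-suc _ _))) (+-monoʳ-≤ (2 ^ length t) (to s t (suc-injective l) h))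
  to (false ∷ s) (true ∷ t)  l h = ≤-trans (toNat< s) (≤-trans (≤-reflexive (cong (2 ^_) (suc-injective l))) (m≤m+n _ _))
  from : ∀ s t → length s ≡ length t → toNat s < toNat t → ltS s t ≡ true
  from (false ∷ s) (false ∷ t) l h = from s t (suc-injective l) h
  from (true ∷ s)  (true ∷ t)  l h rewrite suc-injective l =
    from s t (suc-injective l) (+-cancelˡ-≤ (2 ^ length t) _ _ (≤-trans (≤-reflexive (+-suc _ _)) h))
  from (false ∷ s) (true ∷ t)  l h = refl
  from (true ∷ s)  (false ∷ t) l h = ⊥-elim (<⇒≱ (toNat< t) (≤-trans (≤-reflexive (cong (2 ^_) (sym (suc-injective l)))) (≤-trans (m≤m+n _ _) (<⇒≤ h))))

-- Scanning s against the string after a leading true; a leading false means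
-- that s has been found smaller, the empty string that it has not.
cmpStep : Bool → Str → Str
cmpStep false (true ∷ false ∷ t) = true ∷ t
cmpStep true  (true ∷ true ∷ t)  = true ∷ t
cmpStep false (true ∷ true ∷ t)  = false ∷ []
cmpStep true  (true ∷ false ∷ t) = []
cmpStep b     (false ∷ t)        = false ∷ t
cmpStep b     (true ∷ [])        = []
cmpStep b     []                 = []

PF-cmpStep : ∀ b → PF₁ (cmpStep b)
PF-cmpStep b = pf₁ (PF-ext (λ v → lem b (lookup v zero))
  (PF-case {H = λ c w → if c then caseS (lookup w zero) [] (λ d t → match b d t) else false ∷ lookup w zero} (PF-var zero) PF-[]
    (λ { false → PF-∷ false (PF-var zero) ; true → PF-case {H = λ d w → match b d (lookup w zero)} (PF-var zero) PF-[] (λ d → pm b d) })))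
  where
  match : Bool → Bool → Str → Str
  match false false t = true ∷ t
  match true  true  t = true ∷ t
  match false true  t = false ∷ []
  match true  false t = []
  pm : ∀ b d → PF {3} (λ w → match b d (lookup w zero))
  pm false false = PF-∷ true (PF-var zero)
  pm false true  = PF-const (false ∷ [])
  pm true  false = PF-[]
  pm true  true  = PF-∷ true (PF-var zero)
  lem : ∀ b s → caseS s [] (λ c t → if c then caseS t [] (λ d t → match b d t) else false ∷ t) ≡ cmpStep b s
  lem b     []                    = empty b
    where
    empty : ∀ b → [] ≡ cmpStep b []
    empty false = refl
    empty true  = refl
  lem false (false ∷ t)           = refl
  lem true  (false ∷ t)           = refl
  lem false (true ∷ [])           = refl
  lem true  (true ∷ [])           = refl
  lem false (true ∷ false ∷ t)    = refl
  lem false (true ∷ true ∷ t)     = refl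
  lem true  (true ∷ false ∷ t)    = refl
  lem true  (true ∷ true ∷ t)     = refl

PB-ltS : PB₂ ltS
PB-ltS = pf₂ (PF-ext (λ v → cong flag (lem (lookup v zero) (lookup v (suc zero))))
  (PB-∧ (PB-not (ap₁ PB-isNil scanned)) (PB-not (ap₁ PB-headB scanned))))
  where
  shorter : ∀ b x → length (cmpStep b x) ≤ length x
  shorter false []                    = z≤n
  shorter true  []                    = z≤n
  shorter false (false ∷ t)           = ≤-refl
  shorter true  (false ∷ t)           = ≤-refl
  shorter false (true ∷ [])           = z≤n
  shorter true  (true ∷ [])           = z≤n
  shorter false (true ∷ false ∷ t)    = n≤1+n _
  shorter false (true ∷ true ∷ t)     = s≤s z≤n
  shorter true  (true ∷ false ∷ t)    = z≤n
  shorter true  (true ∷ true ∷ t)     = n≤1+n _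
  scanned = ap₂ (PF-fold cmpStep 0 PF-cmpStep (λ b x → ≤-trans (shorter b x) (≤-reflexive (sym (+-identityʳ _))))) (PF-var zero) (PF-∷ true (PF-var (suc zero)))
  smaller : Str → Bool
  smaller s = not (isNil s) ∧ not (headB s)
  notLess : ∀ s → fold cmpStep s [] ≡ []
  notLess []          = refl
  notLess (false ∷ s) = notLess s
  notLess (true ∷ s)  = notLess s
  isLess : ∀ s t → fold cmpStep s (false ∷ t) ≡ false ∷ t
  isLess []          t = refl
  isLess (false ∷ s) t = isLess s t
  isLess (true ∷ s)  t = isLess s t
  lem : ∀ s t → smaller (fold cmpStep s (true ∷ t)) ≡ ltS s t
  lem []          t           = refl
  lem (false ∷ s) []          = cong smaller (notLess s)
  lem (true ∷ s)  []          = cong smaller (notLess s)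
  lem (false ∷ s) (false ∷ t) = lem s t
  lem (true ∷ s)  (true ∷ t)  = lem s t
  lem (false ∷ s) (true ∷ t)  = cong smaller (isLess s [])
  lem (true ∷ s)  (false ∷ t) = cong smaller (notLess s)

-- `ltS` compares numbers only at equal lengths; leading zeros make up the difference.
widen : Str → Str → Str
widen y g = dropL g (zerosLike y) ++ g

PF-widen : PF₂ widen
PF-widen = pf₂ (ap₂ PF-++ (ap₂ PF-dropL (PF-var (suc zero)) (ap₁ PF-zerosLike (PF-var zero))) (PF-var (suc zero)))

module _ (y g : Str) (short : length g ≤ length y) where
  length-widen : length (widen y g) ≡ length y
  length-widen = begin
    length (widen y g)                             ≡⟨ List.length-++ (dropL g (zerosLike y)) ⟩
    length (dropL g (zerosLike y)) + length g      ≡⟨ cong (_+ length g) (length-dropL g (zerosLike y)) ⟩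
    (length (zerosLike y) ∸ length g) + length g   ≡⟨ cong (λ n → (n ∸ length g) + length g) (length-zerosLike y) ⟩
    (length y ∸ length g) + length g               ≡⟨ m∸n+n≡m short ⟩
    length y                                       ∎ where open ≡-Reasoning

  toNat-widen : toNat (widen y g) ≡ toNat g
  toNat-widen = trans (toNat-++ (dropL g (zerosLike y)) g) (cong (λ n → n * 2 ^ length g + toNat g)
    (trans (cong (λ z → toNat (dropL g z)) (zerosLike≡ y)) (dropped g (length y))))
    where
    dropped : ∀ g n → toNat (dropL g (falses n)) ≡ 0
    dropped []      n       = toNat-falses n
    dropped (_ ∷ g) zero    = dropped g zero
    dropped (_ ∷ g) (suc n) = dropped g n

-- Orders on strings

-- The bijection of the definition is represented by the position `rank`; on the 2^n strings of
-- length `n`, the bound and injectivity already make it bijective. What has to be decided in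
-- polynomial time are `first`, `last` and `prec`.
record IsOrder (n : ℕ) (rank : Str → ℕ) (first last : Str → Bool) (prec : Str → Str → Bool) : Set where
  field
    rank<    : ∀ y → length y ≡ n → rank y < 2 ^ n
    rank-inj : ∀ y z → length y ≡ n → length z ≡ n → rank y ≡ rank z → y ≡ z
    first⇔   : ∀ y → length y ≡ n → (first y ≡ true) ⇔ (rank y ≡ 0)
    last⇔    : ∀ y → length y ≡ n → (last y ≡ true) ⇔ (suc (rank y) ≡ 2 ^ n)
    prec⇔    : ∀ y z → length y ≡ n → length z ≡ n → (prec y z ≡ true) ⇔ (suc (rank y) ≡ rank z)

open Equivalence using (to; from)

∨-elim : ∀ {a b} → a ∨ b ≡ true → a ≡ true ⊎ b ≡ true
∨-elim {true}  h = inj₁ refl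
∨-elim {false} h = inj₂ h

∨-introˡ : ∀ {a b} → a ≡ true → a ∨ b ≡ true
∨-introˡ refl = refl

∨-introʳ : ∀ {a b} → b ≡ true → a ∨ b ≡ true
∨-introʳ {true}  refl = refl
∨-introʳ {false} refl = refl

lex-isOrder : ∀ n → IsOrder n toNat isZeros isOnes succS
lex-isOrder n = record
  { rank<    = λ { y refl → toNat< y }
  ; rank-inj = λ y z l l' → toNat-injective y z (trans l (sym l'))
  ; first⇔   = λ y _ → isZeros⇔ y
  ; last⇔    = λ { y refl → isOnes⇔ y }
  ; prec⇔    = λ y z l l' → succS⇔ y z (trans l (sym l')) }

cyclic : (first last : Str → Bool) (prec : Str → Str → Bool) → Str → Str → Bool
cyclic first last prec y z = prec y z ∨ (last y ∧ first z)

module IsOrderProperties {n rank first last prec} (o : IsOrder n rank first last prec) where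
  open IsOrder o

  cyclic⇒ : ∀ y z → length y ≡ n → length z ≡ n → cyclic first last prec y z ≡ true →
    suc (rank y) ≡ rank z ⊎ (suc (rank y) ≡ 2 ^ n × rank z ≡ 0)
  cyclic⇒ y z ly lz h with ∨-elim h
  ... | inj₁ p = inj₁ (to (prec⇔ y z ly lz) p)
  ... | inj₂ p = let a , b = ∧-true p in inj₂ (to (last⇔ y ly) a , to (first⇔ z lz) b)

  cyclic⇐ : ∀ y z → length y ≡ n → length z ≡ n → suc (rank y) ≡ rank z ⊎ (suc (rank y) ≡ 2 ^ n × rank z ≡ 0) →
    cyclic first last prec y z ≡ true
  cyclic⇐ y z ly lz (inj₁ p)       = ∨-introˡ (from (prec⇔ y z ly lz) p)
  cyclic⇐ y z ly lz (inj₂ (a , b)) = ∨-introʳ (∧-intro (from (last⇔ y ly) a) (from (first⇔ z lz) b))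

-- Products and rotations of orders

module _ {N : ℕ} where
  digits-inj : ∀ a a' {b b'} → b < N → b' < N → a * N + b ≡ a' * N + b' → a ≡ a' × b ≡ b'
  digits-inj zero    zero     hb hb' eq = refl , eq
  digits-inj (suc a) (suc a') {b} {b'} hb hb' eq with digits-inj a a' hb hb'
    (+-cancelˡ-≡ N _ _ (trans (sym (+-assoc N (a * N) b)) (trans eq (+-assoc N (a' * N) b'))))
  ... | refl , e = refl , e
  digits-inj zero    (suc a') {b} {b'} hb hb' eq =
    ⊥-elim (<⇒≱ hb (≤-trans (≤-trans (m≤m+n N (a' * N)) (m≤m+n _ b')) (≤-reflexive (sym eq))))
  digits-inj (suc a) zero     {b} {b'} hb hb' eq =
    ⊥-elim (<⇒≱ hb' (≤-trans (≤-trans (m≤m+n N (a * N)) (m≤m+n _ b)) (≤-reflexive eq)))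

  digits< : ∀ {a b A} → a < A → b < N → a * N + b < A * N
  digits< {a} {b} {A} ha hb = begin-strict
    a * N + b    <⟨ +-monoʳ-< (a * N) hb ⟩
    a * N + N    ≡⟨ +-comm (a * N) N ⟩
    suc a * N    ≤⟨ *-monoˡ-≤ N ha ⟩
    A * N        ∎ where open ≤-Reasoning

  -- Successor with carry. It reduces adjacency in a product order to adjacency in the factors and
  -- to the tests for their ends.
  digits-suc : ∀ {a a' b b'} → b < N → b' < N →
    (suc (a * N + b) ≡ a' * N + b') ⇔ ((a ≡ a' × suc b ≡ b') ⊎ (suc a ≡ a' × suc b ≡ N × b' ≡ 0))
  digits-suc {a} {a'} {b} {b'} hb hb' = mk⇔ fwd bwd
    where
    fwd : suc (a * N + b) ≡ a' * N + b' → (a ≡ a' × suc b ≡ b') ⊎ (suc a ≡ a' × suc b ≡ N × b' ≡ 0)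
    fwd eq with suc b ≟ N
    ... | no ne = inj₁ (digits-inj a a' (≤∧≢⇒< hb ne) hb' (trans (+-suc (a * N) b) eq))
    ... | yes e with digits-inj (suc a) a' {0} (≤-trans (s≤s z≤n) hb) hb' (trans (trans (+-identityʳ _) (trans (+-comm N (a * N)) (trans (cong (a * N +_) (sym e)) (+-suc (a * N) b)))) eq)
    ...   | p , q = inj₂ (p , e , sym q)
    bwd : (a ≡ a' × suc b ≡ b') ⊎ (suc a ≡ a' × suc b ≡ N × b' ≡ 0) → suc (a * N + b) ≡ a' * N + b'
    bwd (inj₁ (refl , refl)) = sym (+-suc (a * N) b)
    bwd (inj₂ (refl , e , refl)) = trans (sym (+-suc (a * N) b)) (trans (cong (a * N +_) e) (trans (+-comm (a * N) N) (sym (+-identityʳ _))))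

-- A dependent lexicographic product: the prefix `hi w`, itself ordered lexicographically, selects
-- the order in which the rest `lo w` is compared.
module Block (r : Str) (n : ℕ) {rank : Str → Str → ℕ} {first last : Str → Str → Bool} {prec : Str → Str → Str → Bool}
             (ord : ∀ a → length a ≡ length r → IsOrder n (rank a) (first a) (last a) (prec a)) where
  hi lo : Str → Str
  hi = takeL r
  lo = dropL r

  rankᵇ : Str → ℕ
  rankᵇ w = toNat (hi w) * 2 ^ n + rank (hi w) (lo w)

  firstᵇ lastᵇ : Str → Bool
  firstᵇ w = isZeros (hi w) ∧ first (hi w) (lo w)
  lastᵇ w  = isOnes (hi w) ∧ last (hi w) (lo w)

  precᵇ : Str → Str → Bool
  precᵇ w w' = (eqS (hi w) (hi w') ∧ prec (hi w) (lo w) (lo w')) ∨ (succS (hi w) (hi w') ∧ (last (hi w) (lo w) ∧ first (hi w') (lo w')))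

  private
    m = length r

    long : ∀ (w : Str) → length w ≡ m + n → m ≤ length w
    long w l = ≤-trans (m≤m+n m n) (≤-reflexive (sym l))

  hi-length : ∀ w → length w ≡ m + n → length (hi w) ≡ m
  hi-length w l = length-takeL r w (long w l)

  lo-length : ∀ w → length w ≡ m + n → length (lo w) ≡ n
  lo-length w l = trans (length-dropL r w) (trans (cong (_∸ m) l) (m+n∸m≡n m n))

  module _ (w : Str) (l : length w ≡ m + n) where
    open IsOrder (ord (hi w) (hi-length w l)) public

  rank-lo< : ∀ w l → rank (hi w) (lo w) < 2 ^ n
  rank-lo< w l = rank< w l (lo w) (lo-length w l)

  private
    cast : ∀ s {t} → length s ≡ t → (suc (toNat s) ≡ 2 ^ length s) ⇔ (suc (toNat s) ≡ 2 ^ t)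
    cast s refl = mk⇔ id id

    pow : 2 ^ (m + n) ≡ 2 ^ m * 2 ^ n
    pow = ^-distribˡ-+-* 2 m n

  block-isOrder : IsOrder (m + n) rankᵇ firstᵇ lastᵇ precᵇ
  block-isOrder = record { rank< = bounded ; rank-inj = injective ; first⇔ = is-first ; last⇔ = is-last ; prec⇔ = is-prec }
    where
    hi< : ∀ w → length w ≡ m + n → toNat (hi w) < 2 ^ m
    hi< w l = subst (λ k → toNat (hi w) < 2 ^ k) (hi-length w l) (toNat< (hi w))
    bounded : ∀ w → length w ≡ m + n → rankᵇ w < 2 ^ (m + n)
    bounded w l = ≤-trans (digits< (hi< w l) (rank-lo< w l)) (≤-reflexive (sym pow))
    rebuild : ∀ {w w'} → length w ≡ m + n → length w' ≡ m + n → hi w ≡ hi w' → lo w ≡ lo w' → w ≡ w'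
    rebuild {w} {w'} l l' p q = trans (sym (takeL-dropL r w (long w l))) (trans (cong₂ _++_ p q) (takeL-dropL r w' (long w' l')))
    injective : ∀ w w' → length w ≡ m + n → length w' ≡ m + n → rankᵇ w ≡ rankᵇ w' → w ≡ w'
    injective w w' l l' eq with digits-inj (toNat (hi w)) (toNat (hi w')) (rank-lo< w l) (rank-lo< w' l') eq
    ... | p , q with toNat-injective (hi w) (hi w') (trans (hi-length w l) (sym (hi-length w' l'))) p
    ... | e = rebuild l l' e (rank-inj w l (lo w) (lo w') (lo-length w l) (lo-length w' l') (trans q (cong (λ a → rank a (lo w')) (sym e))))
    is-first : ∀ w → length w ≡ m + n → (firstᵇ w ≡ true) ⇔ (rankᵇ w ≡ 0)
    is-first w l = mk⇔
      (λ h → let a , b = ∧-true h in cong₂ (λ x y → x * 2 ^ n + y) (to (isZeros⇔ (hi w)) a) (to (first⇔ w l (lo w) (lo-length w l)) b))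
      (λ h → let a , b = digits-inj (toNat (hi w)) 0 (rank-lo< w l) (≤-trans (s≤s z≤n) (rank-lo< w l)) h in
        ∧-intro (from (isZeros⇔ (hi w)) a) (from (first⇔ w l (lo w) (lo-length w l)) b))
    is-last : ∀ w → length w ≡ m + n → (lastᵇ w ≡ true) ⇔ (suc (rankᵇ w) ≡ 2 ^ (m + n))
    -- The last string is the one whose successor would have the digits 2^m and 0; this is the carry
    -- case of `digits-suc`.
    is-last w l = mk⇔
      (λ h → let a , b = ∧-true h in trans (from (digits-suc {a = toNat (hi w)} {suc (toNat (hi w))} {rank (hi w) (lo w)} {0} (rank-lo< w l) (≤-trans (s≤s z≤n) (rank-lo< w l))) (inj₂ (refl , to (last⇔ w l (lo w) (lo-length w l)) b , refl)))
               (trans (+-identityʳ _) (trans (cong (_* 2 ^ n) (to (cast (hi w) (hi-length w l)) (to (isOnes⇔ (hi w)) a))) (sym pow))))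
      (λ h → split (to (digits-suc {a = toNat (hi w)} {2 ^ m} {rank (hi w) (lo w)} {0} (rank-lo< w l) (≤-trans (s≤s z≤n) (rank-lo< w l))) (trans h (trans pow (sym (+-identityʳ _))))))
      where
      split : (toNat (hi w) ≡ 2 ^ m × suc (rank (hi w) (lo w)) ≡ 0) ⊎ (suc (toNat (hi w)) ≡ 2 ^ m × suc (rank (hi w) (lo w)) ≡ 2 ^ n × 0 ≡ 0) → lastᵇ w ≡ true
      split (inj₂ (p , q , _)) = ∧-intro (from (isOnes⇔ (hi w)) (from (cast (hi w) (hi-length w l)) p)) (from (last⇔ w l (lo w) (lo-length w l)) q)
    is-prec : ∀ w w' → length w ≡ m + n → length w' ≡ m + n → (precᵇ w w' ≡ true) ⇔ (suc (rankᵇ w) ≡ rankᵇ w')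
    is-prec w w' l l' = mk⇔ fwd bwd
      where
      same-length : length (hi w) ≡ length (hi w')
      same-length = trans (hi-length w l) (sym (hi-length w' l'))
      digits = digits-suc {a = toNat (hi w)} {toNat (hi w')} (rank-lo< w l) (rank-lo< w' l')
      fwd : precᵇ w w' ≡ true → suc (rankᵇ w) ≡ rankᵇ w'
      fwd h with ∨-elim h
      ... | inj₁ p = let a , b = ∧-true p ; e = to eqS⇔ a in from digits (inj₁ (cong toNat e ,
              trans (to (prec⇔ w l (lo w) (lo w') (lo-length w l) (lo-length w' l')) b) (cong (λ a → rank a (lo w')) e)))
      ... | inj₂ p = let a , bc = ∧-true p ; b , c = ∧-true bc in from digits (inj₂ (to (succS⇔ (hi w) (hi w') same-length) a ,
              to (last⇔ w l (lo w) (lo-length w l)) b , to (first⇔ w' l' (lo w') (lo-length w' l')) c))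
      bwd : suc (rankᵇ w) ≡ rankᵇ w' → precᵇ w w' ≡ true
      bwd h with to digits h
      ... | inj₁ (p , q) = let e = toNat-injective (hi w) (hi w') same-length p in ∨-introˡ (∧-intro (from eqS⇔ e)
              (from (prec⇔ w l (lo w) (lo w') (lo-length w l) (lo-length w' l')) (trans q (cong (λ a → rank a (lo w')) (sym e)))))
      ... | inj₂ (p , q , s) = ∨-introʳ (∧-intro (from (succS⇔ (hi w) (hi w') same-length) p)
              (∧-intro (from (last⇔ w l (lo w) (lo-length w l)) q) (from (first⇔ w' l' (lo w') (lo-length w' l')) s)))

-- The cycle of `N` ranks is cut right behind rank `c` - 1, which becomes the last one; rank `c`, or
-- 0 when `c` is `N`, becomes the first.
rotate : ℕ → ℕ → ℕ → ℕ
rotate N c r with r <? c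
... | yes _ = r + (N ∸ c)
... | no  _ = r ∸ c

module _ {N c : ℕ} (0<c : 0 < c) (c≤N : c ≤ N) where
  -- Adding `c` on the left removes the truncated subtractions, so that the facts about rotation
  -- follow by cancellation.
  rotate-view : ∀ r → (r < c × rotate N c r + c ≡ r + N) ⊎ (c ≤ r × rotate N c r + c ≡ r)
  rotate-view r with r <? c
  ... | yes h = inj₁ (h , trans (+-assoc r (N ∸ c) c) (cong (r +_) (m∸n+n≡m c≤N)))
  ... | no  h = inj₂ (≮⇒≥ h , m∸n+n≡m (≮⇒≥ h))

  rotate< : ∀ r → r < N → rotate N c r < N
  rotate< r h with rotate-view r
  ... | inj₁ (r<c , e) = +-cancelʳ-< c _ _ (≤-trans (≤-reflexive (cong suc (trans e (+-comm r N)))) (≤-trans (≤-reflexive (sym (+-suc N r))) (+-monoʳ-≤ N r<c)))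
  ... | inj₂ (c≤r , e) = ≤-<-trans (≤-trans (m≤m+n _ c) (≤-reflexive e)) h

  rotate-inj : ∀ r s → r < N → s < N → rotate N c r ≡ rotate N c s → r ≡ s
  rotate-inj r s hr hs eq with rotate-view r | rotate-view s
  ... | inj₁ (_ , e) | inj₁ (_ , e') = +-cancelʳ-≡ N r s (trans (sym e) (trans (cong (_+ c) eq) e'))
  ... | inj₂ (_ , e) | inj₂ (_ , e') = trans (sym e) (trans (cong (_+ c) eq) e')
  ... | inj₁ (_ , e) | inj₂ (_ , e') = ⊥-elim (<⇒≱ hs (≤-trans (m≤n+m N r) (≤-reflexive (trans (sym e) (trans (cong (_+ c) eq) e')))))
  ... | inj₂ (_ , e) | inj₁ (_ , e') = ⊥-elim (<⇒≱ hr (≤-trans (m≤n+m N s) (≤-reflexive (trans (sym e') (trans (cong (_+ c) (sym eq)) e)))))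

  -- Rotation only changes where the cycle is open: the link from the last rank to the first is
  -- closed and the one leaving rank `c` - 1 is removed.
  rotate-suc : ∀ r s → r < N → s < N →
    (suc (rotate N c r) ≡ rotate N c s) ⇔ ((suc r ≡ s ⊎ (suc r ≡ N × s ≡ 0)) × suc r ≢ c)
  rotate-suc r s hr hs = mk⇔ fwd bwd
    where
    shift : suc (rotate N c r) ≡ rotate N c s → suc (rotate N c r + c) ≡ rotate N c s + c
    shift = cong (_+ c)
    fwd : suc (rotate N c r) ≡ rotate N c s → (suc r ≡ s ⊎ (suc r ≡ N × s ≡ 0)) × suc r ≢ c
    fwd eq with rotate-view r | rotate-view s
    ... | inj₁ (r<c , e) | inj₁ (s<c , e') = let h = +-cancelʳ-≡ N (suc r) s (trans (cong suc (sym e)) (trans (shift eq) e')) in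
          inj₁ h , λ q → <⇒≢ s<c (trans (sym h) q)
    ... | inj₂ (c≤r , e) | inj₂ (c≤s , e') = inj₁ (trans (cong suc (sym e)) (trans (shift eq) e')) , λ q → <⇒≱ (≤-reflexive q) c≤r
    ... | inj₁ (r<c , e) | inj₂ (c≤s , e') = ⊥-elim (<⇒≱ hs (≤-trans (m≤n+m N (suc r)) (≤-reflexive (trans (cong suc (sym e)) (trans (shift eq) e')))))
    ... | inj₂ (c≤r , e) | inj₁ (s<c , e') = inj₂ (wrap s (trans (cong suc (sym e)) (trans (shift eq) e'))) , λ q → <⇒≱ (≤-reflexive q) c≤r
          where
          wrap : ∀ s → suc r ≡ s + N → suc r ≡ N × s ≡ 0
          wrap zero    q = q , refl
          wrap (suc s) q = ⊥-elim (<⇒≱ hr (≤-trans (m≤n+m N s) (≤-reflexive (sym (suc-injective q)))))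
    bwd : (suc r ≡ s ⊎ (suc r ≡ N × s ≡ 0)) × suc r ≢ c → suc (rotate N c r) ≡ rotate N c s
    bwd (p , ne) = +-cancelʳ-≡ c _ _ (go p (rotate-view r) (rotate-view s))
      where
      go : (suc r ≡ s ⊎ (suc r ≡ N × s ≡ 0)) → (r < c × rotate N c r + c ≡ r + N) ⊎ (c ≤ r × rotate N c r + c ≡ r) →
        (s < c × rotate N c s + c ≡ s + N) ⊎ (c ≤ s × rotate N c s + c ≡ s) → suc (rotate N c r) + c ≡ rotate N c s + c
      go (inj₁ refl) (inj₁ (_ , e)) (inj₁ (_ , e')) = trans (cong suc e) (sym e')
      go (inj₁ refl) (inj₂ (_ , e)) (inj₂ (_ , e')) = trans (cong suc e) (sym e')
      go (inj₁ refl) (inj₁ (r<c , _)) (inj₂ (c≤s , _)) = ⊥-elim (ne (≤-antisym r<c c≤s))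
      go (inj₁ refl) (inj₂ (c≤r , _)) (inj₁ (s<c , _)) = ⊥-elim (<⇒≱ s<c (≤-trans c≤r (n≤1+n r)))
      go (inj₂ (p , refl)) (inj₁ (r<c , _)) _ = ⊥-elim (ne (≤-antisym r<c (≤-trans c≤N (≤-reflexive (sym p)))))
      go (inj₂ (p , refl)) (inj₂ (_ , e)) (inj₁ (_ , e')) = trans (cong suc e) (trans p (sym e'))
      go (inj₂ (p , refl)) (inj₂ _) (inj₂ (c≤0 , _)) = ⊥-elim (<⇒≱ 0<c c≤0)

  rotate-zero : ∀ r → r < N → (rotate N c r ≡ 0) ⇔ (c ≡ r ⊎ (c ≡ N × r ≡ 0))
  rotate-zero r hr with rotate-view r
  ... | inj₁ (r<c , e) = mk⇔ (λ z → inj₂ (origin r (trans (sym (cong (_+ c) z)) e)))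
    (λ { (inj₁ refl) → ⊥-elim (<-irrefl refl r<c) ; (inj₂ (refl , refl)) → +-cancelʳ-≡ c _ _ e })
    where
    origin : ∀ r → c ≡ r + N → c ≡ N × r ≡ 0
    origin zero    q = q , refl
    origin (suc r) q = ⊥-elim (<⇒≱ (s≤s (m≤n+m N r)) (≤-trans (≤-reflexive (sym q)) c≤N))
  ... | inj₂ (c≤r , e) = mk⇔ (λ z → inj₁ (trans (sym (cong (_+ c) z)) e))
    (λ { (inj₁ refl) → +-cancelʳ-≡ c _ _ e ; (inj₂ (_ , refl)) → ⊥-elim (<⇒≱ 0<c c≤r) })

  rotate-last : ∀ r → r < N → (suc (rotate N c r) ≡ N) ⇔ (suc r ≡ c)
  rotate-last r hr with rotate-view r
  ... | inj₁ (r<c , e) = mk⇔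
    (λ z → +-cancelˡ-≡ N _ _ (trans (+-suc N r) (trans (cong suc (+-comm N r)) (trans (cong suc (sym e)) (cong (_+ c) z)))))
    (λ { refl → +-cancelʳ-≡ c _ _ (trans (cong suc e) (+-comm (suc r) N)) })
  ... | inj₂ (c≤r , e) = mk⇔
    (λ z → ⊥-elim (<⇒≱ hr (≤-pred (≤-trans (≤-reflexive (+-comm 1 N)) (≤-trans (+-monoʳ-≤ N 0<c) (≤-reflexive (trans (cong (_+ c) (sym z)) (cong suc e))))))))
    (λ q → ⊥-elim (<⇒≱ (≤-reflexive q) c≤r))

  -- A cut right behind the interval turns it into the last `f` ranks.
  rotate-upper : ∀ lo f r → c ≡ lo + f → r < N → (lo ≤ r × r < lo + f) ⇔ (N ≤ rotate N c r + f)
  rotate-upper lo f r refl hr with rotate-view r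
  ... | inj₁ (r<c , e) = mk⇔
    (λ (h , _) → +-cancelʳ-≤ lo _ _ (≤-trans (≤-reflexive (+-comm N lo)) (≤-trans (+-monoˡ-≤ N h) (≤-reflexive (trans (sym e) (swap (rotate N c r) lo f))))))
    (λ h → +-cancelʳ-≤ N _ _ (≤-trans (≤-reflexive (+-comm lo N)) (≤-trans (+-monoˡ-≤ lo h) (≤-reflexive (trans (sym (swap (rotate N c r) lo f)) e)))) , r<c)
    where
    swap : ∀ a b c → a + (b + c) ≡ a + c + b
    swap = solve-∀
  ... | inj₂ (c≤r , e) = mk⇔ (λ (_ , h) → ⊥-elim (<⇒≱ h c≤r))
    (λ h → ⊥-elim (<⇒≱ hr (≤-trans h (≤-trans (+-monoʳ-≤ (rotate N c r) (m≤n+m f lo)) (≤-reflexive e)))))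

  -- A cut right before the interval turns it into the first `f` ranks. Since `c` is positive, an
  -- interval starting at 0 is met by the cut behind the last rank, which is the second alternative.
  rotate-lower : ∀ lo f r → c ≡ lo ⊎ (c ≡ N × lo ≡ 0) → lo + f ≤ N → r < N → (lo ≤ r × r < lo + f) ⇔ (rotate N c r < f)
  rotate-lower lo f r (inj₁ refl) fits hr with rotate-view r
  ... | inj₁ (r<c , e) = mk⇔ (λ (h , _) → ⊥-elim (<⇒≱ r<c h))
    (λ h → ⊥-elim (<⇒≱ (+-monoˡ-< c h) (≤-trans (≤-reflexive (+-comm f c)) (≤-trans fits (≤-trans (m≤n+m N r) (≤-reflexive (sym e)))))))
  ... | inj₂ (c≤r , e) = mk⇔
    (λ (_ , h) → +-cancelʳ-< c _ _ (≤-trans (≤-reflexive (cong suc e)) (≤-trans h (≤-reflexive (+-comm c f)))))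
    (λ h → c≤r , ≤-trans (≤-reflexive (cong suc (sym e))) (≤-trans (+-monoˡ-< c h) (≤-reflexive (+-comm f c))))
  rotate-lower lo f r (inj₂ (refl , refl)) fits hr with rotate-view r
  ... | inj₁ (_ , e) = let same = +-cancelʳ-≡ N _ _ e in
    mk⇔ (λ (_ , h) → ≤-trans (≤-reflexive (cong suc same)) h) (λ h → z≤n , ≤-trans (≤-reflexive (cong suc (sym same))) h)
  ... | inj₂ (N≤r , _) = ⊥-elim (<⇒≱ hr N≤r)

module _ {n rank first last prec} (o : IsOrder n rank first last prec) (u : Str) (lu : length u ≡ n) where
  open IsOrder o
  open IsOrderProperties o
  private
    c≤N = rank< u lu
    0<c : 0 < suc (rank u)
    0<c = s≤s z≤n

  -- The new order is decided from the old one and the string `u` behind which it is cut; the number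
  -- `rank u` never has to be computed.
  rotate-isOrder : IsOrder n (λ y → rotate (2 ^ n) (suc (rank u)) (rank y)) (cyclic first last prec u) (λ y → eqS y u)
                     (λ y z → cyclic first last prec y z ∧ not (eqS y u))
  rotate-isOrder = record
    { rank<    = λ y ly → rotate< 0<c c≤N (rank y) (rank< y ly)
    ; rank-inj = λ y z ly lz h → rank-inj y z ly lz (rotate-inj 0<c c≤N (rank y) (rank z) (rank< y ly) (rank< z lz) h)
    ; first⇔   = λ z lz → mk⇔ (λ h → from (rotate-zero 0<c c≤N (rank z) (rank< z lz)) (cyclic⇒ u z lu lz h))
                              (λ h → cyclic⇐ u z lu lz (to (rotate-zero 0<c c≤N (rank z) (rank< z lz)) h))
    ; last⇔    = λ y ly → mk⇔ (λ h → from (rotate-last 0<c c≤N (rank y) (rank< y ly)) (cong (λ y → suc (rank y)) (eqS-sound y u h)))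
                              (λ h → from eqS⇔ (rank-inj y u ly lu (suc-injective (to (rotate-last 0<c c≤N (rank y) (rank< y ly)) h))))
    ; prec⇔    = λ y z ly lz → mk⇔
        (λ h → let a , b = ∧-true h in from (rotate-suc 0<c c≤N (rank y) (rank z) (rank< y ly) (rank< z lz))
          (cyclic⇒ y z ly lz a , λ q → true≢false (trans (sym (from eqS⇔ (rank-inj y u ly lu (suc-injective q)))) (not-true b))))
        (λ h → let a , b = to (rotate-suc 0<c c≤N (rank y) (rank z) (rank< y ly) (rank< z lz)) h in
          ∧-intro (cyclic⇐ y z ly lz a) (distinct y b)) }
    where
    distinct : ∀ y → suc (rank y) ≢ suc (rank u) → not (eqS y u) ≡ true
    distinct y ne with eqS y u in eq
    ... | false = refl
    ... | true  = ⊥-elim (ne (cong (λ y → suc (rank y)) (eqS-sound y u eq)))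

-- The order laws are only required at the contexts c with Good c.
record Order : Set where
  field
    ruler    : Str → Str
    rank     : Str → Str → ℕ
    first last : Str → Str → Bool
    prec     : Str → Str → Str → Bool
    PF-ruler : PF₁ ruler
    PB-first : PB₂ first
    PB-last  : PB₂ last
    PB-prec  : PF₃ (λ c y z → flag (prec c y z))

  Good : Str → Set
  Good c = IsOrder (length (ruler c)) (rank c) (first c) (last c) (prec c)

  around : Str → Str → Str → Bool
  around c = cyclic (first c) (last c) (prec c)

  PB-around : PF₃ (λ c y z → flag (around c y z))
  PB-around = pf₃ (PB-∨ (un₃ PB-prec) (PB-∧ (ap₂ PB-last (PF-var zero) (PF-var (suc zero))) (ap₂ PB-first (PF-var zero) (PF-var (suc (suc zero))))))

open Order

lexOrder : ∀ {r} → PF₁ r → Order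
lexOrder {r} pr = record
  { ruler = r ; rank = λ _ → toNat ; first = λ _ → isZeros ; last = λ _ → isOnes ; prec = λ _ → succS ; PF-ruler = pr
  ; PB-first = pf₂ (ap₁ PB-isZeros (PF-var (suc zero))) ; PB-last = pf₂ (ap₁ PB-isOnes (PF-var (suc zero)))
  ; PB-prec = pf₃ (ap₂ PB-succS (PF-var (suc zero)) (PF-var (suc (suc zero)))) }

reindex : ∀ {g} → PF₁ g → Order → Order
reindex {g} pg o = record
  { ruler = λ c → ruler o (g c) ; rank = λ c → rank o (g c) ; first = λ c → first o (g c) ; last = λ c → last o (g c) ; prec = λ c → prec o (g c)
  ; PF-ruler = pf₁ (ap₁ (PF-ruler o) (un₁ pg))
  ; PB-first = pf₂ (ap₂ (PB-first o) (ap₁ pg (PF-var zero)) (PF-var (suc zero)))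
  ; PB-last  = pf₂ (ap₂ (PB-last o) (ap₁ pg (PF-var zero)) (PF-var (suc zero)))
  ; PB-prec  = pf₃ (ap₃ (PB-prec o) (ap₁ pg (PF-var zero)) (PF-var (suc zero)) (PF-var (suc (suc zero)))) }

-- Both orders must live on strings of the same length.
choose : ∀ {b} → PB₁ b → Order → Order → Order
choose {b} pb o₁ o₂ = record
  { ruler = ruler o₁
  ; rank  = λ c y → if b c then rank o₁ c y else rank o₂ c y
  ; first = λ c y → if b c then first o₁ c y else first o₂ c y
  ; last  = λ c y → if b c then last o₁ c y else last o₂ c y
  ; prec  = λ c y z → if b c then prec o₁ c y z else prec o₂ c y z
  ; PF-ruler = PF-ruler o₁
  ; PB-first = pf₂ (PB-if (ap₁ pb (PF-var zero)) (un₂ (PB-first o₁)) (un₂ (PB-first o₂)))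
  ; PB-last  = pf₂ (PB-if (ap₁ pb (PF-var zero)) (un₂ (PB-last o₁)) (un₂ (PB-last o₂)))
  ; PB-prec  = pf₃ (PB-if (ap₁ pb (PF-var zero)) (un₃ (PB-prec o₁)) (un₃ (PB-prec o₂))) }

choose-good : ∀ {b} (pb : PB₁ b) o₁ o₂ c → length (ruler o₂ c) ≡ length (ruler o₁ c) →
  (b c ≡ true → Good o₁ c) → (b c ≡ false → Good o₂ c) → Good (choose pb o₁ o₂) c
choose-good {b} pb o₁ o₂ c l g₁ g₂ with b c
... | true  = g₁ refl
... | false = subst (λ n → IsOrder n (rank o₂ c) (first o₂ c) (last o₂ c) (prec o₂ c)) l (g₂ refl)

rotateOrder : ∀ {u} → PF₁ u → Order → Order
rotateOrder {u} pu o = record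
  { ruler = ruler o
  ; rank  = λ c y → rotate (2 ^ length (ruler o c)) (suc (rank o c (u c))) (rank o c y)
  ; first = λ c → around o c (u c)
  ; last  = λ c y → eqS y (u c)
  ; prec  = λ c y z → around o c y z ∧ not (eqS y (u c))
  ; PF-ruler = PF-ruler o
  ; PB-first = pf₂ (ap₃ (PB-around o) (PF-var zero) (ap₁ pu (PF-var zero)) (PF-var (suc zero)))
  ; PB-last  = pf₂ (ap₂ PB-eqS (PF-var (suc zero)) (ap₁ pu (PF-var zero)))
  ; PB-prec  = pf₃ (PB-∧ (un₃ (PB-around o)) (PB-not (ap₂ PB-eqS (PF-var (suc zero)) (ap₁ pu (PF-var zero))))) }

pair : Str → Str → Str
pair a c = ⟨ a , c , [] ⟩

PF-pair : PF₂ pair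
PF-pair = pf₂ (ap₃ PF-triple (PF-var zero) (PF-var (suc zero)) PF-[])

PF-fst³ : PF₁ fst³
PF-fst³ = PF-component

PF-snd³ : PF₁ snd³
PF-snd³ = pf₁ (ap₁ PF-component (un₁ PF-remainder))

PF-thd³ : PF₁ thd³
PF-thd³ = pf₁ (ap₁ PF-component (ap₁ PF-remainder (un₁ PF-remainder)))

-- The prefix selects the order on the rest: it is handed to o inside the context.
module BlockOrder {m n : Str → Str} (pm : PF₁ m) (pn : PF₁ n) (o : Order) where
  private
    hi lo : Str → Str → Str
    hi c w = takeL (m c) w
    lo c w = dropL (m c) w

    PF-hi : ∀ {k} {C W : Vec Str k → Str} → PF C → PF W → PF (λ v → hi (C v) (W v))
    PF-hi c w = ap₂ PF-takeL (ap₁ pm c) w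

    PF-lo : ∀ {k} {C W : Vec Str k → Str} → PF C → PF W → PF (λ v → lo (C v) (W v))
    PF-lo c w = ap₂ PF-dropL (ap₁ pm c) w

    PF-ctx : ∀ {k} {C W : Vec Str k → Str} → PF C → PF W → PF (λ v → pair (hi (C v) (W v)) (C v))
    PF-ctx c w = ap₂ PF-pair (PF-hi c w) c

  blockOrder : Order
  blockOrder = record
    { ruler = λ c → m c ++ n c
    ; rank  = λ c w → toNat (hi c w) * 2 ^ length (n c) + rank o (pair (hi c w) c) (lo c w)
    ; first = λ c w → isZeros (hi c w) ∧ first o (pair (hi c w) c) (lo c w)
    ; last  = λ c w → isOnes (hi c w) ∧ last o (pair (hi c w) c) (lo c w)
    ; prec  = λ c w w' → (eqS (hi c w) (hi c w') ∧ prec o (pair (hi c w) c) (lo c w) (lo c w'))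
                ∨ (succS (hi c w) (hi c w') ∧ (last o (pair (hi c w) c) (lo c w) ∧ first o (pair (hi c w') c) (lo c w')))
    ; PF-ruler = pf₁ (ap₂ PF-++ (un₁ pm) (un₁ pn))
    ; PB-first = pf₂ (PB-∧ (ap₁ PB-isZeros (PF-hi C W)) (ap₂ (PB-first o) (PF-ctx C W) (PF-lo C W)))
    ; PB-last  = pf₂ (PB-∧ (ap₁ PB-isOnes (PF-hi C W)) (ap₂ (PB-last o) (PF-ctx C W) (PF-lo C W)))
    ; PB-prec  = pf₃ (PB-∨ (PB-∧ (ap₂ PB-eqS (PF-hi C' W') (PF-hi C' W″)) (ap₃ (PB-prec o) (PF-ctx C' W') (PF-lo C' W') (PF-lo C' W″)))
        (PB-∧ (ap₂ PB-succS (PF-hi C' W') (PF-hi C' W″)) (PB-∧ (ap₂ (PB-last o) (PF-ctx C' W') (PF-lo C' W')) (ap₂ (PB-first o) (PF-ctx C' W″) (PF-lo C' W″))))) }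
    where
    C : PF {2} (λ v → lookup v zero)
    C = PF-var zero
    W : PF {2} (λ v → lookup v (suc zero))
    W = PF-var (suc zero)
    C' : PF {3} (λ v → lookup v zero)
    C' = PF-var zero
    W' : PF {3} (λ v → lookup v (suc zero))
    W' = PF-var (suc zero)
    W″ : PF {3} (λ v → lookup v (suc (suc zero)))
    W″ = PF-var (suc (suc zero))

  blockOrder-good : ∀ c → (∀ a → length a ≡ length (m c) → length (ruler o (pair a c)) ≡ length (n c) × Good o (pair a c)) → Good blockOrder c
  blockOrder-good c g = subst (λ k → IsOrder k (rank blockOrder c) (first blockOrder c) (last blockOrder c) (prec blockOrder c)) (sym (List.length-++ (m c)))
    (Block.block-isOrder (m c) (length (n c)) {λ a → rank o (pair a c)} {λ a → first o (pair a c)} {λ a → last o (pair a c)} {λ a → prec o (pair a c)}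
      (λ a l → let e , h = g a l in subst (λ k → IsOrder k (rank o (pair a c)) (first o (pair a c)) (last o (pair a c)) (prec o (pair a c))) e h))

-- Bit vectors and counting

bool-ext : ∀ {a b} → (a ≡ true → b ≡ true) → (b ≡ true → a ≡ true) → a ≡ b
bool-ext {false} {false} f g = refl
bool-ext {true}  {true}  f g = refl
bool-ext {true}  {false} f g = sym (f refl)
bool-ext {false} {true}  f g = g refl

lexRank : ∀ {m} → Vec Bool m → ℕ
lexRank v = toNat (toList v)

length-toList : ∀ {m} (v : Vec Bool m) → length (toList v) ≡ m
length-toList []      = refl
length-toList (_ ∷ v) = cong suc (length-toList v)

lexRank< : ∀ {m} (v : Vec Bool m) → lexRank v < 2 ^ m
lexRank< v = subst (λ k → lexRank v < 2 ^ k) (length-toList v) (toNat< (toList v))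

fit : ∀ m → Str → Vec Bool m
fit zero    s       = []
fit (suc m) []      = false ∷ fit m []
fit (suc m) (b ∷ s) = b ∷ fit m s

fit-toList : ∀ {m} (v : Vec Bool m) → fit m (toList v) ≡ v
fit-toList []      = refl
fit-toList (b ∷ v) = cong (b ∷_) (fit-toList v)

toList-fit : ∀ m s → length s ≡ m → toList (fit m s) ≡ s
toList-fit zero    []      h = refl
toList-fit (suc m) (b ∷ s) h = cong (b ∷_) (toList-fit m s (suc-injective h))

toList-injective : ∀ {m} (v w : Vec Bool m) → toList v ≡ toList w → v ≡ w
toList-injective {m} v w eq = trans (sym (fit-toList v)) (trans (cong (fit m) eq) (fit-toList w))

lexRank-injective : ∀ {m} (v w : Vec Bool m) → lexRank v ≡ lexRank w → v ≡ w
lexRank-injective v w eq = toList-injective v w (toNat-injective _ _ (trans (length-toList v) (sym (length-toList w))) eq)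

lexRank-surjective : ∀ m i → i < 2 ^ m → ∃[ v ] lexRank {m} v ≡ i
lexRank-surjective zero    zero    h = [] , refl
lexRank-surjective zero    (suc i) (s≤s ())
lexRank-surjective (suc m) i h with i <? 2 ^ m
... | yes lt with lexRank-surjective m i lt
...   | v , eq = false ∷ v , eq
lexRank-surjective (suc m) i h | no ge
  with lexRank-surjective m (i ∸ 2 ^ m) (+-cancelˡ-< (2 ^ m) _ _ (≤-trans (≤-reflexive (cong suc (m+[n∸m]≡n (≮⇒≥ ge)))) (≤-trans h (≤-reflexive (cong (2 ^ m +_) (+-identityʳ _))))))
... | v , eq = true ∷ v , trans (cong₂ _+_ (cong (2 ^_) (length-toList v)) eq) (m+[n∸m]≡n (≮⇒≥ ge))

<lex⇒< : ∀ {m} {a b : Vec Bool m} → a <lex b → lexRank a < lexRank b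
<lex⇒< {a = false ∷ a} {true ∷ b} here = ≤-trans (toNat< (toList a))
  (≤-trans (≤-reflexive (cong (2 ^_) (trans (length-toList a) (sym (length-toList b))))) (m≤m+n _ _))
<lex⇒< {a = false ∷ a} {false ∷ b} (there h) = <lex⇒< h
<lex⇒< {a = true ∷ a} {true ∷ b} (there h) = ≤-trans (≤-reflexive (sym (+-suc _ _)))
  (+-mono-≤ (≤-reflexive (cong (2 ^_) (trans (length-toList a) (sym (length-toList b))))) (<lex⇒< h))

<lex-cmp : ∀ {m} (a b : Vec Bool m) → a <lex b ⊎ a ≡ b ⊎ b <lex a
<lex-cmp []          []          = inj₂ (inj₁ refl)
<lex-cmp (false ∷ a) (true ∷ b)  = inj₁ here
<lex-cmp (true ∷ a)  (false ∷ b) = inj₂ (inj₂ here)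
<lex-cmp (false ∷ a) (false ∷ b) with <lex-cmp a b
... | inj₁ h        = inj₁ (there h)
... | inj₂ (inj₁ h) = inj₂ (inj₁ (cong (false ∷_) h))
... | inj₂ (inj₂ h) = inj₂ (inj₂ (there h))
<lex-cmp (true ∷ a)  (true ∷ b) with <lex-cmp a b
... | inj₁ h        = inj₁ (there h)
... | inj₂ (inj₁ h) = inj₂ (inj₁ (cong (true ∷_) h))
... | inj₂ (inj₂ h) = inj₂ (inj₂ (there h))

<⇒<lex : ∀ {m} (a b : Vec Bool m) → lexRank a < lexRank b → a <lex b
<⇒<lex a b h with <lex-cmp a b
... | inj₁ l           = l
... | inj₂ (inj₁ refl) = ⊥-elim (<-irrefl refl h)
... | inj₂ (inj₂ l)    = ⊥-elim (<-asym h (<lex⇒< l))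

≤lex⇔ : ∀ {m} (a b : Vec Bool m) → (a ≤lex b) ⇔ (lexRank a ≤ lexRank b)
≤lex⇔ a b = mk⇔ (λ { (inj₁ l) → <⇒≤ (<lex⇒< l) ; (inj₂ refl) → ≤-refl }) bwd
  where
  bwd : lexRank a ≤ lexRank b → a ≤lex b
  bwd h with m≤n⇒m<n∨m≡n h
  ... | inj₁ l = inj₁ (<⇒<lex a b l)
  ... | inj₂ e = inj₂ (lexRank-injective a b e)

-- Minimality of `b` is applied to the string whose rank is one more than that of `a`; it exists
-- because `b` lies above `a`.
≺lex⇔ : ∀ {m} (a b : Vec Bool m) → (a ≺lex b) ⇔ (suc (lexRank a) ≡ lexRank b)
≺lex⇔ {m} a b = mk⇔ fwd bwd
  where
  fwd : a ≺lex b → suc (lexRank a) ≡ lexRank b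
  fwd (l , least) with lexRank-surjective m (suc (lexRank a)) (≤-<-trans (<lex⇒< l) (lexRank< b))
  ... | c , eq = ≤-antisym (<lex⇒< l) (≤-trans (to (≤lex⇔ b c) (least c (<⇒<lex a c (≤-reflexive (sym eq))))) (≤-reflexive eq))
  bwd : suc (lexRank a) ≡ lexRank b → a ≺lex b
  bwd eq = <⇒<lex a b (≤-reflexive eq) , λ c l → from (≤lex⇔ b c) (≤-trans (≤-reflexive (sym eq)) (<lex⇒< l))

lexRank-zeros : ∀ {m} (v : Vec Bool m) → (v ≡ Vec.replicate m false) ⇔ (lexRank v ≡ 0)
lexRank-zeros {m} v = mk⇔ (λ { refl → zeros m }) (λ h → lexRank-injective v _ (trans h (sym (zeros m))))
  where
  zeros : ∀ m → lexRank (Vec.replicate m false) ≡ 0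
  zeros zero    = refl
  zeros (suc m) = zeros m

lexRank-ones : ∀ {m} (v : Vec Bool m) → (v ≡ Vec.replicate m true) ⇔ (suc (lexRank v) ≡ 2 ^ m)
lexRank-ones {m} v = mk⇔ (λ { refl → ones m }) (λ h → lexRank-injective v _ (suc-injective (trans h (sym (ones m)))))
  where
  ones : ∀ m → suc (lexRank (Vec.replicate m true)) ≡ 2 ^ m
  ones m = trans (cong (λ s → suc (toNat s)) (list m)) (toNat-trues m)
    where
    list : ∀ m → toList (Vec.replicate m true) ≡ trues m
    list zero    = refl
    list (suc m) = cong (true ∷_) (list m)

-- Counting and the pigeonhole principle

indicator : Bool → ℕ
indicator b = if b then 1 else 0

count-suc : ∀ {m} (P : Vec Bool (suc m) → Bool) → count P ≡ count (λ w → P (false ∷ w)) + count (λ w → P (true ∷ w))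
count-suc {m} P = trans (over-++ (List.map (false ∷_) (allVecs m)) _) (cong₂ _+_ (over-map false (allVecs m)) (over-map true (allVecs m)))
  where
  total : ∀ {k} → (Vec Bool k → Bool) → List (Vec Bool k) → ℕ
  total Q = foldr (λ w n → indicator (Q w) + n) 0
  over-++ : ∀ xs ys → total P (xs ++ ys) ≡ total P xs + total P ys
  over-++ []       ys = refl
  over-++ (x ∷ xs) ys = trans (cong (indicator (P x) +_) (over-++ xs ys)) (sym (+-assoc (indicator (P x)) _ _))
  over-map : ∀ b xs → total P (List.map (b ∷_) xs) ≡ total (λ w → P (b ∷ w)) xs
  over-map b []       = refl
  over-map b (x ∷ xs) = cong (indicator (P (b ∷ x)) +_) (over-map b xs)

count-add : ∀ {m} (P Q T : Vec Bool m → Bool) → (∀ w → indicator (P w) ≡ indicator (Q w) + indicator (T w)) → count P ≡ count Q + count T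
count-add {zero} P Q T h = trans (+-identityʳ _) (trans (h []) (sym (cong₂ _+_ (+-identityʳ (indicator (Q []))) (+-identityʳ (indicator (T []))))))
count-add {suc m} P Q T h = begin
  count P                                                  ≡⟨ count-suc P ⟩
  count (λ w → P (false ∷ w)) + count (λ w → P (true ∷ w)) ≡⟨ cong₂ _+_ (count-add _ (λ w → Q (false ∷ w)) (λ w → T (false ∷ w)) (λ w → h (false ∷ w))) (count-add _ (λ w → Q (true ∷ w)) (λ w → T (true ∷ w)) (λ w → h (true ∷ w))) ⟩
  _                                                        ≡⟨ interchange (count (λ w → Q (false ∷ w))) _ _ _ ⟩
  _                                                        ≡⟨ cong₂ _+_ (count-suc Q) (count-suc T) ⟨
  count Q + count T                                        ∎
  where
  open ≡-Reasoning
  interchange : ∀ a b c d → (a + b) + (c + d) ≡ (a + c) + (b + d)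
  interchange = solve-∀

count-cong : ∀ {m} (P Q : Vec Bool m → Bool) → (∀ w → P w ≡ Q w) → count P ≡ count Q
count-cong {zero}  P Q h = cong (λ b → indicator b + 0) (h [])
count-cong {suc m} P Q h = trans (count-suc P) (trans (cong₂ _+_ (count-cong _ _ (λ w → h (false ∷ w))) (count-cong _ _ (λ w → h (true ∷ w)))) (sym (count-suc Q)))

count-none : ∀ {m} (P : Vec Bool m → Bool) → (∀ w → P w ≡ false) → count P ≡ 0
count-none {zero}  P h = cong (λ b → indicator b + 0) (h [])
count-none {suc m} P h = trans (count-suc P) (cong₂ _+_ (count-none _ (λ w → h (false ∷ w))) (count-none _ (λ w → h (true ∷ w))))

count-zero : ∀ {m} (P : Vec Bool m → Bool) → count P ≡ 0 → ∀ w → P w ≡ false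
count-zero {zero}  P h [] with P []
... | false = refl
count-zero {suc m} P h (false ∷ w) = count-zero (λ w → P (false ∷ w)) (m+n≡0⇒m≡0 _ (trans (sym (count-suc P)) h)) w
count-zero {suc m} P h (true ∷ w)  = count-zero (λ w → P (true ∷ w)) (m+n≡0⇒n≡0 (count (λ w → P (false ∷ w))) (trans (sym (count-suc P)) h)) w

count-one : ∀ {m} (P : Vec Bool m → Bool) w₀ → P w₀ ≡ true → (∀ w → P w ≡ true → w ≡ w₀) → count P ≡ 1
count-one {zero}  P [] h u rewrite h = refl
count-one {suc m} P (b ∷ w₀) h u = trans (count-suc P) (halves b h (λ c w e → Vec.∷-injective (u (c ∷ w) e)))
  where
  absent : ∀ {a b : Bool} → (a ≡ true → b ≡ true → ⊥) → a ≡ true → b ≡ false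
  absent {b = false} f e = refl
  absent {b = true}  f e = ⊥-elim (f e refl)
  halves : ∀ b → P (b ∷ w₀) ≡ true → (∀ c w → P (c ∷ w) ≡ true → c ≡ b × w ≡ w₀) → count (λ w → P (false ∷ w)) + count (λ w → P (true ∷ w)) ≡ 1
  halves false h u = cong₂ _+_ (count-one _ w₀ h (λ w e → proj₂ (u false w e)))
    (count-none _ (λ w → absent (λ _ e → true≢false (proj₁ (u true w e))) h))
  halves true h u = cong₂ _+_ (count-none _ (λ w → absent (λ _ e → true≢false (sym (proj₁ (u false w e)))) h))
    (count-one _ w₀ h (λ w e → proj₂ (u true w e)))

InRange : ℕ → ℕ → ℕ → Set
InRange lo k r = lo ≤ r × r < lo + k

inRange : ℕ → ℕ → ℕ → Bool
inRange lo k r = (lo ≤ᵇ r) ∧ (r <ᵇ lo + k)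

inRange⇔ : ∀ lo k r → (inRange lo k r ≡ true) ⇔ InRange lo k r
inRange⇔ lo k r = mk⇔ (λ h → let a , b = ∧-true h in ≤ᵇ⇒≤ lo r (isT a) , <ᵇ⇒< r (lo + k) (isT b))
  (λ (a , b) → ∧-intro (isTrue (≤⇒≤ᵇ a)) (isTrue (<⇒<ᵇ b)))
  where
  isT : ∀ {b} → b ≡ true → Data.Bool.T b
  isT refl = tt
  isTrue : ∀ {b} → Data.Bool.T b → b ≡ true
  isTrue {true} _ = refl

module _ {m : ℕ} (rank : Vec Bool m → ℕ) (inj : ∀ v w → rank v ≡ rank w → v ≡ w) where

  -- Induction on the length of the interval: its highest rank is taken by exactly one vector.
  count-interval : (∀ i → i < 2 ^ m → ∃[ v ] rank v ≡ i) → ∀ lo k → lo + k ≤ 2 ^ m → count (λ v → inRange lo k (rank v)) ≡ k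
  count-interval sur lo zero    h = count-none _ λ w → bool-ext
    (λ e → let a , b = to (inRange⇔ lo 0 (rank w)) e in ⊥-elim (<⇒≱ b (≤-trans (≤-reflexive (+-identityʳ lo)) a))) (λ ())
  count-interval sur lo (suc k) h with sur (lo + k) (≤-trans (≤-reflexive (sym (+-suc lo k))) h)
  ... | v₀ , eq = trans (count-add _ (λ v → inRange lo k (rank v)) (λ v → inRange (lo + k) 1 (rank v)) (λ v → split (rank v)))
    (trans (cong₂ _+_ (count-interval sur lo k (≤-trans (+-monoʳ-≤ lo (n≤1+n k)) h))
      (count-one _ v₀ (from (inRange⇔ (lo + k) 1 (rank v₀)) (≤-reflexive (sym eq) , ≤-reflexive (trans (cong suc eq) (+-comm 1 (lo + k)))))
        (λ w e → let a , b = to (inRange⇔ (lo + k) 1 (rank w)) e in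
          inj w v₀ (trans (≤-antisym (≤-pred (≤-trans b (≤-reflexive (+-comm (lo + k) 1)))) a) (sym eq))))) (+-comm k 1))
    where
    off : ∀ lo k r → ¬ InRange lo k r → inRange lo k r ≡ false
    off lo k r n with inRange lo k r in e
    ... | false = refl
    ... | true  = ⊥-elim (n (to (inRange⇔ lo k r) e))
    split : ∀ r → indicator (inRange lo (suc k) r) ≡ indicator (inRange lo k r) + indicator (inRange (lo + k) 1 r)
    split r with lo ≤? r
    ... | no  n rewrite off lo (suc k) r (λ (a , _) → n a) | off lo k r (λ (a , _) → n a)
        | off (lo + k) 1 r (λ (a , _) → n (≤-trans (m≤m+n lo k) a)) = refl
    ... | yes l with <-cmp r (lo + k)
    ...   | tri< lt _ _ rewrite from (inRange⇔ lo (suc k) r) (l , ≤-trans lt (+-monoʳ-≤ lo (n≤1+n k))) | from (inRange⇔ lo k r) (l , lt)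
            | off (lo + k) 1 r (λ (a , _) → <⇒≱ lt a) = refl
    ...   | tri≈ _ refl _ rewrite from (inRange⇔ lo (suc k) (lo + k)) (l , ≤-reflexive (sym (+-suc lo k))) | off lo k (lo + k) (λ (_ , b) → <-irrefl refl b)
            | from (inRange⇔ (lo + k) 1 (lo + k)) (≤-refl , ≤-reflexive (+-comm 1 (lo + k))) = refl
    ...   | tri> _ _ gt rewrite off lo (suc k) r (λ (_ , b) → <⇒≱ gt (≤-pred (≤-trans b (≤-reflexive (+-suc lo k))))) | off lo k r (λ (_ , b) → <-asym b gt)
            | off (lo + k) 1 r (λ (_ , b) → <⇒≱ gt (≤-pred (≤-trans b (≤-reflexive (+-comm (lo + k) 1))))) = refl

-- If the value `i` were missed, punching it out would inject a finite set into a smaller one.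
Fin-injective⇒surjective : ∀ n (f : Fin n → Fin n) → (∀ i j → f i ≡ f j → i ≡ j) → ∀ i → ∃[ j ] f j ≡ i
Fin-injective⇒surjective (suc n) f inj i with Data.Fin.Properties.any? (λ j → f j Data.Fin.≟ i)
... | yes h = h
... | no  h = ⊥-elim (1+n≰n (Data.Fin.Properties.injective⇒≤ {f = λ j → Data.Fin.punchOut (avoids j)}
      (λ {a} {b} e → inj a b (Data.Fin.Properties.punchOut-injective (avoids a) (avoids b) e))))
  where
  avoids : ∀ j → i ≢ f j
  avoids j e = h (j , sym e)

-- Numbering the vectors by `lexRank` turns `rank` into an injective self-map of `Fin (2 ^ m)`. This
-- is how `IsOrder` yields a bijection without a surjectivity law of its own.
injective⇒surjective : ∀ {m} (rank : Vec Bool m → ℕ) → (∀ v → rank v < 2 ^ m) → (∀ v w → rank v ≡ rank w → v ≡ w) →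
  ∀ i → i < 2 ^ m → ∃[ v ] rank v ≡ i
injective⇒surjective {m} rank rank< inj i h =
  let j , eq = Fin-injective⇒surjective (2 ^ m) F F-inj (Data.Fin.fromℕ< h) in
  vec j , trans (sym (Data.Fin.Properties.toℕ-fromℕ< (rank< (vec j)))) (trans (cong toℕ eq) (Data.Fin.Properties.toℕ-fromℕ< h))
  where
  pick : (j : Fin (2 ^ m)) → ∃[ v ] lexRank {m} v ≡ toℕ j
  pick j = lexRank-surjective m (toℕ j) (Data.Fin.Properties.toℕ<n j)
  vec : Fin (2 ^ m) → Vec Bool m
  vec j = proj₁ (pick j)
  F : Fin (2 ^ m) → Fin (2 ^ m)
  F j = Data.Fin.fromℕ< (rank< (vec j))
  F-inj : ∀ a b → F a ≡ F b → a ≡ b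
  F-inj a b e = Data.Fin.Properties.toℕ-injective (trans (sym (proj₂ (pick a))) (trans (cong lexRank
    (inj (vec a) (vec b) (trans (sym (Data.Fin.Properties.toℕ-fromℕ< (rank< (vec a)))) (trans (cong toℕ e) (Data.Fin.Properties.toℕ-fromℕ< (rank< (vec b)))))))
    (proj₂ (pick b))))

-- Cluster functions

-- The class CLU#P, with the bijection h replaced by the rank of h(y) and the
-- cluster by the interval [lo, lo + f x) of ranks.
record CL (f : Str → ℕ) : Set where
  field
    order   : Order
    poly    : PolyExp
    ruler≡  : ∀ x → length (ruler order x) ≡ ⟪ poly ⟫ (length x)
    good    : ∀ x → Good order x
    acc     : Str → Str → Bool
    PB-acc  : PB₂ acc

  bits : Str → ℕ
  bits x = length (ruler order x)

  field
    interval : ∀ x → ∃[ lo ] lo + f x ≤ 2 ^ bits x × (∀ y → length y ≡ bits x → (acc x y ≡ true) ⇔ InRange lo (f x) (rank order x y))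

module _ {N : ℕ} where
  -- As `l + k ≤ N`, the range stays below the next multiple of `N`, so its members share the upper
  -- digit.
  digits-range : ∀ a A {b l k} → b < N → l + k ≤ N → InRange (A * N + l) k (a * N + b) → a ≡ A × InRange l k b
  digits-range a A {b} {l} {k} hb h (p , q) with <-cmp a A
  ... | tri≈ _ refl _ = refl , +-cancelˡ-≤ (A * N) _ _ p , +-cancelˡ-< (A * N) _ _ (≤-trans q (≤-reflexive (+-assoc (A * N) l k)))
  ... | tri< a<A _ _ = ⊥-elim (<⇒≱ (digits< {a = a} a<A hb) (≤-trans (m≤m+n (A * N) l) p))
  ... | tri> _ _ A<a = ⊥-elim (<⇒≱ q (≤-trans (≤-trans (≤-reflexive (+-assoc (A * N) l k)) (≤-trans (+-monoʳ-≤ (A * N) h) (≤-reflexive (+-comm (A * N) N))))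
                                             (≤-trans (*-monoˡ-≤ N A<a) (m≤m+n (a * N) b))))

  digits-range⁻¹ : ∀ A {b l k} → InRange l k b → InRange (A * N + l) k (A * N + b)
  digits-range⁻¹ A {b} {l} {k} (p , q) = +-monoʳ-≤ (A * N) p , ≤-trans (+-monoʳ-< (A * N) q) (≤-reflexive (sym (+-assoc (A * N) l k)))

module _ {m n : Str → Str} (pm : PF₁ m) (pn : PF₁ n) (o : Order) where
  open BlockOrder pm pn o

  -- A cluster inside the single block `a₀` is a cluster of the whole order, shifted by the rank at
  -- which the block begins.
  block-interval : ∀ c a₀ {l k} {acc' acc″ : Str → Bool} → length a₀ ≡ length (m c) →
    (∀ a → length a ≡ length (m c) → length (ruler o (pair a c)) ≡ length (n c) × Good o (pair a c)) →
    l + k ≤ 2 ^ length (n c) →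
    (∀ y → length y ≡ length (n c) → (acc″ y ≡ true) ⇔ InRange l k (rank o (pair a₀ c) y)) →
    (∀ w → length w ≡ length (m c ++ n c) → (acc' w ≡ true) ⇔ (takeL (m c) w ≡ a₀ × acc″ (dropL (m c) w) ≡ true)) →
    let lo = toNat a₀ * 2 ^ length (n c) + l in
    lo + k ≤ 2 ^ length (m c ++ n c) × (∀ w → length w ≡ length (m c ++ n c) → (acc' w ≡ true) ⇔ InRange lo k (rank blockOrder c w))
  block-interval c a₀ {l} {k} {acc'} {acc″} l₀ inner fits spec spec' = within , λ w lw → mk⇔ (fwd w lw) (bwd w lw)
    where
    r = m c
    N = 2 ^ length (n c)
    A = toNat a₀
    total : length (m c ++ n c) ≡ length (m c) + length (n c)
    total = List.length-++ (m c)
    within : A * N + l + k ≤ 2 ^ length (m c ++ n c)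
    within = begin
      A * N + l + k                     ≡⟨ +-assoc (A * N) l k ⟩
      A * N + (l + k)                   ≤⟨ +-monoʳ-≤ (A * N) fits ⟩
      A * N + N                         ≡⟨ +-comm (A * N) N ⟩
      suc A * N                         ≤⟨ *-monoˡ-≤ N (toNat< a₀) ⟩
      2 ^ length a₀ * N                 ≡⟨ cong (λ j → 2 ^ j * N) l₀ ⟩
      2 ^ length (m c) * N              ≡⟨ ^-distribˡ-+-* 2 (length (m c)) (length (n c)) ⟨
      2 ^ (length (m c) + length (n c)) ≡⟨ cong (2 ^_) total ⟨
      2 ^ length (m c ++ n c)           ∎ where open ≤-Reasoning
    ordered : ∀ a → length a ≡ length r → IsOrder (length (n c)) (rank o (pair a c)) (first o (pair a c)) (last o (pair a c)) (prec o (pair a c))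
    ordered a la with inner a la
    ... | e , h = subst (λ k → IsOrder k (rank o (pair a c)) (first o (pair a c)) (last o (pair a c)) (prec o (pair a c))) e h
    module _ (w : Str) (lw : length w ≡ length (m c ++ n c)) where
      a = takeL r w
      b = dropL r w
      open Block r (length (n c)) ordered using (hi-length; lo-length; rank-lo<)
      lw' = trans lw total
      fwd : acc' w ≡ true → InRange (A * N + l) k (rank blockOrder c w)
      fwd h = let e , h' = to (spec' w lw) h in
        subst (λ a → InRange (A * N + l) k (toNat a * N + rank o (pair a c) b)) (sym e) (digits-range⁻¹ A (to (spec b (lo-length w lw')) h'))
      bwd : InRange (A * N + l) k (rank blockOrder c w) → acc' w ≡ true
      bwd h = let e , h' = digits-range (toNat a) A (rank-lo< w lw') fits h
                  e' = toNat-injective a a₀ (trans (hi-length w lw') (sym l₀)) e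
              in from (spec' w lw) (e' , from (spec b (lo-length w lw')) (subst (λ a → InRange l k (rank o (pair a c) b)) e' h'))

-- Lengthens the strings without changing the count: the block with prefix `g x` inherits order and
-- cluster, all other blocks are lexicographic and rejected. It serves to put the extreme strings
-- outside the inherited block and to bring two clusters to a common length.
module Prefix {f} (C : CL f) (mp : PolyExp) {g : Str → Str} (pg : PF₁ g) (lg : ∀ x → length (g x) ≡ ⟪ mp ⟫ (length x)) where
  open CL C

  private
    marked : Str → Bool
    marked d = eqS (fst³ d) (g (snd³ d))

    PB-marked : PB₁ marked
    PB-marked = pf₁ (ap₂ PB-eqS (un₁ PF-fst³) (ap₁ pg (un₁ PF-snd³)))

    o₁ o₂ : Order
    o₁ = reindex PF-snd³ order
    o₂ = lexOrder {λ d → ruler order (snd³ d)} (pf₁ (ap₁ (PF-ruler order) (un₁ PF-snd³)))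

  inside : Order
  inside = choose PB-marked o₁ o₂

  open BlockOrder pg (PF-ruler order) inside public

  private
    snd≡ : ∀ a x → snd³ (pair a x) ≡ x
    snd≡ a x = snd³-triple a x []

    marked≡ : ∀ a x → marked (pair a x) ≡ eqS a (g x)
    marked≡ a x = cong₂ (λ s t → eqS s (g t)) (fst³-triple a x []) (snd≡ a x)

    inside-good : ∀ x a → length a ≡ length (g x) → length (ruler inside (pair a x)) ≡ length (ruler order x) × Good inside (pair a x)
    inside-good x a la = cong (λ t → length (ruler order t)) (snd≡ a x) ,
      choose-good PB-marked o₁ o₂ (pair a x) refl (λ _ → good (snd³ (pair a x))) (λ _ → lex-isOrder _)

  rank-marked : ∀ x y → rank inside (pair (g x) x) y ≡ rank order x y
  rank-marked x y rewrite marked≡ (g x) x | eqS-refl (g x) | snd≡ (g x) x = refl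

  rank-unmarked : ∀ x a y → a ≢ g x → rank inside (pair a x) y ≡ toNat y
  rank-unmarked x a y ne rewrite marked≡ a x with eqS a (g x) in e
  ... | false = refl
  ... | true  = ⊥-elim (ne (eqS-sound a (g x) e))

  prefixed-acc : Str → Str → Bool
  prefixed-acc x w = eqS (takeL (g x) w) (g x) ∧ acc x (dropL (g x) w)

  prefixCL : CL f
  prefixCL = record
    { order = blockOrder
    ; poly  = mp :+ poly
    ; ruler≡ = λ x → trans (List.length-++ (g x)) (cong₂ _+_ (lg x) (ruler≡ x))
    ; good = λ x → blockOrder-good x (inside-good x)
    ; acc = prefixed-acc
    ; PB-acc = pf₂ (PB-∧ (ap₂ PB-eqS (ap₂ PF-takeL (ap₁ pg (PF-var zero)) (PF-var (suc zero))) (ap₁ pg (PF-var zero)))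
                         (ap₂ PB-acc (PF-var zero) (ap₂ PF-dropL (ap₁ pg (PF-var zero)) (PF-var (suc zero)))))
    ; interval = λ x → let lo , fits , spec = interval x in _ ,
        block-interval pg (PF-ruler order) inside x (g x) {acc″ = acc x} refl (inside-good x) fits
          (λ y ly → subst (λ r → (acc x y ≡ true) ⇔ InRange lo (f x) r) (sym (rank-marked x y)) (spec y ly))
          (λ w _ → mk⇔ (λ h → let a , b = ∧-true h in eqS-sound _ _ a , b) (λ (a , b) → ∧-intro (from eqS⇔ a) b)) }

module FromCLUSharpP {f : Str → ℕ} (c : CLUSharpP f) where
  p = proj₁ c
  M = proj₁ (proj₂ c)
  q = proj₁ (proj₂ (proj₂ c))
  bot = proj₁ (proj₂ (proj₂ (proj₂ (proj₂ c))))
  top = proj₁ (proj₂ (proj₂ (proj₂ (proj₂ (proj₂ c)))))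
  FPt-bot = proj₁ (proj₂ (proj₂ (proj₂ (proj₂ (proj₂ (proj₂ c))))))
  FPt-top = proj₁ (proj₂ (proj₂ (proj₂ (proj₂ (proj₂ (proj₂ (proj₂ c)))))))
  precL = proj₁ (proj₂ (proj₂ (proj₂ (proj₂ (proj₂ (proj₂ (proj₂ (proj₂ c))))))))
  InP-prec = proj₁ (proj₂ (proj₂ (proj₂ (proj₂ (proj₂ (proj₂ (proj₂ (proj₂ (proj₂ c)))))))))
  spec = proj₂ (proj₂ (proj₂ (proj₂ (proj₂ (proj₂ (proj₂ (proj₂ (proj₂ (proj₂ c)))))))))

  m : Str → ℕ
  m x = ⟦ p ⟧ (length x)

  hx : ∀ x → Vec Bool (m x) ⤖ Vec Bool (m x)
  hx x = proj₁ (proj₂ (proj₂ (spec x)))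

  h : ∀ x → Vec Bool (m x) → Vec Bool (m x)
  h x = Bijection.to (hx x)

  order : Order
  order = record
    { ruler = unary (fromPoly p) ; rank = λ x y → lexRank (h x (fit (m x) y)) ; first = λ x y → eqS y (bot x) ; last = λ x y → eqS y (top x)
    ; prec = λ x y z → precL ⟨ x , y , z ⟩ ; PF-ruler = PF-unary (fromPoly p)
    ; PB-first = pf₂ (ap₂ PB-eqS (PF-var (suc zero)) (ap₁ (FPt⇒PF FPt-bot) (PF-var zero)))
    ; PB-last = pf₂ (ap₂ PB-eqS (PF-var (suc zero)) (ap₁ (FPt⇒PF FPt-top) (PF-var zero)))
    ; PB-prec = pf₃ (ap₁ (InP⇒PB InP-prec) (un₃ PF-triple)) }

  ruler-m : ∀ x → length (unary (fromPoly p) x) ≡ m x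
  ruler-m x = trans (length-unary (fromPoly p) x) (fromPoly-eval p (length x))

  module _ (x : Str) where
    private
      rest = proj₂ (proj₂ (proj₂ (spec x)))
      N = m x

    rankV : Vec Bool N → ℕ
    rankV v = lexRank (h x v)

    rankV-inj : ∀ v w → rankV v ≡ rankV w → v ≡ w
    rankV-inj v w e = Bijection.injective (hx x) (lexRank-injective _ _ e)

    -- The definition only says where the end `e` is sent; since the rank is injective, no other
    -- string can be sent there.
    end⇔ : ∀ e y (P : Vec Bool N → Set) (Z : ℕ → Set) → length e ≡ N → length y ≡ N → (∀ v → toList v ≡ e → P (h x v)) →
      (∀ v → P v ⇔ Z (lexRank v)) → (∀ {i j} → Z i → Z j → i ≡ j) → (eqS y e ≡ true) ⇔ Z (rankV (fit N y))
    end⇔ e y P Z le ly ends char unique = mk⇔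
      (λ eq → to (char _) (ends _ (trans (toList-fit N y ly) (eqS-sound y e eq))))
      (λ z → from eqS⇔ (trans (sym (toList-fit N y ly)) (trans (cong toList (rankV-inj _ _ (unique z (to (char _) (ends _ (toList-fit N e le)))))) (toList-fit N e le))))

    prec-cong : ∀ {y z} → length y ≡ N → length z ≡ N → precL ⟨ x , toList (fit N y) , toList (fit N z) ⟩ ≡ precL ⟨ x , y , z ⟩
    prec-cong {y} {z} ly lz = cong₂ (λ s t → precL ⟨ x , s , t ⟩) (toList-fit N y ly) (toList-fit N z lz)

    isOrder : IsOrder N (rank order x) (first order x) (last order x) (prec order x)
    isOrder = record
      { rank<    = λ y _ → lexRank< (h x (fit N y))
      ; rank-inj = λ y z ly lz e → trans (sym (toList-fit N y ly)) (trans (cong toList (rankV-inj _ _ e)) (toList-fit N z lz))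
      ; first⇔   = λ y ly → end⇔ (bot x) y (λ v → v ≡ Vec.replicate N false) (λ i → i ≡ 0) (proj₁ (spec x)) ly (proj₁ rest) lexRank-zeros (λ a b → trans a (sym b))
      ; last⇔    = λ y ly → end⇔ (top x) y (λ v → v ≡ Vec.replicate N true) (λ i → suc i ≡ 2 ^ N) (proj₁ (proj₂ (spec x))) ly (proj₁ (proj₂ rest)) lexRank-ones
                     (λ a b → suc-injective (trans a (sym b)))
      ; prec⇔    = λ y z ly lz → mk⇔
          (λ e → to (≺lex⇔ _ _) (to (proj₁ (proj₂ (proj₂ rest)) (fit N y) (fit N z)) (trans (prec-cong ly lz) e)))
          (λ e → trans (sym (prec-cong ly lz)) (from (proj₁ (proj₂ (proj₂ rest)) (fit N y) (fit N z)) (from (≺lex⇔ _ _) e))) }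

    P : Vec Bool N → Bool
    P w = accB M q x (toList w)

    cluster : ∃[ lo ] lo + f x ≤ 2 ^ N × (∀ w → (P w ≡ true) ⇔ InRange lo (f x) (rankV w))
    cluster with f x ≟ 0
    -- No ends are given when the value is 0, but an empty interval may start anywhere.
    ... | yes z = 0 , subst (_≤ 2 ^ N) (sym z) z≤n , λ w → mk⇔
          (λ e → ⊥-elim (true≢false (trans (sym e) (count-zero P (trans (sym (proj₂ (proj₂ (proj₂ (proj₂ rest))))) z) w))))
          (λ (_ , b) → ⊥-elim (<⇒≱ b (subst (_≤ rankV w) (sym z) z≤n)))
    ... | no nz with proj₁ (proj₂ (proj₂ (proj₂ rest))) nz
    ... | ℓ , u , iff with rankV ℓ ≤? rankV u
    -- With `ℓ` above `u` nothing would be accepted, against `f x ≢ 0`.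
    ... | no gt = ⊥-elim (nz (trans (proj₂ (proj₂ (proj₂ (proj₂ rest)))) (count-none P λ w → bool-ext
            (λ e → let a , b = to (iff w) e in ⊥-elim (gt (≤-trans (to (≤lex⇔ _ _) a) (to (≤lex⇔ _ _) b)))) (λ ()))))
    ... | yes le = rankV ℓ , ≤-trans (≤-reflexive end) (lexRank< (h x u)) , range
      where
      k = suc (rankV u) ∸ rankV ℓ
      end' : rankV ℓ + k ≡ suc (rankV u)
      end' = m+[n∸m]≡n (≤-trans le (n≤1+n _))
      range' : ∀ w → (P w ≡ true) ⇔ InRange (rankV ℓ) k (rankV w)
      range' w = mk⇔ (λ e → let a , b = to (iff w) e in to (≤lex⇔ _ _) a , ≤-trans (s≤s (to (≤lex⇔ _ _) b)) (≤-reflexive (sym end')))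
                     (λ (a , b) → from (iff w) (from (≤lex⇔ _ _) a , from (≤lex⇔ _ _) (≤-pred (≤-trans b (≤-reflexive end')))))
      onto : ∀ i → i < 2 ^ N → ∃[ v ] rankV v ≡ i
      onto = injective⇒surjective rankV (λ v → lexRank< (h x v)) rankV-inj
      -- The width of the interval is determined by counting, as every rank below 2^N is taken
      -- exactly once.
      size≡ : f x ≡ k
      size≡ = trans (proj₂ (proj₂ (proj₂ (proj₂ rest)))) (trans (count-cong P (λ w → inRange (rankV ℓ) k (rankV w))
        (λ w → bool-ext (λ e → from (inRange⇔ _ _ _) (to (range' w) e)) (λ e → from (range' w) (to (inRange⇔ _ _ _) e))))
        (count-interval rankV rankV-inj onto (rankV ℓ) k (≤-trans (≤-reflexive end') (lexRank< (h x u)))))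
      end : rankV ℓ + f x ≡ suc (rankV u)
      end = trans (cong (rankV ℓ +_) size≡) end'
      range : ∀ w → (P w ≡ true) ⇔ InRange (rankV ℓ) (f x) (rankV w)
      range w = subst (λ j → (P w ≡ true) ⇔ InRange (rankV ℓ) j (rankV w)) (sym size≡) (range' w)

  toCL : CL f
  toCL = record
    { order = order ; poly = fromPoly p ; ruler≡ = λ x → length-unary (fromPoly p) x
    ; good = λ x → subst (λ n → IsOrder n (rank order x) (first order x) (last order x) (prec order x)) (sym (ruler-m x)) (isOrder x)
    ; acc = accepts M q ; PB-acc = PB-accepts M q
    ; interval = λ x → let lo , fits , range = cluster x in
        lo , ≤-trans fits (≤-reflexive (cong (2 ^_) (sym (ruler-m x)))) , λ y ly →
        let same = trans (accepts≡accB M q x y) (cong (accB M q x) (sym (toList-fit (m x) y (trans ly (ruler-m x))))) in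
        mk⇔ (λ e → to (range (fit (m x) y)) (trans (sym same) e)) (λ r → trans same (from (range (fit (m x) y)) r)) }

-- The prefix 01 frees the two ends 0…0 and 1…1, so that the extreme elements become computable.
module ToCLUSharpP {f : Str → ℕ} (C₀ : CL f) where
  private
    g : Str → Str
    g _ = false ∷ true ∷ []

    module G = Prefix C₀ (con 2) {g} (pf₁ (PF-const (false ∷ true ∷ []))) (λ _ → refl)

    C : CL f
    C = G.prefixCL

    open CL C

    opaque
      P : Poly
      P = toPoly poly

      P-eval : ∀ k → ⟦ P ⟧ k ≡ ⟪ poly ⟫ k
      P-eval = toPoly-eval poly

    m : Str → ℕ
    m x = ⟦ P ⟧ (length x)

    m≡poly : ∀ x → m x ≡ ⟪ poly ⟫ (length x)
    m≡poly x = P-eval (length x)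

    bits≡m : ∀ x → bits x ≡ m x
    bits≡m x = trans (ruler≡ x) (sym (m≡poly x))

    n : Str → ℕ
    n x = CL.bits C₀ x

    -- A constant string begins with 00 or 11 and so lies in a lexicographic block; by `toNat-++`
    -- its rank is then its value as a binary number.
    outside : ∀ x (b : Bool) → rank order x (List.replicate (bits x) b) ≡ toNat (List.replicate (bits x) b)
    outside x b = begin
      rank order x (b ∷ b ∷ ys)
        ≡⟨ cong₂ (λ a y → toNat a * 2 ^ n x + rank G.inside (pair a x) y) (takeL-++ (g x) (b ∷ b ∷ []) ys refl) (dropL-++ (g x) (b ∷ b ∷ []) ys refl) ⟩
      toNat (b ∷ b ∷ []) * 2 ^ n x + rank G.inside (pair (b ∷ b ∷ []) x) ys
        ≡⟨ cong (toNat (b ∷ b ∷ []) * 2 ^ n x +_) (G.rank-unmarked x (b ∷ b ∷ []) ys (differ b)) ⟩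
      toNat (b ∷ b ∷ []) * 2 ^ n x + toNat ys
        ≡⟨ cong (λ k → toNat (b ∷ b ∷ []) * 2 ^ k + toNat ys) (List.length-replicate (n x)) ⟨
      toNat (b ∷ b ∷ []) * 2 ^ length ys + toNat ys
        ≡⟨ toNat-++ (b ∷ b ∷ []) ys ⟨
      toNat (b ∷ b ∷ ys) ∎
      where
      open ≡-Reasoning
      ys = List.replicate (n x) b
      differ : ∀ b → b ∷ b ∷ [] ≢ false ∷ true ∷ []
      differ false ()
      differ true  ()

    bot top : Str → Str
    bot x = zerosLike (ruler order x)
    top x = onesLike (ruler order x)

    rank-bot : ∀ x → rank order x (bot x) ≡ 0
    rank-bot x = trans (cong (rank order x) (zerosLike≡ (ruler order x))) (trans (outside x false) (toNat-falses (bits x)))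

    rank-top : ∀ x → suc (rank order x (top x)) ≡ 2 ^ bits x
    rank-top x = trans (cong (λ s → suc (rank order x s)) (onesLike≡ (ruler order x))) (trans (cong suc (outside x true)) (toNat-trues (bits x)))

    precL : Str → Bool
    precL s = prec order (fst³ s) (snd³ s) (thd³ s)

    PB-precL : PB₁ precL
    PB-precL = pf₁ (ap₃ (PB-prec order) (un₁ PF-fst³) (un₁ PF-snd³) (un₁ PF-thd³))

    M = verifier poly acc PB-acc
    q = verifierTime poly acc PB-acc

    balanced : Balanced M P q
    balanced x w = _ , verifier-full poly acc PB-acc x (toList w) (trans (length-toList w) (m≡poly x))

    module _ (x : Str) where
      N = m x

      good' : IsOrder N (rank order x) (first order x) (last order x) (prec order x)
      good' = subst (λ k → IsOrder k (rank order x) (first order x) (last order x) (prec order x)) (bits≡m x) (good x)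

      open IsOrder good'

      rankV : Vec Bool N → ℕ
      rankV v = rank order x (toList v)

      rankV< : ∀ v → rankV v < 2 ^ N
      rankV< v = rank< (toList v) (length-toList v)

      rankV-inj : ∀ v w → rankV v ≡ rankV w → v ≡ w
      rankV-inj v w e = toList-injective v w (rank-inj _ _ (length-toList v) (length-toList w) e)

      onto : ∀ i → i < 2 ^ N → ∃[ v ] rankV v ≡ i
      onto = injective⇒surjective rankV rankV< rankV-inj

      -- The bijection is recovered from the ranks, as the vector whose lexicographic position is
      -- the given rank. It only has to exist.
      h : Vec Bool N → Vec Bool N
      h v = proj₁ (lexRank-surjective N (rankV v) (rankV< v))

      h-rank : ∀ v → lexRank (h v) ≡ rankV v
      h-rank v = proj₂ (lexRank-surjective N (rankV v) (rankV< v))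

      bijection : Vec Bool N ⤖ Vec Bool N
      bijection = mk⤖ {to = h} ((λ {v} {w} e → rankV-inj v w (trans (sym (h-rank v)) (trans (cong lexRank e) (h-rank w)))) ,
        λ w → let v , e = onto (lexRank w) (lexRank< w) in v , λ { refl → lexRank-injective _ _ (trans (h-rank v) e) })

      range : ∃[ lo ] lo + f x ≤ 2 ^ N × (∀ w → (accB M q x (toList w) ≡ true) ⇔ InRange lo (f x) (rankV w))
      range = let lo , fits , iff = interval x in lo , subst (λ k → lo + f x ≤ 2 ^ k) (bits≡m x) fits , λ w →
        let same = verifier-accB poly acc PB-acc x (toList w) (trans (length-toList w) (m≡poly x))
            lw = trans (length-toList w) (sym (bits≡m x))
        in mk⇔ (λ e → to (iff (toList w) lw) (trans (sym same) e)) (λ r → trans same (from (iff (toList w) lw) r))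

      cluster : f x ≢ 0 → Σ (Vec Bool N) λ ℓ → Σ (Vec Bool N) λ u → ∀ w → (accB M q x (toList w) ≡ true) ⇔ (h ℓ ≤lex h w × h w ≤lex h u)
      cluster nz = ℓ , u , λ w → mk⇔
          (λ e → let a , b = to (iff w) e in from (≤lex⇔ _ _) (≤-trans (≤-reflexive hℓ) (≤-trans a (≤-reflexive (sym (h-rank w))))) ,
            from (≤lex⇔ _ _) (≤-trans (≤-reflexive (h-rank w)) (≤-pred (≤-trans b (≤-reflexive (sym hu))))))
          (λ (a , b) → from (iff w) (≤-trans (≤-reflexive (sym hℓ)) (≤-trans (to (≤lex⇔ _ _) a) (≤-reflexive (h-rank w))) ,
            ≤-trans (s≤s (≤-trans (≤-reflexive (sym (h-rank w))) (to (≤lex⇔ _ _) b))) (≤-reflexive hu)))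
        where
        lo = proj₁ range
        fits = proj₁ (proj₂ range)
        iff = proj₂ (proj₂ range)
        -- The definition of the class includes the upper end `u` in the cluster, whereas `InRange`
        -- excludes its bound; `f x` is nonzero here.
        hi = lo + pred (f x)
        hi≡ : suc hi ≡ lo + f x
        hi≡ = trans (sym (+-suc lo _)) (cong (lo +_) (suc-pred (f x) {{≢-nonZero nz}}))
        lo< : lo < 2 ^ N
        lo< = ≤-trans (s≤s (m≤m+n lo _)) (≤-trans (≤-reflexive hi≡) fits)
        hi< : hi < 2 ^ N
        hi< = ≤-trans (≤-reflexive hi≡) fits
        ℓ = proj₁ (onto lo lo<)
        u = proj₁ (onto hi hi<)
        hℓ : lexRank (h ℓ) ≡ lo
        hℓ = trans (h-rank ℓ) (proj₂ (onto lo lo<))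
        hu : suc (lexRank (h u)) ≡ lo + f x
        hu = trans (cong suc (trans (h-rank u) (proj₂ (onto hi hi<)))) hi≡

      counted : f x ≡ count {N} (λ w → accB M q x (toList w))
      counted = let lo , fits , iff = range in sym (trans (count-cong _ (λ w → inRange lo (f x) (rankV w))
        (λ w → bool-ext (λ e → from (inRange⇔ _ _ _) (to (iff w) e)) (λ e → from (iff w) (to (inRange⇔ _ _ _) e))))
        (count-interval rankV rankV-inj onto lo (f x) fits))

      precL≡ : ∀ y z → precL ⟨ x , y , z ⟩ ≡ prec order x y z
      precL≡ y z = cong₃ (prec order) (fst³-triple x y z) (snd³-triple x y z) (thd³-triple x y z)
        where
        cong₃ : ∀ (F : Str → Str → Str → Bool) {a a' b b' c c'} → a ≡ a' → b ≡ b' → c ≡ c' → F a b c ≡ F a' b' c'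
        cong₃ F refl refl refl = refl

      adjacent : ∀ y z → (precL ⟨ x , toList y , toList z ⟩ ≡ true) ⇔ (h y ≺lex h z)
      adjacent y z = mk⇔
        (λ e → from (≺lex⇔ _ _) (trans (cong suc (h-rank y)) (trans (to adj (trans (sym (precL≡ (toList y) (toList z))) e)) (sym (h-rank z)))))
        (λ l → trans (precL≡ (toList y) (toList z)) (from adj (trans (cong suc (sym (h-rank y))) (trans (to (≺lex⇔ _ _) l) (h-rank z)))))
        where adj = prec⇔ (toList y) (toList z) (length-toList y) (length-toList z)

  toCLUSharpP : CLUSharpP f
  toCLUSharpP = P , M , q , balanced , bot , top , PF⇒FPt (pf₁ (ap₁ PF-zerosLike (un₁ (PF-ruler order)))) , PF⇒FPt (pf₁ (ap₁ PF-onesLike (un₁ (PF-ruler order)))) ,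
    precL , PB⇒InP PB-precL , λ x →
      trans (length-zerosLike (ruler order x)) (bits≡m x) , trans (length-onesLike (ruler order x)) (bits≡m x) , bijection x ,
      (λ v e → from (lexRank-zeros _) (trans (h-rank x v) (trans (cong (rank order x) e) (rank-bot x)))) ,
      (λ v e → from (lexRank-ones _) (trans (cong suc (trans (h-rank x v) (cong (rank order x) e))) (trans (rank-top x) (cong (2 ^_) (bits≡m x))))) ,
      adjacent x , cluster x , counted x

-- Unique witnesses

CL-ext : ∀ {f g} → (∀ x → f x ≡ g x) → CL f → CL g
CL-ext {f} {g} eq C = record
  { order = order ; poly = poly ; ruler≡ = ruler≡ ; good = good ; acc = acc ; PB-acc = PB-acc
  ; interval = λ x → subst (λ k → ∃[ lo ] lo + k ≤ 2 ^ bits x × (∀ y → length y ≡ bits x → (acc x y ≡ true) ⇔ InRange lo k (CL.order C .rank x y))) (eq x) (interval x) }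
  where open CL C

UP-ext : ∀ {A B} → (∀ x → A x ≡ B x) → UP A → UP B
UP-ext eq (M , q , n , u , iff) = M , q , n , u , λ x →
  mk⇔ (λ b → to (iff x) (trans (eq x) b)) (λ p → trans (sym (eq x)) (from (iff x) p))

splitting : ∀ u (w : Str) {n} → length w ≡ length u + n → length (takeL u w) ≡ length u × length (dropL u w) ≡ n
splitting u w {n} l = length-takeL u w (≤-trans (m≤m+n _ n) (≤-reflexive (sym l))) ,
  trans (length-dropL u w) (trans (cong (_∸ length u) l) (m+n∸m≡n (length u) n))

rejoin : ∀ u (w w' : Str) {n} → length w ≡ length u + n → length w' ≡ length u + n → takeL u w ≡ takeL u w' → dropL u w ≡ dropL u w' → w ≡ w'
rejoin u w w' {n} l l' p q = trans (sym (takeL-dropL u w (long w l))) (trans (cong₂ _++_ p q) (takeL-dropL u w' (long w' l')))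
  where
  long : ∀ (v : Str) → length v ≡ length u + n → length u ≤ length v
  long v e = ≤-trans (m≤m+n _ n) (≤-reflexive (sym e))

module Product (u v : Unambiguous) where
  part₁ part₂ : Str → Str → Str
  part₁ x w = takeL (unary (len u) x) w
  part₂ x w = dropL (unary (len u) x) w

  PF-part₁ : PF₂ part₁
  PF-part₁ = pf₂ (ap₂ PF-takeL (ap₁ (PF-unary (len u)) (PF-var zero)) (PF-var (suc zero)))

  PF-part₂ : PF₂ part₂
  PF-part₂ = pf₂ (ap₂ PF-dropL (ap₁ (PF-unary (len u)) (PF-var zero)) (PF-var (suc zero)))

  module _ (x w : Str) (l : length w ≡ ⟪ len u :+ len v ⟫ (length x)) where
    length-split : length w ≡ length (unary (len u) x) + ⟪ len v ⟫ (length x)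
    length-split = trans l (cong (_+ ⟪ len v ⟫ (length x)) (sym (length-unary (len u) x)))

    length-part₁ : length (part₁ x w) ≡ ⟪ len u ⟫ (length x)
    length-part₁ = trans (proj₁ (splitting (unary (len u) x) w length-split)) (length-unary (len u) x)

    length-part₂ : length (part₂ x w) ≡ ⟪ len v ⟫ (length x)
    length-part₂ = proj₂ (splitting (unary (len u) x) w length-split)

  product : Unambiguous
  product = record
    { len = len u :+ len v
    ; valid = λ x w → valid u x (part₁ x w) ∧ valid v x (part₂ x w)
    ; PB-valid = pf₂ (PB-∧ (ap₂ (PB-valid u) (PF-var zero) (un₂ PF-part₁)) (ap₂ (PB-valid v) (PF-var zero) (un₂ PF-part₂)))
    ; unique = λ x w w' (l , h) (l' , h') → let a , b = ∧-true h ; a' , b' = ∧-true h' in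
        rejoin (unary (len u) x) w w' (length-split x w l) (length-split x w' l')
          (unique u x _ _ (length-part₁ x w l , a) (length-part₁ x w' l' , a')) (unique v x _ _ (length-part₂ x w l , b) (length-part₂ x w' l' , b')) }

  unpair : ∀ x w → Witness product x w → Witness u x (part₁ x w) × Witness v x (part₂ x w)
  unpair x w (l , h) = let a , b = ∧-true h in (length-part₁ x w l , a) , (length-part₂ x w l , b)

  part₁-++ : ∀ x a b → Witness u x a → part₁ x (a ++ b) ≡ a
  part₁-++ x a b (l , _) = takeL-++ (unary (len u) x) a b (trans l (sym (length-unary (len u) x)))

  part₂-++ : ∀ x a b → Witness u x a → part₂ x (a ++ b) ≡ b
  part₂-++ x a b (l , _) = dropL-++ (unary (len u) x) a b (trans l (sym (length-unary (len u) x)))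

  join-witness : ∀ x a b → Witness u x a → Witness v x b → Witness product x (a ++ b)
  join-witness x a b wa@(l , h) (l' , h') = trans (List.length-++ a) (cong₂ _+_ l l') ,
    ∧-intro (trans (cong (valid u x) (part₁-++ x a b wa)) h) (trans (cong (valid v x) (part₂-++ x a b wa)) h')

restrict : ∀ (u : Unambiguous) {b} → PB₂ b → Unambiguous
restrict u {b} pb = record
  { len = len u ; valid = λ x w → valid u x w ∧ b x w ; PB-valid = pf₂ (PB-∧ (un₂ (PB-valid u)) (un₂ pb))
  ; unique = λ x w w' (l , h) (l' , h') → unique u x w w' (l , proj₁ (∧-true h)) (l' , proj₁ (∧-true h')) }

-- A tag bit says which alternative is witnessed; the other field is filled with zeros.
module Alternative (u v : Unambiguous) (disjoint : ∀ x w w' → Witness u x w → Witness v x w' → ⊥) where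
  field₁ field₂ : Str → Str → Str
  field₁ x w = takeL (unary (len u) x) (tailS w)
  field₂ x w = dropL (unary (len u) x) (tailS w)

  PF-field₁ : PF₂ field₁
  PF-field₁ = pf₂ (ap₂ PF-takeL (ap₁ (PF-unary (len u)) (PF-var zero)) (ap₁ PF-tailS (PF-var (suc zero))))

  PF-field₂ : PF₂ field₂
  PF-field₂ = pf₂ (ap₂ PF-dropL (ap₁ (PF-unary (len u)) (PF-var zero)) (ap₁ PF-tailS (PF-var (suc zero))))

  tagged : Str → Str → Bool
  tagged x w = if headB w then valid u x (field₁ x w) ∧ isZeros (field₂ x w) else isZeros (field₁ x w) ∧ valid v x (field₂ x w)

  private
    total : PolyExp
    total = con 1 :+ (len u :+ len v)

    lengths : ∀ x (b : Bool) (w : Str) → length (b ∷ w) ≡ ⟪ total ⟫ (length x) → length w ≡ length (unary (len u) x) + ⟪ len v ⟫ (length x)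
    lengths x b w l = trans (suc-injective l) (cong (_+ ⟪ len v ⟫ (length x)) (sym (length-unary (len u) x)))

    l₁ : ∀ x (b : Bool) (w : Str) → length (b ∷ w) ≡ ⟪ total ⟫ (length x) → length (field₁ x (b ∷ w)) ≡ ⟪ len u ⟫ (length x)
    l₁ x b w l = trans (proj₁ (splitting (unary (len u) x) w (lengths x b w l))) (length-unary (len u) x)

    l₂ : ∀ x (b : Bool) (w : Str) → length (b ∷ w) ≡ ⟪ total ⟫ (length x) → length (field₂ x (b ∷ w)) ≡ ⟪ len v ⟫ (length x)
    l₂ x b w l = proj₂ (splitting (unary (len u) x) w (lengths x b w l))

    zeros-unique : ∀ (s t : Str) → isZeros s ≡ true → isZeros t ≡ true → length s ≡ length t → s ≡ t
    zeros-unique s t h k l = toNat-injective s t l (trans (to (isZeros⇔ s) h) (sym (to (isZeros⇔ t) k)))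

  untag : ∀ x w → length w ≡ ⟪ total ⟫ (length x) → tagged x w ≡ true →
    (headB w ≡ true × Witness u x (field₁ x w) × isZeros (field₂ x w) ≡ true) ⊎ (headB w ≡ false × isZeros (field₁ x w) ≡ true × Witness v x (field₂ x w))
  untag x (true ∷ w)  l h = let a , b = ∧-true h in inj₁ (refl , (l₁ x true w l , a) , b)
  untag x (false ∷ w) l h = let a , b = ∧-true h in inj₂ (refl , a , (l₂ x false w l , b))

  alternative : Unambiguous
  alternative = record
    { len = total ; valid = tagged
    ; PB-valid = pf₂ (PB-if (ap₁ PB-headB (PF-var (suc zero)))
        (PB-∧ (ap₂ (PB-valid u) (PF-var zero) (un₂ PF-field₁)) (ap₁ PB-isZeros (un₂ PF-field₂)))
        (PB-∧ (ap₁ PB-isZeros (un₂ PF-field₁)) (ap₂ (PB-valid v) (PF-var zero) (un₂ PF-field₂))))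
    ; unique = uniq }
    where
    uniq : ∀ x w w' → length w ≡ ⟪ total ⟫ (length x) × tagged x w ≡ true → length w' ≡ ⟪ total ⟫ (length x) × tagged x w' ≡ true → w ≡ w'
    uniq x (b ∷ w) (b' ∷ w') (l , h) (l' , h') with untag x (b ∷ w) l h | untag x (b' ∷ w') l' h'
    ... | inj₁ (refl , p , z) | inj₁ (refl , p' , z') = cong (true ∷_) (rejoin (unary (len u) x) w w' (lengths x true w l) (lengths x true w' l')
          (unique u x _ _ p p') (zeros-unique (field₂ x (true ∷ w)) (field₂ x (true ∷ w')) z z' (trans (l₂ x true w l) (sym (l₂ x true w' l')))))
    ... | inj₂ (refl , z , p) | inj₂ (refl , z' , p') = cong (false ∷_) (rejoin (unary (len u) x) w w' (lengths x false w l) (lengths x false w' l')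
          (zeros-unique (field₁ x (false ∷ w)) (field₁ x (false ∷ w')) z z' (trans (l₁ x false w l) (sym (l₁ x false w' l')))) (unique v x _ _ p p'))
    ... | inj₁ (_ , p , _) | inj₂ (_ , _ , p') = ⊥-elim (disjoint x _ _ p p')
    ... | inj₂ (_ , _ , p) | inj₁ (_ , p' , _) = ⊥-elim (disjoint x _ _ p' p)

  private
    zeros-valid : ∀ p x → isZeros (zerosLike (unary p x)) ≡ true
    zeros-valid p x = from (isZeros⇔ (zerosLike (unary p x))) (trans (cong toNat (zerosLike≡ (unary p x))) (toNat-falses (length (unary p x))))

    zeros-length : ∀ p x → length (zerosLike (unary p x)) ≡ ⟪ p ⟫ (length x)
    zeros-length p x = trans (length-zerosLike (unary p x)) (length-unary p x)

  tag₁ : ∀ x w → Witness u x w → ∃[ w' ] Witness alternative x w'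
  tag₁ x w (l , h) = true ∷ w ++ z , cong suc (trans (List.length-++ w) (cong₂ _+_ l (zeros-length (len v) x))) ,
    ∧-intro (trans (cong (valid u x) (takeL-++ (unary (len u) x) w z l')) h) (trans (cong isZeros (dropL-++ (unary (len u) x) w z l')) (zeros-valid (len v) x))
    where
    z = zerosLike (unary (len v) x)
    l' = trans l (sym (length-unary (len u) x))

  tag₂ : ∀ x w → Witness v x w → ∃[ w' ] Witness alternative x w'
  tag₂ x w (l , h) = false ∷ z ++ w , cong suc (trans (List.length-++ z) (cong₂ _+_ (zeros-length (len u) x) l)) ,
    ∧-intro (trans (cong isZeros (takeL-++ (unary (len u) x) z w l')) (zeros-valid (len u) x)) (trans (cong (valid v x) (dropL-++ (unary (len u) x) z w l')) h)
    where
    z = zerosLike (unary (len u) x)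
    l' = length-zerosLike (unary (len u) x)

-- The cluster consists of the strings w ++ y with y below the value at the witness w.
module _ {f : Str → ℕ} (u : Unambiguous) {o : Str → Str → Str} (po : PF₂ o)
         (value : ∀ x w → Witness u x w → f x ≡ decodeℕ (o x w)) (zero-value : ∀ x → (∀ w → ¬ Witness u x w) → f x ≡ 0)
         (dec : ∀ x → (∃[ w ] Witness u x w) ⊎ (∀ w → ¬ Witness u x w)) where
  private
    -- Long enough for any value: the bound on the output of `o` at an input together with a witness
    -- of the prescribed length. The final `con 0` is the size of the empty rest of the argument
    -- vector.
    s : PolyExp
    s = bound (un₂ po) :∘ (X :+ (len u :+ con 0))

    inner : Order
    inner = lexOrder {λ d → unary s (snd³ d)} (pf₁ (ap₁ (PF-unary s) (un₁ PF-snd³)))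

    module O = BlockOrder (PF-unary (len u)) (PF-unary s) inner

    head₁ rest₁ : Str → Str → Str
    head₁ x w = takeL (unary (len u) x) w
    rest₁ x w = dropL (unary (len u) x) w

    below : Str → Str → Str → Bool
    below x a y = ltS y (widen y (o x a))

    PF-head₁ : PF {2} (λ v → head₁ (lookup v zero) (lookup v (suc zero)))
    PF-head₁ = ap₂ PF-takeL (ap₁ (PF-unary (len u)) (PF-var zero)) (PF-var (suc zero))

    PF-rest₁ : PF {2} (λ v → rest₁ (lookup v zero) (lookup v (suc zero)))
    PF-rest₁ = ap₂ PF-dropL (ap₁ (PF-unary (len u)) (PF-var zero)) (PF-var (suc zero))

    accept : Str → Str → Bool
    accept x w = valid u x (head₁ x w) ∧ below x (head₁ x w) (rest₁ x w)

    inner-good : ∀ x a → length a ≡ length (unary (len u) x) → length (ruler inner (pair a x)) ≡ length (unary s x) × Good inner (pair a x)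
    inner-good x a _ = cong (λ y → length (unary s y)) (snd³-triple a x []) , lex-isOrder _

    ruler-length : ∀ x → length (unary (len u) x ++ unary s x) ≡ length (unary (len u) x) + length (unary s x)
    ruler-length x = List.length-++ (unary (len u) x)

    cluster : ∀ x → (∃[ w ] Witness u x w) ⊎ (∀ w → ¬ Witness u x w) → ∃[ lo ] lo + f x ≤ 2 ^ length (unary (len u) x ++ unary s x) ×
      (∀ y → length y ≡ length (unary (len u) x ++ unary s x) → (accept x y ≡ true) ⇔ InRange lo (f x) (rank O.blockOrder x y))
    cluster x (inj₂ none) = 0 , subst (_≤ 2 ^ length (unary (len u) x ++ unary s x)) (sym (zero-value x none)) z≤n , λ y ly → mk⇔
      (λ h → ⊥-elim (none _ (trans (proj₁ (splitting (unary (len u) x) y (trans ly (ruler-length x)))) (length-unary (len u) x) , proj₁ (∧-true h))))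
      (λ (_ , b) → ⊥-elim (<⇒≱ b (subst (_≤ rank O.blockOrder x y) (sym (zero-value x none)) z≤n)))
    cluster x (inj₁ (w , wit@(lw , vw))) = _ ,
      block-interval (PF-unary (len u)) (PF-unary s) inner x w {acc″ = below x w} (trans lw (sym (length-unary (len u) x))) (inner-good x)
        fits below⇔
        (λ v lv → mk⇔ (λ h → let a , b = ∧-true h
                                 e = unique u x _ _ (trans (proj₁ (splitting (unary (len u) x) v (trans lv (ruler-length x)))) (length-unary (len u) x) , a) wit
                             in e , subst (λ a → below x a (rest₁ x v) ≡ true) e b)
                      (λ (e , h) → ∧-intro (trans (cong (valid u x) e) vw) (trans (cong (λ a → below x a (rest₁ x v)) e) h)))
      where
      val≡ : f x ≡ toNat (o x w)
      val≡ = trans (value x w wit) (decodeℕ≡toNat (o x w))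
      short : length (o x w) ≤ length (unary s x)
      short = ≤-trans (PF-out (un₂ po) (x ∷ w ∷ [])) (≤-reflexive (trans (cong (λ k → ⟪ bound (un₂ po) ⟫ (length x + (k + 0))) lw) (sym (length-unary s x))))
      fits : f x ≤ 2 ^ length (unary s x)
      fits = ≤-trans (≤-reflexive val≡) (≤-trans (<⇒≤ (toNat< (o x w))) (^-monoʳ-≤ 2 short))
      below⇔ : ∀ y → length y ≡ length (unary s x) → (below x w y ≡ true) ⇔ InRange 0 (f x) (toNat y)
      below⇔ y ly = mk⇔ (λ h → z≤n , ≤-trans (to lt h) (≤-reflexive same)) (λ (_ , h) → from lt (≤-trans h (≤-reflexive (sym same))))
        where
        short' = ≤-trans short (≤-reflexive (sym ly))
        lt = ltS⇔ y (widen y (o x w)) (sym (length-widen y (o x w) short'))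
        same : toNat (widen y (o x w)) ≡ f x
        same = trans (toNat-widen y (o x w) short') (sym val≡)

  countCL : CL f
  countCL = record
    { order = O.blockOrder ; poly = len u :+ s
    ; ruler≡ = λ x → trans (ruler-length x) (cong₂ _+_ (length-unary (len u) x) (length-unary s x))
    ; good = λ x → O.blockOrder-good x (inner-good x)
    ; acc = accept
    ; PB-acc = pf₂ (PB-∧ (ap₂ (PB-valid u) (PF-var zero) PF-head₁) (ap₂ PB-ltS PF-rest₁ (ap₂ PF-widen PF-rest₁ (ap₂ po (PF-var zero) PF-head₁))))
    ; interval = λ x → cluster x (dec x) }

UPSVtℕ⇒CL : ∀ {g} → UPSVtℕ g → CL g
UPSVtℕ⇒CL (g' , up , eq) with UPSVt⇒Unambiguous up
... | u , o , po , ex , val = countCL u po (λ x w wit → trans (eq x) (cong decodeℕ (val x w wit)))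
  (λ x none → ⊥-elim (none _ (proj₂ (ex x)))) (λ x → inj₁ (ex x))

charCL : ∀ {A} → UP A → CL (λ x → indicator (A x))
charCL {A} up with UP⇒Unambiguous up
... | u , iff = countCL u {λ _ _ → true ∷ []} (pf₂ (PF-const (true ∷ []))) (λ x w wit → cong indicator (from (iff x) (w , wit))) none (λ x → decide x (A x) refl)
  where
  none : ∀ x → (∀ w → ¬ Witness u x w) → indicator (A x) ≡ 0
  none x n with A x in e
  ... | false = refl
  ... | true  = let w , wit = to (iff x) e in ⊥-elim (n w wit)
  decide : ∀ x b → A x ≡ b → (∃[ w ] Witness u x w) ⊎ (∀ w → ¬ Witness u x w)
  decide x true  e = inj₁ (to (iff x) e)
  decide x false e = inj₂ (λ w wit → true≢false (trans (sym (from (iff x) (w , wit))) e))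

-- Ends of clusters

-- The ends of the cluster, together with their cyclic neighbours outside it,
-- are the unique witnesses of its being nonempty.
module Edges {f : Str → ℕ} (C : CL f) where
  open CL C

  half₁ half₂ : Str → Str → Str
  half₁ x w = takeL (ruler order x) w
  half₂ x w = dropL (ruler order x) w

  PF-half₁ : PF₂ half₁
  PF-half₁ = pf₂ (ap₂ PF-takeL (ap₁ (PF-ruler order) (PF-var zero)) (PF-var (suc zero)))

  PF-half₂ : PF₂ half₂
  PF-half₂ = pf₂ (ap₂ PF-dropL (ap₁ (PF-ruler order) (PF-var zero)) (PF-var (suc zero)))

  private
    halves : ∀ x (w : Str) → length w ≡ ⟪ poly :+ poly ⟫ (length x) → length w ≡ bits x + bits x
    halves x w l = trans l (sym (cong₂ _+_ (ruler≡ x) (ruler≡ x)))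

  length-half₁ : ∀ x w → length w ≡ ⟪ poly :+ poly ⟫ (length x) → length (half₁ x w) ≡ bits x
  length-half₁ x w l = proj₁ (splitting (ruler order x) w (halves x w l))

  length-half₂ : ∀ x w → length w ≡ ⟪ poly :+ poly ⟫ (length x) → length (half₂ x w) ≡ bits x
  length-half₂ x w l = proj₂ (splitting (ruler order x) w (halves x w l))

  -- In `upperValid` the halves are the top of the cluster and its successor, in `lowerValid` the
  -- predecessor and the bottom; in both cases the order is later cut behind the first half. If the
  -- end of the cluster is an extreme string, its cyclic neighbour lies at the other extreme and may
  -- be accepted as well, hence the disjunction.
  upperValid lowerValid : Str → Str → Bool
  upperValid x w = acc x (half₁ x w) ∧ (around order x (half₁ x w) (half₂ x w) ∧ (last order x (half₁ x w) ∨ not (acc x (half₂ x w))))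
  lowerValid x w = acc x (half₂ x w) ∧ (around order x (half₁ x w) (half₂ x w) ∧ (first order x (half₂ x w) ∨ not (acc x (half₁ x w))))

  module _ (x : Str) where
    open IsOrder (good x)
    open IsOrderProperties (good x)
    private
      N = bits x
      r = rank order x
      Lo = proj₁ (interval x)
      fits = proj₁ (proj₂ (interval x))
      iff = proj₂ (proj₂ (interval x))

    onto : ∀ i → i < 2 ^ N → ∃[ y ] length y ≡ N × r y ≡ i
    onto i h = let v , e = injective⇒surjective (λ v → r (toList v)) (λ v → rank< (toList v) (length-toList v))
                             (λ v w e → toList-injective v w (rank-inj _ _ (length-toList v) (length-toList w) e)) i h
               in toList v , length-toList v , e

    next-unique : ∀ b c c' → length b ≡ N → length c ≡ N → length c' ≡ N → around order x b c ≡ true → around order x b c' ≡ true → c ≡ c'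
    next-unique b c c' lb lc lc' h h' with cyclic⇒ b c lb lc h | cyclic⇒ b c' lb lc' h'
    ... | inj₁ p       | inj₁ p'       = rank-inj c c' lc lc' (trans (sym p) p')
    ... | inj₂ (_ , p) | inj₂ (_ , p') = rank-inj c c' lc lc' (trans p (sym p'))
    ... | inj₁ p       | inj₂ (q , _)  = ⊥-elim (<⇒≢ (rank< c lc) (trans (sym p) q))
    ... | inj₂ (q , _) | inj₁ p        = ⊥-elim (<⇒≢ (rank< c' lc') (trans (sym p) q))

    previous-unique : ∀ a a' b → length a ≡ N → length a' ≡ N → length b ≡ N → around order x a b ≡ true → around order x a' b ≡ true → a ≡ a'
    previous-unique a a' b la la' lb h h' with cyclic⇒ a b la lb h | cyclic⇒ a' b la' lb h'
    ... | inj₁ p       | inj₁ p'       = rank-inj a a' la la' (suc-injective (trans p (sym p')))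
    ... | inj₂ (p , _) | inj₂ (p' , _) = rank-inj a a' la la' (suc-injective (trans p (sym p')))
    ... | inj₁ p       | inj₂ (_ , q)  = ⊥-elim (1+n≢0 (trans p q))
    ... | inj₂ (_ , q) | inj₁ p        = ⊥-elim (1+n≢0 (trans p q))

    next-exists : ∀ b → length b ≡ N → ∃[ c ] length c ≡ N × around order x b c ≡ true × (suc (r b) ≡ r c ⊎ suc (r b) ≡ 2 ^ N)
    next-exists b lb with m≤n⇒m<n∨m≡n (rank< b lb)
    ... | inj₁ lt = let c , lc , e = onto (suc (r b)) lt in c , lc , cyclic⇐ b c lb lc (inj₁ (sym e)) , inj₁ (sym e)
    ... | inj₂ eq = let c , lc , e = onto 0 (≤-trans (s≤s z≤n) (rank< b lb)) in c , lc , cyclic⇐ b c lb lc (inj₂ (eq , e)) , inj₂ eq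

    previous-exists : ∀ b → length b ≡ N → ∃[ a ] length a ≡ N × around order x a b ≡ true × (suc (r a) ≡ r b ⊎ r b ≡ 0)
    previous-exists b lb with r b in e
    ... | suc i = let a , la , e' = onto i (≤-trans (n≤1+n (suc i)) (subst (_< 2 ^ N) e (rank< b lb)))
                      s = cong suc e'
                  in a , la , cyclic⇐ a b la lb (inj₁ (trans s (sym e))) , inj₁ s
    ... | zero  = let a , la , e' = onto (pred (2 ^ N)) (≤-reflexive (suc-pred (2 ^ N) {{m^n≢0 2 N}})) in
                  a , la , cyclic⇐ a b la lb (inj₂ (trans (cong suc e') (suc-pred (2 ^ N) {{m^n≢0 2 N}}) , e)) , inj₂ refl

    -- If the rank after that of `b` still belonged to the interval, `b` would not be the last
    -- string and its successor `c` would be accepted, so both alternatives of the final test would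
    -- fail.
    upper-end : ∀ b c → length b ≡ N → length c ≡ N → acc x b ∧ (around order x b c ∧ (last order x b ∨ not (acc x c))) ≡ true → suc (r b) ≡ Lo + f x
    upper-end b c lb lc h with ∧-true h
    ... | ab , h' with ∧-true h' | to (iff b lb) ab
    ... | ar , edge | lo≤ , <hi with m≤n⇒m<n∨m≡n <hi
    ... | inj₂ eq = eq
    ... | inj₁ lt with cyclic⇒ b c lb lc ar
    ...   | inj₂ (tp≡ , _) = ⊥-elim (<⇒≱ lt (≤-trans fits (≤-reflexive (sym tp≡))))
    ...   | inj₁ next with ∨-elim edge
    ...     | inj₁ l = ⊥-elim (<⇒≱ lt (≤-trans fits (≤-reflexive (sym (to (last⇔ b lb) l)))))
    ...     | inj₂ n = ⊥-elim (true≢false (trans (sym (from (iff c lc) (≤-trans lo≤ (≤-trans (n≤1+n _) (≤-reflexive next)) ,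
                         ≤-trans (≤-reflexive (cong suc (sym next))) lt))) (not-true n)))

    lower-end : ∀ a b → length a ≡ N → length b ≡ N → acc x b ∧ (around order x a b ∧ (first order x b ∨ not (acc x a))) ≡ true → r b ≡ Lo
    lower-end a b la lb h with ∧-true h
    ... | ab , h' with ∧-true h' | to (iff b lb) ab
    ... | ar , edge | lo≤ , <hi with m≤n⇒m<n∨m≡n lo≤
    ... | inj₂ eq = sym eq
    ... | inj₁ lt with cyclic⇒ a b la lb ar
    ...   | inj₂ (_ , z) = ⊥-elim (<⇒≱ lt (≤-trans (≤-reflexive z) z≤n))
    ...   | inj₁ next with ∨-elim edge
    ...     | inj₁ l = ⊥-elim (<⇒≱ lt (≤-trans (≤-reflexive (to (first⇔ b lb) l)) z≤n))
    ...     | inj₂ n = ⊥-elim (true≢false (trans (sym (from (iff a la) (≤-pred (≤-trans lt (≤-reflexive (sym next))) ,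
                         ≤-trans (≤-reflexive next) (≤-trans (n≤1+n _) <hi)))) (not-true n)))

    reject : ∀ c → length c ≡ N → ¬ InRange Lo (f x) (r c) → not (acc x c) ≡ true
    reject c lc n with acc x c in e
    ... | false = refl
    ... | true  = ⊥-elim (n (to (iff c lc) e))

    join-halves : ∀ b c → length b ≡ N → length c ≡ N → length (b ++ c) ≡ ⟪ poly :+ poly ⟫ (length x) × half₁ x (b ++ c) ≡ b × half₂ x (b ++ c) ≡ c
    join-halves b c lb lc = trans (List.length-++ b) (cong₂ _+_ (trans lb (ruler≡ x)) (trans lc (ruler≡ x))) ,
      takeL-++ (ruler order x) b c lb , dropL-++ (ruler order x) b c lb

    upper-exists : f x ≢ 0 → ∃[ w ] length w ≡ ⟪ poly :+ poly ⟫ (length x) × upperValid x w ≡ true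
    upper-exists nz with onto (Lo + pred (f x)) (≤-trans (≤-reflexive (trans (sym (+-suc Lo _)) (cong (Lo +_) (suc-pred (f x) {{≢-nonZero nz}})))) fits)
    ... | b , lb , eb with next-exists b lb
    ... | c , lc , ar , next with join-halves b c lb lc
    ... | l , e₁ , e₂ = b ++ c , l , subst₂ (λ b c → acc x b ∧ (around order x b c ∧ (last order x b ∨ not (acc x c))) ≡ true) (sym e₁) (sym e₂)
        (∧-intro (from (iff b lb) (≤-trans (m≤m+n Lo _) (≤-reflexive (sym eb)) , ≤-reflexive hi)) (∧-intro ar (stops next)))
      where
      hi : suc (r b) ≡ Lo + f x
      hi = trans (cong suc eb) (trans (sym (+-suc Lo _)) (cong (Lo +_) (suc-pred (f x) {{≢-nonZero nz}})))
      stops : suc (r b) ≡ r c ⊎ suc (r b) ≡ 2 ^ N → last order x b ∨ not (acc x c) ≡ true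
      stops (inj₂ top)  = ∨-introˡ (from (last⇔ b lb) top)
      stops (inj₁ next) = ∨-introʳ (reject c lc (λ (_ , q) → <⇒≢ q (trans (sym next) hi)))

    lower-exists : f x ≢ 0 → ∃[ w ] length w ≡ ⟪ poly :+ poly ⟫ (length x) × lowerValid x w ≡ true
    lower-exists nz with onto Lo (≤-trans (≤-trans (s≤s (m≤m+n Lo (pred (f x)))) (≤-reflexive (trans (sym (+-suc Lo _)) (cong (Lo +_) (suc-pred (f x) {{≢-nonZero nz}}))))) fits)
    ... | b , lb , eb with previous-exists b lb
    ... | a , la , ar , prev with join-halves a b la lb
    ... | l , e₁ , e₂ = a ++ b , l , subst₂ (λ a b → acc x b ∧ (around order x a b ∧ (first order x b ∨ not (acc x a))) ≡ true) (sym e₁) (sym e₂)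
        (∧-intro (from (iff b lb) (≤-reflexive (sym eb) , ≤-trans (≤-reflexive (cong suc eb)) hi)) (∧-intro ar (stops prev)))
      where
      hi : suc Lo ≤ Lo + f x
      hi = ≤-trans (≤-reflexive (+-comm 1 Lo)) (+-monoʳ-≤ Lo (n≢0⇒n>0 nz))
      stops : suc (r a) ≡ r b ⊎ r b ≡ 0 → first order x b ∨ not (acc x a) ≡ true
      stops (inj₂ z)    = ∨-introˡ (from (first⇔ b lb) z)
      stops (inj₁ next) = ∨-introʳ (reject a la (λ (p , _) → <⇒≱ (≤-reflexive next) (≤-trans (≤-reflexive eb) p)))

    nonzero : ∀ b → length b ≡ N → acc x b ≡ true → f x ≢ 0
    nonzero b lb h z = let p , q = to (iff b lb) h in <⇒≱ q (≤-trans (≤-reflexive (trans (cong (Lo +_) z) (+-identityʳ Lo))) p)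

  private
    middle : ∀ {a b c} → a ∧ (b ∧ c) ≡ true → b ≡ true
    middle {true} {true} _ = refl

    PB-half : ∀ {F : Str → Str → Str} → PF₂ F → PB {2} (λ v → acc (lookup v zero) (F (lookup v zero) (lookup v (suc zero))))
    PB-half p = ap₂ PB-acc (PF-var zero) (un₂ p)

    PB-neighbours : PB {2} (λ v → around order (lookup v zero) (half₁ (lookup v zero) (lookup v (suc zero))) (half₂ (lookup v zero) (lookup v (suc zero))))
    PB-neighbours = ap₃ (PB-around order) (PF-var zero) (un₂ PF-half₁) (un₂ PF-half₂)

  upper lower : Unambiguous
  upper = record
    { len = poly :+ poly ; valid = upperValid
    ; PB-valid = pf₂ (PB-∧ (PB-half PF-half₁) (PB-∧ PB-neighbours (PB-∨ (ap₂ (PB-last order) (PF-var zero) (un₂ PF-half₁)) (PB-not (PB-half PF-half₂)))))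
    ; unique = λ x w w' (l , h) (l' , h') →
        let b≡ = IsOrder.rank-inj (good x) _ _ (length-half₁ x w l) (length-half₁ x w' l') (suc-injective (trans
                   (upper-end x (half₁ x w) (half₂ x w) (length-half₁ x w l) (length-half₂ x w l) h)
                   (sym (upper-end x (half₁ x w') (half₂ x w') (length-half₁ x w' l') (length-half₂ x w' l') h'))))
        in rejoin (ruler order x) w w' (halves x w l) (halves x w' l') b≡
             (next-unique x (half₁ x w) _ _ (length-half₁ x w l) (length-half₂ x w l) (length-half₂ x w' l') (middle {acc x (half₁ x w)} {c = last order x (half₁ x w) ∨ not (acc x (half₂ x w))} h)
               (subst (λ b → around order x b (half₂ x w') ≡ true) (sym b≡) (middle {acc x (half₁ x w')} {c = last order x (half₁ x w') ∨ not (acc x (half₂ x w'))} h'))) }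
  lower = record
    { len = poly :+ poly ; valid = lowerValid
    ; PB-valid = pf₂ (PB-∧ (PB-half PF-half₂) (PB-∧ PB-neighbours (PB-∨ (ap₂ (PB-first order) (PF-var zero) (un₂ PF-half₂)) (PB-not (PB-half PF-half₁)))))
    ; unique = λ x w w' (l , h) (l' , h') →
        let b≡ = IsOrder.rank-inj (good x) _ _ (length-half₂ x w l) (length-half₂ x w' l') (trans
                   (lower-end x (half₁ x w) (half₂ x w) (length-half₁ x w l) (length-half₂ x w l) h)
                   (sym (lower-end x (half₁ x w') (half₂ x w') (length-half₁ x w' l') (length-half₂ x w' l') h')))
        in rejoin (ruler order x) w w' (halves x w l) (halves x w' l')
             (previous-unique x _ _ (half₂ x w) (length-half₁ x w l) (length-half₁ x w' l') (length-half₂ x w l) (middle {acc x (half₂ x w)} {c = first order x (half₂ x w) ∨ not (acc x (half₁ x w))} h)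
               (subst (λ b → around order x (half₁ x w') b ≡ true) (sym b≡) (middle {acc x (half₂ x w')} {c = first order x (half₂ x w') ∨ not (acc x (half₁ x w'))} h')))
             b≡ }

  upper⇔ : ∀ x → f x ≢ 0 ⇔ (∃[ w ] Witness upper x w)
  upper⇔ x = mk⇔ (upper-exists x) (λ (w , l , h) → nonzero x (half₁ x w) (length-half₁ x w l) (proj₁ (∧-true h)))

  lower⇔ : ∀ x → f x ≢ 0 ⇔ (∃[ w ] Witness lower x w)
  lower⇔ x = mk⇔ (lower-exists x) (λ (w , l , h) → nonzero x (half₂ x w) (length-half₂ x w l) (proj₁ (∧-true h)))

nonzeroᵇ : ℕ → Bool
nonzeroᵇ zero    = false
nonzeroᵇ (suc _) = true

nonzeroᵇ⇔ : ∀ n → (nonzeroᵇ n ≡ true) ⇔ (n ≢ 0)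
nonzeroᵇ⇔ zero    = mk⇔ (λ ()) (λ h → ⊥-elim (h refl))
nonzeroᵇ⇔ (suc n) = mk⇔ (λ _ ()) (λ _ → refl)

-- The language of inputs with nonzero value is in UP through `u`; by hypothesis so is its
-- complement. Combining both gives exactly one witness for every input, whose tag bit tells whether
-- the value vanishes.
module Total (eq : UP≡coUP) {f : Str → ℕ} (u : Unambiguous) (u⇔ : ∀ x → f x ≢ 0 ⇔ (∃[ w ] Witness u x w)) where
  private
    nz⇔ : ∀ x → (nonzeroᵇ (f x) ≡ true) ⇔ (∃[ w ] Witness u x w)
    nz⇔ x = mk⇔ (λ h → to (u⇔ x) (to (nonzeroᵇ⇔ (f x)) h)) (λ w → from (nonzeroᵇ⇔ (f x)) (from (u⇔ x) w))

    opaque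
      co : Σ Unambiguous λ v → ∀ x → (not (nonzeroᵇ (f x)) ≡ true) ⇔ (∃[ w ] Witness v x w)
      co = UP⇒Unambiguous (to (eq (λ x → nonzeroᵇ (f x))) (Unambiguous⇒UP u nz⇔))

    disjoint : ∀ x w w' → Witness u x w → Witness (proj₁ co) x w' → ⊥
    disjoint x w w' p p' = true≢false (trans (sym (from (nz⇔ x) (w , p))) (not-true (from (proj₂ co x) (w' , p'))))

  open Alternative u (proj₁ co) disjoint public

  total-exists : ∀ x → ∃[ w ] Witness alternative x w
  total-exists x with nonzeroᵇ (f x) in e
  ... | true  = let w , p = to (nz⇔ x) e in tag₁ x w p
  ... | false = let w , p = to (proj₂ co x) (not-false e) in tag₂ x w p

  total-cases : ∀ x w → Witness alternative x w → (headB w ≡ true × Witness u x (field₁ x w)) ⊎ (headB w ≡ false × f x ≡ 0)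
  total-cases x w (l , h) with untag x w l h
  ... | inj₁ (t , p , _) = inj₁ (t , p)
  ... | inj₂ (t , _ , p) = inj₂ (t , vanishing (f x) (not-true (from (proj₂ co x) (field₂ x w , p))))
    where
    vanishing : ∀ n → nonzeroᵇ n ≡ false → n ≡ 0
    vanishing zero _ = refl

-- The pivot is where the cyclic order is cut; any place will do if the cluster is empty.
module Pivot (eq : UP≡coUP) {f : Str → ℕ} (C : CL f) (u : Unambiguous) (u⇔ : ∀ x → f x ≢ 0 ⇔ (∃[ w ] Witness u x w))
             (length-half : ∀ x w → Witness u x w → length (Edges.half₁ C x w) ≡ CL.bits C x) where
  open CL C
  open Edges C using (half₁; PF-half₁)
  open Total eq u u⇔ public

  pivot : Str → Str → Str
  pivot x w = if headB w then half₁ x (field₁ x w) else zerosLike (ruler order x)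

  PF-pivot : PF₂ pivot
  PF-pivot = pf₂ (PF-if (ap₁ PB-headB (PF-var (suc zero))) (ap₂ PF-half₁ (PF-var zero) (un₂ PF-field₁)) (ap₁ PF-zerosLike (ap₁ (PF-ruler order) (PF-var zero))))

  pivot-cases : ∀ x w → Witness alternative x w → (∃[ e ] Witness u x e × pivot x w ≡ half₁ x e) ⊎ f x ≡ 0
  pivot-cases x w p with total-cases x w p
  ... | inj₁ (t , q) = inj₁ (field₁ x w , q , cong (λ b → if b then half₁ x (field₁ x w) else zerosLike (ruler order x)) t)
  ... | inj₂ (_ , z) = inj₂ z

  length-pivot : ∀ x w → Witness alternative x w → length (pivot x w) ≡ bits x
  length-pivot x w p with total-cases x w p
  ... | inj₁ (t , q) = trans (cong (λ b → length (if b then half₁ x (field₁ x w) else zerosLike (ruler order x))) t) (length-half x _ q)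
  ... | inj₂ (t , _) = trans (cong (λ b → length (if b then half₁ x (field₁ x w) else zerosLike (ruler order x))) t) (length-zerosLike (ruler order x))

  cut : Str → Str → ℕ
  cut x w = suc (rank order x (pivot x w))

  cut≤ : ∀ x w → Witness alternative x w → cut x w ≤ 2 ^ bits x
  cut≤ x w p = IsOrder.rank< (good x) (pivot x w) (length-pivot x w p)

-- Sums of clusters and the theorem

record CutPoint {f : Str → ℕ} (C : CL f) : Set where
  open CL C
  field
    witness      : Unambiguous
    exists       : ∀ x → ∃[ w ] Witness witness x w
    pivot        : Str → Str → Str
    PF-pivot     : PF₂ pivot
    length-pivot : ∀ x w → Witness witness x w → length (pivot x w) ≡ bits x

  rotated : Str → Str → Str → ℕ
  rotated x w y = rotate (2 ^ bits x) (suc (rank order x (pivot x w))) (rank order x y)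

  rotated< : ∀ x w y → Witness witness x w → length y ≡ bits x → rotated x w y < 2 ^ bits x
  rotated< x w y p ly = rotate< (s≤s z≤n) (IsOrder.rank< (good x) (pivot x w) (length-pivot x w p)) (rank order x y) (IsOrder.rank< (good x) y ly)

  ClusterLast ClusterFirst : Set
  ClusterLast  = ∀ x w y → Witness witness x w → length y ≡ bits x → (acc x y ≡ true) ⇔ (2 ^ bits x ≤ rotated x w y + f x)
  ClusterFirst = ∀ x w y → Witness witness x w → length y ≡ bits x → (acc x y ≡ true) ⇔ (rotated x w y < f x)

module _ (eq : UP≡coUP) {f : Str → ℕ} (C : CL f) where
  open CL C
  open Edges C

  private
    -- For an empty cluster both sides are false, wherever the order is cut.
    empty⇔ : ∀ x {lo y} {B : Set} → (acc x y ≡ true) ⇔ InRange lo (f x) (rank order x y) → f x ≡ 0 → ¬ B → (acc x y ≡ true) ⇔ B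
    empty⇔ x {lo} iff z n = mk⇔ (λ h → let a , b = to iff h in ⊥-elim (<⇒≱ b (≤-trans (≤-reflexive (trans (cong (lo +_) z) (+-identityʳ lo))) a))) (λ b → ⊥-elim (n b))

  cutAbove : Σ (CutPoint C) CutPoint.ClusterLast
  cutAbove = cutpoint , last⇔
    where
    open Pivot eq C upper upper⇔ (λ x w p → length-half₁ x w (proj₁ p))
    cutpoint : CutPoint C
    cutpoint = record { witness = alternative ; exists = total-exists ; pivot = pivot ; PF-pivot = PF-pivot ; length-pivot = length-pivot }
    last⇔ : CutPoint.ClusterLast cutpoint
    last⇔ x w y p ly = byCase (pivot-cases x w p)
      where
      lo = proj₁ (interval x)
      iff = proj₂ (proj₂ (interval x)) y ly
      byCase : (∃[ e ] Witness upper x e × pivot x w ≡ half₁ x e) ⊎ f x ≡ 0 → (acc x y ≡ true) ⇔ (2 ^ bits x ≤ CutPoint.rotated cutpoint x w y + f x)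
      byCase (inj₂ z) = empty⇔ x iff z
        (λ h → <⇒≱ (CutPoint.rotated< cutpoint x w y p ly) (≤-trans h (≤-reflexive (trans (cong (CutPoint.rotated cutpoint x w y +_) z) (+-identityʳ _)))))
      byCase (inj₁ (e , (le , ve) , piv)) = mk⇔ (λ h → to rot (to iff h)) (λ h → from iff (from rot h))
       where
       cut≡ : cut x w ≡ lo + f x
       cut≡ = trans (cong (λ u → suc (rank order x u)) piv) (upper-end x (half₁ x e) (half₂ x e) (length-half₁ x e le) (length-half₂ x e le) ve)
       rot = rotate-upper (s≤s z≤n) (cut≤ x w p) lo (f x) (rank order x y) cut≡ (IsOrder.rank< (good x) y ly)

  cutBelow : Σ (CutPoint C) CutPoint.ClusterFirst
  cutBelow = cutpoint , first⇔
    where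
    -- The first half of a lower witness is the cyclic predecessor of the cluster, so the cut behind
    -- it lies right before the bottom.
    open Pivot eq C lower lower⇔ (λ x w p → length-half₁ x w (proj₁ p))
    cutpoint : CutPoint C
    cutpoint = record { witness = alternative ; exists = total-exists ; pivot = pivot ; PF-pivot = PF-pivot ; length-pivot = length-pivot }
    first⇔ : CutPoint.ClusterFirst cutpoint
    first⇔ x w y p ly = byCase (pivot-cases x w p)
      where
      lo = proj₁ (interval x)
      iff = proj₂ (proj₂ (interval x)) y ly
      byCase : (∃[ e ] Witness lower x e × pivot x w ≡ half₁ x e) ⊎ f x ≡ 0 → (acc x y ≡ true) ⇔ (CutPoint.rotated cutpoint x w y < f x)
      byCase (inj₂ z) = empty⇔ x iff z (λ h → <⇒≱ h (≤-trans (≤-reflexive z) z≤n))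
      byCase (inj₁ (e , (le , ve) , piv)) = mk⇔ (λ h → to rot (to iff h)) (λ h → from iff (from rot h))
        where
        a = half₁ x e
        b = half₂ x e
        la = length-half₁ x e le
        lb = length-half₂ x e le
        lo≡ : rank order x b ≡ lo
        lo≡ = lower-end x a b la lb ve
        place : ∀ {c} → c ≡ suc (rank order x a) → suc (rank order x a) ≡ rank order x b ⊎ (suc (rank order x a) ≡ 2 ^ bits x × rank order x b ≡ 0) →
          c ≡ lo ⊎ (c ≡ 2 ^ bits x × lo ≡ 0)
        place e (inj₁ q)       = inj₁ (trans e (trans q lo≡))
        place e (inj₂ (q , z)) = inj₂ (trans e q , trans (sym lo≡) z)
        neighbours : around order x a b ≡ true
        neighbours = proj₁ (∧-true {around order x a b} {first order x b ∨ not (acc x a)} (proj₂ (∧-true {acc x b} ve)))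
        cut-place = place (cong (λ u → suc (rank order x u)) piv) (IsOrderProperties.cyclic⇒ (good x) a b la lb neighbours)
        rot = rotate-lower (s≤s z≤n) (cut≤ x w p) lo (f x) (rank order x y) cut-place (proj₁ (proj₂ (interval x))) (IsOrder.rank< (good x) y ly)

-- With f's order rotated so that its cluster comes last and g's so that its cluster
-- comes first, the two clusters become adjacent in the block of the only witness.
module Sum {f g : Str → ℕ} (F : CL f) (G : CL g) (same-bits : ∀ x → CL.bits G x ≡ CL.bits F x)
           (cutF : CutPoint F) (cutG : CutPoint G) (lastF : CutPoint.ClusterLast cutF) (firstG : CutPoint.ClusterFirst cutG) where
  private
    module F = CL F
    module G = CL G
    module TF = CutPoint cutF
    module TG = CutPoint cutG
    open Product TF.witness TG.witness

    N : Str → ℕ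
    N = F.bits

    -- The context inside a block is nested: the bit choosing a side is paired with a pair of the
    -- candidate witness and the input.
    xOf wOf : Str → Str
    xOf j = snd³ (snd³ j)
    wOf j = fst³ (snd³ j)

    PF-xOf : PF₁ xOf
    PF-xOf = pf₁ (ap₁ PF-snd³ (un₁ PF-snd³))

    PF-wOf : PF₁ wOf
    PF-wOf = pf₁ (ap₁ PF-fst³ (un₁ PF-snd³))

    pivotF pivotG : Str → Str
    pivotF j = TF.pivot (xOf j) (part₁ (xOf j) (wOf j))
    pivotG j = TG.pivot (xOf j) (part₂ (xOf j) (wOf j))

    sideF sideG sides mid inner : Order
    sideF = rotateOrder {pivotF} (pf₁ (ap₂ TF.PF-pivot (un₁ PF-xOf) (ap₂ PF-part₁ (un₁ PF-xOf) (un₁ PF-wOf)))) (reindex PF-xOf F.order)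
    sideG = rotateOrder {pivotG} (pf₁ (ap₂ TG.PF-pivot (un₁ PF-xOf) (ap₂ PF-part₂ (un₁ PF-xOf) (un₁ PF-wOf)))) (reindex PF-xOf G.order)

    PB-side : PB₁ (λ j → headB (fst³ j))
    PB-side = pf₁ (ap₁ PB-headB (un₁ PF-fst³))

    -- Bit 0 stands for f and bit 1 for g, so that f's strings come below those of g.
    sides = choose PB-side sideG sideF

    PF-bit : PF₁ (λ _ → true ∷ [])
    PF-bit = pf₁ (PF-const (true ∷ []))

    PF-rulerF : PF₁ (λ i → ruler F.order (snd³ i))
    PF-rulerF = pf₁ (ap₁ (PF-ruler F.order) (un₁ PF-snd³))

    module Mid = BlockOrder PF-bit PF-rulerF sides
    mid = Mid.blockOrder

    PB-known : PB₁ (λ i → valid product (snd³ i) (fst³ i))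
    PB-known = pf₁ (ap₂ (PB-valid product) (un₁ PF-snd³) (un₁ PF-fst³))

    plain : Order
    plain = lexOrder {λ i → true ∷ ruler F.order (snd³ i)} (pf₁ (PF-∷ true (un₁ PF-rulerF)))

    -- The pivots are guaranteed to have the right length only at a valid witness; all other blocks
    -- fall back on the lexicographic order.
    inner = choose PB-known mid plain

    PF-block : PF₁ (λ x → true ∷ ruler F.order x)
    PF-block = pf₁ (PF-∷ true (un₁ (PF-ruler F.order)))

    module Outer = BlockOrder (PF-unary (len product)) PF-block inner

    sides-good : ∀ j → Witness product (xOf j) (wOf j) → Good sides j
    sides-good j p = choose-good PB-side sideG sideF j (sym (same-bits (xOf j)))
      (λ _ → rotate-isOrder (G.good (xOf j)) (pivotG j) (TG.length-pivot (xOf j) _ (proj₂ (unpair (xOf j) (wOf j) p))))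
      (λ _ → rotate-isOrder (F.good (xOf j)) (pivotF j) (TF.length-pivot (xOf j) _ (proj₁ (unpair (xOf j) (wOf j) p))))

    mid-good : ∀ i → Witness product (snd³ i) (fst³ i) → Good mid i
    mid-good i p = Mid.blockOrder-good i λ a _ →
      trans (same-bits (xOf (pair a i))) (cong (λ d → length (ruler F.order (snd³ d))) (snd³-triple a i [])) ,
      sides-good (pair a i) (subst (λ d → Witness product (snd³ d) (fst³ d)) (sym (snd³-triple a i [])) p)

    inner-good : ∀ x a → length a ≡ length (unary (len product) x) → length (ruler inner (pair a x)) ≡ length (true ∷ ruler F.order x) × Good inner (pair a x)
    inner-good x a l = cong (λ y → suc (length (ruler F.order y))) (snd³-triple a x []) ,
      choose-good PB-known mid plain (pair a x) refl (λ v → mid-good (pair a x) (length≡ , v)) (λ _ → lex-isOrder _)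
      where
      length≡ : length (fst³ (pair a x)) ≡ ⟪ len product ⟫ (length (snd³ (pair a x)))
      length≡ = trans (cong length (fst³-triple a x [])) (trans l (trans (length-unary (len product) x)
        (cong (λ y → ⟪ len product ⟫ (length y)) (sym (snd³-triple a x [])))))

    rotF rotG : Str → Str → Str → ℕ
    rotF x w y = TF.rotated x (part₁ x w) y
    rotG x w y = TG.rotated x (part₂ x w) y

    rank-sides : ∀ b w x y → rank sides (pair (b ∷ []) (pair w x)) y ≡ (if b then rotG x w y else rotF x w y)
    rank-sides b w x y = trans (cong₂ byBit (cong headB (fst³-triple (b ∷ []) (pair w x) [])) (snd³-triple (b ∷ []) (pair w x) []))
      (cong₂ (λ w x → if b then rotG x w y else rotF x w y) (fst³-triple w x []) (snd³-triple w x []))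
      where
      byBit : Bool → Str → ℕ
      byBit b i = if b then rotG (snd³ i) (fst³ i) y else rotF (snd³ i) (fst³ i) y

    rank-inner : ∀ b w x y → Witness product x w → rank inner (pair w x) (b ∷ y) ≡ bitVal b (2 ^ N x) + (if b then rotG x w y else rotF x w y)
    rank-inner b w x y (_ , v) = begin
      rank inner (pair w x) (b ∷ y)
        ≡⟨ cong (λ k → if k then rank mid (pair w x) (b ∷ y) else toNat (b ∷ y)) (trans (cong₂ (valid product) (snd³-triple w x []) (fst³-triple w x [])) v) ⟩
      rank mid (pair w x) (b ∷ y)
        ≡⟨ cong₂ (λ a z → toNat a * 2 ^ length (ruler F.order z) + rank sides (pair a (pair w x)) y) (takeL-++ (true ∷ []) (b ∷ []) y refl) (snd³-triple w x []) ⟩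
      toNat (b ∷ []) * 2 ^ N x + rank sides (pair (b ∷ []) (pair w x)) y
        ≡⟨ cong₂ _+_ (digit b) (rank-sides b w x y) ⟩
      bitVal b (2 ^ N x) + (if b then rotG x w y else rotF x w y) ∎
      where
      open ≡-Reasoning
      digit : ∀ b → toNat (b ∷ []) * 2 ^ N x ≡ bitVal b (2 ^ N x)
      digit false = refl
      digit true  = +-identityʳ _

    sideAcc : Str → Str → Bool
    sideAcc x v = if headB v then G.acc x (tailS v) else F.acc x (tailS v)

    module _ (x w : Str) (p : Witness product x w) where
      private
        pF = proj₁ (unpair x w p)
        pG = proj₂ (unpair x w p)

      accF⇔ : ∀ y → length y ≡ F.bits x → (F.acc x y ≡ true) ⇔ (2 ^ F.bits x ≤ rotF x w y + f x)
      accF⇔ y = lastF x (part₁ x w) y pF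

      accG⇔ : ∀ y → length y ≡ G.bits x → (G.acc x y ≡ true) ⇔ (rotG x w y < g x)
      accG⇔ y = firstG x (part₂ x w) y pG

      f≤ : f x ≤ 2 ^ N x
      f≤ = ≤-trans (m≤n+m (f x) _) (proj₁ (proj₂ (F.interval x)))

      g≤ : g x ≤ 2 ^ N x
      g≤ = ≤-trans (m≤n+m (g x) _) (≤-trans (proj₁ (proj₂ (G.interval x))) (≤-reflexive (cong (2 ^_) (same-bits x))))

      -- f's cluster fills the last `f x` ranks of the lower half of the block and g's cluster the
      -- first `g x` ranks of the upper half; they meet at 2 ^ `N x`.
      start-at : ℕ
      start-at = 2 ^ N x ∸ f x

      end-at : start-at + (f x + g x) ≡ 2 ^ N x + g x
      end-at = trans (sym (+-assoc start-at (f x) (g x))) (cong (_+ g x) (m∸n+n≡m f≤))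

      fits-block : start-at + (f x + g x) ≤ 2 ^ length (true ∷ ruler F.order x)
      fits-block = ≤-trans (≤-reflexive end-at) (+-monoʳ-≤ (2 ^ N x) (≤-trans g≤ (≤-reflexive (sym (+-identityʳ _)))))

      side⇔ : ∀ v → length v ≡ length (true ∷ ruler F.order x) → (sideAcc x v ≡ true) ⇔ InRange start-at (f x + g x) (rank inner (pair w x) v)
      side⇔ (false ∷ y) lv = mk⇔
        (λ h → subst (InRange start-at (f x + g x)) (sym eq')
          (+-cancelʳ-≤ (f x) _ _ (≤-trans (≤-reflexive (m∸n+n≡m f≤)) (to (accF⇔ y ly) h)) ,
           ≤-trans (TF.rotated< x _ y pF ly) (≤-trans (m≤m+n _ (g x)) (≤-reflexive (sym end-at)))))
        (λ h → from (accF⇔ y ly) (≤-trans (≤-reflexive (sym (m∸n+n≡m f≤))) (+-monoˡ-≤ (f x) (proj₁ (subst (InRange start-at (f x + g x)) eq' h)))))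
        where
        ly = suc-injective lv
        eq' = rank-inner false w x y p
      side⇔ (true ∷ y) lv = mk⇔
        (λ h → subst (InRange start-at (f x + g x)) (sym eq')
          (≤-trans (m∸n≤m (2 ^ N x) (f x)) (m≤m+n _ _) , ≤-trans (+-monoʳ-< (2 ^ N x) (to (accG⇔ y ly) h)) (≤-reflexive (sym end-at))))
        (λ h → from (accG⇔ y ly) (+-cancelˡ-< (2 ^ N x) _ _ (≤-trans (proj₂ (subst (InRange start-at (f x + g x)) eq' h)) (≤-reflexive end-at))))
        where
        ly = trans (suc-injective lv) (sym (same-bits x))
        eq' = rank-inner true w x y p

    top-part bottom-part : Str → Str → Str
    top-part x w = takeL (unary (len product) x) w
    bottom-part x w = dropL (unary (len product) x) w

    PF-top : PF {2} (λ v → top-part (lookup v zero) (lookup v (suc zero)))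
    PF-top = ap₂ PF-takeL (ap₁ (PF-unary (len product)) (PF-var zero)) (PF-var (suc zero))

    PF-bottom : PF {2} (λ v → bottom-part (lookup v zero) (lookup v (suc zero)))
    PF-bottom = ap₂ PF-dropL (ap₁ (PF-unary (len product)) (PF-var zero)) (PF-var (suc zero))

    sumAcc : Str → Str → Bool
    sumAcc x w = valid product x (top-part x w) ∧ sideAcc x (bottom-part x w)

    ruler-length : ∀ x → length (unary (len product) x ++ true ∷ ruler F.order x) ≡ length (unary (len product) x) + length (true ∷ ruler F.order x)
    ruler-length x = List.length-++ (unary (len product) x)

    cluster : ∀ x → ∃[ lo ] lo + (f x + g x) ≤ 2 ^ length (unary (len product) x ++ true ∷ ruler F.order x) ×
      (∀ y → length y ≡ length (unary (len product) x ++ true ∷ ruler F.order x) → (sumAcc x y ≡ true) ⇔ InRange lo (f x + g x) (rank Outer.blockOrder x y))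
    cluster x = _ , block-interval (PF-unary (len product)) PF-block inner x w {acc″ = sideAcc x} (trans (proj₁ p) (sym (length-unary (len product) x)))
        (inner-good x) (fits-block x w p) (side⇔ x w p)
        (λ v lv → mk⇔ (λ h → let a , b = ∧-true h in
              unique product x _ _ (trans (proj₁ (splitting (unary (len product) x) v (trans lv (ruler-length x)))) (length-unary (len product) x) , a) p , b)
            (λ (e , h) → ∧-intro (trans (cong (valid product x) e) (proj₂ p)) h))
      where
      wF = TF.exists x
      wG = TG.exists x
      w = proj₁ wF ++ proj₁ wG
      p : Witness product x w
      p = join-witness x _ _ (proj₂ wF) (proj₂ wG)

  sumCL : CL (λ x → f x + g x)
  sumCL = record
    { order = Outer.blockOrder ; poly = len product :+ (con 1 :+ F.poly)
    ; ruler≡ = λ x → trans (ruler-length x) (cong₂ _+_ (length-unary (len product) x) (cong suc (F.ruler≡ x)))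
    ; good = λ x → Outer.blockOrder-good x (inner-good x)
    ; acc = sumAcc
    ; PB-acc = pf₂ (PB-∧ (ap₂ (PB-valid product) (PF-var zero) PF-top)
        (PB-if (ap₁ PB-headB PF-bottom) (ap₂ G.PB-acc (PF-var zero) (ap₁ PF-tailS PF-bottom)) (ap₂ F.PB-acc (PF-var zero) (ap₁ PF-tailS PF-bottom))))
    ; interval = cluster }

addCL : UP≡coUP → ∀ {f g} → CL f → CL g → CL (λ x → f x + g x)
addCL eq F G = Sum.sumCL F' G' (λ x → trans (CL.ruler≡ G' x) (trans (+-comm (⟪ CL.poly F ⟫ (length x)) _) (sym (CL.ruler≡ F' x))))
  (proj₁ cF) (proj₁ cG) (proj₂ cF) (proj₂ cG)
  where
  -- Each cluster is lengthened by the string length of the other, which makes the two lengths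
  -- equal.
  F' = Prefix.prefixCL F (CL.poly G) (PF-unary (CL.poly G)) (length-unary (CL.poly G))
  G' = Prefix.prefixCL G (CL.poly F) (PF-unary (CL.poly F)) (length-unary (CL.poly F))
  cF = cutAbove eq F'
  cG = cutBelow eq G'

-- A cluster is a singleton iff its lower and upper ends coincide.
module Singleton {f : Str → ℕ} (C : CL f) where
  open CL C
  open Edges C
  open Product lower upper

  private
    bottom top : Str → Str → Str
    bottom x w = half₂ x (part₁ x w)
    top x w = half₁ x (part₂ x w)

    PB-equal : PB₂ (λ x w → eqS (bottom x w) (top x w))
    PB-equal = pf₂ (ap₂ PB-eqS (ap₂ PF-half₂ (PF-var zero) (un₂ PF-part₁)) (ap₂ PF-half₁ (PF-var zero) (un₂ PF-part₂)))

  singleton : Unambiguous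
  singleton = restrict product PB-equal

  singleton⇔ : ∀ x → (f x ≡ 1) ⇔ (∃[ w ] Witness singleton x w)
  singleton⇔ x = mk⇔ exists forces
    where
    Lo = proj₁ (interval x)
    bottom-rank : ∀ w → Witness lower x w → rank order x (half₂ x w) ≡ Lo
    bottom-rank w (l , h) = lower-end x (half₁ x w) (half₂ x w) (length-half₁ x w l) (length-half₂ x w l) h
    top-rank : ∀ w → Witness upper x w → suc (rank order x (half₁ x w)) ≡ Lo + f x
    top-rank w (l , h) = upper-end x (half₁ x w) (half₂ x w) (length-half₁ x w l) (length-half₂ x w l) h
    forces : (∃[ w ] Witness singleton x w) → f x ≡ 1
    forces (w , l , h) = let h₁ , e = ∧-true h ; wl , wu = unpair x w (l , h₁) in
      +-cancelˡ-≡ Lo _ _ (trans (sym (top-rank _ wu)) (trans (cong suc (trans (cong (rank order x) (sym (eqS-sound _ _ e))) (bottom-rank _ wl))) (+-comm 1 Lo)))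
    exists : f x ≡ 1 → ∃[ w ] Witness singleton x w
    exists one = a ++ b , proj₁ joined , ∧-intro (proj₂ joined) (from eqS⇔ (trans (cong (half₂ x) (part₁-++ x a b wa)) (trans ends (sym (cong (half₁ x) (part₂-++ x a b wa))))))
      where
      nz : f x ≢ 0
      nz z = 1+n≢0 (trans (sym one) z)
      a = proj₁ (to (lower⇔ x) nz)
      wa = proj₂ (to (lower⇔ x) nz)
      b = proj₁ (to (upper⇔ x) nz)
      wb = proj₂ (to (upper⇔ x) nz)
      joined = join-witness x a b wa wb
      ends : half₂ x a ≡ half₁ x b
      ends = IsOrder.rank-inj (good x) _ _ (length-half₂ x a (proj₁ wa)) (length-half₁ x b (proj₁ wb))
        (suc-injective (trans (cong suc (bottom-rank a wa)) (trans (+-comm 1 Lo) (trans (cong (Lo +_) (sym one)) (sym (top-rank b wb))))))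

increment⇒UP≡coUP : (∀ f → CLUSharpP f → CLUSharpP (λ x → suc (f x))) → UP≡coUP
increment⇒UP≡coUP inc A = mk⇔ (complement A) (λ co → UP-ext (λ x → not-involutive (A x)) (complement (λ x → not (A x)) co))
  where
  not-involutive : ∀ b → not (not b) ≡ b
  not-involutive false = refl
  not-involutive true  = refl
  complement : ∀ A → UP A → UP (λ x → not (A x))
  complement A up = Unambiguous⇒UP (Singleton.singleton C) λ x → mk⇔
    (λ h → to (Singleton.singleton⇔ C x) (cong (λ b → suc (indicator b)) (not-true h)))
    (λ w → absent (A x) (from (Singleton.singleton⇔ C x) w))
    where
    C : CL (λ x → suc (indicator (A x)))
    C = FromCLUSharpP.toCL (inc _ (ToCLUSharpP.toCLUSharpP (charCL up)))
    absent : ∀ b → suc (indicator b) ≡ 1 → not b ≡ true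
    absent false _ = refl

theorem4p2 : (UP≡coUP ⇔ (∀ f → CLUSharpP f → CLUSharpP (λ x → suc (f x)))) ×
    (UP≡coUP ⇔ (∀ f g → CLUSharpP f → FPtℕ g → CLUSharpP (λ x → f x + g x))) ×
    (UP≡coUP ⇔ (∀ f g → CLUSharpP f → UPSVtℕ g → CLUSharpP (λ x → f x + g x))) ×
    (UP≡coUP ⇔ (∀ f g → CLUSharpP f → CLUSharpP g → CLUSharpP (λ x → f x + g x)))
-- Closure under addition yields the other closure properties one after the other down to increment,
-- and only increment is led back to `UP≡coUP`.
theorem4p2 = mk⇔ (λ eq → increment (fpt (upsvt (add eq)))) increment⇒UP≡coUP ,
    mk⇔ (λ eq → fpt (upsvt (add eq))) (λ h → increment⇒UP≡coUP (increment h)) ,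
    mk⇔ (λ eq → upsvt (add eq)) (λ h → increment⇒UP≡coUP (increment (fpt h))) ,
    mk⇔ add (λ h → increment⇒UP≡coUP (increment (fpt (upsvt h))))
  where
  Closed : ((Str → ℕ) → Set) → Set
  Closed K = ∀ f g → CLUSharpP f → K g → CLUSharpP (λ x → f x + g x)
  add : UP≡coUP → Closed CLUSharpP
  add eq f g cf cg = ToCLUSharpP.toCLUSharpP (addCL eq (FromCLUSharpP.toCL cf) (FromCLUSharpP.toCL cg))
  upsvt : Closed CLUSharpP → Closed UPSVtℕ
  upsvt h f g cf ug = h f g cf (ToCLUSharpP.toCLUSharpP (UPSVtℕ⇒CL ug))
  fpt : Closed UPSVtℕ → Closed FPtℕ
  fpt h f g cf (g' , fg , eq) = h f g cf (g' , FPt⇒UPSVt fg , eq)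
  increment : Closed FPtℕ → ∀ f → CLUSharpP f → CLUSharpP (λ x → suc (f x))
  increment h f cf = ToCLUSharpP.toCLUSharpP (CL-ext (λ x → +-comm (f x) 1) (FromCLUSharpP.toCL
    (h f (λ _ → 1) cf ((λ _ → true ∷ []) , PF⇒FPt (pf₁ (PF-const (true ∷ []))) , λ _ → refl))))
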